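{- Let $q=p^n\ge 5$ with $p$ prime, $T=\mathrm{PSL}(2,q)$ and $T\le G\le\mathrm{P\Gamma L}(2,q)$. Let $m$ be a positive integer with $p^m>2$ such that either $n/m$ is an odd prime, or $p=2$ and $n=2m$. Let $M$ be a maximal subgroup of $G$ with $M\cap T\cong\mathrm{PSL}(2,p^m)$, and consider the (primitive) action of $G$ on the set $[G:M]$ of right cosets of $M$ by right multiplication. Then $b(G)=2$ if and only if $n/m$ is an odd prime; and in that case the Saxl graph $\Sigma(G)$ has diameter $2$.
   Context: $\mathrm{P\Gamma L}(2,q)$ is the group $\mathrm{PGL}(2,q):\langle f\rangle$ where $f$ is induced by the field automorphism $x\mapsto x^p$. For a group acting on a finite set, a base is a subset whose pointwise stabilizer is trivial, and $b(G)$ is the minimal size of a base. If $b(G)=2$, the Saxl graph $\Sigma(G)$ has vertex set the acted-on set, two distinct points being adjacent iff they form a base for $G$. -}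

module Defs where

open import Level using (0ℓ)
open import Data.Nat using (ℕ; zero; suc; _∸_; _^_; _≤_; _<_) renaming (_+_ to _+ℕ_; _*_ to _*ℕ_)
open import Data.Nat.Primality using (Prime)
open import Data.List using (List; []; _∷_; length)
open import Data.List.Membership.Propositional using (_∈_)
open import Data.List.Relation.Unary.Unique.Propositional using (Unique)
open import Data.List.Relation.Unary.All using (All)
open import Data.Product using (Σ; ∃; ∃₂; _×_; proj₁)
open import Data.Sum using (_⊎_)
open import Relation.Nullary using (¬_)
open import Relation.Binary.PropositionalEquality using (_≡_; _≢_)
open import Algebra.Structures using (IsCommutativeRing)

record FiniteField : Set₁ where
  infixl 7 _*_
  infixl 6 _+_
  field
    Carrier : Set
    _+_ _*_ : Carrier → Carrier → Carrier
    -_ : Carrier → Carrier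
    0# 1# : Carrier
    _⁻¹ : Carrier → Carrier          -- value at 0# is irrelevant
    isCommutativeRing : IsCommutativeRing _≡_ _+_ _*_ -_ 0# 1#
    0≢1 : 0# ≢ 1#
    ⁻¹-inverse : ∀ x → x ≢ 0# → x * (x ⁻¹) ≡ 1#
    elements : List Carrier
    elements-complete : ∀ x → x ∈ elements
    elements-unique : Unique elements

  order : ℕ
  order = length elements

open FiniteField using (order) public

-- PΓL(2,F) for a field F of order p^n, as the semidirect product
-- PGL(2,F):⟨f⟩, f induced by x ↦ x^p.
--
-- An element ⟨ A , k ⟩ represents the semilinear map on row vectors
--   v ↦ (v A)^(φ^k),   φ(x) = x^p,
-- modulo nonzero scalars on A and modulo equality of the automorphisms φ^k.

module PΓL (F : FiniteField) (p n : ℕ) where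
  open FiniteField F

  pow : Carrier → ℕ → Carrier
  pow x zero = 1#
  pow x (suc k) = x * pow x k

  frob : Carrier → Carrier
  frob x = pow x p

  frob^ : ℕ → Carrier → Carrier
  frob^ zero z = z
  frob^ (suc k) z = frob (frob^ k z)

  record Mat : Set where
    constructor mat
    field a b c d : Carrier

  _·M_ : Mat → Mat → Mat
  mat a b c d ·M mat a' b' c' d' =
    mat (a * a' + b * c') (a * b' + b * d') (c * a' + d * c') (c * b' + d * d')

  mapMat : (Carrier → Carrier) → Mat → Mat
  mapMat f (mat a b c d) = mat (f a) (f b) (f c) (f d)

  scale : Carrier → Mat → Mat
  scale s = mapMat (s *_)

  det : Mat → Carrier
  det (mat a b c d) = a * d + - (b * c)

  adj : Mat → Mat
  adj (mat a b c d) = mat d (- b) (- c) a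

  I₂ : Mat
  I₂ = mat 1# 0# 0# 1#

  record Elt : Set where
    constructor ⟨_,_⟩
    field
      matrix : Mat
      aut : ℕ
  open Elt public

  _≈_ : Elt → Elt → Set
  x ≈ y = (∃ λ s → s ≢ 0# × matrix y ≡ scale s (matrix x))
        × (∀ z → frob^ (aut x) z ≡ frob^ (aut y) z)

  -- (A,k)(B,j) = (A · B^(φ^(-k)), k+j), with φ^(-k) = φ^(k(n-1))
  _∙_ : Elt → Elt → Elt
  x ∙ y = ⟨ matrix x ·M mapMat (frob^ (aut x *ℕ (n ∸ 1))) (matrix y) , aut x +ℕ aut y ⟩

  e : Elt
  e = ⟨ I₂ , 0 ⟩

  inv : Elt → Elt
  inv x = ⟨ mapMat (frob^ (aut x)) (adj (matrix x)) , aut x *ℕ (n ∸ 1) ⟩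

  IsPΓL : Elt → Set
  IsPΓL x = det (matrix x) ≢ 0#

  IsPSL : Elt → Set
  IsPSL x = IsPΓL x × (∀ z → frob^ (aut x) z ≡ z) × ∃ λ s → det (matrix x) ≡ s * s

  _⊆_ : (Elt → Set) → (Elt → Set) → Set
  H ⊆ K = ∀ x → H x → K x

  record IsSubgroup (H : Elt → Set) : Set where
    field
      ⊆PΓL : H ⊆ IsPΓL
      respects : ∀ {x y} → x ≈ y → H x → H y
      has-e : H e
      closed-∙ : ∀ {x y} → H x → H y → H (x ∙ y)
      closed-inv : ∀ {x} → H x → H (inv x)

  IsMaximalSubgroupOf : (M G : Elt → Set) → Set₁
  IsMaximalSubgroupOf M G =
    IsSubgroup M × M ⊆ G × (∃ λ g → G g × ¬ M g)
    × (∀ K → IsSubgroup K → M ⊆ K → K ⊆ G → (K ⊆ M) ⊎ (G ⊆ K))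

  -- Right coset action of G on [G:M]; points are represented by g ∈ G
  -- (standing for the coset Mg).
  module CosetAction (G M : Elt → Set) where
    Point : Set
    Point = Σ Elt G

    _≡ᶜ_ : Point → Point → Set
    α ≡ᶜ β = ∃ λ m → M m × (proj₁ α ≈ (m ∙ proj₁ β))

    Fixes : Elt → Point → Set
    Fixes g α = ∃ λ m → M m × ((proj₁ α ∙ g) ≈ (m ∙ proj₁ α))

    IsBase : List Point → Set
    IsBase B = ∀ g → G g → All (Fixes g) B → g ≈ e

    BaseSizeIs2 : Set
    BaseSizeIs2 = ¬ IsBase [] × ¬ (∃ λ α → IsBase (α ∷ []))
                × ∃₂ λ α β → ¬ (α ≡ᶜ β) × IsBase (α ∷ β ∷ [])

    Adj : Point → Point → Set
    Adj α β = ¬ (α ≡ᶜ β) × IsBase (α ∷ β ∷ [])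

    Within : ℕ → Point → Point → Set
    Within zero α β = α ≡ᶜ β
    Within (suc k) α β = Within k α β ⊎ ∃ λ γ → Within k α γ × Adj γ β

    SaxlDiameter : ℕ → Set
    SaxlDiameter zero = ∀ α β → Within zero α β
    SaxlDiameter (suc d) = (∀ α β → Within (suc d) α β) × ∃₂ λ α β → ¬ Within d α β

record IsoToPSL (F : FiniteField) (p n : ℕ) (H : PΓL.Elt F p n → Set)
                (F' : FiniteField) (m : ℕ) : Set where
  module A = PΓL F p n
  module B = PΓL F' p m
  field
    to : A.Elt → B.Elt
    from : B.Elt → A.Elt
    to-mem : ∀ x → H x → B.IsPSL (to x)
    from-mem : ∀ y → B.IsPSL y → H (from y)
    to-resp : ∀ {x y} → H x → H y → x A.≈ y → to x B.≈ to y
    from-resp : ∀ {x y} → B.IsPSL x → B.IsPSL y → x B.≈ y → from x A.≈ from y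
    from∘to : ∀ x → H x → from (to x) A.≈ x
    to∘from : ∀ y → B.IsPSL y → to (from y) B.≈ y
    hom : ∀ x y → H x → H y → to (x A.∙ y) B.≈ (to x B.∙ to y)

OddPrimeRatio : ℕ → ℕ → Set
OddPrimeRatio n m = ∃ λ r → n ≡ r *ℕ m × Prime r × r ≢ 2

{-# OPTIONS --safe #-}

-- Write q₀ = p^m. An embedding of PSL(2,q₀) in PSL(2,q) sends the two opposite root subgroups to unipotent
-- elements with two distinct fixed points; the action of the torus makes the resulting map of root subgroups a field
-- embedding, so up to conjugation M ∩ T is PSL(2,K) for the subfield K of order q₀. Hence M normalises PSL(2,K), and by
-- maximality M is the stabiliser in G of the subline K ∪ {∞}: the points of the action are sublines.
--
-- If p = 2 and n = 2m, two sublines correspond to A and to the involution τ of F over K, and every matrix over K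
-- commuting with A⁻¹τ(A) stabilises both; a nonscalar invertible one exists, so no pair is a base.
--
-- If n/m is an odd prime, K ∪ {∞} and (sK + t) ∪ {∞} form a base as soon as they meet only in ∞ and no nontrivial field
-- automorphism preserves sK. Given two sublines, take ∞ on the first one only and t on the second one only, and look
-- for a common neighbour (sK + t) ∪ {∞}. Every obstruction to s is an equation s^N = c with at most N solutions, and
-- the exponents add up to less than q - 1, unless q₀ = 4 and q = 64. There a table of discrete logarithms provides s,
-- in two instances after moving the point ∞.

module Submission where

open import Defs
open import Level using (0ℓ)
open import Algebra.Bundles using (CommutativeRing; CommutativeMonoid; Group)
import Algebra.Solver.Ring as Solver
open import Algebra.Solver.Ring.AlmostCommutativeRing using (fromCommutativeRing; _-Raw-AlmostCommutative⟶_)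
open import Data.Bool.Base using (Bool; true; false; _xor_; if_then_else_)
import Data.Bool.Properties as Boolₚ
open import Data.Empty using (⊥; ⊥-elim)
open import Data.Fin.Base using (Fin; zero; suc; toℕ; fromℕ; fromℕ<; inject₁)
open import Data.Fin using (#_)
import Data.Fin.Properties as Finₚ
import Data.Integer.Properties as ℤₚ
open import Data.List.Base using (List; []; _∷_; _++_; length; map; filter; foldr)
import Data.List.Properties as Listₚ
open import Data.List.Membership.Propositional using (_∈_; find)
open import Data.List.Membership.Propositional.Properties using (∈-map⁺; ∈-map⁻; ∈-filter⁺; ∈-filter⁻; ∈-∃++; ∈-++⁻; ∈-++⁺ˡ; ∈-++⁺ʳ)
open import Data.List.Membership.Propositional.Properties.WithK using (unique∧set⇒bag)
open import Data.List.Relation.Binary.BagAndSetEquality using (∼bag⇒↭)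
open import Data.List.Relation.Binary.Permutation.Propositional using (_↭_; ↭⇒↭ₛ′)
open import Data.List.Relation.Binary.Permutation.Propositional.Properties using (↭-length)
import Data.List.Relation.Binary.Permutation.Setoid.Properties as ↭ₛ
open import Data.List.Relation.Unary.All as All using (All; []; _∷_)
import Data.List.Relation.Unary.All.Properties as Allₚ
open import Data.List.Relation.Unary.AllPairs using ([]; _∷_)
open import Data.List.Relation.Unary.Any as Any using (Any; here; there)
open import Data.List.Relation.Unary.Any.Properties using (lookup-index)
open import Data.List.Relation.Unary.Unique.Propositional using (Unique)
import Data.List.Relation.Unary.Unique.Propositional.Properties as Uniqueₚ
open import Data.Maybe.Base using (Maybe; just; nothing)
open import Data.Nat.Base as ℕ using (ℕ; zero; suc; _∸_; _!; _≤_; _<_; s≤s; z≤n)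
open import Data.Nat.Combinatorics using (nCk≡n!/k![n-k]!; nCk≡nC[n∸k]; nCn≡1; k![n∸k]!∣n!) renaming (_C_ to _choose_)
open import Data.Nat.Divisibility using (_∣_; divides; _∣?_; ∣⇒≤; m∣m*n; 1∣_; m%n≡0⇒n∣m)
open import Data.Nat.DivMod using (_/_; _%_; m/n*n≡m; m/n*n≤m; m*n/n≡m; /-monoˡ-≤; m≡m%n+[m/n]*n; m%n<n)
open import Data.Nat.GCD using (gcd; gcd[m,n]∣m; gcd[m,n]∣n; gcd-GCD; module Bézout)
import Data.Nat.ListAction as ListAction
open import Data.Nat.ListAction.Properties using (sum-++)
open import Data.Nat.Primality using (Prime; euclidsLemma; prime⇒irreducible; prime⇒nonZero; prime⇒nonTrivial)
import Data.Nat.Properties as ℕₚ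
open import Data.Nat.Solver using (module +-*-Solver)
open import Data.Product using (Σ; ∃; ∃₂; _×_; _,_; proj₁; proj₂)
import Data.Sign.Base as Sign
open import Data.Sum using (_⊎_; inj₁; inj₂; [_,_]′)
open import Data.Unit using (tt)
open import Data.Vec.Base as Vec using (Vec; []; _∷_; replicate)
import Data.Vec.Properties as Vecₚ
open import Function.Base using (_∘_)
open import Function.Bundles using (_⇔_; mk⇔)
open import Relation.Binary.Definitions using (DecidableEquality)
open import Relation.Binary.PropositionalEquality as ≡ using (_≡_; _≢_; refl; sym; trans; cong; cong₂; subst; isEquivalence; module ≡-Reasoning)
open import Relation.Nullary using (Dec; yes; no; ¬_; ¬?; map′; toWitness; _×-dec_; _⊎-dec_; _→-dec_)
open import Relation.Unary using (Decidable)

-- Whether (sK + t) ∪ {∞} is a neighbour depends only on the class sK*, hence on s^(q₀-1); this is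
-- what makes every obstruction a power equation. Each element of K contributes two equations of
-- degree q₀-1, and each g up to n/2 two of degree (q₀-1)(p^g-1); they come in pairs because the
-- middle subline must be adjacent to both given ones. For q₀ = 4 and q = 64 the degrees add up to
-- 90, against 63 nonzero elements. A second obstacle is that G may be as small as T. The middle
-- subline is a point of the action only if an element of G leads to it, which asks for a square
-- determinant. As s matters only modulo K*, it may be replaced by its product with its norm, an
-- even power of s when n/m is odd. Sublines never appear as sets of points. They are encoded by
-- matrices that are K-rational up to a scalar, and adjacency by a factorisation of the element
-- leading from one coset to the other. Since G and M are arbitrary predicates, equality of cosets
-- is not decidable from the outset; maximality of M has to supply the decision.

-- Ring solver with integer coefficients

module IntegerSolver (R : CommutativeRing 0ℓ 0ℓ) where
  open CommutativeRing R renaming (refl to ≈-refl; sym to ≈-sym; trans to ≈-trans)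
  open import Data.Integer.Base as ℤ using (ℤ; +_; -[1+_])
  open import Algebra.Properties.Ring ring
  open import Algebra.Properties.Semiring.Mult semiring renaming (_×_ to _×#_)
  open import Relation.Binary.Reasoning.Setoid setoid

  -- The coefficient 1 denotes `1# + 0#`, which is not `1#` by computation; this is why later calls
  -- of the solver pass `1#` as a variable.
  ⟦_⟧ℤ : ℤ → Carrier
  ⟦ + n ⟧ℤ = n ×# 1#
  ⟦ -[1+ n ] ⟧ℤ = - (suc n ×# 1#)

  ⟦⊖⟧ : ∀ m n → ⟦ m ℤ.⊖ n ⟧ℤ ≈ m ×# 1# - n ×# 1#
  ⟦⊖⟧ m zero = begin
    m ×# 1# ≈⟨ +-identityʳ _ ⟨
    m ×# 1# + 0# ≈⟨ +-congˡ -0#≈0# ⟨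
    m ×# 1# - 0# ∎
  ⟦⊖⟧ zero (suc n) = ≈-sym (+-identityˡ _)
  ⟦⊖⟧ (suc m) (suc n) = begin
    ⟦ suc m ℤ.⊖ suc n ⟧ℤ ≡⟨ ≡.cong ⟦_⟧ℤ (ℤₚ.[1+m]⊖[1+n]≡m⊖n m n) ⟩
    ⟦ m ℤ.⊖ n ⟧ℤ ≈⟨ ⟦⊖⟧ m n ⟩
    m ×# 1# - n ×# 1# ≈⟨ +-congʳ (+-identityʳ _) ⟨
    (m ×# 1# + 0#) - n ×# 1# ≈⟨ +-congʳ (+-congˡ (-‿inverseʳ 1#)) ⟨
    (m ×# 1# + (1# - 1#)) - n ×# 1# ≈⟨ +-congʳ (+-assoc _ _ _) ⟨
    ((m ×# 1# + 1#) - 1#) - n ×# 1# ≈⟨ +-assoc _ _ _ ⟩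
    (m ×# 1# + 1#) + (- 1# - n ×# 1#) ≈⟨ +-cong (+-comm _ _) (-‿+-comm _ _) ⟩
    (1# + m ×# 1#) - (1# + n ×# 1#) ∎

  +-homoℤ : ∀ i j → ⟦ i ℤ.+ j ⟧ℤ ≈ ⟦ i ⟧ℤ + ⟦ j ⟧ℤ
  +-homoℤ (+ m) (+ n) = ×-homo-+ 1# m n
  +-homoℤ (+ m) -[1+ n ] = ⟦⊖⟧ m (suc n)
  +-homoℤ -[1+ m ] (+ n) = ≈-trans (⟦⊖⟧ n (suc m)) (+-comm _ _)
  +-homoℤ -[1+ m ] -[1+ n ] = begin
    - (suc (suc (m ℕ.+ n)) ×# 1#) ≡⟨ ≡.cong (λ k → - (suc k ×# 1#)) (≡.sym (ℕₚ.+-suc m n)) ⟩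
    - ((suc m ℕ.+ suc n) ×# 1#) ≈⟨ -‿cong (×-homo-+ 1# (suc m) (suc n)) ⟩
    - (suc m ×# 1# + suc n ×# 1#) ≈⟨ -‿+-comm _ _ ⟨
    - (suc m ×# 1#) - suc n ×# 1# ∎

  -‿homoℤ : ∀ i → ⟦ ℤ.- i ⟧ℤ ≈ - ⟦ i ⟧ℤ
  -‿homoℤ (+ zero) = ≈-sym -0#≈0#
  -‿homoℤ (+ suc n) = ≈-refl
  -‿homoℤ -[1+ n ] = ≈-sym (-‿involutive _)

  *-homo-× : ∀ m n → (m ℕ.* n) ×# 1# ≈ (m ×# 1#) * (n ×# 1#)
  *-homo-× m n = ×1-homo-* m n

  *-homoℤ : ∀ i j → ⟦ i ℤ.* j ⟧ℤ ≈ ⟦ i ⟧ℤ * ⟦ j ⟧ℤ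
  *-homoℤ (+ m) (+ n) = begin
    ⟦ Sign.+ ℤ.◃ (m ℕ.* n) ⟧ℤ ≡⟨ ≡.cong ⟦_⟧ℤ (ℤₚ.+◃n≡+n (m ℕ.* n)) ⟩
    (m ℕ.* n) ×# 1# ≈⟨ *-homo-× m n ⟩
    (m ×# 1#) * (n ×# 1#) ∎
  *-homoℤ (+ m) -[1+ n ] = begin
    ⟦ Sign.- ℤ.◃ (m ℕ.* suc n) ⟧ℤ ≡⟨ ≡.cong ⟦_⟧ℤ (ℤₚ.-◃n≡-n (m ℕ.* suc n)) ⟩
    ⟦ ℤ.- (+ (m ℕ.* suc n)) ⟧ℤ ≈⟨ -‿homoℤ (+ (m ℕ.* suc n)) ⟩
    - ((m ℕ.* suc n) ×# 1#) ≈⟨ -‿cong (*-homo-× m (suc n)) ⟩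
    - ((m ×# 1#) * (suc n ×# 1#)) ≈⟨ -‿distribʳ-* _ _ ⟩
    (m ×# 1#) * - (suc n ×# 1#) ∎
  *-homoℤ -[1+ m ] (+ n) = begin
    ⟦ Sign.- ℤ.◃ (suc m ℕ.* n) ⟧ℤ ≡⟨ ≡.cong ⟦_⟧ℤ (ℤₚ.-◃n≡-n (suc m ℕ.* n)) ⟩
    ⟦ ℤ.- (+ (suc m ℕ.* n)) ⟧ℤ ≈⟨ -‿homoℤ (+ (suc m ℕ.* n)) ⟩
    - ((suc m ℕ.* n) ×# 1#) ≈⟨ -‿cong (*-homo-× (suc m) n) ⟩
    - ((suc m ×# 1#) * (n ×# 1#)) ≈⟨ -‿distribˡ-* _ _ ⟩
    - (suc m ×# 1#) * (n ×# 1#) ∎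
  *-homoℤ -[1+ m ] -[1+ n ] = begin
    (suc m ℕ.* suc n) ×# 1# ≈⟨ *-homo-× (suc m) (suc n) ⟩
    (suc m ×# 1#) * (suc n ×# 1#) ≈⟨ -‿involutive _ ⟨
    - - ((suc m ×# 1#) * (suc n ×# 1#)) ≈⟨ -‿cong (-‿distribʳ-* _ _) ⟩
    - ((suc m ×# 1#) * - (suc n ×# 1#)) ≈⟨ -‿distribˡ-* _ _ ⟩
    - (suc m ×# 1#) * - (suc n ×# 1#) ∎

  ℤ⟶R : ℤ.+-*-rawRing -Raw-AlmostCommutative⟶ fromCommutativeRing R
  ℤ⟶R = record
    { ⟦_⟧ = ⟦_⟧ℤ ; +-homo = +-homoℤ ; *-homo = *-homoℤ ; -‿homo = -‿homoℤ
    ; 0-homo = ≈-refl ; 1-homo = +-identityʳ 1# }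

  decℤ : ∀ i j → Maybe (⟦ i ⟧ℤ ≈ ⟦ j ⟧ℤ)
  decℤ i j with i ℤₚ.≟ j
  ... | yes ≡.refl = just ≈-refl
  ... | no _ = nothing

  open Solver ℤ.+-*-rawRing (fromCommutativeRing R) ℤ⟶R decℤ public
    using (solve; con; _:+_; _:*_; _:-_; :-_; _:=_)

-- Additivity of the p-th power in characteristic p

prime∤! : ∀ {p} → Prime p → ∀ k → k < p → ¬ (p ∣ k !)
prime∤! pp zero k<p p∣1 = ℕₚ.<⇒≱ (ℕ.nonTrivial⇒n>1 _ {{prime⇒nonTrivial pp}}) (∣⇒≤ p∣1)
prime∤! pp (suc k) k<p p∣ with euclidsLemma (suc k) (k !) pp p∣
... | inj₁ p∣1+k = ℕₚ.<⇒≱ k<p (∣⇒≤ p∣1+k)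
... | inj₂ p∣k! = prime∤! pp k (ℕₚ.<-trans (ℕₚ.n<1+n k) k<p) p∣k!

-- The prime divides p! = C · k! · (p - k)!, but neither of the two factorials.
prime∣C : ∀ {p} → Prime p → ∀ k → 0 < k → k < p → p ∣ p choose k
prime∣C {p@(suc p′)} pp k 0<k k<p =
  [ (λ d → d) , (λ d → ⊥-elim ([ prime∤! pp k k<p , prime∤! pp (p ∸ k) p∸k<p ]′ (euclidsLemma (k !) ((p ∸ k) !) pp d))) ]′
    (euclidsLemma (p choose k) (k ! ℕ.* (p ∸ k) !) pp (≡.subst (p ∣_) (≡.sym eq) (m∣m*n (p′ !))))
  where
  instance _ = k ℕₚ.!* (p ∸ k) !≢0
  p∸k<p : p ∸ k < p
  p∸k<p = ℕₚ.∸-monoʳ-< 0<k (ℕₚ.<⇒≤ k<p)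
  eq : (p choose k) ℕ.* (k ! ℕ.* (p ∸ k) !) ≡ p !
  eq = ≡.trans (≡.cong (ℕ._* (k ! ℕ.* (p ∸ k) !)) (nCk≡n!/k![n-k]! (ℕₚ.<⇒≤ k<p)))
               (m/n*n≡m (k![n∸k]!∣n! (ℕₚ.<⇒≤ k<p)))

module Freshman (R : CommutativeRing 0ℓ 0ℓ) where
  open CommutativeRing R hiding (zero) renaming (refl to ≈-refl; sym to ≈-sym; trans to ≈-trans)
  open import Algebra.Properties.CommutativeSemiring.Binomial commutativeSemiring
  open import Algebra.Properties.Semiring.Sum semiring
  open import Algebra.Properties.Semiring.Mult semiring renaming (_×_ to _×#_)
  open import Algebra.Properties.Semiring.Exp semiring
  open import Relation.Binary.Reasoning.Setoid setoid

  ∣⇒×≈0 : ∀ {p k} → p ×# 1# ≈ 0# → p ∣ k → ∀ x → k ×# x ≈ 0#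
  ∣⇒×≈0 {p} char (divides c ≡.refl) x = begin
    (c ℕ.* p) ×# x ≈⟨ ×-assocˡ x c p ⟨
    c ×# (p ×# x) ≈⟨ ×-congʳ c (×-congʳ p (*-identityˡ x)) ⟨
    c ×# (p ×# (1# * x)) ≈⟨ ×-congʳ c (×-assoc-* p 1# x) ⟨
    c ×# (p ×# 1# * x) ≈⟨ ×-congʳ c (≈-trans (*-congʳ char) (zeroˡ x)) ⟩
    c ×# 0# ≈⟨ sum-replicate c ⟨
    _ ≈⟨ sum-replicate-zero c ⟩
    0# ∎

  sum-zero : ∀ n (t : Fin n → Carrier) → (∀ i → t i ≈ 0#) → sum t ≈ 0#
  sum-zero n t t≈0 = ≈-trans (sum-cong-≋ t≈0) (sum-replicate-zero n)

  -- Valid in any commutative ring of characteristic p. It is used for the field and also for the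
  -- quadratic algebra generated by a matrix, which may have zero divisors.
  ^-additive : ∀ {p} → Prime p → p ×# 1# ≈ 0# → ∀ x y → (x + y) ^ p ≈ x ^ p + y ^ p
  ^-additive {suc p′} pp char x y = begin
    (x + y) ^ p ≈⟨ theorem p x y ⟩
    sum t ≈⟨ sum-init-last t ⟩
    (t zero + sum mid) + t (fromℕ p) ≈⟨ +-cong (+-cong first (sum-zero p′ mid mid≈0)) last′ ⟩
    (y ^ p + 0#) + x ^ p ≈⟨ +-congʳ (+-identityʳ _) ⟩
    y ^ p + x ^ p ≈⟨ +-comm _ _ ⟩
    x ^ p + y ^ p ∎
    where
    p = suc p′
    t : Fin (suc p) → Carrier
    t = binomialTerm x y p
    mid : Fin p′ → Carrier
    mid i = t (inject₁ (suc i))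
    first : t zero ≈ y ^ p
    first = begin
      (p choose 0) ×# (1# * y ^ p) ≡⟨ ≡.cong (_×# (1# * y ^ p)) (≡.trans (nCk≡nC[n∸k] {0} {p} z≤n) (nCn≡1 p)) ⟩
      1 ×# (1# * y ^ p) ≈⟨ ≈-trans (×-homo-1 _) (*-identityˡ _) ⟩
      y ^ p ∎
    last′ : t (fromℕ p) ≈ x ^ p
    last′ = begin
      (p choose toℕ (fromℕ p)) ×# (x ^ toℕ (fromℕ p) * y ^ (p ∸ toℕ (fromℕ p)))
        ≡⟨ ≡.cong (λ k → (p choose k) ×# (x ^ k * y ^ (p ∸ k))) (Finₚ.toℕ-fromℕ p) ⟩
      (p choose p) ×# (x ^ p * y ^ (p ∸ p))
        ≡⟨ ≡.cong₂ (λ k l → k ×# (x ^ p * y ^ l)) (nCn≡1 p) (ℕₚ.n∸n≡0 p) ⟩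
      1 ×# (x ^ p * 1#)
        ≈⟨ ≈-trans (×-homo-1 _) (*-identityʳ _) ⟩
      x ^ p ∎
    mid≈0 : ∀ i → mid i ≈ 0#
    mid≈0 i = ∣⇒×≈0 char
      (prime∣C pp k (≡.subst (0 <_) (≡.sym k≡) (s≤s z≤n)) (≡.subst (_< p) (≡.sym k≡) (s≤s (Finₚ.toℕ<n i)))) _
      where
      k = toℕ (inject₁ (suc i))
      k≡ : k ≡ suc (toℕ i)
      k≡ = Finₚ.toℕ-inject₁ (suc i)

unique-⊆⇒length≤ : ∀ {A : Set} {xs ys : List A} → Unique xs → (∀ {x} → x ∈ xs → x ∈ ys) → length xs ≤ length ys
unique-⊆⇒length≤ {xs = []} _ _ = z≤n
unique-⊆⇒length≤ {xs = x ∷ xs} {ys} (x∉xs ∷ uxs) xs⊆ys with ∈-∃++ (xs⊆ys (here refl))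
... | as , bs , refl = subst (suc (length xs) ≤_) (sym len) (s≤s (unique-⊆⇒length≤ uxs rest))
  where
  len : length (as ++ x ∷ bs) ≡ suc (length (as ++ bs))
  len = trans (Listₚ.length-++ as) (trans (ℕₚ.+-suc _ _) (cong suc (sym (Listₚ.length-++ as))))
  rest : ∀ {y} → y ∈ xs → y ∈ as ++ bs
  rest {y} y∈ with ∈-++⁻ as (xs⊆ys (there y∈))
  ... | inj₁ y∈as = ∈-++⁺ˡ y∈as
  ... | inj₂ (here refl) = ⊥-elim (All.lookup x∉xs y∈ refl)
  ... | inj₂ (there y∈bs) = ∈-++⁺ʳ as y∈bs

length-filter-¬ : ∀ {A : Set} {P : A → Set} (P? : Decidable P) (xs : List A) →
  length xs ≡ length (filter P? xs) ℕ.+ length (filter (¬? ∘ P?) xs)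
length-filter-¬ P? [] = refl
length-filter-¬ P? (x ∷ xs) with P? x
... | yes _ = cong suc (length-filter-¬ P? xs)
... | no _ = trans (cong suc (length-filter-¬ P? xs)) (sym (ℕₚ.+-suc _ _))

-- Finite fields: Fermat's theorem and root counting

module FieldFacts (F : FiniteField) where
  open FiniteField F hiding (order)

  commutativeRing : CommutativeRing 0ℓ 0ℓ
  commutativeRing = record { isCommutativeRing = isCommutativeRing }

  open CommutativeRing commutativeRing public using
    ( +-assoc; +-comm; +-identityˡ; +-identityʳ; -‿inverseˡ; -‿inverseʳ
    ; *-assoc; *-comm; *-identityˡ; *-identityʳ; distribˡ; distribʳ; zeroˡ; zeroʳ; ring; semiring; commutativeSemiring
    ; +-commutativeMonoid; *-commutativeMonoid; _-_)
  open import Algebra.Properties.Ring ring public using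
    (-‿involutive; -0#≈0#; -‿distribˡ-*; -‿distribʳ-*; -‿+-comm; +-cancelˡ; +-cancelʳ; -‿injective)
  open import Algebra.Properties.CommutativeSemiring.Exp commutativeSemiring public using
    (_^_; ^-homo-*; ^-assocʳ; ^-distrib-*)
  open import Algebra.Properties.Semiring.Mult semiring public using (×1-homo-*) renaming (_×_ to _×#_)
  open IntegerSolver commutativeRing public
  open Freshman commutativeRing public using (^-additive)
  open ≡-Reasoning

  infix 4 _≟_
  -- Completeness of `elements` assigns a position to every element; elements with the same position
  -- are the same entry of the list.
  _≟_ : DecidableEquality Carrier
  x ≟ y with Any.index (elements-complete x) Finₚ.≟ Any.index (elements-complete y)
  ... | yes i≡j = yes (trans (lookup-index (elements-complete x))
                      (trans (cong (Data.List.Base.lookup elements) i≡j) (sym (lookup-index (elements-complete y)))))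
  ... | no i≢j = no (λ x≡y → i≢j (cong (Any.index ∘ elements-complete) x≡y))

  1≢0 : 1# ≢ 0#
  1≢0 = 0≢1 ∘ sym

  inverseˡ : ∀ {x} → x ≢ 0# → (x ⁻¹) * x ≡ 1#
  inverseˡ {x} x≢0 = trans (*-comm _ _) (⁻¹-inverse x x≢0)

  x⁻¹*xy : ∀ {x} y → x ≢ 0# → (x ⁻¹) * (x * y) ≡ y
  x⁻¹*xy {x} y x≢0 = trans (sym (*-assoc _ _ _)) (trans (cong (_* y) (inverseˡ x≢0)) (*-identityˡ y))

  x*x⁻¹y : ∀ {x} y → x ≢ 0# → x * ((x ⁻¹) * y) ≡ y
  x*x⁻¹y {x} y x≢0 = trans (sym (*-assoc _ _ _)) (trans (cong (_* y) (⁻¹-inverse x x≢0)) (*-identityˡ y))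

  *-cancelˡ : ∀ {x y z} → x ≢ 0# → x * y ≡ x * z → y ≡ z
  *-cancelˡ {x} {y} {z} x≢0 eq = trans (sym (x⁻¹*xy y x≢0)) (trans (cong ((x ⁻¹) *_) eq) (x⁻¹*xy z x≢0))

  zero-product : ∀ {x y} → x * y ≡ 0# → x ≢ 0# → y ≡ 0#
  zero-product {x} xy≡0 x≢0 = *-cancelˡ x≢0 (trans xy≡0 (sym (zeroʳ x)))

  *-nonzero : ∀ {x y} → x ≢ 0# → y ≢ 0# → x * y ≢ 0#
  *-nonzero x≢0 y≢0 xy≡0 = y≢0 (zero-product xy≡0 x≢0)

  nonzeroˡ : ∀ {x y} → x * y ≢ 0# → x ≢ 0#
  nonzeroˡ {y = y} xy≢0 x≡0 = xy≢0 (trans (cong (_* y) x≡0) (zeroˡ y))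

  nonzeroʳ : ∀ {x y} → x * y ≢ 0# → y ≢ 0#
  nonzeroʳ {x = x} xy≢0 y≡0 = xy≢0 (trans (cong (x *_) y≡0) (zeroʳ x))

  ⁻¹-nonzero : ∀ {x} → x ≢ 0# → x ⁻¹ ≢ 0#
  ⁻¹-nonzero {x} x≢0 = nonzeroʳ {x = x} (λ eq → 1≢0 (trans (sym (⁻¹-inverse x x≢0)) eq))

  neg-nonzero : ∀ {x} → x ≢ 0# → - x ≢ 0#
  neg-nonzero {x} x≢0 -x≡0 = x≢0 (trans (sym (-‿involutive x)) (trans (cong -_ -x≡0) -0#≈0#))

  x-y≡0⇒x≡y : ∀ {x y} → x - y ≡ 0# → x ≡ y
  x-y≡0⇒x≡y {x} {y} eq = begin
    x ≡⟨ solve 2 (λ x y → x := (x :- y) :+ y) refl x y ⟩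
    (x - y) + y ≡⟨ cong (_+ y) eq ⟩
    0# + y ≡⟨ +-identityˡ y ⟩
    y ∎

  x≡y⇒x-y≡0 : ∀ {x y} → x ≡ y → x - y ≡ 0#
  x≡y⇒x-y≡0 {x} refl = -‿inverseʳ x

  1^ : ∀ k → 1# ^ k ≡ 1#
  1^ zero = refl
  1^ (suc k) = trans (*-identityˡ _) (1^ k)

  0^ : ∀ k → 1 ≤ k → 0# ^ k ≡ 0#
  0^ (suc k) _ = zeroˡ _

  ^-nonzero : ∀ {x} k → x ≢ 0# → x ^ k ≢ 0#
  ^-nonzero zero x≢0 = 1≢0
  ^-nonzero (suc k) x≢0 = *-nonzero x≢0 (^-nonzero k x≢0)

  ^≡0⇒≡0 : ∀ {x} k → x ^ k ≡ 0# → x ≡ 0#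
  ^≡0⇒≡0 {x} k eq with x ≟ 0#
  ... | yes x≡0 = x≡0
  ... | no x≢0 = ⊥-elim (^-nonzero k x≢0 eq)

  ^-comm : ∀ x j k → (x ^ j) ^ k ≡ (x ^ k) ^ j
  ^-comm x j k = trans (^-assocʳ x j k) (trans (cong (x ^_) (ℕₚ.*-comm j k)) (sym (^-assocʳ x k j)))

  ^-inverse : ∀ {x} k → x ≢ 0# → x ^ k * (x ⁻¹) ^ k ≡ 1#
  ^-inverse {x} k x≢0 = trans (sym (^-distrib-* x (x ⁻¹) k)) (trans (cong (_^ k) (⁻¹-inverse x x≢0)) (1^ k))

  nonzeros : List Carrier
  nonzeros = filter (¬? ∘ (_≟ 0#)) elements

  nonzeros-unique : Unique nonzeros
  nonzeros-unique = Uniqueₚ.filter⁺ (¬? ∘ (_≟ 0#)) elements-unique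

  ∈nonzeros⁺ : ∀ {x} → x ≢ 0# → x ∈ nonzeros
  ∈nonzeros⁺ x≢0 = ∈-filter⁺ (¬? ∘ (_≟ 0#)) (elements-complete _) x≢0

  ∈nonzeros⁻ : ∀ {x} → x ∈ nonzeros → x ≢ 0#
  ∈nonzeros⁻ x∈ = proj₂ (∈-filter⁻ (¬? ∘ (_≟ 0#)) {xs = elements} x∈)

  order≡1+nonzeros : order F ≡ suc (length nonzeros)
  order≡1+nonzeros = ↭-length (∼bag⇒↭ (unique∧set⇒bag elements-unique (fresh ∷ nonzeros-unique)
    (λ {x} → mk⇔ (λ _ → split x) (λ _ → elements-complete x))))
    where
    fresh : All (0# ≢_) nonzeros
    fresh = All.tabulate (λ x∈ 0≡x → ∈nonzeros⁻ x∈ (sym 0≡x))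
    split : ∀ x → x ∈ 0# ∷ nonzeros
    split x with x ≟ 0#
    ... | yes x≡0 = here x≡0
    ... | no x≢0 = there (∈nonzeros⁺ x≢0)

  module _ (xs : List Carrier) (unique : Unique xs)
           (f g : Carrier → Carrier) (f-inj : ∀ {x y} → f x ≡ f y → x ≡ y) (f∘g : ∀ x → f (g x) ≡ x)
           (f-closed : ∀ {x} → x ∈ xs → f x ∈ xs) (g-closed : ∀ {x} → x ∈ xs → g x ∈ xs) where

    permuted : xs ↭ map f xs
    permuted = ∼bag⇒↭ (unique∧set⇒bag unique (Uniqueₚ.map⁺ f-inj unique) (λ {x} → mk⇔ to from))
      where
      to : ∀ {x} → x ∈ xs → x ∈ map f xs
      to {x} x∈ = subst (_∈ map f xs) (f∘g x) (∈-map⁺ f (g-closed x∈))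
      from : ∀ {x} → x ∈ map f xs → x ∈ xs
      from x∈ with ∈-map⁻ f x∈
      ... | y , y∈ , refl = f-closed y∈

  foldr-↭ : ∀ (M : CommutativeMonoid 0ℓ 0ℓ) → let module M = CommutativeMonoid M in
    ∀ {xs ys} → xs ↭ ys → M._≈_ (foldr M._∙_ M.ε xs) (foldr M._∙_ M.ε ys)
  foldr-↭ M p = ↭ₛ.foldr-commMonoid M.setoid M.isCommutativeMonoid (↭⇒↭ₛ′ M.isEquivalence p)
    where module M = CommutativeMonoid M

  -- Adding `1#` permutes the field, so the sum of all elements does not change although every
  -- summand grows by `1#`.
  order×1≡0 : order F ×# 1# ≡ 0#
  order×1≡0 = +-cancelʳ (total elements) _ _ (begin
    order F ×# 1# + total elements ≡⟨ shift elements ⟨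
    total (map (1# +_) elements) ≡⟨ foldr-↭ +-commutativeMonoid perm ⟨
    total elements ≡⟨ +-identityˡ _ ⟨
    0# + total elements ∎)
    where
    total = foldr _+_ 0#
    shift : ∀ xs → total (map (1# +_) xs) ≡ length xs ×# 1# + total xs
    shift [] = sym (+-identityˡ 0#)
    shift (x ∷ xs) = trans (cong ((1# + x) +_) (shift xs))
      (solve 4 (λ a x b c → (a :+ x) :+ (b :+ c) := (a :+ b) :+ (x :+ c)) refl 1# x _ _)
    perm = permuted elements elements-unique (1# +_) (- 1# +_) (+-cancelˡ 1# _ _)
      (λ x → solve 2 (λ a x → a :+ (:- a :+ x) := x) refl 1# x)
      (λ _ → elements-complete _) (λ _ → elements-complete _)

  -- Multiplication by `x` permutes the nonzero elements, and their product is nonzero and can be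
  -- cancelled.
  ^[order-1] : ∀ {x} → x ≢ 0# → x ^ (order F ∸ 1) ≡ 1#
  ^[order-1] {x} x≢0 = trans (cong (λ k → x ^ (k ∸ 1)) order≡1+nonzeros) (*-cancelˡ (nonzero nonzeros (λ z → z)) (begin
    Π nonzeros * x ^ length nonzeros ≡⟨ *-comm _ _ ⟩
    x ^ length nonzeros * Π nonzeros ≡⟨ shift nonzeros ⟨
    Π (map (x *_) nonzeros) ≡⟨ foldr-↭ *-commutativeMonoid perm ⟨
    Π nonzeros ≡⟨ *-identityʳ _ ⟨
    Π nonzeros * 1# ∎))
    where
    Π = foldr _*_ 1#
    nonzero : ∀ xs → (∀ {y} → y ∈ xs → y ∈ nonzeros) → Π xs ≢ 0#
    nonzero [] _ = 1≢0
    nonzero (y ∷ ys) sub = *-nonzero (∈nonzeros⁻ (sub (here refl))) (nonzero ys (sub ∘ there))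
    shift : ∀ xs → Π (map (x *_) xs) ≡ x ^ length xs * Π xs
    shift [] = sym (*-identityˡ 1#)
    shift (y ∷ ys) = trans (cong ((x * y) *_) (shift ys))
      (solve 4 (λ x y b c → (x :* y) :* (b :* c) := (x :* b) :* (y :* c)) refl x y _ _)
    perm = permuted nonzeros nonzeros-unique (x *_) ((x ⁻¹) *_) (*-cancelˡ x≢0) (λ y → x*x⁻¹y y x≢0)
      (λ y∈ → ∈nonzeros⁺ (*-nonzero x≢0 (∈nonzeros⁻ y∈)))
      (λ y∈ → ∈nonzeros⁺ (*-nonzero (⁻¹-nonzero x≢0) (∈nonzeros⁻ y∈)))

  ^order : ∀ x → x ^ order F ≡ x
  ^order x rewrite order≡1+nonzeros with x ≟ 0#
  ... | yes refl = zeroˡ _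
  ... | no x≢0 = trans (cong (x *_) (trans (cong (λ k → x ^ (k ∸ 1)) (sym order≡1+nonzeros)) (^[order-1] x≢0))) (*-identityʳ x)

  -- Coefficients of a monic polynomial, constant term first and the leading 1 omitted.
  eval : ∀ {N} → Vec Carrier N → Carrier → Carrier
  eval [] x = 1#
  eval (c ∷ cs) x = c + x * eval cs x

  -- Synthetic division by X - r: the coefficients of the quotient are the intermediate values of
  -- Horner's scheme at `r`, and the last value is the remainder.
  quotient : ∀ {N} → Vec Carrier (suc N) → Carrier → Vec Carrier N
  quotient (c ∷ []) r = []
  quotient (c ∷ cs@(_ ∷ _)) r = eval cs r ∷ quotient cs r

  eval-quotient : ∀ {N} (cs : Vec Carrier (suc N)) r x → eval cs x ≡ (x - r) * eval (quotient cs r) x + eval cs r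
  eval-quotient (c ∷ []) r x = solve 4 (λ c r x o → c :+ x :* o := (x :- r) :* o :+ (c :+ r :* o)) refl c r x 1#
  eval-quotient (c ∷ cs@(_ ∷ _)) r x = trans (cong (λ e → c + x * e) (eval-quotient cs r x))
    (solve 5 (λ c r x q e → c :+ x :* ((x :- r) :* q :+ e) := (x :- r) :* (e :+ x :* q) :+ (c :+ r :* e)) refl
      c r x (eval (quotient cs r) x) (eval cs r))

  roots≤degree : ∀ {N} (cs : Vec Carrier N) xs → Unique xs → All (λ x → eval cs x ≡ 0#) xs → length xs ≤ N
  roots≤degree cs [] _ _ = z≤n
  roots≤degree [] (x ∷ xs) _ (1≡0 ∷ _) = ⊥-elim (1≢0 1≡0)
  roots≤degree cs@(_ ∷ _) (r ∷ xs) (r∉xs ∷ u) (r-root ∷ roots) =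
    s≤s (roots≤degree (quotient cs r) xs u (All.zipWith step (r∉xs , roots)))
    where
    step : ∀ {x} → (r ≢ x) × (eval cs x ≡ 0#) → eval (quotient cs r) x ≡ 0#
    step {x} (r≢x , x-root) = zero-product
      (begin
        (x - r) * eval (quotient cs r) x ≡⟨ +-identityʳ _ ⟨
        (x - r) * eval (quotient cs r) x + 0# ≡⟨ cong ((x - r) * eval (quotient cs r) x +_) r-root ⟨
        (x - r) * eval (quotient cs r) x + eval cs r ≡⟨ eval-quotient cs r x ⟨
        eval cs x ≡⟨ x-root ⟩
        0# ∎)
      (λ eq → r≢x (sym (x-y≡0⇒x≡y eq)))

  eval-replicate : ∀ k x → eval (replicate k 0#) x ≡ x ^ k
  eval-replicate zero x = refl
  eval-replicate (suc k) x = trans (+-identityˡ _) (cong (x *_) (eval-replicate k x))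

  power-roots≤ : ∀ N c xs → 1 ≤ N → Unique xs → All (λ x → x ^ N ≡ c) xs → length xs ≤ N
  power-roots≤ (suc N) c xs _ u roots = roots≤degree (- c ∷ replicate N 0#) xs u (All.map step roots)
    where
    step : ∀ {x} → x * x ^ N ≡ c → - c + x * eval (replicate N 0#) x ≡ 0#
    step {x} eq = trans (cong (λ e → - c + x * e) (eval-replicate N x)) (trans (cong (- c +_) eq) (-‿inverseˡ c))

  -- Each equation x^N = c removes at most N candidates. The list `xs` is arbitrary so that the
  -- induction can pass to the candidates that survive one equation.
  avoid-powers : (conds : List (ℕ × Carrier)) → All (λ Nc → 1 ≤ proj₁ Nc) conds →
    ∀ xs → Unique xs → ListAction.sum (map proj₁ conds) < length xs →
    ∃ λ x → x ∈ xs × All (λ Nc → x ^ proj₁ Nc ≢ proj₂ Nc) conds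
  avoid-powers [] _ (x ∷ xs) _ _ = x , here refl , []
  avoid-powers ((N , c) ∷ conds) (1≤N ∷ pos) xs u lt =
    let x , x∈ , av = avoid-powers conds pos ys (Uniqueₚ.filter⁺ (¬? ∘ P?) u) lt′
        x∈xs , xN≢c = ∈-filter⁻ (¬? ∘ P?) {xs = xs} x∈
    in x , x∈xs , xN≢c ∷ av
    where
    P? = λ x → x ^ N ≟ c
    ys = filter (¬? ∘ P?) xs
    bad≤N : length (filter P? xs) ≤ N
    bad≤N = power-roots≤ N c _ 1≤N (Uniqueₚ.filter⁺ P? u) (Allₚ.all-filter P? xs)
    lt′ : ListAction.sum (map proj₁ conds) < length ys
    lt′ = ℕₚ.+-cancelˡ-< N _ _ (ℕₚ.<-≤-trans (subst (N ℕ.+ _ <_) (length-filter-¬ P? xs) lt) (ℕₚ.+-monoˡ-≤ _ bad≤N))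

-- The Frobenius automorphism

module Frobenius (F : FiniteField) (p n : ℕ) (pp : Prime p) (order≡ : order F ≡ p ℕ.^ n) where
  open FiniteField F hiding (order)
  open FieldFacts F
  open PΓL F p n using (pow; frob; frob^)
  open ≡-Reasoning

  -- The n-th power of p · 1 is q · 1 = 0, and a field has no nilpotent elements besides 0.
  p×1≡0 : p ×# 1# ≡ 0#
  p×1≡0 = ^≡0⇒≡0 n (trans (pow-× n) (trans (cong (_×# 1#) (sym order≡)) order×1≡0))
    where
    pow-× : ∀ k → (p ×# 1#) ^ k ≡ (p ℕ.^ k) ×# 1#
    pow-× zero = sym (+-identityʳ 1#)
    pow-× (suc k) = trans (cong ((p ×# 1#) *_) (pow-× k)) (sym (×1-homo-* p (p ℕ.^ k)))

  pow≡^ : ∀ x k → pow x k ≡ x ^ k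
  pow≡^ x zero = refl
  pow≡^ x (suc k) = cong (x *_) (pow≡^ x k)

  frob-+ : ∀ x y → frob (x + y) ≡ frob x + frob y
  frob-+ x y = trans (pow≡^ _ p) (trans (^-additive pp p×1≡0 x y) (sym (cong₂ _+_ (pow≡^ x p) (pow≡^ y p))))

  frob-* : ∀ x y → frob (x * y) ≡ frob x * frob y
  frob-* x y = trans (pow≡^ _ p) (trans (^-distrib-* x y p) (sym (cong₂ _*_ (pow≡^ x p) (pow≡^ y p))))

  frob^≡^ : ∀ k x → frob^ k x ≡ x ^ (p ℕ.^ k)
  frob^≡^ zero x = sym (*-identityʳ x)
  frob^≡^ (suc k) x = begin
    frob (frob^ k x) ≡⟨ pow≡^ _ p ⟩
    frob^ k x ^ p ≡⟨ cong (_^ p) (frob^≡^ k x) ⟩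
    (x ^ (p ℕ.^ k)) ^ p ≡⟨ ^-assocʳ x (p ℕ.^ k) p ⟩
    x ^ (p ℕ.^ k ℕ.* p) ≡⟨ cong (x ^_) (ℕₚ.*-comm (p ℕ.^ k) p) ⟩
    x ^ (p ℕ.^ suc k) ∎

  frob^-+ : ∀ k x y → frob^ k (x + y) ≡ frob^ k x + frob^ k y
  frob^-+ zero x y = refl
  frob^-+ (suc k) x y = trans (cong frob (frob^-+ k x y)) (frob-+ _ _)

  frob^-* : ∀ k x y → frob^ k (x * y) ≡ frob^ k x * frob^ k y
  frob^-* zero x y = refl
  frob^-* (suc k) x y = trans (cong frob (frob^-* k x y)) (frob-* _ _)

  frob^-1 : ∀ k → frob^ k 1# ≡ 1#
  frob^-1 k = trans (frob^≡^ k 1#) (1^ (p ℕ.^ k))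

  frob^-0 : ∀ k → frob^ k 0# ≡ 0#
  frob^-0 k = +-cancelˡ (frob^ k 0#) _ _
    (trans (sym (frob^-+ k 0# 0#)) (trans (cong (frob^ k) (+-identityˡ 0#)) (sym (+-identityʳ _))))

  frob^-neg : ∀ k x → frob^ k (- x) ≡ - frob^ k x
  frob^-neg k x = +-cancelˡ (frob^ k x) _ _
    (trans (sym (frob^-+ k x (- x))) (trans (cong (frob^ k) (-‿inverseʳ x)) (trans (frob^-0 k) (sym (-‿inverseʳ _)))))

  frob^-nonzero : ∀ k {x} → x ≢ 0# → frob^ k x ≢ 0#
  frob^-nonzero k {x} x≢0 eq = ^-nonzero (p ℕ.^ k) x≢0 (trans (sym (frob^≡^ k x)) eq)

  frob^-inj : ∀ k {x y} → frob^ k x ≡ frob^ k y → x ≡ y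
  frob^-inj k {x} {y} eq with (x - y) ≟ 0#
  ... | yes d = x-y≡0⇒x≡y d
  ... | no d = ⊥-elim (frob^-nonzero k d (trans (frob^-+ k x (- y)) (trans (cong (frob^ k x +_) (frob^-neg k y)) (x≡y⇒x-y≡0 eq))))

  frob^-^ : ∀ k x j → frob^ k (x ^ j) ≡ frob^ k x ^ j
  frob^-^ k x j = trans (frob^≡^ k (x ^ j)) (trans (^-comm x j (p ℕ.^ k)) (cong (_^ j) (sym (frob^≡^ k x))))

  frob^-∘ : ∀ j k x → frob^ (j ℕ.+ k) x ≡ frob^ j (frob^ k x)
  frob^-∘ zero k x = refl
  frob^-∘ (suc j) k x = cong frob (frob^-∘ j k x)

  frob^-comm : ∀ j k x → frob^ j (frob^ k x) ≡ frob^ k (frob^ j x)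
  frob^-comm j k x = trans (sym (frob^-∘ j k x)) (trans (cong (λ l → frob^ l x) (ℕₚ.+-comm j k)) (frob^-∘ k j x))

  frob^-fix-* : ∀ {k x} c → frob^ k x ≡ x → frob^ (c ℕ.* k) x ≡ x
  frob^-fix-* zero eq = refl
  frob^-fix-* {k} {x} (suc c) eq = trans (frob^-∘ k (c ℕ.* k) x) (trans (cong (frob^ k) (frob^-fix-* c eq)) eq)

  frob^n : ∀ x → frob^ n x ≡ x
  frob^n x = trans (frob^≡^ n x) (trans (cong (x ^_) (sym order≡)) (^order x))

  frob^-multiple : ∀ c x → frob^ (c ℕ.* n) x ≡ x
  frob^-multiple c x = frob^-fix-* c (frob^n x)

  -- The exponents whose Frobenius power fixes `x` contain both k and n, hence their gcd by Bézout.
  -- Over the natural numbers Bézout's identity has two forms, which gives the two cases.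
  frob^-gcd : ∀ k {x} → frob^ k x ≡ x → frob^ (gcd k n) x ≡ x
  frob^-gcd k {x} fix with Bézout.identity (gcd-GCD k n)
  ... | Bézout.+- a b eq = trans (sym (trans (frob^-∘ (gcd k n) (b ℕ.* n) x) (cong (frob^ (gcd k n)) (frob^-multiple b x))))
                             (trans (cong (λ l → frob^ l x) eq) (frob^-fix-* a fix))
  ... | Bézout.-+ a b eq = trans (sym (trans (frob^-∘ (gcd k n) (a ℕ.* k) x) (cong (frob^ (gcd k n)) (frob^-fix-* a fix))))
                             (trans (cong (λ l → frob^ l x) eq) (frob^-multiple b x))

-- Two by two matrices modulo scalars

module Matrices (F : FiniteField) (p n : ℕ) where
  open FiniteField F hiding (order)
  open FieldFacts F
  open PΓL F p n using (Mat; mat; _·M_; mapMat; scale; det; adj; I₂)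
  open ≡-Reasoning

  mat≡ : ∀ {a b c d a′ b′ c′ d′} → a ≡ a′ → b ≡ b′ → c ≡ c′ → d ≡ d′ → mat a b c d ≡ mat a′ b′ c′ d′
  mat≡ refl refl refl refl = refl

  mat-a : ∀ {a b c d a′ b′ c′ d′} → mat a b c d ≡ mat a′ b′ c′ d′ → a ≡ a′
  mat-a refl = refl
  mat-b : ∀ {a b c d a′ b′ c′ d′} → mat a b c d ≡ mat a′ b′ c′ d′ → b ≡ b′
  mat-b refl = refl
  mat-c : ∀ {a b c d a′ b′ c′ d′} → mat a b c d ≡ mat a′ b′ c′ d′ → c ≡ c′
  mat-c refl = refl
  mat-d : ∀ {a b c d a′ b′ c′ d′} → mat a b c d ≡ mat a′ b′ c′ d′ → d ≡ d′
  mat-d refl = refl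

  ·M-assoc : ∀ A B C → (A ·M B) ·M C ≡ A ·M (B ·M C)
  ·M-assoc (mat a b c d) (mat a′ b′ c′ d′) (mat x y z w) = mat≡ (e a b x z) (e a b y w) (e c d x z) (e c d y w)
    where
    e : ∀ a b x z → (a * a′ + b * c′) * x + (a * b′ + b * d′) * z ≡ a * (a′ * x + b′ * z) + b * (c′ * x + d′ * z)
    e a b x z = solve 8 (λ a b a′ b′ c′ d′ x z →
      (a :* a′ :+ b :* c′) :* x :+ (a :* b′ :+ b :* d′) :* z := a :* (a′ :* x :+ b′ :* z) :+ b :* (c′ :* x :+ d′ :* z))
      refl a b a′ b′ c′ d′ x z

  1x+0y : ∀ x y → 1# * x + 0# * y ≡ x
  1x+0y x y = trans (cong₂ _+_ (*-identityˡ x) (zeroˡ y)) (+-identityʳ x)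

  0x+1y : ∀ x y → 0# * x + 1# * y ≡ y
  0x+1y x y = trans (cong₂ _+_ (zeroˡ x) (*-identityˡ y)) (+-identityˡ y)

  ·M-identityˡ : ∀ A → I₂ ·M A ≡ A
  ·M-identityˡ (mat a b c d) = mat≡ (1x+0y _ _) (1x+0y _ _) (0x+1y _ _) (0x+1y _ _)

  ·M-identityʳ : ∀ A → A ·M I₂ ≡ A
  ·M-identityʳ (mat a b c d) = mat≡ (l a b) (r a b) (l c d) (r c d)
    where
    l : ∀ x y → x * 1# + y * 0# ≡ x
    l x y = trans (cong₂ _+_ (*-identityʳ x) (zeroʳ y)) (+-identityʳ x)
    r : ∀ x y → x * 0# + y * 1# ≡ y
    r x y = trans (cong₂ _+_ (zeroʳ x) (*-identityʳ y)) (+-identityˡ y)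

  det-· : ∀ A B → det (A ·M B) ≡ det A * det B
  det-· (mat a b c d) (mat a′ b′ c′ d′) = solve 8 (λ a b c d a′ b′ c′ d′ →
    (a :* a′ :+ b :* c′) :* (c :* b′ :+ d :* d′) :+ :- ((a :* b′ :+ b :* d′) :* (c :* a′ :+ d :* c′))
      := (a :* d :+ :- (b :* c)) :* (a′ :* d′ :+ :- (b′ :* c′))) refl a b c d a′ b′ c′ d′

  det-I : det I₂ ≡ 1#
  det-I = trans (cong₂ _+_ (*-identityˡ 1#) (trans (cong -_ (zeroˡ 0#)) -0#≈0#)) (+-identityʳ 1#)

  det-scale : ∀ s A → det (scale s A) ≡ (s * s) * det A
  det-scale s (mat a b c d) = solve 5 (λ s a b c d →
    (s :* a) :* (s :* d) :+ :- ((s :* b) :* (s :* c)) := (s :* s) :* (a :* d :+ :- (b :* c))) refl s a b c d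

  det-adj : ∀ A → det (adj A) ≡ det A
  det-adj (mat a b c d) = solve 4 (λ a b c d → d :* a :+ :- ((:- b) :* (:- c)) := a :* d :+ :- (b :* c)) refl a b c d

  ·M-adj : ∀ A → A ·M adj A ≡ scale (det A) I₂
  ·M-adj (mat a b c d) = mat≡
    (trans (solve 4 (λ a b c d → a :* d :+ b :* (:- c) := a :* d :+ :- (b :* c)) refl a b c d) (sym (*-identityʳ _)))
    (trans (solve 4 (λ a b c d → a :* (:- b) :+ b :* a := con (+ 0)) refl a b c d) (sym (zeroʳ _)))
    (trans (solve 4 (λ a b c d → c :* d :+ d :* (:- c) := con (+ 0)) refl a b c d) (sym (zeroʳ _)))
    (trans (solve 4 (λ a b c d → c :* (:- b) :+ d :* a := a :* d :+ :- (b :* c)) refl a b c d) (sym (*-identityʳ _)))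
    where open import Data.Integer.Base using (+_)

  adj-·M : ∀ A → adj A ·M A ≡ scale (det A) I₂
  adj-·M (mat a b c d) = mat≡
    (trans (solve 4 (λ a b c d → d :* a :+ (:- b) :* c := a :* d :+ :- (b :* c)) refl a b c d) (sym (*-identityʳ _)))
    (trans (solve 4 (λ a b c d → d :* b :+ (:- b) :* d := con (+ 0)) refl a b c d) (sym (zeroʳ _)))
    (trans (solve 4 (λ a b c d → (:- c) :* a :+ a :* c := con (+ 0)) refl a b c d) (sym (zeroʳ _)))
    (trans (solve 4 (λ a b c d → (:- c) :* b :+ a :* d := a :* d :+ :- (b :* c)) refl a b c d) (sym (*-identityʳ _)))
    where open import Data.Integer.Base using (+_)

  scale-·M : ∀ s A B → scale s A ·M B ≡ scale s (A ·M B)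
  scale-·M s (mat a b c d) (mat a′ b′ c′ d′) = mat≡ (e a b a′ c′) (e a b b′ d′) (e c d a′ c′) (e c d b′ d′)
    where
    e : ∀ x y z w → (s * x) * z + (s * y) * w ≡ s * (x * z + y * w)
    e x y z w = solve 5 (λ s x y z w → (s :* x) :* z :+ (s :* y) :* w := s :* (x :* z :+ y :* w)) refl s x y z w

  ·M-scale : ∀ s A B → A ·M scale s B ≡ scale s (A ·M B)
  ·M-scale s (mat a b c d) (mat a′ b′ c′ d′) = mat≡ (e a b a′ c′) (e a b b′ d′) (e c d a′ c′) (e c d b′ d′)
    where
    e : ∀ x y z w → x * (s * z) + y * (s * w) ≡ s * (x * z + y * w)
    e x y z w = solve 5 (λ s x y z w → x :* (s :* z) :+ y :* (s :* w) := s :* (x :* z :+ y :* w)) refl s x y z w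

  scale-scale : ∀ s t A → scale s (scale t A) ≡ scale (s * t) A
  scale-scale s t (mat a b c d) = mat≡ (sym (*-assoc s t a)) (sym (*-assoc s t b)) (sym (*-assoc s t c)) (sym (*-assoc s t d))

  scale-1 : ∀ A → scale 1# A ≡ A
  scale-1 (mat a b c d) = mat≡ (*-identityˡ a) (*-identityˡ b) (*-identityˡ c) (*-identityˡ d)

  infix 4 _~_
  -- A record in place of the existential inside `_≈_`, so that unification recovers the two
  -- matrices from the type.
  record _~_ (A B : Mat) : Set where
    constructor scaled
    field
      scalar : Carrier
      scalar≢0 : scalar ≢ 0#
      ≡scale : B ≡ scale scalar A

  ~⁻ : ∀ {A B} → A ~ B → ∃ λ s → s ≢ 0# × B ≡ scale s A
  ~⁻ (scaled s s≢0 eq) = s , s≢0 , eq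

  ~⁺ : ∀ {A B} → (∃ λ s → s ≢ 0# × B ≡ scale s A) → A ~ B
  ~⁺ (s , s≢0 , eq) = scaled s s≢0 eq

  ≡⇒~ : ∀ {A B} → A ≡ B → A ~ B
  ≡⇒~ {A} refl = scaled 1# 1≢0 (sym (scale-1 A))

  ~-refl : ∀ {A} → A ~ A
  ~-refl = ≡⇒~ refl

  ~-sym : ∀ {A B} → A ~ B → B ~ A
  ~-sym {A} (scaled s s≢0 refl) = scaled (s ⁻¹) (⁻¹-nonzero s≢0)
    (trans (sym (scale-1 A)) (trans (cong (λ t → scale t A) (sym (inverseˡ s≢0))) (sym (scale-scale _ _ A))))

  ~-trans : ∀ {A B C} → A ~ B → B ~ C → A ~ C
  ~-trans {A} (scaled s s≢0 refl) (scaled t t≢0 refl) = scaled (t * s) (*-nonzero t≢0 s≢0) (scale-scale t s A)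

  ~-cong : ∀ {A A′ B B′} → A ~ A′ → B ~ B′ → A ·M B ~ A′ ·M B′
  ~-cong {A} {B = B} (scaled s s≢0 refl) (scaled t t≢0 refl) = scaled (s * t) (*-nonzero s≢0 t≢0)
    (trans (scale-·M s A (scale t B)) (trans (cong (scale s) (·M-scale t A B)) (scale-scale s t (A ·M B))))

  ~-det : ∀ {A B} → A ~ B → det A ≢ 0# → det B ≢ 0#
  ~-det {A} (scaled s s≢0 refl) d≢0 eq = *-nonzero (*-nonzero s≢0 s≢0) d≢0 (trans (sym (det-scale s A)) eq)

  scale~ : ∀ {s A} → s ≢ 0# → A ~ scale s A
  scale~ s≢0 = scaled _ s≢0 refl

  record IsFieldHom (f : Carrier → Carrier) : Set where
    field
      f-+ : ∀ x y → f (x + y) ≡ f x + f y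
      f-* : ∀ x y → f (x * y) ≡ f x * f y
      f-neg : ∀ x → f (- x) ≡ - f x
      f-0 : f 0# ≡ 0#
      f-1 : f 1# ≡ 1#

    mapMat-· : ∀ A B → mapMat f (A ·M B) ≡ mapMat f A ·M mapMat f B
    mapMat-· (mat a b c d) (mat a′ b′ c′ d′) = mat≡ (e a b a′ c′) (e a b b′ d′) (e c d a′ c′) (e c d b′ d′)
      where
      e : ∀ x y z w → f (x * z + y * w) ≡ f x * f z + f y * f w
      e x y z w = trans (f-+ _ _) (cong₂ _+_ (f-* x z) (f-* y w))

    mapMat-det : ∀ A → det (mapMat f A) ≡ f (det A)
    mapMat-det (mat a b c d) = sym (trans (f-+ _ _) (cong₂ _+_ (f-* a d) (trans (f-neg _) (cong -_ (f-* b c)))))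

    mapMat-scale : ∀ s A → mapMat f (scale s A) ≡ scale (f s) (mapMat f A)
    mapMat-scale s (mat a b c d) = mat≡ (f-* s a) (f-* s b) (f-* s c) (f-* s d)

    mapMat-I : mapMat f I₂ ≡ I₂
    mapMat-I = mat≡ f-1 f-0 f-0 f-1

  mapMat-cong : ∀ {f g : Carrier → Carrier} → (∀ x → f x ≡ g x) → ∀ A → mapMat f A ≡ mapMat g A
  mapMat-cong eq (mat a b c d) = mat≡ (eq a) (eq b) (eq c) (eq d)

-- The semilinear projective group as a `Group`

module SemilinearGroup (F : FiniteField) (p n : ℕ) (pp : Prime p) (order≡ : order F ≡ p ℕ.^ n) (1≤n : 1 ≤ n) where
  open FiniteField F hiding (order)
  open FieldFacts F
  open PΓL F p n
  open Frobenius F p n pp order≡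
  open Matrices F p n

  frob^-hom : ∀ k → IsFieldHom (frob^ k)
  frob^-hom k = record { f-+ = frob^-+ k ; f-* = frob^-* k ; f-neg = frob^-neg k ; f-0 = frob^-0 k ; f-1 = frob^-1 k }

  module Frob^ (k : ℕ) = IsFieldHom (frob^-hom k)

  1+n∸1 : suc (n ∸ 1) ≡ n
  1+n∸1 = ℕₚ.m+[n∸m]≡n 1≤n

  -- The inverse of `frob^ k`, expressed by the exponent that occurs in `_∙_` and `inv`: k(n - 1) is
  -- congruent to -k modulo n.
  frob⁻ : ℕ → Carrier → Carrier
  frob⁻ k = frob^ (k ℕ.* (n ∸ 1))

  frob⁻-frob : ∀ k x → frob⁻ k (frob^ k x) ≡ x
  frob⁻-frob k x = trans (sym (frob^-∘ (k ℕ.* (n ∸ 1)) k x)) (trans (cong (λ l → frob^ l x) eq) (frob^-multiple k x))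
    where
    eq : k ℕ.* (n ∸ 1) ℕ.+ k ≡ k ℕ.* n
    eq = trans (ℕₚ.+-comm _ k) (trans (sym (ℕₚ.*-suc k (n ∸ 1))) (cong (k ℕ.*_) 1+n∸1))

  frob-frob⁻ : ∀ k x → frob^ k (frob⁻ k x) ≡ x
  frob-frob⁻ k x = trans (frob^-comm k (k ℕ.* (n ∸ 1)) x) (frob⁻-frob k x)

  frob⁻-cong : ∀ {j k} → (∀ z → frob^ j z ≡ frob^ k z) → ∀ z → frob⁻ j z ≡ frob⁻ k z
  frob⁻-cong {j} {k} eq z = frob^-inj j (trans (frob-frob⁻ j z) (trans (sym (frob-frob⁻ k z)) (sym (eq (frob⁻ k z)))))

  frob⁻-+ : ∀ j k z → frob⁻ (j ℕ.+ k) z ≡ frob⁻ j (frob⁻ k z)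
  frob⁻-+ j k z = trans (cong (λ l → frob^ l z) (ℕₚ.*-distribʳ-+ (n ∸ 1) j k)) (frob^-∘ (j ℕ.* (n ∸ 1)) _ z)

  frob⁻⁻ : ∀ k z → frob⁻ (k ℕ.* (n ∸ 1)) z ≡ frob^ k z
  frob⁻⁻ k z = trans (cong (frob⁻ (k ℕ.* (n ∸ 1))) (sym (frob⁻-frob k z))) (frob⁻-frob (k ℕ.* (n ∸ 1)) (frob^ k z))

  mapMat-~ : ∀ k {A B} → A ~ B → mapMat (frob^ k) A ~ mapMat (frob^ k) B
  mapMat-~ k {A} (scaled s s≢0 refl) = scaled (frob^ k s) (frob^-nonzero k s≢0) (Frob^.mapMat-scale k s A)

  mapMat-∘ : ∀ (f g : Carrier → Carrier) A → mapMat f (mapMat g A) ≡ mapMat (f ∘ g) A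
  mapMat-∘ f g (mat a b c d) = refl

  mapMat-id : ∀ {f : Carrier → Carrier} → (∀ x → f x ≡ x) → ∀ A → mapMat f A ≡ A
  mapMat-id eq (mat a b c d) = mat≡ (eq a) (eq b) (eq c) (eq d)

  det-frob^ : ∀ k A → det A ≢ 0# → det (mapMat (frob^ k) A) ≢ 0#
  det-frob^ k A d≢0 eq = frob^-nonzero k d≢0 (trans (sym (Frob^.mapMat-det k A)) eq)

  -- The operations on `Elt` obey the inverse laws only for nonsingular matrices, so the
  -- nonsingularity is carried along to obtain a group.
  ΓL : Set
  ΓL = Σ Elt IsPΓL

  infix 4 _≋_
  record _≋_ (g h : ΓL) : Set where
    constructor equiv
    field
      matrix~ : matrix (proj₁ g) ~ matrix (proj₁ h)
      aut≗ : ∀ z → frob^ (aut (proj₁ g)) z ≡ frob^ (aut (proj₁ h)) z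
  open _≋_ public

  ≋⇒≈ : ∀ {g h} → g ≋ h → proj₁ g ≈ proj₁ h
  ≋⇒≈ (equiv m a) = ~⁻ m , a

  ≈⇒≋ : ∀ {g h : ΓL} → proj₁ g ≈ proj₁ h → g ≋ h
  ≈⇒≋ (m , a) = equiv (~⁺ m) a

  infixl 7 _⊙_
  _⊙_ : ΓL → ΓL → ΓL
  (x@(⟨ A , j ⟩) , dx) ⊙ (y@(⟨ B , k ⟩) , dy) = (x ∙ y) ,
    λ eq → *-nonzero dx (det-frob^ (j ℕ.* (n ∸ 1)) B dy) (trans (sym (det-· A _)) eq)

  ⊙-inv : ΓL → ΓL
  ⊙-inv (x@(⟨ A , j ⟩) , dx) = inv x , det-frob^ j (adj A) (λ eq → dx (trans (sym (det-adj A)) eq))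

  ⊙-e : ΓL
  ⊙-e = e , λ eq → 1≢0 (trans (sym det-I) eq)

  ⊙-cong : ∀ {g g′ h h′} → g ≋ g′ → h ≋ h′ → g ⊙ h ≋ g′ ⊙ h′
  ⊙-cong {⟨ A , j ⟩ , _} {⟨ A′ , j′ ⟩ , _} {⟨ B , k ⟩ , _} {⟨ B′ , k′ ⟩ , _} (equiv m a) (equiv m′ a′) = equiv
    (~-cong m (~-trans (mapMat-~ (j ℕ.* (n ∸ 1)) m′) (≡⇒~ (mapMat-cong (frob⁻-cong {j} {j′} a) B′))))
    (λ z → trans (frob^-∘ j k z) (trans (a _) (trans (cong (frob^ j′) (a′ z)) (sym (frob^-∘ j′ k′ z)))))

  ⊙-assoc : ∀ f g h → (f ⊙ g) ⊙ h ≋ f ⊙ (g ⊙ h)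
  ⊙-assoc (⟨ A , j ⟩ , _) (⟨ B , k ⟩ , _) (⟨ C , l ⟩ , _) = equiv
    (≡⇒~ (trans (·M-assoc A _ _) (cong (A ·M_) (trans
      (cong (mapMat (frob⁻ j) B ·M_) (trans (mapMat-cong (frob⁻-+ j k) C) (sym (mapMat-∘ (frob⁻ j) (frob⁻ k) C))))
      (sym (Frob^.mapMat-· (j ℕ.* (n ∸ 1)) B _))))))
    (λ z → cong (λ i → frob^ i z) (ℕₚ.+-assoc j k l))

  ⊙-identityˡ : ∀ g → ⊙-e ⊙ g ≋ g
  ⊙-identityˡ (⟨ A , j ⟩ , _) = equiv (≡⇒~ (trans (·M-identityˡ _) (mapMat-id (λ _ → refl) A))) (λ _ → refl)

  ⊙-identityʳ : ∀ g → g ⊙ ⊙-e ≋ g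
  ⊙-identityʳ (⟨ A , j ⟩ , _) = equiv
    (≡⇒~ (trans (cong (A ·M_) (Frob^.mapMat-I (j ℕ.* (n ∸ 1)))) (·M-identityʳ A)))
    (λ z → cong (λ i → frob^ i z) (ℕₚ.+-identityʳ j))

  ⊙-inverseʳ : ∀ g → g ⊙ ⊙-inv g ≋ ⊙-e
  ⊙-inverseʳ (⟨ A , j ⟩ , dA) = equiv
    (~-sym (scaled (det A) dA
      (trans (cong (A ·M_) (trans (mapMat-∘ (frob⁻ j) (frob^ j) (adj A)) (mapMat-id (frob⁻-frob j) (adj A)))) (·M-adj A))))
    (λ z → trans (frob^-∘ j _ z) (frob-frob⁻ j z))

  ⊙-inverseˡ : ∀ g → ⊙-inv g ⊙ g ≋ ⊙-e
  ⊙-inverseˡ (⟨ A , j ⟩ , dA) = equiv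
    (~-sym (scaled (frob^ j (det A)) (frob^-nonzero j dA)
      (trans (cong (mapMat (frob^ j) (adj A) ·M_) (mapMat-cong (frob⁻⁻ j) A))
      (trans (sym (Frob^.mapMat-· j (adj A) A))
      (trans (cong (mapMat (frob^ j)) (adj-·M A))
      (trans (Frob^.mapMat-scale j (det A) I₂) (cong (scale (frob^ j (det A))) (Frob^.mapMat-I j))))))))
    (λ z → trans (frob^-∘ (j ℕ.* (n ∸ 1)) j z) (frob⁻-frob j z))

  ⊙-inv-cong : ∀ {g h} → g ≋ h → ⊙-inv g ≋ ⊙-inv h
  ⊙-inv-cong {⟨ A , j ⟩ , _} {⟨ B , k ⟩ , _} (equiv (scaled s s≢0 refl) a) = equiv
    (scaled (frob^ j s) (frob^-nonzero j s≢0)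
      (trans (cong (mapMat (frob^ k)) (adj-scale A))
      (trans (mapMat-cong (λ z → sym (a z)) (scale s (adj A))) (Frob^.mapMat-scale j s (adj A)))))
    (frob⁻-cong {j} {k} a)
    where
    adj-scale : ∀ A → adj (scale s A) ≡ scale s (adj A)
    adj-scale (mat a b c d) = mat≡ refl (-‿distribʳ-* s b) (-‿distribʳ-* s c) refl

  𝔾 : Group 0ℓ 0ℓ
  𝔾 = record
    { Carrier = ΓL ; _≈_ = _≋_ ; _∙_ = _⊙_ ; ε = ⊙-e ; _⁻¹ = ⊙-inv
    ; isGroup = record
      { isMonoid = record
        { isSemigroup = record
          { isMagma = record
            { isEquivalence = record
              { refl = equiv ~-refl (λ _ → refl)
              ; sym = λ (equiv m a) → equiv (~-sym m) (λ z → sym (a z))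
              ; trans = λ (equiv m a) (equiv m′ a′) → equiv (~-trans m m′) (λ z → trans (a z) (a′ z)) }
            ; ∙-cong = ⊙-cong }
          ; assoc = ⊙-assoc }
        ; identity = ⊙-identityˡ , ⊙-identityʳ }
      ; inverse = ⊙-inverseˡ , ⊙-inverseʳ
      ; ⁻¹-cong = ⊙-inv-cong } }

-- The quadratic algebra of a characteristic polynomial

module QuadraticAlgebra (F : FiniteField) (τ δ : FiniteField.Carrier F) where
  open FiniteField F hiding (order)
  open FieldFacts F

  -- F[t]/(t² - τt + δ), with (x , y) standing for x + yt.
  Q : Set
  Q = Carrier × Carrier

  _+Q_ _*Q_ : Q → Q → Q
  (x , y) +Q (x′ , y′) = (x + x′) , (y + y′)
  (x , y) *Q (x′ , y′) = (x * x′ - δ * (y * y′)) , ((x * y′ + y * x′) + τ * (y * y′))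

  -Q_ : Q → Q
  -Q (x , y) = (- x) , (- y)

  *Q-comm : ∀ u v → u *Q v ≡ v *Q u
  *Q-comm (x , y) (x′ , y′) = cong₂ _,_
    (solve 5 (λ d x y x′ y′ → x :* x′ :- d :* (y :* y′) := x′ :* x :- d :* (y′ :* y)) refl δ x y x′ y′)
    (solve 5 (λ t x y x′ y′ → (x :* y′ :+ y :* x′) :+ t :* (y :* y′) := (x′ :* y :+ y′ :* x) :+ t :* (y′ :* y)) refl τ x y x′ y′)

  *Q-assoc : ∀ u v w → (u *Q v) *Q w ≡ u *Q (v *Q w)
  *Q-assoc (x , y) (x′ , y′) (x″ , y″) = cong₂ _,_
    (solve 8 (λ t d x y x′ y′ x″ y″ →
      (x :* x′ :- d :* (y :* y′)) :* x″ :- d :* (((x :* y′ :+ y :* x′) :+ t :* (y :* y′)) :* y″)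
      := x :* (x′ :* x″ :- d :* (y′ :* y″)) :- d :* (y :* ((x′ :* y″ :+ y′ :* x″) :+ t :* (y′ :* y″))))
      refl τ δ x y x′ y′ x″ y″)
    (solve 8 (λ t d x y x′ y′ x″ y″ →
      ((x :* x′ :- d :* (y :* y′)) :* y″ :+ ((x :* y′ :+ y :* x′) :+ t :* (y :* y′)) :* x″)
        :+ t :* (((x :* y′ :+ y :* x′) :+ t :* (y :* y′)) :* y″)
      := (x :* ((x′ :* y″ :+ y′ :* x″) :+ t :* (y′ :* y″)) :+ y :* (x′ :* x″ :- d :* (y′ :* y″)))
        :+ t :* (y :* ((x′ :* y″ :+ y′ :* x″) :+ t :* (y′ :* y″))))
      refl τ δ x y x′ y′ x″ y″)

  *Q-identityˡ : ∀ u → (1# , 0#) *Q u ≡ u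
  *Q-identityˡ (x , y) = cong₂ _,_
    (trans (cong₂ _-_ (*-identityˡ x) (trans (cong (δ *_) (zeroˡ y)) (zeroʳ δ))) (trans (cong (x +_) -0#≈0#) (+-identityʳ x)))
    (trans (cong₂ _+_ (cong₂ _+_ (*-identityˡ y) (zeroˡ x)) (trans (cong (τ *_) (zeroˡ y)) (zeroʳ τ)))
           (trans (+-identityʳ _) (+-identityʳ y)))

  *Q-distribˡ : ∀ u v w → u *Q (v +Q w) ≡ (u *Q v) +Q (u *Q w)
  *Q-distribˡ (x , y) (x′ , y′) (x″ , y″) = cong₂ _,_
    (solve 7 (λ d x y x′ y′ x″ y″ → x :* (x′ :+ x″) :- d :* (y :* (y′ :+ y″))
      := (x :* x′ :- d :* (y :* y′)) :+ (x :* x″ :- d :* (y :* y″))) refl δ x y x′ y′ x″ y″)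
    (solve 7 (λ t x y x′ y′ x″ y″ → (x :* (y′ :+ y″) :+ y :* (x′ :+ x″)) :+ t :* (y :* (y′ :+ y″))
      := ((x :* y′ :+ y :* x′) :+ t :* (y :* y′)) :+ ((x :* y″ :+ y :* x″) :+ t :* (y :* y″))) refl τ x y x′ y′ x″ y″)

  -- The p-th power is not additive on matrices, which do not commute. This commutative ring maps
  -- onto the algebra generated by one matrix and carries the additivity over to it.
  quadraticRing : CommutativeRing 0ℓ 0ℓ
  quadraticRing = record
    { Carrier = Q ; _≈_ = _≡_ ; _+_ = _+Q_ ; _*_ = _*Q_ ; -_ = -Q_ ; 0# = 0# , 0# ; 1# = 1# , 0#
    ; isCommutativeRing = record
      { isRing = record
        { +-isAbelianGroup = record
          { isGroup = record
            { isMonoid = record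
              { isSemigroup = record
                { isMagma = record { isEquivalence = isEquivalence ; ∙-cong = cong₂ _+Q_ }
                ; assoc = λ _ _ _ → cong₂ _,_ (+-assoc _ _ _) (+-assoc _ _ _) }
              ; identity = (λ _ → cong₂ _,_ (+-identityˡ _) (+-identityˡ _)) , (λ _ → cong₂ _,_ (+-identityʳ _) (+-identityʳ _)) }
            ; inverse = (λ _ → cong₂ _,_ (-‿inverseˡ _) (-‿inverseˡ _)) , (λ _ → cong₂ _,_ (-‿inverseʳ _) (-‿inverseʳ _))
            ; ⁻¹-cong = cong -Q_ }
          ; comm = λ _ _ → cong₂ _,_ (+-comm _ _) (+-comm _ _) }
        ; *-cong = cong₂ _*Q_
        ; *-assoc = *Q-assoc
        ; *-identity = *Q-identityˡ , (λ u → trans (*Q-comm u _) (*Q-identityˡ u))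
        ; distrib = *Q-distribˡ , (λ u v w → trans (*Q-comm (v +Q w) u) (trans (*Q-distribˡ u v w) (cong₂ _+Q_ (*Q-comm u v) (*Q-comm u w)))) }
      ; *-comm = *Q-comm } }

-- Eigenvectors of matrices of projective order p

module Eigenvectors (F : FiniteField) (p n : ℕ) (pp : Prime p) (order≡ : order F ≡ p ℕ.^ n) (1≤n : 1 ≤ n) where
  open FiniteField F hiding (order)
  open FieldFacts F
  open PΓL F p n using (Mat; mat; _·M_; mapMat; scale; det; adj; I₂; frob; frob^)
  open Frobenius F p n pp order≡
  open Matrices F p n
  open ≡-Reasoning

  frob-root : ∀ c → ∃ λ d → d ^ p ≡ c
  frob-root c = frob^ (n ∸ 1) c , trans (sym (pow≡^ _ p)) (trans (cong (λ k → frob^ k c) (ℕₚ.m+[n∸m]≡n 1≤n)) (frob^n c))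

  ^p-neg : ∀ x → (- x) ^ p ≡ - (x ^ p)
  ^p-neg x = trans (sym (pow≡^ (- x) p)) (trans (frob^-neg 1 x) (cong -_ (pow≡^ x p)))

  ^p-inj : ∀ {x y} → x ^ p ≡ y ^ p → x ≡ y
  ^p-inj {x} {y} eq = frob^-inj 1 (trans (pow≡^ x p) (trans eq (sym (pow≡^ y p))))

  _^M_ : Mat → ℕ → Mat
  A ^M zero = I₂
  A ^M suc k = A ·M (A ^M k)

  ^M-det : ∀ A k → det (A ^M k) ≡ det A ^ k
  ^M-det A zero = det-I
  ^M-det A (suc k) = trans (det-· A (A ^M k)) (cong (det A *_) (^M-det A k))

  ^M-~ : ∀ {A B} k → A ~ B → A ^M k ~ B ^M k
  ^M-~ zero _ = ~-refl
  ^M-~ (suc k) A~B = ~-cong A~B (^M-~ k A~B)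

  shift : Carrier → Mat → Mat
  shift d (mat a b c e) = mat (a - d) b c (e - d)

  -- A satisfies its characteristic polynomial t² - τt + δ, so (A - d)^p is the image of
  -- (t - d)^p = t^p - d^p.
  det-shift≡0 : ∀ A {c d} → A ^M p ≡ scale c I₂ → d ^ p ≡ c → det (shift d A) ≡ 0#
  det-shift≡0 A@(mat a b c e) {k} {d} A^p≡k d^p≡k = ^≡0⇒≡0 p (begin
    det (shift d A) ^ p ≡⟨ ^M-det (shift d A) p ⟨
    det (shift d A ^M p) ≡⟨ cong (λ B → det (B ^M p)) shift≡ ⟩
    det (image (- d , 1#) ^M p) ≡⟨ cong det (image-^ (- d , 1#) p) ⟨
    det (image ((- d , 1#) ^Q p)) ≡⟨ cong (det ∘ image) expand ⟩
    det (image (((0# , 1#) ^Q p) +Q ((- d , 0#) ^Q p)))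
      ≡⟨ cong det (image-+ ((0# , 1#) ^Q p) _) ⟩
    det (image ((0# , 1#) ^Q p) +M image ((- d , 0#) ^Q p))
      ≡⟨ cong₂ (λ B u → det (B +M image u)) (trans (image-^ (0# , 1#) p) (trans (cong (_^M p) image-t) A^p≡k)) (scalar-^ (- d) p) ⟩
    det (scale k I₂ +M image ((- d) ^ p , 0#))
      ≡⟨ cong (λ x → det (scale k I₂ +M image (x , 0#))) (trans (^p-neg d) (cong -_ d^p≡k)) ⟩
    det (scale k I₂ +M image (- k , 0#)) ≡⟨ cancel ⟩
    0# ∎)
    where
    τ = a + e
    δ = det A
    open QuadraticAlgebra F τ δ
    module Q = CommutativeRing quadraticRing
    open import Algebra.Properties.CommutativeSemiring.Exp Q.commutativeSemiring using () renaming (_^_ to _^Q_)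
    open import Algebra.Properties.Semiring.Mult Q.semiring using () renaming (_×_ to _×Q_)
    _+M_ : Mat → Mat → Mat
    mat a b c d +M mat a′ b′ c′ d′ = mat (a + a′) (b + b′) (c + c′) (d + d′)
    image : Q → Mat
    image (x , y) = mat (x + y * a) (y * b) (y * c) (x + y * e)
    image-+ : ∀ u v → image (u +Q v) ≡ image u +M image v
    image-+ (x , y) (x′ , y′) = mat≡ (f a) (distribʳ b y y′) (distribʳ c y y′) (f e)
      where
      f : ∀ z → (x + x′) + (y + y′) * z ≡ (x + y * z) + (x′ + y′ * z)
      f z = solve 5 (λ x y x′ y′ z → (x :+ x′) :+ (y :+ y′) :* z := (x :+ y :* z) :+ (x′ :+ y′ :* z)) refl x y x′ y′ z
    image-* : ∀ u v → image (u *Q v) ≡ image u ·M image v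
    image-* (x , y) (x′ , y′) = mat≡
      (solve 8 (λ a b c e x y x′ y′ → (x :* x′ :- (a :* e :+ :- (b :* c)) :* (y :* y′)) :+ ((x :* y′ :+ y :* x′) :+ (a :+ e) :* (y :* y′)) :* a
        := (x :+ y :* a) :* (x′ :+ y′ :* a) :+ (y :* b) :* (y′ :* c)) refl a b c e x y x′ y′)
      (solve 7 (λ a b e x y x′ y′ → ((x :* y′ :+ y :* x′) :+ (a :+ e) :* (y :* y′)) :* b
        := (x :+ y :* a) :* (y′ :* b) :+ (y :* b) :* (x′ :+ y′ :* e)) refl a b e x y x′ y′)
      (solve 7 (λ a c e x y x′ y′ → ((x :* y′ :+ y :* x′) :+ (a :+ e) :* (y :* y′)) :* c
        := (y :* c) :* (x′ :+ y′ :* a) :+ (x :+ y :* e) :* (y′ :* c)) refl a c e x y x′ y′)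
      (solve 8 (λ a b c e x y x′ y′ → (x :* x′ :- (a :* e :+ :- (b :* c)) :* (y :* y′)) :+ ((x :* y′ :+ y :* x′) :+ (a :+ e) :* (y :* y′)) :* e
        := (y :* c) :* (y′ :* b) :+ (x :+ y :* e) :* (x′ :+ y′ :* e)) refl a b c e x y x′ y′)
    x+0y : ∀ x y → x + 0# * y ≡ x
    x+0y x y = trans (cong (_+_ x) (zeroˡ y)) (+-identityʳ x)
    image-^ : ∀ u j → image (u ^Q j) ≡ image u ^M j
    image-^ u zero = mat≡ (x+0y _ _) (zeroˡ _) (zeroˡ _) (x+0y _ _)
    image-^ u (suc j) = trans (image-* u (u ^Q j)) (cong (image u ·M_) (image-^ u j))
    0+1y : ∀ y → 0# + 1# * y ≡ y
    0+1y y = trans (+-identityˡ _) (*-identityˡ y)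
    image-t : image (0# , 1#) ≡ A
    image-t = mat≡ (0+1y a) (*-identityˡ b) (*-identityˡ c) (0+1y e)
    shift≡ : shift d A ≡ image (- d , 1#)
    shift≡ = mat≡ (f a) (sym (*-identityˡ b)) (sym (*-identityˡ c)) (f e)
      where
      f : ∀ z → z - d ≡ - d + 1# * z
      f z = trans (+-comm z (- d)) (cong (_+_ (- d)) (sym (*-identityˡ z)))
    scalar-^ : ∀ x j → (x , 0#) ^Q j ≡ (x ^ j , 0#)
    scalar-^ x zero = refl
    scalar-^ x (suc j) = trans (cong ((x , 0#) *Q_) (scalar-^ x j)) (cong₂ _,_
      (trans (cong (λ z → x * x ^ j - δ * z) (zeroˡ 0#)) (trans (cong (λ z → x * x ^ j - z) (zeroʳ δ)) (trans (cong (_+_ (x * x ^ j)) -0#≈0#) (+-identityʳ _))))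
      (trans (cong₂ _+_ (cong₂ _+_ (zeroʳ x) (zeroˡ _)) (trans (cong (τ *_) (zeroˡ 0#)) (zeroʳ τ))) (trans (+-identityʳ _) (+-identityʳ _))))
    ×Q≡ : ∀ j → j ×Q (1# , 0#) ≡ (j ×# 1# , 0#)
    ×Q≡ zero = refl
    ×Q≡ (suc j) = trans (cong ((1# , 0#) +Q_) (×Q≡ j)) (cong₂ _,_ refl (+-identityʳ 0#))
    expand : (- d , 1#) ^Q p ≡ ((0# , 1#) ^Q p) +Q ((- d , 0#) ^Q p)
    expand = trans (cong (_^Q p) (cong₂ _,_ (sym (+-identityˡ _)) (sym (+-identityʳ _))))
      (Freshman.^-additive quadraticRing pp (trans (×Q≡ p) (cong (_, 0#) p×1≡0)) (0# , 1#) (- d , 0#))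
    cancel : det (scale k I₂ +M image (- k , 0#)) ≡ 0#
    cancel = trans (cong₂ (λ x y → x * (k * 1# + (- k + 0# * e)) + - ((k * 0# + 0# * b) * y)) (g a) (h c))
      (trans (cong₂ _+_ (zeroˡ _) (trans (cong -_ (zeroʳ _)) -0#≈0#)) (+-identityʳ 0#))
      where
      g : ∀ z → k * 1# + (- k + 0# * z) ≡ 0#
      g z = trans (cong₂ _+_ (*-identityʳ k) (x+0y (- k) z)) (-‿inverseʳ k)
      h : ∀ z → k * 0# + 0# * z ≡ 0#
      h z = trans (x+0y _ z) (zeroʳ k)

  IsEigenrow : Mat → Carrier → Carrier → Carrier → Set
  IsEigenrow (mat a b c e) d x y = (x * a + y * c ≡ d * x) × (x * b + y * e ≡ d * y)

  -- The adjugate of `shift d A` times `shift d A` is zero, so the rows of the adjugate are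
  -- eigenrows. The first cases choose a nonzero one up to sign; if the adjugate vanishes, `A` is
  -- the scalar `d` and any row serves.
  eigenrow : ∀ A {d} → det (shift d A) ≡ 0# → ∃₂ λ x y → (x ≢ 0# ⊎ y ≢ 0#) × IsEigenrow A d x y
  eigenrow (mat a b c e) {d} det≡0 with c ≟ 0# | a - d ≟ 0# | e - d ≟ 0# | b ≟ 0#
  ... | no c≢0 | _ | _ | _ = c , - (a - d) , inj₁ c≢0 ,
    solve 3 (λ a c d → c :* a :+ (:- (a :- d)) :* c := d :* c) refl a c d ,
    kernel (solve 5 (λ a b c d e → c :* b :+ (:- (a :- d)) :* e :- d :* (:- (a :- d)) := :- ((a :- d) :* (e :- d) :+ :- (b :* c))) refl a b c d e)
    where
    kernel : ∀ {u v} → u - v ≡ - det (mat (a - d) b c (e - d)) → u ≡ v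
    kernel eq = x-y≡0⇒x≡y (trans eq (trans (cong -_ det≡0) -0#≈0#))
  ... | yes refl | no k≢0 | _ | _ = 0# , - (a - d) , inj₂ (neg-nonzero k≢0) ,
    trans (cong₂ _+_ (zeroˡ a) (zeroʳ _)) (trans (+-identityʳ 0#) (sym (zeroʳ d))) ,
    kernel (solve 5 (λ a b c d e → c :* b :+ (:- (a :- d)) :* e :- d :* (:- (a :- d)) := :- ((a :- d) :* (e :- d) :+ :- (b :* c))) refl a b 0# d e)
    where
    kernel : ∀ {u v} → u - v ≡ - det (mat (a - d) b 0# (e - d)) → u ≡ v
    kernel eq = x-y≡0⇒x≡y (trans eq (trans (cong -_ det≡0) -0#≈0#))
  ... | yes refl | yes k≡0 | no o≢0 | _ = e - d , - b , inj₁ o≢0 ,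
    trans (cong₂ _+_ (*-comm _ a) (zeroʳ _)) (trans (+-identityʳ _) (cong (_* (e - d)) (x-y≡0⇒x≡y k≡0))) ,
    solve 3 (λ b d e → (e :- d) :* b :+ (:- b) :* e := d :* (:- b)) refl b d e
  ... | yes refl | yes k≡0 | yes o≡0 | no b≢0 = e - d , - b , inj₂ (neg-nonzero b≢0) ,
    trans (cong₂ _+_ (*-comm _ a) (zeroʳ _)) (trans (+-identityʳ _) (cong (_* (e - d)) (x-y≡0⇒x≡y k≡0))) ,
    solve 3 (λ b d e → (e :- d) :* b :+ (:- b) :* e := d :* (:- b)) refl b d e
  ... | yes refl | yes k≡0 | yes o≡0 | yes refl = 1# , 0# , inj₁ 1≢0 ,
    trans (1x+0y a 0#) (trans (x-y≡0⇒x≡y k≡0) (sym (*-identityʳ d))) ,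
    trans (1x+0y 0# e) (sym (zeroʳ d))

  -- The scalar A^p has a p-th root `d` in the field because Frobenius is surjective. So the
  -- eigenvalue lies in F itself and no extension is involved.
  p-torsion⇒eigenrow : ∀ A → A ^M p ~ I₂ → ∃ λ d → ∃₂ λ x y → (x ≢ 0# ⊎ y ≢ 0#) × IsEigenrow A d x y
  p-torsion⇒eigenrow A A^p~I with ~-sym A^p~I
  ... | scaled c c≢0 eq = let d , d^p≡c = frob-root c in d , eigenrow A (det-shift≡0 A eq d^p≡c)

module OddCharacteristic (F : FiniteField) (p : ℕ) (pp : Prime p) where
  open FiniteField F hiding (order)
  open FieldFacts F

  2≢0 : p ≢ 2 → p ×# 1# ≡ 0# → 1# + 1# ≢ 0#
  2≢0 p≢2 p×1≡0 2≡0 with p % 2 in eq | m%n<n p 2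
  ... | 0 | _ with prime⇒irreducible pp (m%n≡0⇒n∣m p 2 eq)
  ...   | inj₂ 2≡p = p≢2 (sym 2≡p)
  2≢0 p≢2 p×1≡0 2≡0 | 1 | _ = 1≢0 (trans (sym p×1≡1) p×1≡0)
    where
    double : ∀ k → (k ℕ.* 2) ×# 1# ≡ 0#
    double k = trans (×1-homo-* k 2) (trans (cong ((k ×# 1#) *_) (trans (cong (_+_ 1#) (+-identityʳ 1#)) 2≡0)) (zeroʳ _))
    p×1≡1 : p ×# 1# ≡ 1#
    p×1≡1 = trans (cong (_×# 1#) (trans (m≡m%n+[m/n]*n p 2) (cong (ℕ._+ (p / 2) ℕ.* 2) eq)))
      (trans (cong (_+_ 1#) (double (p / 2))) (+-identityʳ 1#))
  2≢0 _ _ _ | suc (suc _) | s≤s (s≤s ())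

-- Root subgroups, their centralisers, and conjugation

module Unipotents (F : FiniteField) (p n : ℕ) where
  open FiniteField F hiding (order)
  open FieldFacts F
  open PΓL F p n using (Mat; mat; _·M_; mapMat; scale; det; adj; I₂)
  open Matrices F p n
  open ≡-Reasoning

  -- The two opposite root subgroups. On row vectors `u` fixes the point (0 1) and `v` fixes the
  -- point (1 0).
  u v : Carrier → Mat
  u x = mat 1# x 0# 1#
  v x = mat 1# 0# x 1#

  diag : Carrier → Carrier → Mat
  diag x y = mat x 0# 0# y

  x+y0 : ∀ x y → x + y * 0# ≡ x
  x+y0 x y = trans (cong (_+_ x) (zeroʳ y)) (+-identityʳ x)

  x+0y : ∀ x y → x + 0# * y ≡ x
  x+0y x y = trans (cong (_+_ x) (zeroˡ y)) (+-identityʳ x)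

  x0+y : ∀ x y → x * 0# + y ≡ y
  x0+y x y = trans (cong (_+ y) (zeroʳ x)) (+-identityˡ y)

  0x+y : ∀ x y → 0# * x + y ≡ y
  0x+y x y = trans (cong (_+ y) (zeroˡ x)) (+-identityˡ y)

  x1+y0 : ∀ x y → x * 1# + y * 0# ≡ x
  x1+y0 x y = trans (x+y0 _ y) (*-identityʳ x)

  x0+y1 : ∀ x y → x * 0# + y * 1# ≡ y
  x0+y1 x y = trans (x0+y x _) (*-identityʳ y)

  u· : ∀ t a b c d → u t ·M mat a b c d ≡ mat (a + t * c) (b + t * d) c d
  u· t a b c d = mat≡ (cong (_+ t * c) (*-identityˡ a)) (cong (_+ t * d) (*-identityˡ b)) (0x+1y a c) (0x+1y b d)

  v· : ∀ t a b c d → v t ·M mat a b c d ≡ mat a b (t * a + c) (t * b + d)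
  v· t a b c d = mat≡ (1x+0y a c) (1x+0y b d) (cong (_+_ (t * a)) (*-identityˡ c)) (cong (_+_ (t * b)) (*-identityˡ d))

  ·u : ∀ t a b c d → mat a b c d ·M u t ≡ mat a (a * t + b) c (c * t + d)
  ·u t a b c d = mat≡ (x1+y0 a b) (cong (_+_ (a * t)) (*-identityʳ b)) (x1+y0 c d) (cong (_+_ (c * t)) (*-identityʳ d))

  ·v : ∀ t a b c d → mat a b c d ·M v t ≡ mat (a + b * t) b (c + d * t) d
  ·v t a b c d = mat≡ (cong (_+ b * t) (*-identityʳ a)) (x0+y1 a b) (cong (_+ d * t) (*-identityʳ c)) (x0+y1 c d)

  u-+ : ∀ s t → u s ·M u t ≡ u (s + t)
  u-+ s t = trans (·u t 1# s 0# 1#) (mat≡ refl (trans (cong (_+ s) (*-identityˡ t)) (+-comm t s)) refl (0x+y t 1#))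

  v-+ : ∀ s t → v s ·M v t ≡ v (s + t)
  v-+ s t = trans (·v t 1# 0# s 1#) (mat≡ (x+0y 1# t) refl (cong (_+_ s) (*-identityˡ t)) refl)

  det-u : ∀ t → det (u t) ≡ 1#
  det-u t = trans (cong₂ _+_ (*-identityˡ 1#) (trans (cong -_ (zeroʳ t)) -0#≈0#)) (+-identityʳ 1#)

  det-v : ∀ t → det (v t) ≡ 1#
  det-v t = trans (cong₂ _+_ (*-identityˡ 1#) (trans (cong -_ (zeroˡ t)) -0#≈0#)) (+-identityʳ 1#)

  det-diag : ∀ x y → det (diag x y) ≡ x * y
  det-diag x y = trans (cong (λ z → x * y - z) (zeroˡ 0#)) (trans (cong (_+_ (x * y)) -0#≈0#) (+-identityʳ _))

  ·≡⇒scalar≡1 : ∀ {s x} → x ≢ 0# → x ≡ s * x → s ≡ 1#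
  ·≡⇒scalar≡1 {s} {x} x≢0 eq = *-cancelˡ x≢0 (trans (*-comm x s) (trans (sym eq) (sym (*-identityʳ x))))

  scaled-1 : ∀ {s x y} → s ≡ 1# → y ≡ s * x → y ≡ x
  scaled-1 {x = x} refl eq = trans eq (*-identityˡ x)

  u-injective : ∀ {s t} → u s ~ u t → s ≡ t
  u-injective (scaled k _ eq) = sym (scaled-1 (·≡⇒scalar≡1 1≢0 (mat-a eq)) (mat-b eq))

  v-injective : ∀ {s t} → v s ~ v t → s ≡ t
  v-injective (scaled k _ eq) = sym (scaled-1 (·≡⇒scalar≡1 1≢0 (mat-a eq)) (mat-c eq))

  upper : ∀ {a b} → a ≢ 0# → mat a b 0# a ~ u ((a ⁻¹) * b)
  upper {a} {b} a≢0 = ~-sym (scaled a a≢0 (mat≡ (sym (*-identityʳ a)) (sym (x*x⁻¹y b a≢0)) (sym (zeroʳ a)) (sym (*-identityʳ a))))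

  lower : ∀ {a c} → a ≢ 0# → mat a 0# c a ~ v ((a ⁻¹) * c)
  lower {a} {c} a≢0 = ~-sym (scaled a a≢0 (mat≡ (sym (*-identityʳ a)) (sym (zeroʳ a)) (sym (x*x⁻¹y c a≢0)) (sym (*-identityʳ a))))

  x+ty≡x⇒y≡0 : ∀ {t x y} → t ≢ 0# → x + t * y ≡ x → y ≡ 0#
  x+ty≡x⇒y≡0 {t} {x} {y} t≢0 eq = zero-product (+-cancelˡ x _ _ (trans eq (sym (+-identityʳ x)))) t≢0

  det-upper : ∀ {a b d} → det (mat a b 0# d) ≢ 0# → (a ≢ 0#) × (d ≢ 0#)
  det-upper {a} {b} {d} det≢0 = nonzeroˡ ad≢0 , nonzeroʳ ad≢0
    where
    ad≢0 : a * d ≢ 0#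
    ad≢0 eq = det≢0 (trans (cong (λ z → a * d - z) (zeroʳ b)) (trans (cong (_+_ (a * d)) -0#≈0#) (trans (+-identityʳ _) eq)))

  det-lower : ∀ {a c d} → det (mat a 0# c d) ≢ 0# → (a ≢ 0#) × (d ≢ 0#)
  det-lower {a} {c} {d} det≢0 = nonzeroˡ ad≢0 , nonzeroʳ ad≢0
    where
    ad≢0 : a * d ≢ 0#
    ad≢0 eq = det≢0 (trans (cong (λ z → a * d - z) (zeroˡ c)) (trans (cong (_+_ (a * d)) -0#≈0#) (trans (+-identityʳ _) eq)))

  -- A matrix commuting with `u t` fixes its only fixed point and is therefore triangular.
  -- Commutation is given only up to a scalar; comparing a nonzero diagonal entry shows that the
  -- scalar is 1, and then the diagonal entries agree.
  u-centralizer : ∀ {t} B → t ≢ 0# → det B ≢ 0# → u t ·M B ~ B ·M u t → ∃ λ x → B ~ u x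
  u-centralizer {t} (mat a b c d) t≢0 detB (scaled s s≢0 eq) with trans (trans (sym (·u t a b c d)) eq) (cong (scale s) (u· t a b c d))
  ... | eq′ with c ≟ 0#
  ...   | no c≢0 = ⊥-elim (c≢0 (x+ty≡x⇒y≡0 t≢0 (sym (scaled-1 (·≡⇒scalar≡1 c≢0 (mat-c eq′)) (mat-a eq′)))))
  ...   | yes refl = (a ⁻¹) * b , subst (λ z → mat a b 0# z ~ u ((a ⁻¹) * b)) a≡d (upper a≢0)
    where
    a≢0 = proj₁ (det-upper detB)
    s≡1 : s ≡ 1#
    s≡1 = ·≡⇒scalar≡1 a≢0 (trans (mat-a eq′) (cong (s *_) (x+y0 a t)))
    a≡d : a ≡ d
    a≡d = *-cancelˡ t≢0 (trans (*-comm t a) (+-cancelʳ b _ _ (trans (scaled-1 s≡1 (mat-b eq′)) (+-comm b _))))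

  v-centralizer : ∀ {t} B → t ≢ 0# → det B ≢ 0# → v t ·M B ~ B ·M v t → ∃ λ x → B ~ v x
  v-centralizer {t} (mat a b c d) t≢0 detB (scaled s s≢0 eq) with trans (trans (sym (·v t a b c d)) eq) (cong (scale s) (v· t a b c d))
  ... | eq′ with b ≟ 0#
  ...   | no b≢0 = ⊥-elim (b≢0 (x+ty≡x⇒y≡0 t≢0 (trans (cong (_+_ a) (*-comm t b)) (scaled-1 (·≡⇒scalar≡1 b≢0 (mat-b eq′)) (mat-a eq′)))))
  ...   | yes refl = (a ⁻¹) * c , subst (λ z → mat a 0# c z ~ v ((a ⁻¹) * c)) a≡d (lower a≢0)
    where
    a≢0 = proj₁ (det-lower detB)
    s≡1 : s ≡ 1#
    s≡1 = ·≡⇒scalar≡1 a≢0 (trans (sym (x+0y a t)) (mat-a eq′))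
    a≡d : a ≡ d
    a≡d = *-cancelˡ t≢0 (sym (trans (*-comm t d) (+-cancelˡ c _ _ (trans (scaled-1 s≡1 (mat-c eq′)) (+-comm _ c)))))

  infixl 8 _^^_
  -- Conjugation with the adjugate in place of the inverse. It differs from true conjugation by the
  -- factor `det C`, which `_~_` ignores.
  _^^_ : Mat → Mat → Mat
  A ^^ C = (C ·M A) ·M adj C

  ^^-· : ∀ A B C → det C ≢ 0# → (A ·M B) ^^ C ~ (A ^^ C) ·M (B ^^ C)
  ^^-· A B C detC = scaled (det C) detC (begin
    ((C ·M A) ·M adj C) ·M ((C ·M B) ·M adj C) ≡⟨ ·M-assoc (C ·M A) (adj C) _ ⟩
    (C ·M A) ·M (adj C ·M ((C ·M B) ·M adj C)) ≡⟨ cong (λ X → (C ·M A) ·M (adj C ·M X)) (·M-assoc C B (adj C)) ⟩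
    (C ·M A) ·M (adj C ·M (C ·M (B ·M adj C))) ≡⟨ cong ((C ·M A) ·M_) (·M-assoc (adj C) C _) ⟨
    (C ·M A) ·M ((adj C ·M C) ·M (B ·M adj C)) ≡⟨ cong (λ X → (C ·M A) ·M (X ·M (B ·M adj C))) (adj-·M C) ⟩
    (C ·M A) ·M (scale (det C) I₂ ·M (B ·M adj C)) ≡⟨ cong ((C ·M A) ·M_) (scale-·M (det C) I₂ _) ⟩
    (C ·M A) ·M scale (det C) (I₂ ·M (B ·M adj C)) ≡⟨ cong (λ X → (C ·M A) ·M scale (det C) X) (·M-identityˡ _) ⟩
    (C ·M A) ·M scale (det C) (B ·M adj C) ≡⟨ ·M-scale (det C) (C ·M A) (B ·M adj C) ⟩
    scale (det C) ((C ·M A) ·M (B ·M adj C)) ≡⟨ cong (scale (det C)) (·M-assoc (C ·M A) B (adj C)) ⟨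
    scale (det C) (((C ·M A) ·M B) ·M adj C) ≡⟨ cong (λ X → scale (det C) (X ·M adj C)) (·M-assoc C A B) ⟩
    scale (det C) ((A ·M B) ^^ C) ∎)

  ^^-~ : ∀ {A B} C → A ~ B → A ^^ C ~ B ^^ C
  ^^-~ C A~B = ~-cong (~-cong (~-refl {C}) A~B) ~-refl

  det-^^ : ∀ A C → det A ≢ 0# → det C ≢ 0# → det (A ^^ C) ≢ 0#
  det-^^ A C dA dC eq = *-nonzero (*-nonzero dC dA) dC
    (trans (sym (cong₂ _*_ (det-· C A) (det-adj C))) (trans (sym (det-· (C ·M A) (adj C))) eq))

  adj-· : ∀ A B → adj (A ·M B) ≡ adj B ·M adj A
  adj-· (mat a b c d) (mat a′ b′ c′ d′) = mat≡
    (solve 4 (λ c d b′ d′ → c :* b′ :+ d :* d′ := d′ :* d :+ (:- b′) :* (:- c)) refl c d b′ d′)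
    (solve 4 (λ a b b′ d′ → :- (a :* b′ :+ b :* d′) := d′ :* (:- b) :+ (:- b′) :* a) refl a b b′ d′)
    (solve 4 (λ c d a′ c′ → :- (c :* a′ :+ d :* c′) := (:- c′) :* d :+ a′ :* (:- c)) refl c d a′ c′)
    (solve 4 (λ a b a′ c′ → a :* a′ :+ b :* c′ := (:- c′) :* (:- b) :+ a′ :* a) refl a b a′ c′)

  ^^-^^ : ∀ A C D → (A ^^ C) ^^ D ≡ A ^^ (D ·M C)
  ^^-^^ A C D = begin
    (D ·M ((C ·M A) ·M adj C)) ·M adj D ≡⟨ cong (_·M adj D) (·M-assoc D (C ·M A) (adj C)) ⟨
    ((D ·M (C ·M A)) ·M adj C) ·M adj D ≡⟨ ·M-assoc (D ·M (C ·M A)) (adj C) (adj D) ⟩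
    (D ·M (C ·M A)) ·M (adj C ·M adj D) ≡⟨ cong₂ _·M_ (sym (·M-assoc D C A)) (sym (adj-· D C)) ⟩
    A ^^ (D ·M C) ∎

  ~-cancelˡ : ∀ {A B C} → det A ≢ 0# → A ·M B ~ A ·M C → B ~ C
  ~-cancelˡ {A} {B} {C} detA AB~AC = ~-trans (to B) (~-trans (~-cong (~-refl {adj A}) AB~AC) (~-sym (to C)))
    where
    to : ∀ X → X ~ adj A ·M (A ·M X)
    to X = scaled (det A) detA (trans (sym (·M-assoc (adj A) A X)) (trans (cong (_·M X) (adj-·M A))
      (trans (scale-·M (det A) I₂ X) (cong (scale (det A)) (·M-identityˡ X)))))

  ~-cancelʳ : ∀ {A B C} → det A ≢ 0# → B ·M A ~ C ·M A → B ~ C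
  ~-cancelʳ {A} {B} {C} detA BA~CA = ~-trans (to B) (~-trans (~-cong BA~CA (~-refl {adj A})) (~-sym (to C)))
    where
    to : ∀ X → X ~ (X ·M A) ·M adj A
    to X = scaled (det A) detA (trans (·M-assoc X A (adj A)) (trans (cong (X ·M_) (·M-adj A))
      (trans (·M-scale (det A) X I₂) (cong (scale (det A)) (·M-identityʳ X)))))

  ^^-cancel : ∀ {A B} C → det C ≢ 0# → A ^^ C ~ B ^^ C → A ~ B
  ^^-cancel C detC eq = ~-cancelˡ detC (~-cancelʳ (λ d≡0 → detC (trans (sym (det-adj C)) d≡0)) eq)

  u-^^u : ∀ t z → u t ^^ u z ~ u t
  u-^^u t z = ≡⇒~ (trans (cong (_·M adj (u z)) (u-+ z t)) (trans (cong (u (z + t) ·M_) (mat≡ refl refl -0#≈0# refl))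
    (trans (u-+ (z + t) (- z)) (cong u (solve 2 (λ z t → (z :+ t) :+ :- z := t) refl z t)))))

  u-^^diag : ∀ t g → g ≢ 0# → u t ^^ diag g 1# ~ u (g * t)
  u-^^diag t g g≢0 = ~-sym (scaled g g≢0 (trans (cong (_·M adj (diag g 1#)) step) (mat≡
    (trans (cong₂ _+_ (*-identityʳ g) (trans (cong ((g * t) *_) -0#≈0#) (zeroʳ _))) (trans (+-identityʳ g) (sym (*-identityʳ g))))
    (trans (cong (_+ (g * t) * g) (trans (cong (g *_) -0#≈0#) (zeroʳ g))) (trans (+-identityˡ _) (*-comm (g * t) g)))
    (trans (cong₂ _+_ (zeroˡ 1#) (trans (*-identityˡ _) -0#≈0#)) (trans (+-identityʳ 0#) (sym (zeroʳ g))))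
    (trans (cong₂ _+_ (zeroˡ _) (*-identityˡ g)) (trans (+-identityˡ g) (sym (*-identityʳ g)))))))
    where
    step : diag g 1# ·M u t ≡ mat g (g * t) 0# 1#
    step = trans (·u t g 0# 0# 1#) (mat≡ refl (+-identityʳ _) refl (0x+y t 1#))

  v-^^diag : ∀ t g → g ≢ 0# → v t ^^ diag g 1# ~ v ((g ⁻¹) * t)
  v-^^diag t g g≢0 = ~-sym (scaled g g≢0 (trans (cong (_·M adj (diag g 1#)) step) (mat≡
    (trans (cong₂ _+_ (*-identityʳ g) (zeroˡ _)) (trans (+-identityʳ g) (sym (*-identityʳ g))))
    (trans (cong₂ _+_ (trans (cong (g *_) -0#≈0#) (zeroʳ g)) (zeroˡ g)) (trans (+-identityʳ 0#) (sym (zeroʳ g))))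
    (trans (cong₂ _+_ (*-identityʳ t) (trans (*-identityˡ _) -0#≈0#)) (trans (+-identityʳ t) (sym (x*x⁻¹y t g≢0))))
    (trans (cong₂ _+_ (trans (cong (t *_) -0#≈0#) (zeroʳ t)) (*-identityˡ g)) (trans (+-identityˡ g) (sym (*-identityʳ g)))))))
    where
    step : diag g 1# ·M v t ≡ mat g 0# t 1#
    step = trans (·v t g 0# 0# 1#) (mat≡ (x+0y g t) refl (trans (+-identityˡ _) (*-identityˡ t)) refl)

-- Faithful projective representations of SL(2,q₀)

module Representations (F F′ : FiniteField) (p n m : ℕ) (pp : Prime p)
    (order≡ : order F ≡ p ℕ.^ n) (order≡′ : order F′ ≡ p ℕ.^ m) (1≤n : 1 ≤ n) (1≤m : 1 ≤ m) where
  open FiniteField F hiding (order)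
  open FieldFacts F
  open PΓL F p n using (Mat; mat; _·M_; mapMat; scale; det; adj; I₂)
  open Frobenius F p n pp order≡ using (frob^≡^)
  open Matrices F p n
  open Unipotents F p n
  open Eigenvectors F p n pp order≡ 1≤n
  private
    module F′ = FiniteField F′
    module L′ = FieldFacts F′
    module B = PΓL F′ p m
    module M′ = Matrices F′ p m
    module U′ = Unipotents F′ p m
    module Fr′ = Frobenius F′ p m pp order≡′
  open B using () renaming (Mat to Mat′; mat to mat′; _·M_ to _·′_; det to det′)

  Unimodular : Mat′ → Set
  Unimodular B = det′ B ≡ F′.1#

  -- A homomorphism from SL(2,q₀) to PGL(2,q) that is injective modulo scalars. Working with
  -- SL(2,q₀) avoids square roots of determinants: the root elements and the torus are unimodular as
  -- they stand.
  record Representation (ρ : Mat′ → Mat) : Set where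
    field
      nonsingular : ∀ {B} → Unimodular B → det (ρ B) ≢ 0#
      hom : ∀ {B C} → Unimodular B → Unimodular C → ρ (B ·′ C) ~ ρ B ·M ρ C
      faithful : ∀ {B C} → Unimodular B → Unimodular C → ρ B ~ ρ C → B M′.~ C

  ·-unimodular : ∀ {B C} → Unimodular B → Unimodular C → Unimodular (B ·′ C)
  ·-unimodular {B} {C} uB uC = trans (M′.det-· B C) (trans (cong₂ F′._*_ uB uC) (L′.*-identityˡ F′.1#))

  conjugate : ∀ {ρ} C → det C ≢ 0# → Representation ρ → Representation (λ B → ρ B ^^ C)
  conjugate {ρ} C detC R = record
    { nonsingular = λ {B} uB → det-^^ (ρ B) C (nonsingular uB) detC
    ; hom = λ {B} {D} uB uD → ~-trans (^^-~ C (hom uB uD)) (^^-· (ρ B) (ρ D) C detC)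
    ; faithful = λ uB uD eq → faithful uB uD (^^-cancel C detC eq) }
    where open Representation R

  row-basis : ∀ {x y} → (x ≢ 0# ⊎ y ≢ 0#) → ∃₂ λ k l → det (mat k l x y) ≢ 0#
  row-basis {x} {y} (inj₁ x≢0) = 0# , 1# , λ eq → neg-nonzero x≢0
    (trans (sym (trans (cong₂ _+_ (zeroˡ y) (cong -_ (*-identityˡ x))) (+-identityˡ _))) eq)
  row-basis {x} {y} (inj₂ y≢0) = 1# , 0# , λ eq → y≢0
    (trans (sym (trans (cong₂ _+_ (*-identityˡ y) (trans (cong -_ (zeroˡ x)) -0#≈0#)) (+-identityʳ y))) eq)

  eigenrow⇒upper : ∀ A {d} k l x y → IsEigenrow A d x y → ∃₂ λ a b → ∃ λ e → A ^^ mat k l x y ≡ mat a b 0# e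
  eigenrow⇒upper A@(mat a b c e) {d} k l x y (eq₁ , eq₂) = _ , _ , _ , mat≡ refl refl
    (trans (cong₂ (λ X Y → X * y + Y * - x) eq₁ eq₂)
      (trans (solve 3 (λ d x y → (d :* x) :* y :+ (d :* y) :* (:- x) := x :- x) refl d x y) (-‿inverseʳ x))) refl

  upper-^M : ∀ a b e j → ∃ λ b′ → mat a b 0# e ^M j ≡ mat (a ^ j) b′ 0# (e ^ j)
  upper-^M a b e zero = 0# , refl
  upper-^M a b e (suc j) with upper-^M a b e j
  ... | b′ , eq = _ , trans (cong (mat a b 0# e ·M_) eq)
    (mat≡ (x+y0 _ b) refl (trans (cong₂ _+_ (zeroˡ _) (zeroʳ e)) (+-identityʳ 0#)) (0x+y b′ _))

  lower-^M : ∀ a c e j → ∃ λ c′ → mat a 0# c e ^M j ≡ mat (a ^ j) 0# c′ (e ^ j)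
  lower-^M a c e zero = 0# , refl
  lower-^M a c e (suc j) with lower-^M a c e j
  ... | c′ , eq = _ , trans (cong (mat a 0# c e ·M_) eq)
    (mat≡ (x+0y _ c′) (trans (cong₂ _+_ (zeroʳ a) (zeroˡ _)) (+-identityʳ 0#)) refl (x0+y c _))

  equal-diagonal : ∀ {a e x y} → mat (a ^ p) x y (e ^ p) ~ I₂ → a ≡ e
  equal-diagonal (scaled s s≢0 eq) = ^p-inj (*-cancelˡ s≢0 (trans (sym (mat-a eq)) (mat-d eq)))

  -- The p-th powers of the two diagonal entries agree, hence so do the entries, the p-th power
  -- being injective.
  upper-p-torsion : ∀ {a b e} → det (mat a b 0# e) ≢ 0# → mat a b 0# e ^M p ~ I₂ → ∃ λ t → mat a b 0# e ~ u t
  upper-p-torsion {a} {b} {e} det≢0 torsion with upper-^M a b e p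
  ... | _ , eq = (a ⁻¹) * b , subst (λ z → mat a b 0# z ~ u ((a ⁻¹) * b))
    (equal-diagonal (subst (_~ I₂) eq torsion)) (upper (proj₁ (det-upper det≢0)))

  lower-p-torsion : ∀ {a c e} → det (mat a 0# c e) ≢ 0# → mat a 0# c e ^M p ~ I₂ → ∃ λ t → mat a 0# c e ~ v t
  lower-p-torsion {a} {c} {e} det≢0 torsion with lower-^M a c e p
  ... | _ , eq = (a ⁻¹) * c , subst (λ z → mat a 0# c z ~ v ((a ⁻¹) * c))
    (equal-diagonal (subst (_~ I₂) eq torsion)) (lower (proj₁ (det-lower det≢0)))

  module _ (C : Mat) (detC : det C ≢ 0#) where
    I-^^ : I₂ ^^ C ~ I₂
    I-^^ = ~-sym (scaled (det C) detC (trans (cong (_·M adj C) (·M-identityʳ C)) (·M-adj C)))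

    ^^-^M : ∀ A j → (A ^M j) ^^ C ~ (A ^^ C) ^M j
    ^^-^M A zero = I-^^
    ^^-^M A (suc j) = ~-trans (^^-· A (A ^M j) C detC) (~-cong ~-refl (^^-^M A j))

    ^^-torsion : ∀ {A} j → A ^M j ~ I₂ → (A ^^ C) ^M j ~ I₂
    ^^-torsion {A} j eq = ~-trans (~-sym (^^-^M A j)) (~-trans (^^-~ C eq) I-^^)

  -- The eigenrow becomes the second row of `C`, so that conjugation by `C` sends its eigenline to
  -- the point (0 1) fixed by every `u t`.
  make-upper : ∀ A → det A ≢ 0# → A ^M p ~ I₂ → ∃ λ C → det C ≢ 0# × ∃ λ t → A ^^ C ~ u t
  make-upper A detA torsion = build (p-torsion⇒eigenrow A torsion)
    where
    build : (∃ λ d → ∃₂ λ x y → (x ≢ 0# ⊎ y ≢ 0#) × IsEigenrow A d x y) → ∃ λ C → det C ≢ 0# × ∃ λ t → A ^^ C ~ u t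
    build (d , x , y , xy≢0 , eigen) with row-basis xy≢0
    ... | k , l , detC = mat k l x y , detC , finish (eigenrow⇒upper A k l x y eigen)
      where
      C = mat k l x y
      finish : (∃₂ λ a b → ∃ λ e → A ^^ C ≡ mat a b 0# e) → ∃ λ t → A ^^ C ~ u t
      finish (a , b , e , eq) = subst (λ X → ∃ λ t → X ~ u t) (sym eq)
        (upper-p-torsion (subst (λ X → det X ≢ 0#) eq (det-^^ A C detA detC)) (subst (λ X → X ^M p ~ I₂) eq (^^-torsion C detC p torsion)))

  eigenrow-normalise : ∀ {d x y f g h} → x ≢ 0# → x * f + y * g ≡ d * h → 1# * f + ((x ⁻¹) * y) * g ≡ d * ((x ⁻¹) * h)
  eigenrow-normalise {d} {x} {y} {f} {g} {h} x≢0 eq = *-cancelˡ x≢0 (begin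
    x * (1# * f + ((x ⁻¹) * y) * g) ≡⟨ cong (λ o → x * (o + ((x ⁻¹) * y) * g)) (*-identityˡ f) ⟩
    x * (f + ((x ⁻¹) * y) * g) ≡⟨ solve 5 (λ x i y f g → x :* (f :+ (i :* y) :* g) := x :* f :+ (x :* (i :* y)) :* g) refl x (x ⁻¹) y f g ⟩
    x * f + (x * ((x ⁻¹) * y)) * g ≡⟨ cong (λ o → x * f + o * g) (x*x⁻¹y y x≢0) ⟩
    x * f + y * g ≡⟨ eq ⟩
    d * h ≡⟨ cong (d *_) (x*x⁻¹y h x≢0) ⟨
    d * (x * ((x ⁻¹) * h)) ≡⟨ solve 3 (λ d x o → d :* (x :* o) := x :* (d :* o)) refl d x ((x ⁻¹) * h) ⟩
    x * (d * ((x ⁻¹) * h)) ∎)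
    where open ≡-Reasoning

  eigenrow⇒lower : ∀ A {d x y} → x ≢ 0# → IsEigenrow A d x y → ∃₂ λ a c → ∃ λ e → A ^^ u ((x ⁻¹) * y) ≡ mat a 0# c e
  eigenrow⇒lower (mat a b c e) {d} {x} {y} x≢0 (eq₁ , eq₂) = _ , _ , _ , mat≡ refl
    (trans (cong₂ (λ X Y → X * - z + Y * 1#) (trans (eigenrow-normalise x≢0 eq₁) (trans (cong (d *_) (inverseˡ x≢0)) (*-identityʳ d))) (eigenrow-normalise x≢0 eq₂))
      (trans (cong (_+_ (d * - z)) (*-identityʳ _)) (trans (solve 2 (λ d z → d :* (:- z) :+ d :* z := d :* z :- d :* z) refl d z) (-‿inverseʳ _))))
    refl refl
    where z = (x ⁻¹) * y

  -- Only conjugation by some `u z` is allowed, because it leaves the upper unipotent elements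
  -- unchanged. An eigenrow (x y) with x ≠ 0 can be moved to (1 0) in this way; if x = 0, then `A`
  -- would itself be upper unipotent.
  make-lower : ∀ A → det A ≢ 0# → A ^M p ~ I₂ → (∀ t → ¬ (A ~ u t)) → ∃₂ λ z s → A ^^ u z ~ v s
  make-lower A detA torsion not-upper = build (p-torsion⇒eigenrow A torsion)
    where
    finish : ∀ z → (∃₂ λ a c → ∃ λ e → A ^^ u z ≡ mat a 0# c e) → ∃ λ s → A ^^ u z ~ v s
    finish z (a , c , e , eq) = subst (λ X → ∃ λ s → X ~ v s) (sym eq)
      (lower-p-torsion (subst (λ X → det X ≢ 0#) eq (det-^^ A (u z) detA detu)) (subst (λ X → X ^M p ~ I₂) eq (^^-torsion (u z) detu p torsion)))
      where
      detu : det (u z) ≢ 0#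
      detu eq = 1≢0 (trans (sym (det-u z)) eq)
    upper-case : ∀ {d y} B → A ≡ B → y ≢ 0# → IsEigenrow B d 0# y → ⊥
    upper-case {d} {y} (mat a b c e) A≡ y≢0 (eq₁ , _) = not-upper (proj₁ found) (subst (_~ u (proj₁ found)) (sym A≡′) (proj₂ found))
      where
      c≡0 : c ≡ 0#
      c≡0 = zero-product (trans (sym (0x+y a _)) (trans eq₁ (zeroʳ d))) y≢0
      A≡′ : A ≡ mat a b 0# e
      A≡′ = trans A≡ (mat≡ refl refl c≡0 refl)
      found = upper-p-torsion (subst (λ X → det X ≢ 0#) A≡′ detA) (subst (λ X → X ^M p ~ I₂) A≡′ torsion)
    build : (∃ λ d → ∃₂ λ x y → (x ≢ 0# ⊎ y ≢ 0#) × IsEigenrow A d x y) → ∃₂ λ z s → A ^^ u z ~ v s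
    build (d , x , y , xy≢0 , eigen) with x ≟ 0#
    ... | no x≢0 = (x ⁻¹) * y , finish _ (eigenrow⇒lower A x≢0 eigen)
    ... | yes refl with xy≢0
    ...   | inj₁ 0≢0 = ⊥-elim (0≢0 refl)
    ...   | inj₂ y≢0 = ⊥-elim (upper-case A refl y≢0 eigen)

  module _ {ρ : Mat′ → Mat} (R : Representation ρ) where
    open Representation R

    relation : ∀ {A B C D} → Unimodular A → Unimodular B → Unimodular C → Unimodular D →
      A ·′ B ≡ C ·′ D → ρ A ·M ρ B ~ ρ C ·M ρ D
    relation uA uB uC uD eq = ~-trans (~-sym (hom uA uB)) (subst (λ X → ρ X ~ _) (sym eq) (hom uC uD))

    ρ-I : ρ B.I₂ ~ I₂
    ρ-I = ~-cancelˡ (nonsingular M′.det-I)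
      (~-trans (~-sym (hom M′.det-I M′.det-I)) (≡⇒~ (trans (cong ρ (M′.·M-identityˡ _)) (sym (·M-identityʳ _)))))

    ρu-^M : ∀ k → ρ (U′.u (k L′.×# F′.1#)) ~ ρ (U′.u F′.1#) ^M k
    ρu-^M zero = ρ-I
    ρu-^M (suc k) = ~-trans (≡⇒~ (cong ρ (sym (U′.u-+ F′.1# (k L′.×# F′.1#)))))
      (~-trans (hom (U′.det-u F′.1#) (U′.det-u (k L′.×# F′.1#))) (~-cong ~-refl (ρu-^M k)))

    ρv-^M : ∀ k → ρ (U′.v (k L′.×# F′.1#)) ~ ρ (U′.v F′.1#) ^M k
    ρv-^M zero = ρ-I
    ρv-^M (suc k) = ~-trans (≡⇒~ (cong ρ (sym (U′.v-+ F′.1# (k L′.×# F′.1#)))))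
      (~-trans (hom (U′.det-v F′.1#) (U′.det-v (k L′.×# F′.1#))) (~-cong ~-refl (ρv-^M k)))

    ρu-torsion : ρ (U′.u F′.1#) ^M p ~ I₂
    ρu-torsion = ~-trans (~-sym (ρu-^M p)) (~-trans (≡⇒~ (cong (ρ ∘ U′.u) Fr′.p×1≡0)) ρ-I)

    ρv-torsion : ρ (U′.v F′.1#) ^M p ~ I₂
    ρv-torsion = ~-trans (~-sym (ρv-^M p)) (~-trans (≡⇒~ (cong (ρ ∘ U′.v) Fr′.p×1≡0)) ρ-I)

    ρu≁ : ∀ {t} x → x ≢ F′.0# → ρ (U′.u x) ~ u t → t ≢ 0#
    ρu≁ x x≢0 eq refl = x≢0 (U′.u-injective (faithful (U′.det-u x) (U′.det-u F′.0#) (~-trans eq (~-sym ρ-I))))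

    ρv≁ : ∀ {t} x → x ≢ F′.0# → ρ (U′.v x) ~ v t → t ≢ 0#
    ρv≁ x x≢0 eq refl = x≢0 (U′.v-injective (faithful (U′.det-v x) (U′.det-v F′.0#) (~-trans eq (~-sym ρ-I))))

    -- The root subgroup is abelian, so its image lies in the centraliser of the image of `u 1`.
    ρu-upper : ∀ {t} → ρ (U′.u F′.1#) ~ u t → ∀ x → ∃ λ s → ρ (U′.u x) ~ u s
    ρu-upper {t} eq x = u-centralizer (ρ (U′.u x)) (ρu≁ F′.1# L′.1≢0 eq) (nonsingular (U′.det-u x))
      (~-trans (~-cong (~-sym eq) ~-refl) (~-trans
        (relation (U′.det-u F′.1#) (U′.det-u x) (U′.det-u x) (U′.det-u F′.1#)
          (trans (U′.u-+ F′.1# x) (trans (cong U′.u (L′.+-comm F′.1# x)) (sym (U′.u-+ x F′.1#)))))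
        (~-cong ~-refl eq)))

    ρv-lower : ∀ {t} → ρ (U′.v F′.1#) ~ v t → ∀ x → ∃ λ s → ρ (U′.v x) ~ v s
    ρv-lower {t} eq x = v-centralizer (ρ (U′.v x)) (ρv≁ F′.1# L′.1≢0 eq) (nonsingular (U′.det-v x))
      (~-trans (~-cong (~-sym eq) ~-refl) (~-trans
        (relation (U′.det-v F′.1#) (U′.det-v x) (U′.det-v x) (U′.det-v F′.1#)
          (trans (U′.v-+ F′.1# x) (trans (cong U′.v (L′.+-comm F′.1# x)) (sym (U′.v-+ x F′.1#)))))
        (~-cong ~-refl eq)))

    uv~vu⇒⊥ : ¬ (U′.u F′.1# ·′ U′.v F′.1# M′.~ U′.v F′.1# ·′ U′.u F′.1#)
    uv~vu⇒⊥ (M′.scaled k _ eq) = L′.1≢0 (sym (trans (L′.+-cancelˡ F′.1# _ _ (trans (L′.+-identityʳ F′.1#) (U′.scaled-1 k≡1 (M′.mat-a eq′)))) (L′.*-identityˡ F′.1#)))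
      where
      eq′ = trans (trans (sym (U′.·u F′.1# F′.1# F′.0# F′.1# F′.1#)) eq) (cong (B.scale k) (U′.·v F′.1# F′.1# F′.1# F′.0# F′.1#))
      k≡1 : k ≡ F′.1#
      k≡1 = U′.·≡⇒scalar≡1 L′.1≢0 (trans (sym (trans (L′.+-identityʳ _) (L′.*-identityˡ F′.1#))) (M′.mat-b eq′))

    -- If ρ(v 1) had the same eigenrow as ρ(u 1), the two would commute.
    ρv-not-upper : ∀ {t} → ρ (U′.u F′.1#) ~ u t → ∀ s → ¬ (ρ (U′.v F′.1#) ~ u s)
    ρv-not-upper {t} equ s eqv = uv~vu⇒⊥ (faithful
      (·-unimodular (U′.det-u F′.1#) (U′.det-v F′.1#)) (·-unimodular (U′.det-v F′.1#) (U′.det-u F′.1#))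
      (~-trans (hom (U′.det-u F′.1#) (U′.det-v F′.1#))
      (~-trans (~-cong equ eqv)
      (~-trans (≡⇒~ (trans (u-+ t s) (trans (cong u (+-comm t s)) (sym (u-+ s t)))))
      (~-trans (~-cong (~-sym eqv) (~-sym equ))
      (~-sym (hom (U′.det-v F′.1#) (U′.det-u F′.1#))))))))

-- Representations are field embeddings up to conjugation

module StandardForm (F F′ : FiniteField) (p n m : ℕ) (pp : Prime p)
    (order≡ : order F ≡ p ℕ.^ n) (order≡′ : order F′ ≡ p ℕ.^ m) (1≤n : 1 ≤ n) (1≤m : 1 ≤ m) where
  open FiniteField F hiding (order)
  open FieldFacts F
  open PΓL F p n using (Mat; mat; _·M_; mapMat; scale; det; adj; I₂)
  open Matrices F p n
  open Unipotents F p n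
  open Representations F F′ p n m pp order≡ order≡′ 1≤n 1≤m
  private
    module F′ = FiniteField F′
    module L′ = FieldFacts F′
    module B = PΓL F′ p m
    module M′ = Matrices F′ p m
    module U′ = Unipotents F′ p m
    module Fr′ = Frobenius F′ p m pp order≡′
  open B using () renaming (Mat to Mat′; mat to mat′; _·M_ to _·′_; det to det′)

  -- The maps `θ` and `ψ` on the two root subgroups are unrelated at first; the torus makes them
  -- proportional, and a relation between root elements makes them equal.
  record RootData (ρ : Mat′ → Mat) : Set where
    field
      θ ψ : F′.Carrier → Carrier
      ρ-u : ∀ x → ρ (U′.u x) ~ u (θ x)
      ρ-v : ∀ x → ρ (U′.v x) ~ v (ψ x)
      θ-1 : θ F′.1# ≡ 1#

  Normalisable : (Mat′ → Mat) → Set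
  Normalisable ρ = ∃ λ C → det C ≢ 0# × RootData (λ B → ρ B ^^ C)

  normalisable-^^ : ∀ {ρ} C → det C ≢ 0# → Normalisable (λ B → ρ B ^^ C) → Normalisable ρ
  normalisable-^^ {ρ} C detC (D , detD , data′) =
    D ·M C , (λ eq → *-nonzero detD detC (trans (sym (det-· D C)) eq)) , record
      { θ = θ ; ψ = ψ ; θ-1 = θ-1
      ; ρ-u = λ x → subst (_~ u (θ x)) (^^-^^ (ρ (U′.u x)) C D) (ρ-u x)
      ; ρ-v = λ x → subst (_~ v (ψ x)) (^^-^^ (ρ (U′.v x)) C D) (ρ-v x) }
    where open RootData data′

  -- Once both fixed points are in place, only diagonal matrices can still be used for conjugation.
  -- This freedom is spent on `θ-1`.
  scale-roots : ∀ {ρ} → Representation ρ → (∀ x → ∃ λ s → ρ (U′.u x) ~ u s) → (∀ x → ∃ λ s → ρ (U′.v x) ~ v s) → Normalisable ρ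
  scale-roots {ρ} R f h = diag g 1# , (λ eq → g≢0 (trans (sym (trans (det-diag g 1#) (*-identityʳ g))) eq)) , record
    { θ = λ x → g * proj₁ (f x) ; ψ = λ x → (g ⁻¹) * proj₁ (h x)
    ; ρ-u = λ x → ~-trans (^^-~ (diag g 1#) (proj₂ (f x))) (u-^^diag (proj₁ (f x)) g g≢0)
    ; ρ-v = λ x → ~-trans (^^-~ (diag g 1#) (proj₂ (h x))) (v-^^diag (proj₁ (h x)) g g≢0)
    ; θ-1 = inverseˡ f1≢0 }
    where
    f1≢0 : proj₁ (f F′.1#) ≢ 0#
    f1≢0 = ρu≁ R F′.1# L′.1≢0 (proj₂ (f F′.1#))
    g = (proj₁ (f F′.1#)) ⁻¹
    g≢0 = ⁻¹-nonzero f1≢0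

  normalise-lower : ∀ {ρ} → Representation ρ → ∀ {t} → ρ (U′.u F′.1#) ~ u t → (∃₂ λ z s → ρ (U′.v F′.1#) ^^ u z ~ v s) → Normalisable ρ
  normalise-lower {ρ} R {t} equ (z , s , eqv) = normalisable-^^ (u z) detuz (scale-roots R′ (ρu-upper R′ equ′) (ρv-lower R′ eqv))
    where
    detuz : det (u z) ≢ 0#
    detuz eq = 1≢0 (trans (sym (det-u z)) eq)
    R′ = conjugate (u z) detuz R
    equ′ : ρ (U′.u F′.1#) ^^ u z ~ u t
    equ′ = ~-trans (^^-~ (u z) equ) (u-^^u t z)

  normalise-upper : ∀ {ρ} → Representation ρ → (∃ λ C → det C ≢ 0# × ∃ λ t → ρ (U′.u F′.1#) ^^ C ~ u t) → Normalisable ρ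
  normalise-upper {ρ} R (C , detC , t , equ) = normalisable-^^ C detC (normalise-lower R′ equ
      (make-lower (ρ (U′.v F′.1#) ^^ C) (Representation.nonsingular R′ {U′.v F′.1#} (U′.det-v F′.1#)) (ρv-torsion R′) (ρv-not-upper R′ equ)))
    where
    R′ = conjugate C detC R

  normalise : ∀ {ρ} → Representation ρ → Normalisable ρ
  normalise {ρ} R = normalise-upper R
    (make-upper (ρ (U′.u F′.1#)) (Representation.nonsingular R {U′.u F′.1#} (U′.det-u F′.1#)) (ρu-torsion R))

  record FieldHom : Set where
    field
      θ : F′.Carrier → Carrier
      θ-+ : ∀ x y → θ (x F′.+ y) ≡ θ x + θ y
      θ-* : ∀ x y → θ (x F′.* y) ≡ θ x * θ y
      θ-0 : θ F′.0# ≡ 0#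
      θ-1 : θ F′.1# ≡ 1#

    θ-neg : ∀ x → θ (F′.- x) ≡ - θ x
    θ-neg x = +-cancelˡ (θ x) _ _ (trans (sym (θ-+ x (F′.- x))) (trans (cong θ (L′.-‿inverseʳ x)) (trans θ-0 (sym (-‿inverseʳ _)))))

    mapθ : Mat′ → Mat
    mapθ (mat′ a b c d) = mat (θ a) (θ b) (θ c) (θ d)

    mapθ-· : ∀ A B → mapθ (A ·′ B) ≡ mapθ A ·M mapθ B
    mapθ-· (mat′ a b c d) (mat′ a′ b′ c′ d′) = mat≡ (e a b a′ c′) (e a b b′ d′) (e c d a′ c′) (e c d b′ d′)
      where
      e : ∀ x y z w → θ (x F′.* z F′.+ y F′.* w) ≡ θ x * θ z + θ y * θ w
      e x y z w = trans (θ-+ _ _) (cong₂ _+_ (θ-* x z) (θ-* y w))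

    mapθ-u : ∀ x → mapθ (U′.u x) ≡ u (θ x)
    mapθ-u x = mat≡ θ-1 refl θ-0 θ-1

    mapθ-v : ∀ x → mapθ (U′.v x) ≡ v (θ x)
    mapθ-v x = mat≡ θ-1 θ-0 refl θ-1

    mapθ-det : ∀ A → det (mapθ A) ≡ θ (det′ A)
    mapθ-det (mat′ a b c d) = sym (trans (θ-+ _ _) (cong₂ _+_ (θ-* a d) (trans (θ-neg _) (cong -_ (θ-* b c)))))

  module Roots {ρ : Mat′ → Mat} (R : Representation ρ) (D : RootData ρ) where
    open Representation R
    open RootData D

    θ-≢0 : ∀ {x} → x ≢ F′.0# → θ x ≢ 0#
    θ-≢0 {x} x≢0 = ρu≁ R x x≢0 (ρ-u x)

    ψ-≢0 : ∀ {x} → x ≢ F′.0# → ψ x ≢ 0#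
    ψ-≢0 {x} x≢0 = ρv≁ R x x≢0 (ρ-v x)

    θ-+ : ∀ x y → θ (x F′.+ y) ≡ θ x + θ y
    θ-+ x y = u-injective (~-trans (~-sym (ρ-u _)) (~-trans (≡⇒~ (cong ρ (sym (U′.u-+ x y))))
      (~-trans (hom {U′.u x} {U′.u y} (U′.det-u x) (U′.det-u y)) (~-trans (~-cong (ρ-u x) (ρ-u y)) (≡⇒~ (u-+ _ _))))))

    ψ-+ : ∀ x y → ψ (x F′.+ y) ≡ ψ x + ψ y
    ψ-+ x y = v-injective (~-trans (~-sym (ρ-v _)) (~-trans (≡⇒~ (cong ρ (sym (U′.v-+ x y))))
      (~-trans (hom {U′.v x} {U′.v y} (U′.det-v x) (U′.det-v y)) (~-trans (~-cong (ρ-v x) (ρ-v y)) (≡⇒~ (v-+ _ _))))))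

    additive-0 : ∀ (f : F′.Carrier → Carrier) → (∀ x y → f (x F′.+ y) ≡ f x + f y) → f F′.0# ≡ 0#
    additive-0 f f-+ = +-cancelˡ (f F′.0#) _ _ (trans (sym (f-+ _ _)) (trans (cong f (L′.+-identityˡ _)) (sym (+-identityʳ _))))

    additive-neg : ∀ (f : F′.Carrier → Carrier) → (∀ x y → f (x F′.+ y) ≡ f x + f y) → ∀ x → f (F′.- x) ≡ - f x
    additive-neg f f-+ x = +-cancelˡ (f x) _ _
      (trans (sym (f-+ _ _)) (trans (cong f (L′.-‿inverseʳ x)) (trans (additive-0 f f-+) (sym (-‿inverseʳ _)))))

    h′ : F′.Carrier → Mat′
    h′ a = U′.diag a (a F′.⁻¹)

    h′-det : ∀ {a} → a ≢ F′.0# → Unimodular (h′ a)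
    h′-det {a} a≢0 = trans (U′.det-diag a _) (F′.⁻¹-inverse a a≢0)

    h′-u : ∀ {a} → a ≢ F′.0# → ∀ x → h′ a ·′ U′.u x ≡ U′.u ((a F′.* a) F′.* x) ·′ h′ a
    h′-u {a} a≢0 x = trans (U′.·u x a F′.0# F′.0# (a F′.⁻¹)) (trans (M′.mat≡
      (sym (U′.x+y0 a _))
      (trans (L′.+-identityʳ _) (trans (sym (L′.x*x⁻¹y (a F′.* x) a≢0)) (trans
        (L′.solve 3 (λ a i x → a L′.:* (i L′.:* (a L′.:* x)) L′.:= ((a L′.:* a) L′.:* x) L′.:* i) refl a (a F′.⁻¹) x)
        (sym (L′.+-identityˡ _)))))
      refl (U′.0x+y x _))
      (sym (U′.u· _ a F′.0# F′.0# (a F′.⁻¹))))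

    h′-v : ∀ {a} → a ≢ F′.0# → ∀ x → U′.v ((a F′.⁻¹ F′.* a F′.⁻¹) F′.* x) ·′ h′ a ≡ h′ a ·′ U′.v x
    h′-v {a} a≢0 x = trans (U′.v· _ a F′.0# F′.0# (a F′.⁻¹)) (trans (M′.mat≡
      (sym (U′.x+0y a x)) refl
      (trans (L′.+-identityʳ _) (trans (L′.solve 3 (λ a i x → ((i L′.:* i) L′.:* x) L′.:* a L′.:= i L′.:* (a L′.:* (i L′.:* x))) refl a (a F′.⁻¹) x)
        (trans (L′.x⁻¹*xy ((a F′.⁻¹) F′.* x) a≢0) (sym (L′.+-identityˡ _)))))
      (trans (U′.x0+y _ _) refl))
      (sym (U′.·v x a F′.0# F′.0# (a F′.⁻¹))))

    -- `A` carries a nontrivial element of each root subgroup to an element of the same root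
    -- subgroup, so it preserves both of the fixed points.
    torus-diagonal : ∀ {t s s′} A → det A ≢ 0# → t ≢ 0# → s ≢ 0# → A ·M u 1# ~ u t ·M A → A ·M v s ~ v s′ ·M A →
      ∃₂ λ k o → k ≢ 0# × o ≢ 0# × A ≡ diag k o
    torus-diagonal {t} {s} {s′} (mat k l m o) detA t≢0 s≢0 (scaled r _ eq₁) (scaled r′ _ eq₂) =
      k , o , proj₁ (det-upper detA′) , proj₂ (det-upper detA′) , mat≡ refl l≡0 m≡0 refl
      where
      eq₁′ = trans (trans (sym (u· t k l m o)) eq₁) (cong (scale r) (·u 1# k l m o))
      eq₂′ = trans (trans (sym (v· s′ k l m o)) eq₂) (cong (scale r′) (·v s k l m o))
      m≡0 : m ≡ 0#
      m≡0 with m ≟ 0#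
      ... | yes m≡0 = m≡0
      ... | no m≢0 = ⊥-elim (m≢0 (x+ty≡x⇒y≡0 t≢0 (scaled-1 (·≡⇒scalar≡1 m≢0 (mat-c eq₁′)) (mat-a eq₁′))))
      l≡0 : l ≡ 0#
      l≡0 with l ≟ 0#
      ... | yes l≡0 = l≡0
      ... | no l≢0 = ⊥-elim (l≢0 (x+ty≡x⇒y≡0 s≢0 (trans (cong (_+_ k) (*-comm s l)) (sym (scaled-1 (·≡⇒scalar≡1 l≢0 (mat-b eq₂′)) (mat-a eq₂′))))))
      detA′ : det (mat k l 0# o) ≢ 0#
      detA′ eq = detA (subst (λ z → det (mat k l z o) ≡ 0#) (sym m≡0) eq)

    diag-u : ∀ {k o x y} → k ≢ 0# → diag k o ·M u x ~ u y ·M diag k o → k * x ≡ y * o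
    diag-u {k} {o} {x} {y} k≢0 (scaled r _ eq) =
      sym (trans (sym (+-identityˡ _)) (trans (scaled-1 (·≡⇒scalar≡1 k≢0 (trans (sym (x+y0 k y)) (mat-a eq′))) (mat-b eq′)) (+-identityʳ _)))
      where eq′ = trans (trans (sym (u· y k 0# 0# o)) eq) (cong (scale r) (·u x k 0# 0# o))

    diag-v : ∀ {k o x y} → k ≢ 0# → diag k o ·M v x ~ v y ·M diag k o → y * k ≡ o * x
    diag-v {k} {o} {x} {y} k≢0 (scaled r _ eq) =
      trans (sym (+-identityʳ _)) (trans (scaled-1 (·≡⇒scalar≡1 k≢0 (trans (mat-a eq′) (cong (r *_) (x+0y k x)))) (mat-c eq′)) (+-identityˡ _))
      where eq′ = trans (trans (sym (v· y k 0# 0# o)) eq) (cong (scale r) (·v x k 0# 0# o))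

    module Torus {a : F′.Carrier} (a≢0 : a ≢ F′.0#) where
      a² = a F′.* a
      a⁻² = a F′.⁻¹ F′.* a F′.⁻¹
      a⁻¹≢0 = L′.⁻¹-nonzero a≢0

      u-relation : ∀ x → ρ (h′ a) ·M u (θ x) ~ u (θ (a² F′.* x)) ·M ρ (h′ a)
      u-relation x = ~-trans (~-cong ~-refl (~-sym (ρ-u x))) (~-trans
        (relation R {h′ a} {U′.u x} {U′.u (a² F′.* x)} {h′ a} (h′-det a≢0) (U′.det-u x) (U′.det-u (a² F′.* x)) (h′-det a≢0) (h′-u a≢0 x))
        (~-cong (ρ-u _) ~-refl))

      v-relation : ∀ x → ρ (h′ a) ·M v (ψ x) ~ v (ψ (a⁻² F′.* x)) ·M ρ (h′ a)
      v-relation x = ~-trans (~-cong ~-refl (~-sym (ρ-v x))) (~-trans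
        (relation R {h′ a} {U′.v x} {U′.v (a⁻² F′.* x)} {h′ a} (h′-det a≢0) (U′.det-v x) (U′.det-v (a⁻² F′.* x)) (h′-det a≢0) (sym (h′-v a≢0 x)))
        (~-cong (ρ-v _) ~-refl))

      diagonal = torus-diagonal (ρ (h′ a)) (nonsingular (h′-det a≢0))
        (θ-≢0 (L′.*-nonzero (L′.*-nonzero a≢0 a≢0) L′.1≢0)) (ψ-≢0 L′.1≢0)
        (subst (λ z → ρ (h′ a) ·M u z ~ u (θ (a² F′.* F′.1#)) ·M ρ (h′ a)) θ-1 (u-relation F′.1#)) (v-relation F′.1#)
      k = proj₁ diagonal
      o = proj₁ (proj₂ diagonal)
      k≢0 = proj₁ (proj₂ (proj₂ diagonal))
      o≢0 = proj₁ (proj₂ (proj₂ (proj₂ diagonal)))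
      ρh≡ = proj₂ (proj₂ (proj₂ (proj₂ diagonal)))

      kθ : ∀ x → k * θ x ≡ θ (a² F′.* x) * o
      kθ x = diag-u k≢0 (subst (λ A → A ·M u (θ x) ~ u (θ (a² F′.* x)) ·M A) ρh≡ (u-relation x))

      ψk : ∀ x → ψ (a⁻² F′.* x) * k ≡ o * ψ x
      ψk x = diag-v k≢0 (subst (λ A → A ·M v (ψ x) ~ v (ψ (a⁻² F′.* x)) ·M A) ρh≡ (v-relation x))

      k≡ : k ≡ θ a² * o
      k≡ = trans (sym (*-identityʳ k)) (trans (cong (k *_) (sym θ-1)) (trans (kθ F′.1#) (cong (λ z → θ z * o) (L′.*-identityʳ a²))))

      -- Conjugation by the diagonal matrix ρ(h′ a) multiplies the parameter of `u` by one constant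
      -- for all x. Evaluation at 1 identifies the constant as θ(a²).
      θ-square : ∀ x → θ (a² F′.* x) ≡ θ a² * θ x
      θ-square x = *-cancelˡ o≢0 (trans (*-comm o _) (trans (sym (kθ x)) (trans (cong (_* θ x) k≡)
        (solve 3 (λ s o x → (s :* o) :* x := o :* (s :* x)) refl (θ a²) o (θ x)))))

      ψ-inverse-square : θ a² * ψ a⁻² ≡ ψ F′.1#
      ψ-inverse-square = *-cancelˡ o≢0 (trans (solve 3 (λ o s y → o :* (s :* y) := y :* (s :* o)) refl o (θ a²) (ψ a⁻²))
        (trans (cong (ψ a⁻² *_) (sym k≡)) (trans (cong (λ z → ψ z * k) (sym (L′.*-identityʳ a⁻²))) (ψk F′.1#))))

    -- The torus gives `ψ` at the inverse square of its parameter, so it is applied to a⁻¹ and the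
    -- factor θ(a⁻²) is cancelled.
    ψ-square : ∀ {a} → a ≢ F′.0# → ψ (a F′.* a) ≡ θ (a F′.* a) * ψ F′.1#
    ψ-square {a} a≢0 = *-cancelˡ {x = θ b²} (θ-≢0 (L′.*-nonzero b≢0 b≢0)) (begin
      θ b² * ψ (a F′.* a) ≡⟨ cong (λ z → θ b² * ψ (z F′.* z)) a≡ ⟩
      θ b² * ψ (b F′.⁻¹ F′.* b F′.⁻¹) ≡⟨ Torus.ψ-inverse-square b≢0 ⟩
      ψ F′.1# ≡⟨ *-identityˡ _ ⟨
      1# * ψ F′.1# ≡⟨ cong (_* ψ F′.1#) θθ ⟨
      (θ b² * θ (a F′.* a)) * ψ F′.1# ≡⟨ *-assoc _ _ _ ⟩
      θ b² * (θ (a F′.* a) * ψ F′.1#) ∎)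
      where
      open ≡-Reasoning
      b = a F′.⁻¹
      b≢0 = L′.⁻¹-nonzero a≢0
      b² = b F′.* b
      a≡ : a ≡ b F′.⁻¹
      a≡ = L′.*-cancelˡ b≢0 (trans (L′.inverseˡ a≢0) (sym (F′.⁻¹-inverse b b≢0)))
      θθ : θ b² * θ (a F′.* a) ≡ 1#
      θθ = trans (sym (Torus.θ-square b≢0 (a F′.* a))) (trans (cong θ
        (trans (L′.solve 2 (λ b a → (b L′.:* b) L′.:* (a L′.:* a) L′.:= (b L′.:* a) L′.:* (b L′.:* a)) refl b a)
          (trans (cong₂ F′._*_ (L′.inverseˡ a≢0) (L′.inverseˡ a≢0)) (L′.*-identityˡ _)))) θ-1)

    -- Both clauses hold for squares by the torus action and are inherited by sums and negatives;
    -- treating them together settles `θ` and `ψ` with one generation argument.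
    Multiplicative : F′.Carrier → Set
    Multiplicative x = (∀ y → θ (x F′.* y) ≡ θ x * θ y) × ψ x ≡ θ x * ψ F′.1#

    multiplicative-0 : Multiplicative F′.0#
    multiplicative-0 = (λ y → trans (cong θ (L′.zeroˡ y)) (trans θ0 (sym (trans (cong (_* θ y) θ0) (zeroˡ _))))) ,
      trans (additive-0 ψ ψ-+) (sym (trans (cong (_* ψ F′.1#) θ0) (zeroˡ _)))
      where θ0 = additive-0 θ θ-+

    multiplicative-square : ∀ a → Multiplicative (a F′.* a)
    multiplicative-square a with a L′.≟ F′.0#
    ... | no a≢0 = Torus.θ-square a≢0 , ψ-square a≢0
    ... | yes refl = subst Multiplicative (sym (L′.zeroˡ F′.0#)) multiplicative-0

    multiplicative-+ : ∀ {x y} → Multiplicative x → Multiplicative y → Multiplicative (x F′.+ y)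
    multiplicative-+ {x} {y} (mx , ψx) (my , ψy) =
      (λ z → trans (cong θ (L′.distribʳ z x y)) (trans (θ-+ _ _) (trans (cong₂ _+_ (mx z) (my z))
        (trans (sym (distribʳ (θ z) (θ x) (θ y))) (cong (_* θ z) (sym (θ-+ x y))))))) ,
      trans (ψ-+ x y) (trans (cong₂ _+_ ψx ψy) (trans (sym (distribʳ _ (θ x) (θ y))) (cong (_* ψ F′.1#) (sym (θ-+ x y)))))

    multiplicative-neg : ∀ {x} → Multiplicative x → Multiplicative (F′.- x)
    multiplicative-neg {x} (mx , ψx) =
      (λ z → trans (cong θ (sym (L′.-‿distribˡ-* x z))) (trans (additive-neg θ θ-+ _) (trans (cong -_ (mx z))
        (trans (-‿distribˡ-* (θ x) (θ z)) (cong (_* θ z) (sym (additive-neg θ θ-+ x))))))) ,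
      trans (additive-neg ψ ψ-+ x) (trans (cong -_ ψx) (trans (-‿distribˡ-* (θ x) _) (cong (_* ψ F′.1#) (sym (additive-neg θ θ-+ x)))))

    -- Squares generate the additive group. In characteristic 2 every element is a square; otherwise
    -- x = ((x + 1)/2)² - ((x - 1)/2)².
    multiplicative : ∀ x → Multiplicative x
    multiplicative x with p ℕₚ.≟ 2
    ... | yes p≡2 = subst Multiplicative root² (multiplicative-square root)
      where
      root = B.frob^ (m ∸ 1) x
      pow≡ : ∀ {k} → k ≡ 2 → ∀ y → y L′.^ k ≡ y F′.* y
      pow≡ refl y = cong (y F′.*_) (L′.*-identityʳ y)
      root² : root F′.* root ≡ x
      root² = trans (sym (pow≡ p≡2 root)) (trans (sym (Fr′.pow≡^ root p))
        (trans (cong (λ k → B.frob^ k x) (ℕₚ.m+[n∸m]≡n 1≤m)) (Fr′.frob^n x)))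
    ... | no p≢2 = subst Multiplicative difference
        (multiplicative-+ (multiplicative-square (h F′.* (x F′.+ F′.1#))) (multiplicative-neg (multiplicative-square (h F′.* (x L′.- F′.1#)))))
      where
      2# = F′.1# F′.+ F′.1#
      2≢0 : 2# ≢ F′.0#
      2≢0 = OddCharacteristic.2≢0 F′ p pp p≢2 Fr′.p×1≡0
      h = 2# F′.⁻¹
      difference : ((h F′.* (x F′.+ F′.1#)) F′.* (h F′.* (x F′.+ F′.1#))) F′.+ F′.- ((h F′.* (x L′.- F′.1#)) F′.* (h F′.* (x L′.- F′.1#))) ≡ x
      difference = trans (L′.solve 3 (λ h x o → ((h L′.:* (x L′.:+ o)) L′.:* (h L′.:* (x L′.:+ o))) L′.:+ L′.:- ((h L′.:* (x L′.:- o)) L′.:* (h L′.:* (x L′.:- o)))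
          L′.:= (h L′.:* (o L′.:+ o)) L′.:* (h L′.:* (x L′.:+ x))) refl h x F′.1#)
        (trans (cong₂ F′._*_ (L′.inverseˡ 2≢0) (cong (h F′.*_) (sym (trans (L′.distribʳ x F′.1# F′.1#) (cong₂ F′._+_ (L′.*-identityˡ x) (L′.*-identityˡ x))))))
          (trans (L′.*-identityˡ _) (L′.x⁻¹*xy x 2≢0)))

    hom-θ : FieldHom
    hom-θ = record { θ = θ ; θ-+ = θ-+ ; θ-* = λ x → proj₁ (multiplicative x) ; θ-0 = additive-0 θ θ-+ ; θ-1 = θ-1 }
    open FieldHom hom-θ using (mapθ; mapθ-·; mapθ-u; mapθ-v; θ-neg)

    -1′ = F′.- F′.1#

    ψ-neg-1 : ψ -1′ ≡ - ψ F′.1#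
    ψ-neg-1 = additive-neg ψ ψ-+ F′.1#

    -- This relation forces ψ(1) = 1.
    braid : (U′.u F′.1# ·′ U′.v -1′) ·′ U′.u F′.1# ≡ (U′.v -1′ ·′ U′.u F′.1#) ·′ U′.v -1′
    braid = trans (trans (cong (_·′ U′.u F′.1#) (U′.·v -1′ F′.1# F′.1# F′.0# F′.1#)) (U′.·u F′.1# _ _ _ _))
      (trans (M′.mat≡
        (trans 1+1*-1 (sym (trans (cong (F′._+_ F′.1#) (trans (cong (F′._* -1′) 1*1+0) (L′.*-identityˡ -1′))) (L′.-‿inverseʳ _))))
        (trans (cong (F′._+ F′.1#) (trans (cong (F′._* F′.1#) 1+1*-1) (L′.zeroˡ _))) (trans (L′.+-identityˡ _) (sym 1*1+0)))
        (trans 0+1*-1 (sym (trans (cong (F′._+_ -1′) (trans (cong (F′._* -1′) -1*1+1) (L′.zeroˡ _))) (L′.+-identityʳ -1′))))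
        (trans (cong (λ z → z F′.* F′.1# F′.+ F′.1#) 0+1*-1) refl))
      (sym (trans (cong (_·′ U′.v -1′) (U′.·u F′.1# F′.1# F′.0# -1′ F′.1#)) (U′.·v -1′ _ _ _ _))))
      where
      1*1+0 : F′.1# F′.* F′.1# F′.+ F′.0# ≡ F′.1#
      1*1+0 = trans (L′.+-identityʳ _) (L′.*-identityˡ _)
      1+1*-1 : F′.1# F′.+ F′.1# F′.* -1′ ≡ F′.0#
      1+1*-1 = trans (cong (F′._+_ F′.1#) (L′.*-identityˡ -1′)) (L′.-‿inverseʳ _)
      0+1*-1 : F′.0# F′.+ F′.1# F′.* -1′ ≡ -1′
      0+1*-1 = trans (L′.+-identityˡ _) (L′.*-identityˡ -1′)
      -1*1+1 : -1′ F′.* F′.1# F′.+ F′.1# ≡ F′.0#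
      -1*1+1 = trans (cong (F′._+ F′.1#) (L′.*-identityʳ -1′)) (L′.-‿inverseˡ _)

    -- The top left entries of both sides are 1 - c. If this is nonzero the proportionality factor
    -- is 1, and then the top right entries give c = 1 after all.
    braid-image : ∀ {c} → (u 1# ·M v (- c)) ·M u 1# ~ (v (- c) ·M u 1#) ·M v (- c) → c ≡ 1#
    braid-image {c} (scaled s s≢0 eq) with (1# - c) ≟ 0#
    ... | yes d = sym (x-y≡0⇒x≡y d)
    ... | no d = +-cancelˡ 1# _ _ (trans (+-comm 1# c) (x-y≡0⇒x≡y′ (scaled-1 s≡1 (mat-b eq′))))
      where
      eq′ : mat (1# - c) 1# ((- c) + (- c + 1#) * - c) (- c + 1#) ≡ scale s (mat (1# - c) ((1# - c) + 1#) (- c) (- c + 1#))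
      eq′ = trans (sym (trans (trans (cong (_·M v (- c)) (·u 1# 1# 0# (- c) 1#)) (·v (- c) _ _ _ _))
          (mat≡ (trans (cong (λ z → 1# + z * - c) o) (cong (_+_ 1#) (*-identityˡ _))) o (cong (λ z → - c + (z + 1#) * - c) (*-identityʳ _)) (cong (_+ 1#) (*-identityʳ _)))))
        (trans eq (cong (scale s) (trans (trans (cong (_·M u 1#) (·v (- c) 1# 1# 0# 1#)) (·u 1# _ _ _ _))
          (mat≡ (cong (_+_ 1#) (*-identityˡ _)) (cong (_+ 1#) (trans (*-identityʳ _) (cong (_+_ 1#) (*-identityˡ _))))
            (trans (+-identityˡ _) (*-identityˡ _)) (cong (_+ 1#) (trans (*-identityʳ _) (trans (+-identityˡ _) (*-identityˡ _))))))))
        where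
        o : 1# * 1# + 0# ≡ 1#
        o = trans (+-identityʳ _) (*-identityˡ _)
      s≡1 = ·≡⇒scalar≡1 d (mat-a eq′)
      x-y≡0⇒x≡y′ : ∀ {c} → 1# ≡ (1# - c) + 1# → c + 1# ≡ 1# + 1#
      x-y≡0⇒x≡y′ {c} eq = trans (cong (_+_ c) eq) (solve 2 (λ c o → c :+ ((o :- c) :+ o) := o :+ o) refl c 1#)

    ψ-1 : ψ F′.1# ≡ 1#
    ψ-1 = braid-image (~-trans (~-sym lhs) (~-trans (≡⇒~ (cong ρ braid)) rhs))
      where
      ρ-u1 : ρ (U′.u F′.1#) ~ u 1#
      ρ-u1 = subst (λ z → ρ (U′.u F′.1#) ~ u z) θ-1 (ρ-u F′.1#)
      ρ-v-1 : ρ (U′.v -1′) ~ v (- ψ F′.1#)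
      ρ-v-1 = subst (λ z → ρ (U′.v -1′) ~ v z) ψ-neg-1 (ρ-v -1′)
      lhs : ρ ((U′.u F′.1# ·′ U′.v -1′) ·′ U′.u F′.1#) ~ (u 1# ·M v (- ψ F′.1#)) ·M u 1#
      lhs = ~-trans (hom {U′.u F′.1# ·′ U′.v -1′} {U′.u F′.1#} (·-unimodular {U′.u F′.1#} {U′.v -1′} (U′.det-u F′.1#) (U′.det-v -1′)) (U′.det-u F′.1#))
        (~-cong (~-trans (hom {U′.u F′.1#} {U′.v -1′} (U′.det-u F′.1#) (U′.det-v -1′)) (~-cong ρ-u1 ρ-v-1)) ρ-u1)
      rhs : ρ ((U′.v -1′ ·′ U′.u F′.1#) ·′ U′.v -1′) ~ (v (- ψ F′.1#) ·M u 1#) ·M v (- ψ F′.1#)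
      rhs = ~-trans (hom {U′.v -1′ ·′ U′.u F′.1#} {U′.v -1′} (·-unimodular {U′.v -1′} {U′.u F′.1#} (U′.det-v -1′) (U′.det-u F′.1#)) (U′.det-v -1′))
        (~-cong (~-trans (hom {U′.v -1′} {U′.u F′.1#} (U′.det-v -1′) (U′.det-u F′.1#)) (~-cong ρ-v-1 ρ-u1)) ρ-v-1)

    Agrees : Mat′ → Set
    Agrees B = ρ B ~ mapθ B

    agrees-u : ∀ x → Agrees (U′.u x)
    agrees-u x = ~-trans (ρ-u x) (≡⇒~ (sym (mapθ-u x)))

    agrees-v : ∀ x → Agrees (U′.v x)
    agrees-v x = ~-trans (ρ-v x) (≡⇒~ (trans (cong v (trans (proj₂ (multiplicative x)) (trans (cong (θ x *_) ψ-1) (*-identityʳ _)))) (sym (mapθ-v x))))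

    agrees-· : ∀ {A B} → Unimodular A → Unimodular B → Agrees A → Agrees B → Agrees (A ·′ B)
    agrees-· {A} {B} uA uB rA rB = ~-trans (hom {A} {B} uA uB) (~-trans (~-cong rA rB) (≡⇒~ (sym (mapθ-· A B))))

    -- Three of the entries determine the two outer factors; the top right entry then agrees because
    -- the determinant is 1.
    factor : ∀ {a b c d} → c ≢ F′.0# → Unimodular (mat′ a b c d) →
      (U′.u ((a L′.- F′.1#) F′.* c F′.⁻¹) ·′ U′.v c) ·′ U′.u ((d L′.- F′.1#) F′.* c F′.⁻¹) ≡ mat′ a b c d
    factor {a} {b} {c} {d} c≢0 uni = trans (trans (cong (_·′ U′.u z) (U′.·v c F′.1# x F′.0# F′.1#)) (U′.·u z _ _ _ _)) (M′.mat≡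
        a≡ (L′.*-cancelˡ c≢0 b≡) c≡ (trans (cong (λ o → o F′.* z F′.+ F′.1#) c≡) (trans (cong (F′._+ F′.1#) (L′.*-comm c z)) (trans (cong (F′._+ F′.1#) zc) (back d)))))
      where
      x = (a L′.- F′.1#) F′.* c F′.⁻¹
      z = (d L′.- F′.1#) F′.* c F′.⁻¹
      cancel : ∀ y → (y F′.* c F′.⁻¹) F′.* c ≡ y
      cancel y = trans (L′.*-assoc y _ c) (trans (cong (y F′.*_) (L′.inverseˡ c≢0)) (L′.*-identityʳ y))
      xc = cancel (a L′.- F′.1#)
      zc = cancel (d L′.- F′.1#)
      back : ∀ y → (y L′.- F′.1#) F′.+ F′.1# ≡ y
      back y = L′.solve 2 (λ y o → (y L′.:- o) L′.:+ o L′.:= y) refl y F′.1#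
      a≡ : F′.1# F′.+ x F′.* c ≡ a
      a≡ = trans (cong (F′._+_ F′.1#) xc) (trans (L′.+-comm _ _) (back a))
      c≡ : F′.0# F′.+ F′.1# F′.* c ≡ c
      c≡ = trans (L′.+-identityˡ _) (L′.*-identityˡ c)
      b≡ : c F′.* ((F′.1# F′.+ x F′.* c) F′.* z F′.+ x) ≡ c F′.* b
      b≡ = begin
        c F′.* ((F′.1# F′.+ x F′.* c) F′.* z F′.+ x) ≡⟨ cong (λ o → c F′.* (o F′.* z F′.+ x)) a≡ ⟩
        c F′.* (a F′.* z F′.+ x) ≡⟨ L′.solve 4 (λ c a z x → c L′.:* (a L′.:* z L′.:+ x) L′.:= a L′.:* (z L′.:* c) L′.:+ x L′.:* c) refl c a z x ⟩
        a F′.* (z F′.* c) F′.+ x F′.* c ≡⟨ cong₂ (λ o o′ → a F′.* o F′.+ o′) zc xc ⟩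
        a F′.* (d L′.- F′.1#) F′.+ (a L′.- F′.1#) ≡⟨ cong (F′._+ (a L′.- F′.1#)) (trans (L′.distribˡ a d _) (cong (F′._+_ (a F′.* d)) (trans (sym (L′.-‿distribʳ-* a _)) (cong F′.-_ (L′.*-identityʳ a))))) ⟩
        (a F′.* d L′.- a) F′.+ (a L′.- F′.1#) ≡⟨ cong (λ o → (a F′.* d L′.- a) F′.+ (a L′.- o)) uni ⟨
        (a F′.* d L′.- a) F′.+ (a L′.- det′ (mat′ a b c d)) ≡⟨ L′.solve 4 (λ a b c d → (a L′.:* d L′.:- a) L′.:+ (a L′.:- (a L′.:* d L′.:+ L′.:- (b L′.:* c))) L′.:= c L′.:* b) refl a b c d ⟩
        c F′.* b ∎
        where open ≡-Reasoning

    agrees-c≢0 : ∀ {a b c d} → c ≢ F′.0# → Unimodular (mat′ a b c d) → Agrees (mat′ a b c d)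
    agrees-c≢0 {a} {b} {c} {d} c≢0 uni = subst Agrees (factor c≢0 uni)
      (agrees-· {U′.u x ·′ U′.v c} {U′.u z} (·-unimodular {U′.u x} {U′.v c} (U′.det-u x) (U′.det-v c)) (U′.det-u z)
        (agrees-· {U′.u x} {U′.v c} (U′.det-u x) (U′.det-v c) (agrees-u x) (agrees-v c)) (agrees-u z))
      where
      x = (a L′.- F′.1#) F′.* c F′.⁻¹
      z = (d L′.- F′.1#) F′.* c F′.⁻¹

    -- Products of root elements reach every matrix with nonzero bottom left entry. If that entry is
    -- zero, multiplication by `v 1` makes it nonzero, and `v (- 1)` undoes this.
    agrees : ∀ B → Unimodular B → Agrees B
    agrees (mat′ a b c d) uni with c L′.≟ F′.0#
    ... | no c≢0 = agrees-c≢0 c≢0 uni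
    ... | yes refl = subst Agrees B≡ (agrees-· {B ·′ U′.v F′.1#} {U′.v -1′} (·-unimodular {B} {U′.v F′.1#} uni (U′.det-v F′.1#)) (U′.det-v -1′)
        (subst Agrees (sym B·v≡) (agrees-c≢0 c′≢0 (subst Unimodular B·v≡ (·-unimodular {B} {U′.v F′.1#} uni (U′.det-v F′.1#))))) (agrees-v -1′))
      where
      B = mat′ a b F′.0# d
      B·v≡ = U′.·v F′.1# a b F′.0# d
      d≢0 : d ≢ F′.0#
      d≢0 = proj₂ (U′.det-upper {a} {b} {d} (λ eq → L′.1≢0 (trans (sym uni) eq)))
      c′≢0 : F′.0# F′.+ d F′.* F′.1# ≢ F′.0#
      c′≢0 eq = d≢0 (trans (sym (trans (L′.+-identityˡ _) (L′.*-identityʳ d))) eq)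
      B≡ : (B ·′ U′.v F′.1#) ·′ U′.v -1′ ≡ B
      B≡ = trans (M′.·M-assoc B (U′.v F′.1#) (U′.v -1′)) (trans (cong (B ·′_) (trans (U′.v-+ F′.1# -1′) (cong U′.v (L′.-‿inverseʳ F′.1#)))) (M′.·M-identityʳ B))

  standard-form : ∀ {ρ} → Representation ρ → ∃ λ C → det C ≢ 0# × Σ FieldHom λ h → ∀ B → Unimodular B → ρ B ^^ C ~ FieldHom.mapθ h B
  standard-form R = let C , detC , D = normalise R ; R′ = conjugate C detC R in
    C , detC , Roots.hom-θ R′ D , Roots.agrees R′ D

-- The subfield K, its subline, and a criterion for bases

module Subfield (F : FiniteField) (p n : ℕ) (pp : Prime p) (order≡ : order F ≡ p ℕ.^ n) (1≤n : 1 ≤ n) (m : ℕ) where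
  open FiniteField F hiding (order)
  open FieldFacts F
  open PΓL F p n hiding (_≈_)
  open Frobenius F p n pp order≡
  open Matrices F p n
  open SemilinearGroup F p n pp order≡ 1≤n
  open Unipotents F p n

  K : Carrier → Set
  K x = frob^ m x ≡ x

  K? : ∀ x → Dec (K x)
  K? x = frob^ m x ≟ x

  K-+ : ∀ {x y} → K x → K y → K (x + y)
  K-+ kx ky = trans (frob^-+ m _ _) (cong₂ _+_ kx ky)

  K-* : ∀ {x y} → K x → K y → K (x * y)
  K-* kx ky = trans (frob^-* m _ _) (cong₂ _*_ kx ky)

  K-neg : ∀ {x} → K x → K (- x)
  K-neg kx = trans (frob^-neg m _) (cong -_ kx)

  K-0 : K 0#
  K-0 = frob^-0 m

  K-1 : K 1#
  K-1 = frob^-1 m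

  K-cancelˡ : ∀ {x y} → x ≢ 0# → K x → K (x * y) → K y
  K-cancelˡ {x} {y} x≢0 kx kxy = *-cancelˡ x≢0 (trans (cong (_* frob^ m y) (sym kx)) (trans (sym (frob^-* m x y)) kxy))

  K-⁻¹ : ∀ {x} → x ≢ 0# → K x → K (x ⁻¹)
  K-⁻¹ {x} x≢0 kx = K-cancelˡ x≢0 kx (subst K (sym (⁻¹-inverse x x≢0)) K-1)

  K-frob^ : ∀ k {x} → K x → K (frob^ k x)
  K-frob^ k kx = trans (frob^-comm m k _) (cong (frob^ k) kx)

  q₀-1 : ℕ
  q₀-1 = p ℕ.^ m ∸ 1

  1≤p^ : ∀ k → 1 ≤ p ℕ.^ k
  1≤p^ k = ℕₚ.m^n>0 p {{prime⇒nonZero pp}} k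

  x^pred : ∀ k {x} → x ≢ 0# → frob^ k x ≡ x → x ^ (p ℕ.^ k ∸ 1) ≡ 1#
  x^pred k {x} x≢0 fix = *-cancelˡ x≢0 (trans (cong (x ^_) (ℕₚ.m+[n∸m]≡n (1≤p^ k))) (trans (sym (frob^≡^ k x)) (trans fix (sym (*-identityʳ x)))))

  K^ : ∀ {x} → x ≢ 0# → K x → x ^ q₀-1 ≡ 1#
  K^ = x^pred m

  record KMat (A : Mat) : Set where
    constructor kmat
    field
      Ka : K (Mat.a A)
      Kb : K (Mat.b A)
      Kc : K (Mat.c A)
      Kd : K (Mat.d A)

  KMat-· : ∀ {A B} → KMat A → KMat B → KMat (A ·M B)
  KMat-· {mat _ _ _ _} {mat _ _ _ _} (kmat a b c d) (kmat a′ b′ c′ d′) =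
    kmat (K-+ (K-* a a′) (K-* b c′)) (K-+ (K-* a b′) (K-* b d′)) (K-+ (K-* c a′) (K-* d c′)) (K-+ (K-* c b′) (K-* d d′))

  KMat-adj : ∀ {A} → KMat A → KMat (adj A)
  KMat-adj {mat _ _ _ _} (kmat a b c d) = kmat d (K-neg b) (K-neg c) a

  KMat-frob^ : ∀ k {A} → KMat A → KMat (mapMat (frob^ k) A)
  KMat-frob^ k {mat _ _ _ _} (kmat a b c d) = kmat (K-frob^ k a) (K-frob^ k b) (K-frob^ k c) (K-frob^ k d)

  KMat-I : KMat I₂
  KMat-I = kmat K-1 K-0 K-0 K-1

  Rational : Mat → Set
  Rational A = ∃ λ B → KMat B × A ~ B

  Rational-~ : ∀ {A B} → A ~ B → Rational A → Rational B
  Rational-~ A~B (C , kC , A~C) = C , kC , ~-trans (~-sym A~B) A~C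

  -- The stabiliser of the subline K ∪ {∞}. As K is invariant under Frobenius, membership depends on
  -- the matrix alone.
  L : ΓL → Set
  L g = Rational (matrix (proj₁ g))

  L-resp : ∀ {g h} → g ≋ h → L g → L h
  L-resp (equiv m _) = Rational-~ m

  L-⊙ : ∀ {g h} → L g → L h → L (g ⊙ h)
  L-⊙ {⟨ A , j ⟩ , _} {⟨ B , k ⟩ , _} (A′ , kA , A~) (B′ , kB , B~) =
    A′ ·M mapMat (frob⁻ j) B′ , KMat-· kA (KMat-frob^ (j ℕ.* (n ∸ 1)) kB) , ~-cong A~ (mapMat-~ (j ℕ.* (n ∸ 1)) B~)

  adj-~ : ∀ {A B} → A ~ B → adj A ~ adj B
  adj-~ {mat a b c d} (scaled s s≢0 refl) = scaled s s≢0 (mat≡ refl (-‿distribʳ-* s b) (-‿distribʳ-* s c) refl)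

  L-inv : ∀ {g} → L g → L (⊙-inv g)
  L-inv {⟨ A , j ⟩ , _} (A′ , kA , A~) = mapMat (frob^ j) (adj A′) , KMat-frob^ j (KMat-adj kA) , mapMat-~ j (adj-~ A~)

  L-e : L ⊙-e
  L-e = I₂ , KMat-I , ~-refl

  ι : ∀ A → det A ≢ 0# → ΓL
  ι A detA = ⟨ A , 0 ⟩ , detA

  mapMat-1 : ∀ A → mapMat (frob^ 0) A ≡ A
  mapMat-1 = mapMat-id (λ _ → refl)

  -- On row vectors, W s t maps the subline K ∪ {∞} to (sK + t) ∪ {∞}.
  W : Carrier → Carrier → Mat
  W s t = mat s 0# t 1#

  det-W : ∀ {s t} → s ≢ 0# → det (W s t) ≢ 0#
  det-W {s} {t} s≢0 eq = s≢0 (trans (sym (trans (cong₂ _+_ (*-identityʳ s) (trans (cong -_ (zeroˡ t)) -0#≈0#)) (+-identityʳ s))) eq)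

  -- By Galois theory no x ↦ x^(p^k) other than the identity maps sK to itself when s is good.
  Good : Carrier → Set
  Good s = ∀ g → 1 ≤ g → 2 ℕ.* g ≤ n → g ∣ n → s ^ (q₀-1 ℕ.* (p ℕ.^ g ∸ 1)) ≢ 1#

  -- The condition that K and sK + t intersect, so that the two sublines share a point other than ∞.
  InSpan : Carrier → Carrier → Set
  InSpan s t = ∃₂ λ f f′ → K f × K f′ × t ≡ f + s * f′

  -- If the k-th Frobenius power fixes s^(q₀-1), so does the one with g = gcd(k,n). When n does not
  -- divide k, g is a proper divisor of n, so 2g ≤ n, and the resulting equation is one that `Good`
  -- forbids.
  good⇒trivial : ∀ {s} → s ≢ 0# → Good s → ∀ k → frob^ k (s ^ q₀-1) ≡ s ^ q₀-1 → ∀ x → frob^ k x ≡ x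
  good⇒trivial {s} s≢0 good k fix x with n ∣? k
  ... | yes (divides c refl) = frob^-multiple c x
  ... | no n∤k = ⊥-elim (good g 1≤g (2g≤n (gcd[m,n]∣n k n)) (gcd[m,n]∣n k n)
      (trans (sym (^-assocʳ s q₀-1 (p ℕ.^ g ∸ 1))) (x^pred g (^-nonzero q₀-1 s≢0) (frob^-gcd k fix))))
    where
    g = gcd k n
    instance _ = ℕ.>-nonZero 1≤n
    1≤g : 1 ≤ g
    1≤g with g in eq
    ... | zero = ⊥-elim (n∤0 (subst (_∣ n) eq (gcd[m,n]∣n k n)))
      where
      n∤0 : ¬ (0 ∣ n)
      n∤0 (divides c eq′) = ℕₚ.<⇒≢ 1≤n (sym (trans eq′ (ℕₚ.*-zeroʳ c)))
    ... | suc _ = s≤s z≤n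
    2g≤n : g ∣ n → 2 ℕ.* g ≤ n
    2g≤n (divides 0 eq) = ⊥-elim (ℕₚ.<⇒≢ 1≤n (sym eq))
    2g≤n (divides 1 eq) = ⊥-elim (n∤k (subst (_∣ k) (sym (trans eq (ℕₚ.+-identityʳ g))) (gcd[m,n]∣m k n)))
    2g≤n (divides (suc (suc c)) eq) = ℕₚ.≤-trans (ℕₚ.*-monoˡ-≤ g (s≤s (s≤s (z≤n {c})))) (ℕₚ.≤-reflexive (sym eq))

  module BaseLemma {s t} (2≤n : 2 ≤ n) (s≢0 : s ≢ 0#) (good : Good s) (t∉ : ¬ InSpan s t) where

    s∉K : ¬ K s
    s∉K ks = good 1 (s≤s z≤n) 2≤n (1∣ n) (trans (sym (^-assocʳ s q₀-1 _)) (trans (cong (_^ (p ℕ.^ 1 ∸ 1)) (K^ s≢0 ks)) (1^ (p ℕ.^ 1 ∸ 1))))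

    -- The hypothesis is W s t · A = B · φ(W s t) up to the scalar c, where φ is the inverse of x ↦ x^(p^j).
    module _ (j : ℕ) {a b c′ d x y z w c} (Ka : K a) (Kb : K b) (Kc′ : K c′) (Kd : K d)
             (Kx : K x) (Ky : K y) (Kz : K z) (Kw : K w) (detA : det (mat a b c′ d) ≢ 0#) (c≢0 : c ≢ 0#)
             (eqx : x * frob⁻ j s + y * frob⁻ j t ≡ c * (s * a)) (eqy : y ≡ c * (s * b))
             (eqz : z * frob⁻ j s + w * frob⁻ j t ≡ c * (t * a + c′)) (eqw : w ≡ c * (t * b + d)) where

      -- An element stabilising both sublines fixes their only common point ∞, the row (1 0).
      -- Algebraically, if b ≠ 0 then w/y = (t b + d)/(s b) lies in K, which would put t in K + sK.
      b≡0 : b ≡ 0#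
      b≡0 with b ≟ 0#
      ... | yes eq = eq
      ... | no b≢0 = ⊥-elim (t∉ (- (i * (y * d)) , i * (w * b) , K-neg (K-* Ki (K-* Ky Kd)) , K-* Ki (K-* Kw Kb) ,
          *-cancelˡ yb≢0 (begin
            (y * b) * t ≡⟨ solve 4 (λ y b t d → (y :* b) :* t := y :* (t :* b :+ d) :- y :* d) refl y b t d ⟩
            y * (t * b + d) - y * d ≡⟨ cong (λ o → o * (t * b + d) - y * d) eqy ⟩
            (c * (s * b)) * (t * b + d) - y * d ≡⟨ cong (_- y * d) (solve 4 (λ c s b e → (c :* (s :* b)) :* e := (c :* e) :* (s :* b)) refl c s b (t * b + d)) ⟩
            (c * (t * b + d)) * (s * b) - y * d ≡⟨ cong (λ o → o * (s * b) - y * d) eqw ⟨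
            w * (s * b) - y * d ≡⟨ solve 5 (λ w s b y d → w :* (s :* b) :- y :* d := (:- (y :* d)) :+ s :* (w :* b)) refl w s b y d ⟩
            - (y * d) + s * (w * b) ≡⟨ cong₂ (λ o o′ → - o + s * o′) (x*x⁻¹y (y * d) yb≢0) (x*x⁻¹y (w * b) yb≢0) ⟨
            - ((y * b) * (i * (y * d))) + s * ((y * b) * (i * (w * b)))
              ≡⟨ solve 4 (λ e k l s → (:- (e :* k)) :+ s :* (e :* l) := e :* ((:- k) :+ s :* l)) refl (y * b) (i * (y * d)) (i * (w * b)) s ⟩
            (y * b) * (- (i * (y * d)) + s * (i * (w * b))) ∎)))
        where
        open ≡-Reasoning
        y≢0 : y ≢ 0#
        y≢0 eq = *-nonzero c≢0 (*-nonzero s≢0 b≢0) (trans (sym eqy) eq)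
        yb≢0 = *-nonzero y≢0 b≢0
        i = (y * b) ⁻¹
        Ki = K-⁻¹ yb≢0 (K-* Ky Kb)

      y≡0 : y ≡ 0#
      y≡0 = trans eqy (trans (cong (λ o → c * (s * o)) b≡0) (trans (cong (c *_) (zeroʳ s)) (zeroʳ c)))

      diagonal≢0 : a ≢ 0# × d ≢ 0#
      diagonal≢0 = det-lower (subst (λ o → det (mat a o c′ d) ≢ 0#) b≡0 detA)
      a≢0 = proj₁ diagonal≢0
      d≢0 = proj₂ diagonal≢0

      w≡cd : w ≡ c * d
      w≡cd = trans eqw (cong (c *_) (trans (cong (λ o → t * o + d) b≡0) (trans (cong (_+ d) (zeroʳ t)) (+-identityˡ d))))

      Kc : K c
      Kc = K-cancelˡ d≢0 Kd (subst K (trans w≡cd (*-comm c d)) Kw)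

      xs′ : x * frob⁻ j s ≡ s * (c * a)
      xs′ = trans (sym (trans (cong (λ o → x * frob⁻ j s + o * frob⁻ j t) y≡0) (x+0y _ _))) (trans eqx (solve 3 (λ c s a → c :* (s :* a) := s :* (c :* a)) refl c s a))

      x≢0 : x ≢ 0#
      x≢0 = nonzeroˡ (λ eq → *-nonzero s≢0 (*-nonzero c≢0 a≢0) (trans (sym xs′) eq))

      -- By `xs′` the automorphism changes `s` by a factor in K*, and the power with exponent q₀ - 1
      -- removes such factors.
      u-fixed : frob^ j (s ^ q₀-1) ≡ s ^ q₀-1
      u-fixed = sym (begin
        s ^ q₀-1 ≡⟨ frob-frob⁻ j (s ^ q₀-1) ⟨
        frob^ j (frob⁻ j (s ^ q₀-1)) ≡⟨ cong (frob^ j) (frob^-^ (j ℕ.* (n ∸ 1)) s q₀-1) ⟩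
        frob^ j (frob⁻ j s ^ q₀-1) ≡⟨ cong (frob^ j) eq ⟩
        frob^ j (s ^ q₀-1) ∎)
        where
        open ≡-Reasoning
        eq : frob⁻ j s ^ q₀-1 ≡ s ^ q₀-1
        eq = begin
          frob⁻ j s ^ q₀-1 ≡⟨ *-identityˡ _ ⟨
          1# * frob⁻ j s ^ q₀-1 ≡⟨ cong (_* frob⁻ j s ^ q₀-1) (K^ x≢0 Kx) ⟨
          x ^ q₀-1 * frob⁻ j s ^ q₀-1 ≡⟨ ^-distrib-* x _ q₀-1 ⟨
          (x * frob⁻ j s) ^ q₀-1 ≡⟨ cong (_^ q₀-1) xs′ ⟩
          (s * (c * a)) ^ q₀-1 ≡⟨ ^-distrib-* s (c * a) q₀-1 ⟩
          s ^ q₀-1 * (c * a) ^ q₀-1 ≡⟨ cong (s ^ q₀-1 *_) (K^ (*-nonzero c≢0 a≢0) (K-* Kc Ka)) ⟩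
          s ^ q₀-1 * 1# ≡⟨ *-identityʳ _ ⟩
          s ^ q₀-1 ∎

      frob^-trivial : ∀ v → frob^ j v ≡ v
      frob^-trivial = good⇒trivial s≢0 good j u-fixed

      frob⁻-trivial : ∀ v → frob⁻ j v ≡ v
      frob⁻-trivial v = trans (cong (frob⁻ j) (sym (frob^-trivial v))) (frob⁻-frob j v)

      zs : z * s + (c * d) * t ≡ c * (t * a + c′)
      zs = trans (cong₂ _+_ (cong (z *_) (sym (frob⁻-trivial s))) (cong₂ _*_ (sym w≡cd) (sym (frob⁻-trivial t)))) eqz

      -- With the automorphism trivial, `zs` is linear in `t` with leading coefficient c(a - d); if
      -- this is nonzero, solving for `t` puts it in K + sK.
      a≡d : a ≡ d
      a≡d with (a - d) ≟ 0#
      ... | yes eq = x-y≡0⇒x≡y eq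
      ... | no a-d≢0 = ⊥-elim (t∉ (- (i * (c * c′)) , i * z , K-neg (K-* Ki (K-* Kc Kc′)) , K-* Ki Kz ,
          *-cancelˡ e≢0 (begin
            (c * (a - d)) * t ≡⟨ solve 5 (λ c a d t f → (c :* (a :- d)) :* t := c :* (t :* a :+ f) :- c :* f :- (c :* d) :* t) refl c a d t c′ ⟩
            c * (t * a + c′) - c * c′ - (c * d) * t ≡⟨ cong (λ o → o - c * c′ - (c * d) * t) zs ⟨
            (z * s + (c * d) * t) - c * c′ - (c * d) * t ≡⟨ solve 4 (λ z s e f → (z :* s :+ e) :- f :- e := (:- f) :+ s :* z) refl z s ((c * d) * t) (c * c′) ⟩
            - (c * c′) + s * z ≡⟨ cong₂ (λ o o′ → - o + s * o′) (x*x⁻¹y (c * c′) e≢0) (x*x⁻¹y z e≢0) ⟨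
            - ((c * (a - d)) * (i * (c * c′))) + s * ((c * (a - d)) * (i * z))
              ≡⟨ solve 4 (λ e k l s → (:- (e :* k)) :+ s :* (e :* l) := e :* ((:- k) :+ s :* l)) refl (c * (a - d)) (i * (c * c′)) (i * z) s ⟩
            (c * (a - d)) * (- (i * (c * c′)) + s * (i * z)) ∎)))
        where
        open ≡-Reasoning
        e≢0 = *-nonzero c≢0 a-d≢0
        i = (c * (a - d)) ⁻¹
        Ki = K-⁻¹ e≢0 (K-* Kc (K-+ Ka (K-neg Kd)))

      zs≡cc′ : z * s ≡ c * c′
      zs≡cc′ = +-cancelʳ ((c * d) * t) _ _ (trans zs (trans (cong (λ o → c * (t * o + c′)) a≡d) (solve 4 (λ c t d f → c :* (t :* d :+ f) := c :* f :+ (c :* d) :* t) refl c t d c′)))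

      c′≡0 : c′ ≡ 0#
      c′≡0 with z ≟ 0#
      ... | yes refl = zero-product (trans (sym zs≡cc′) (zeroˡ s)) c≢0
      ... | no z≢0 = ⊥-elim (s∉K (K-cancelˡ z≢0 Kz (subst K (sym zs≡cc′) (K-* Kc Kc′))))

      scalar : mat a b c′ d ~ I₂
      scalar = ~-sym (scaled a a≢0 (mat≡ (sym (*-identityʳ a)) (trans b≡0 (sym (zeroʳ a))) (trans c′≡0 (sym (zeroʳ a))) (trans (sym a≡d) (sym (*-identityʳ a)))))

    frob⁻-W : ∀ j → mapMat (frob⁻ j) (W s t) ≡ mat (frob⁻ j s) 0# (frob⁻ j t) 1#
    frob⁻-W j = mat≡ refl (frob^-0 (j ℕ.* (n ∸ 1))) refl (frob^-1 (j ℕ.* (n ∸ 1)))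

    -- Both `g` and `l` carry the same field automorphism. Hence the triviality derived from the
    -- entries of `l` also shows that `g` is linear.
    base : ∀ {g l} → L g → L l → ι (W s t) (det-W s≢0) ⊙ g ≋ l ⊙ ι (W s t) (det-W s≢0) → g ≋ ⊙-e
    base {⟨ A₀ , k ⟩ , detA₀} {⟨ B₀ , j ⟩ , _} (A@(mat a b c′ d) , kmat Ka Kb Kc′ Kd , A₀~A) (B@(mat x y z w) , kmat Kx Ky Kz Kw , B₀~B) (equiv mat~ aut≗) =
      finish (~-trans (~-cong ~-refl (~-sym A₀~A)) (~-trans (≡⇒~ (cong (W s t ·M_) (sym (mapMat-1 A₀)))) (~-trans mat~ (~-cong B₀~B (≡⇒~ (frob⁻-W j))))))
      where
      finish : W s t ·M A ~ B ·M mat (frob⁻ j s) 0# (frob⁻ j t) 1# → (⟨ A₀ , k ⟩ , detA₀) ≋ ⊙-e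
      finish (scaled c c≢0 eq) = equiv (~-trans A₀~A (scalar j Ka Kb Kc′ Kd Kx Ky Kz Kw (~-det A₀~A detA₀) c≢0 eqx eqy eqz eqw))
        (λ v → trans (aut≗ v) (trans (frob^-∘ j 0 v) (frob^-trivial j Ka Kb Kc′ Kd Kx Ky Kz Kw (~-det A₀~A detA₀) c≢0 eqx eqy eqz eqw v)))
        where
        eqx : x * frob⁻ j s + y * frob⁻ j t ≡ c * (s * a)
        eqx = trans (mat-a eq) (cong (c *_) (x+0y (s * a) c′))
        eqy : y ≡ c * (s * b)
        eqy = trans (sym (x0+y1 x y)) (trans (mat-b eq) (cong (c *_) (x+0y (s * b) d)))
        eqz : z * frob⁻ j s + w * frob⁻ j t ≡ c * (t * a + c′)
        eqz = trans (mat-c eq) (cong (λ o → c * (t * a + o)) (*-identityˡ c′))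
        eqw : w ≡ c * (t * b + d)
        eqw = trans (sym (x0+y1 z w)) (trans (mat-d eq) (cong (λ o → c * (t * b + o)) (*-identityˡ d)))

-- Base pairs and double cosets in an abstract group

module BasePairs (𝔾 : Group 0ℓ 0ℓ) (L : Group.Carrier 𝔾 → Set)
    (L-∙ : ∀ {x y} → L x → L y → L (Group._∙_ 𝔾 x y)) (L-⁻¹ : ∀ {x} → L x → L (Group._⁻¹ 𝔾 x))
    (L-resp : ∀ {x y} → Group._≈_ 𝔾 x y → L x → L y) where
  open Group 𝔾 hiding (refl; sym; trans)
  open Group 𝔾 using () renaming (refl to ≈-refl; sym to ≈-sym; trans to ≈-trans)
  open import Algebra.Properties.Group 𝔾
  open import Relation.Binary.Reasoning.Setoid setoid

  Stabilises : Carrier → Carrier → Set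
  Stabilises g x = ∃ λ l → L l × x ∙ g ≈ l ∙ x

  BasePair : Carrier → Carrier → Set
  BasePair x y = ∀ g → Stabilises g x → Stabilises g y → g ≈ ε

  -- L and its conjugate by `w` meet trivially, that is, the cosets L and L w form a base.
  Basic : Carrier → Set
  Basic w = ∀ {g l} → L g → L l → w ∙ g ≈ l ∙ w → g ≈ ε

  x⁻¹∙[x∙y] : ∀ x y → x ⁻¹ ∙ (x ∙ y) ≈ y
  x⁻¹∙[x∙y] x y = ≈-trans (≈-sym (assoc (x ⁻¹) x y)) (≈-trans (∙-congʳ (inverseˡ x)) (identityˡ y))

  -- Being a base depends only on the double coset of the element leading from x to y: factors from
  -- L on either side conjugate the stabilisers within L.
  basic⇒basePair : ∀ {w} → Basic w → ∀ {d d′} → L d → L d′ → ∀ {x y} → y ≈ d ∙ (w ∙ (d′ ∙ x)) → BasePair x y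
  basic⇒basePair {w} basic {d} {d′} Ld Ld′ {x} {y} y≈ g (l , Ll , xg) (l′ , Ll′ , yg) = begin
    g ≈⟨ x⁻¹∙[x∙y] z g ⟨
    z ⁻¹ ∙ (z ∙ g) ≈⟨ ∙-congˡ zg ⟩
    z ⁻¹ ∙ (g′ ∙ z) ≈⟨ ∙-congˡ (∙-congʳ (basic Lg′ (L-∙ (L-∙ (L-⁻¹ Ld) Ll′) Ld) wg′)) ⟩
    z ⁻¹ ∙ (ε ∙ z) ≈⟨ ∙-congˡ (identityˡ z) ⟩
    z ⁻¹ ∙ z ≈⟨ inverseˡ z ⟩
    ε ∎
    where
    z = d′ ∙ x
    g′ = (d′ ∙ l) ∙ d′ ⁻¹
    Lg′ = L-∙ (L-∙ Ld′ Ll) (L-⁻¹ Ld′)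
    zg : z ∙ g ≈ g′ ∙ z
    zg = begin
      (d′ ∙ x) ∙ g ≈⟨ assoc d′ x g ⟩
      d′ ∙ (x ∙ g) ≈⟨ ∙-congˡ xg ⟩
      d′ ∙ (l ∙ x) ≈⟨ assoc d′ l x ⟨
      (d′ ∙ l) ∙ x ≈⟨ ∙-congˡ (x⁻¹∙[x∙y] d′ x) ⟨
      (d′ ∙ l) ∙ (d′ ⁻¹ ∙ (d′ ∙ x)) ≈⟨ assoc (d′ ∙ l) (d′ ⁻¹) z ⟨
      g′ ∙ z ∎
    wg′ : w ∙ g′ ≈ ((d ⁻¹ ∙ l′) ∙ d) ∙ w
    wg′ = ∙-cancelʳ z _ _ (begin
      (w ∙ g′) ∙ z ≈⟨ assoc w g′ z ⟩
      w ∙ (g′ ∙ z) ≈⟨ ∙-congˡ zg ⟨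
      w ∙ (z ∙ g) ≈⟨ assoc w z g ⟨
      (w ∙ z) ∙ g ≈⟨ x⁻¹∙[x∙y] d ((w ∙ z) ∙ g) ⟨
      d ⁻¹ ∙ (d ∙ ((w ∙ z) ∙ g)) ≈⟨ ∙-congˡ (assoc d (w ∙ z) g) ⟨
      d ⁻¹ ∙ ((d ∙ (w ∙ z)) ∙ g) ≈⟨ ∙-congˡ (∙-congʳ y≈) ⟨
      d ⁻¹ ∙ (y ∙ g) ≈⟨ ∙-congˡ yg ⟩
      d ⁻¹ ∙ (l′ ∙ y) ≈⟨ ∙-congˡ (∙-congˡ y≈) ⟩
      d ⁻¹ ∙ (l′ ∙ (d ∙ (w ∙ z))) ≈⟨ assoc (d ⁻¹) l′ (d ∙ (w ∙ z)) ⟨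
      (d ⁻¹ ∙ l′) ∙ (d ∙ (w ∙ z)) ≈⟨ assoc (d ⁻¹ ∙ l′) d (w ∙ z) ⟨
      ((d ⁻¹ ∙ l′) ∙ d) ∙ (w ∙ z) ≈⟨ assoc ((d ⁻¹ ∙ l′) ∙ d) w z ⟨
      (((d ⁻¹ ∙ l′) ∙ d) ∙ w) ∙ z ∎)

  L-ε : ∀ {x} → L x → L ε
  L-ε {x} Lx = L-resp (inverseʳ x) (L-∙ Lx (L-⁻¹ Lx))

  -- A factorisation of `y` in L w′ L w L exhibits a path of length two from the coset of x to that
  -- of y x, with the coset of w d x in the middle.
  common-neighbour : ∀ {w w′ d e j y} → Basic w → Basic w′ → L d → L e → L j →
    y ≈ e ∙ (w′ ∙ (j ∙ (w ∙ d))) → ∀ x → BasePair x ((w ∙ d) ∙ x) × BasePair ((w ∙ d) ∙ x) (y ∙ x)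
  common-neighbour {w} {w′} {d} {e} {j} {y} basic basic′ Ld Le Lj y≈ x =
    basic⇒basePair basic (L-ε Ld) Ld (≈-trans (assoc w d x) (≈-sym (identityˡ _))) ,
    basic⇒basePair basic′ Le Lj (begin
      y ∙ x ≈⟨ ∙-congʳ y≈ ⟩
      (e ∙ (w′ ∙ (j ∙ (w ∙ d)))) ∙ x ≈⟨ assoc e _ x ⟩
      e ∙ ((w′ ∙ (j ∙ (w ∙ d))) ∙ x) ≈⟨ ∙-congˡ (assoc w′ _ x) ⟩
      e ∙ (w′ ∙ ((j ∙ (w ∙ d)) ∙ x)) ≈⟨ ∙-congˡ (∙-congˡ (assoc j _ x)) ⟩
      e ∙ (w′ ∙ (j ∙ ((w ∙ d) ∙ x))) ∎)

-- Normal forms for a pair of sublines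

module NormalForms (F : FiniteField) (p n : ℕ) (pp : Prime p) (order≡ : order F ≡ p ℕ.^ n) (1≤n : 1 ≤ n) (m : ℕ) where
  open FiniteField F hiding (order)
  open FieldFacts F
  open PΓL F p n hiding (_≈_; e)
  open Matrices F p n
  open Unipotents F p n
  open Subfield F p n pp order≡ 1≤n m

  -- Either the point with coordinates x and y lies on K ∪ {∞}, or both coordinates vanish.
  RationalPair : Carrier → Carrier → Set
  RationalPair x y = ∃ λ k → k ≢ 0# × K (k * x) × K (k * y)

  rationalPair? : ∀ x y → Dec (RationalPair x y)
  rationalPair? x y with y ≟ 0#
  rationalPair? x y | yes refl with x ≟ 0#
  ... | yes refl = yes (1# , 1≢0 , subst K (sym (zeroʳ 1#)) K-0 , subst K (sym (zeroʳ 1#)) K-0)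
  ... | no x≢0 = yes (x ⁻¹ , ⁻¹-nonzero x≢0 , subst K (sym (inverseˡ x≢0)) K-1 , subst K (sym (zeroʳ _)) K-0)
  rationalPair? x y | no y≢0 with K? ((y ⁻¹) * x)
  ... | yes k = yes (y ⁻¹ , ⁻¹-nonzero y≢0 , k , subst K (sym (inverseˡ y≢0)) K-1)
  ... | no ¬k = no (λ (k , k≢0 , kx , ky) → ¬k (K-cancelˡ (*-nonzero k≢0 y≢0) ky
      (subst K (trans (cong (k *_) (sym (x*x⁻¹y x y≢0))) (sym (*-assoc k y _))) kx)))

  J : Mat
  J = mat 0# 1# (- 1#) 0#

  det-J : det J ≡ 1#
  det-J = trans (cong₂ _+_ (zeroˡ 0#) (trans (cong -_ (*-identityˡ _)) (-‿involutive 1#))) (+-identityˡ 1#)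

  KMat-J : KMat J
  KMat-J = kmat K-0 K-1 (K-neg K-1) K-0

  KMat-u1 : KMat (u 1#)
  KMat-u1 = kmat K-1 K-1 K-0 K-1

  -- Cramer's rule: h carries the rows (a , b) and (c , d) into K² because it does so with their sum.
  rows-rational : ∀ {a b c d} → det (mat a b c d) ≢ 0# → RationalPair a b → RationalPair c d → RationalPair (a + c) (b + d) → Rational (mat a b c d)
  rows-rational {a} {b} {c} {d} det≢0 (k , k≢0 , ka , kb) (l , l≢0 , lc , ld) (h , h≢0 , hac , hbd) =
    scale h (mat a b c d) , kmat (first a ka) (first b kb) (second c lc) (second d ld) , scale~ h≢0
    where
    Δ = (k * a) * (l * d) - (k * b) * (l * c)
    X = (h * (a + c)) * (l * d) - (h * (b + d)) * (l * c)
    Y = (k * a) * (h * (b + d)) - (k * b) * (h * (a + c))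
    Δ≢0 : Δ ≢ 0#
    Δ≢0 eq = *-nonzero (*-nonzero k≢0 l≢0) det≢0
      (trans (solve 6 (λ k l a b c d → (k :* l) :* (a :* d :+ :- (b :* c)) := (k :* a) :* (l :* d) :- (k :* b) :* (l :* c)) refl k l a b c d) eq)
    KΔ : K Δ
    KΔ = K-+ (K-* ka ld) (K-neg (K-* kb lc))
    KX : K X
    KX = K-+ (K-* hac ld) (K-neg (K-* hbd lc))
    KY : K Y
    KY = K-+ (K-* ka hbd) (K-neg (K-* kb hac))
    first : ∀ x → K (k * x) → K (h * x)
    first x kx = K-cancelˡ Δ≢0 KΔ (subst K (solve 8 (λ h k l a b c d x →
      ((h :* (a :+ c)) :* (l :* d) :- (h :* (b :+ d)) :* (l :* c)) :* (k :* x)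
      := ((k :* a) :* (l :* d) :- (k :* b) :* (l :* c)) :* (h :* x)) refl h k l a b c d x) (K-* KX kx))
    second : ∀ x → K (l * x) → K (h * x)
    second x lx = K-cancelˡ Δ≢0 KΔ (subst K (solve 8 (λ h k l a b c d x →
      ((k :* a) :* (h :* (b :+ d)) :- (k :* b) :* (h :* (a :+ c))) :* (l :* x)
      := ((k :* a) :* (l :* d) :- (k :* b) :* (l :* c)) :* (h :* x)) refl h k l a b c d x) (K-* KY lx))

  columns-rational : ∀ {a b c d} → det (mat a b c d) ≢ 0# → RationalPair a c → RationalPair b d → RationalPair (a + b) (c + d) → Rational (mat a b c d)
  columns-rational {a} {b} {c} {d} det≢0 r₁ r₂ r₃ = transpose (rows-rational (λ eq → det≢0 (trans (cong (λ o → a * d - o) (*-comm b c)) eq)) r₁ r₂ r₃)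
    where
    transpose : Rational (mat a c b d) → Rational (mat a b c d)
    transpose (mat a′ c′ b′ d′ , kmat ka kc kb kd , scaled s s≢0 eq) =
      mat a′ b′ c′ d′ , kmat ka kb kc kd , scaled s s≢0 (mat≡ (mat-a eq) (mat-c eq) (mat-b eq) (mat-d eq))

  J· : ∀ a b c d → J ·M mat a b c d ≡ mat c d (- a) (- b)
  J· a b c d = mat≡ (0x+1y a c) (0x+1y b d) (neg a c) (neg b d)
    where
    neg : ∀ x y → (- 1#) * x + 0# * y ≡ - x
    neg x y = trans (x+0y _ y) (trans (sym (-‿distribˡ-* 1# x)) (cong -_ (*-identityˡ x)))

  ·J : ∀ a b c d → mat a b c d ·M J ≡ mat (- b) a (- d) c
  ·J a b c d = mat≡ (neg a b) (x1+y0 a b) (neg c d) (x1+y0 c d)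
    where
    neg : ∀ x y → x * 0# + y * (- 1#) ≡ - y
    neg x y = trans (x0+y x _) (trans (sym (-‿distribʳ-* y 1#)) (cong -_ (*-identityʳ y)))

  FirstRowIrrational : Mat → Set
  FirstRowIrrational A = ¬ RationalPair (Mat.a A) (Mat.b A)

  LastColumnIrrational : Mat → Set
  LastColumnIrrational A = ¬ RationalPair (Mat.b A) (Mat.d A)

  -- Determinant 1, and not mere rationality, is demanded so that multiplication by `D` does not
  -- change whether a determinant is a square.
  record KUnimodular (D : Mat) : Set where
    constructor kuni
    field
      entries : KMat D
      det≡1 : det D ≡ 1#

  KU-I : KUnimodular I₂
  KU-I = kuni KMat-I det-I
  KU-J = kuni KMat-J det-J
  KU-u = kuni KMat-u1 (det-u 1#)

  -- A projectivity that maps the points (1 0), (0 1) and (1 1) into K ∪ {∞} is rational. So an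
  -- irrational one moves some of them off the subline, and `D` brings such a point to the first
  -- place.
  row-step : ∀ A → det A ≢ 0# → ¬ Rational A → ∃ λ D → KUnimodular D × FirstRowIrrational (D ·M A)
  row-step (mat a b c d) detA irr with rationalPair? a b | rationalPair? c d | rationalPair? (a + c) (b + d)
  ... | no ¬r | _ | _ = I₂ , KU-I , subst FirstRowIrrational (sym (·M-identityˡ (mat a b c d))) ¬r
  ... | yes _ | no ¬r | _ = J , KU-J , subst FirstRowIrrational (sym (J· a b c d)) ¬r
  ... | yes _ | yes _ | no ¬r = u 1# , KU-u , subst FirstRowIrrational (sym (u· 1# a b c d))
      (subst₂′ (cong (_+_ a) (sym (*-identityˡ c))) (cong (_+_ b) (sym (*-identityˡ d))) ¬r)
    where
    subst₂′ : ∀ {x y x′ y′} → x ≡ x′ → y ≡ y′ → ¬ RationalPair x y → ¬ RationalPair x′ y′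
    subst₂′ refl refl r = r
  ... | yes r₁ | yes r₂ | yes r₃ = ⊥-elim (irr (rows-rational detA r₁ r₂ r₃))

  -- The last column is orthogonal to the point that `A` maps to ∞, so its irrationality says that ∞
  -- is not on the image subline. The operations have entries in K and act on the right; they
  -- preserve the irrationality of the first row already achieved.
  column-step : ∀ A → det A ≢ 0# → ¬ Rational A → FirstRowIrrational A →
    ∃ λ D → KUnimodular D × FirstRowIrrational (A ·M D) × LastColumnIrrational (A ·M D)
  column-step (mat a b c d) detA irr row with rationalPair? b d | rationalPair? a c | rationalPair? (a + b) (c + d)
  ... | no ¬r | _ | _ = I₂ , KU-I , subst FirstRowIrrational (sym (·M-identityʳ (mat a b c d))) row ,
      subst LastColumnIrrational (sym (·M-identityʳ (mat a b c d))) ¬r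
  ... | yes _ | no ¬r | _ = J , KU-J , subst FirstRowIrrational (sym (·J a b c d)) row′ , subst LastColumnIrrational (sym (·J a b c d)) ¬r
    where
    row′ : ¬ RationalPair (- b) a
    row′ (k , k≢0 , kb , ka) = row (k , k≢0 , ka , subst K (trans (cong -_ (sym (-‿distribʳ-* k b))) (-‿involutive _)) (K-neg kb))
  ... | yes _ | yes _ | no ¬r = u 1# , KU-u , subst FirstRowIrrational (sym (·u 1# a b c d)) row′ ,
      subst LastColumnIrrational (sym (·u 1# a b c d)) (subst₂′ (cong (_+ b) (sym (*-identityʳ a))) (cong (_+ d) (sym (*-identityʳ c))) ¬r)
    where
    subst₂′ : ∀ {x y x′ y′} → x ≡ x′ → y ≡ y′ → ¬ RationalPair x y → ¬ RationalPair x′ y′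
    subst₂′ refl refl r = r
    row′ : ¬ RationalPair a (a * 1# + b)
    row′ (k , k≢0 , ka , kab) = row (k , k≢0 , ka , subst K (solve 4 (λ k a b o → k :* (a :* o :+ b) :- k :* (a :* o) := k :* b) refl k a b 1#)
      (K-+ kab (K-neg (subst K (cong (k *_) (sym (*-identityʳ a))) ka))))
  ... | yes r₂ | yes r₁ | yes r₃ = ⊥-elim (irr (columns-rational detA r₁ r₂ r₃))

  -- The projectivity of determinant δ that maps ∞ to a and -d to ∞.
  N : Carrier → Carrier → Carrier → Mat
  N a d δ = mat a 1# (a * d - δ) d

  record NormalForm (A : Mat) : Set where
    field
      {D D′} : Mat
      KU-D : KUnimodular D
      KU-D′ : KUnimodular D′
      {a d δ} : Carrier
      a∉K : ¬ K a
      d∉K : ¬ K d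
      δ≢0 : δ ≢ 0#
      equivalent : (D ·M A) ·M D′ ~ N a d δ

  detKU·≢0 : ∀ {D A} → KUnimodular D → det A ≢ 0# → det (D ·M A) ≢ 0#
  detKU·≢0 {D} {A} (kuni _ det1) detA eq = detA (trans (sym (*-identityˡ _)) (trans (cong (_* det A) (sym det1)) (trans (sym (det-· D A)) eq)))

  det·KU≢0 : ∀ {D A} → KUnimodular D → det A ≢ 0# → det (A ·M D) ≢ 0#
  det·KU≢0 {D} {A} (kuni _ det1) detA eq = detA (trans (sym (*-identityʳ _)) (trans (cong (det A *_) (sym det1)) (trans (sym (det-· A D)) eq)))

  KU-adj : ∀ {D} → KUnimodular D → KUnimodular (adj D)
  KU-adj {D} (kuni k d) = kuni (KMat-adj k) (trans (det-adj D) d)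

  adj-KU : ∀ {D} → KUnimodular D → adj D ·M D ≡ I₂
  adj-KU {D} (kuni _ d) = trans (adj-·M D) (trans (cong (λ s → scale s I₂) d) (scale-1 I₂))

  KU-· : ∀ {A B} → KUnimodular A → KUnimodular B → KUnimodular (A ·M B)
  KU-· {A} {B} (kuni k d) (kuni k′ d′) = kuni (KMat-· k k′) (trans (det-· A B) (trans (cong₂ _*_ d d′) (*-identityˡ 1#)))

  KU-adjʳ : ∀ {D} → KUnimodular D → D ·M adj D ≡ I₂
  KU-adjʳ {D} (kuni _ d) = trans (·M-adj D) (trans (cong (λ s → scale s I₂) d) (scale-1 I₂))

  Rational-KU· : ∀ {D A} → KUnimodular D → Rational (D ·M A) → Rational A
  Rational-KU· {D} {A} ku (B , kB , DA~B) = adj D ·M B , KMat-· (KMat-adj (KUnimodular.entries ku)) kB ,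
    ~-trans (≡⇒~ (sym (trans (sym (·M-assoc (adj D) D A)) (trans (cong (_·M A) (adj-KU ku)) (·M-identityˡ A))))) (~-cong ~-refl DA~B)

  normal-entries : ∀ B → det B ≢ 0# → FirstRowIrrational B → LastColumnIrrational B →
    ∃₂ λ a d → ∃ λ δ → ¬ K a × ¬ K d × δ ≢ 0# × B ~ N a d δ
  normal-entries (mat a b c d) detB row col = i * a , i * d , δ , (λ k → row (i , i≢0 , k , Kib)) , (λ k → col (i , i≢0 , Kib , k)) ,
      (λ eq → ~-det (scale~ i≢0) detB (trans detN eq)) ,
      scaled i i≢0 (mat≡ refl (sym (inverseˡ b≢0)) (solve 3 (λ x y z → x :- (x :- y :* z) := y :* z) refl ((i * a) * (i * d)) i c) refl)
    where
    b≢0 : b ≢ 0#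
    b≢0 refl with a ≟ 0#
    ... | yes refl = row (1# , 1≢0 , subst K (sym (zeroʳ 1#)) K-0 , subst K (sym (zeroʳ 1#)) K-0)
    ... | no a≢0 = row (a ⁻¹ , ⁻¹-nonzero a≢0 , subst K (sym (inverseˡ a≢0)) K-1 , subst K (sym (zeroʳ _)) K-0)
    i = b ⁻¹
    i≢0 = ⁻¹-nonzero b≢0
    Kib : K (i * b)
    Kib = subst K (sym (inverseˡ b≢0)) K-1
    δ = (i * a) * (i * d) - i * c
    detN : det (scale i (mat a b c d)) ≡ δ
    detN = cong (λ o → (i * a) * (i * d) - o) (trans (cong (_* (i * c)) (inverseˡ b≢0)) (*-identityˡ _))

  normal-form : ∀ A → det A ≢ 0# → ¬ Rational A → NormalForm A
  normal-form A detA irr =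
    let D , kuD , row = row-step A detA irr
        irr′ : ¬ Rational (D ·M A)
        irr′ r = irr (Rational-KU· kuD r)
        D′ , kuD′ , row′ , col′ = column-step (D ·M A) (detKU·≢0 kuD detA) irr′ row
        a , d , δ , a∉K , d∉K , δ≢0 , eq = normal-entries ((D ·M A) ·M D′) (det·KU≢0 kuD′ (detKU·≢0 kuD detA)) row′ col′
    in record { KU-D = kuD ; KU-D′ = kuD′ ; a∉K = a∉K ; d∉K = d∉K ; δ≢0 = δ≢0 ; equivalent = eq }

  -- The subline (sK + a) ∪ {∞} is then adjacent to both K ∪ {∞} and the image of K ∪ {∞} under N a d δ.
  record Middle (a d δ : Carrier) : Set where
    field
      s : Carrier
      s≢0 : s ≢ 0#
      good-s : ∀ g → 1 ≤ g → 2 ℕ.* g ≤ n → g ∣ n → (s ^ q₀-1) ^ (p ℕ.^ g ∸ 1) ≢ 1#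
      good-δ/s : ∀ g → 1 ≤ g → 2 ℕ.* g ≤ n → g ∣ n → (s ^ q₀-1) ^ (p ℕ.^ g ∸ 1) ≢ (δ ^ q₀-1) ^ (p ℕ.^ g ∸ 1)
      avoid-a : ∀ {f} → K f → (a - f) ^ q₀-1 ≢ s ^ q₀-1
      avoid-d : ∀ {f} → K f → (d - f) ^ q₀-1 * s ^ q₀-1 ≢ δ ^ q₀-1

  module Sublines {a d δ} (a∉K : ¬ K a) (d∉K : ¬ K d) (δ≢0 : δ ≢ 0#) (M : Middle a d δ) where
    open Middle M

    good : Good s
    good g 1≤g 2g≤n g∣n eq = good-s g 1≤g 2g≤n g∣n (trans (^-assocʳ s q₀-1 _) eq)

    a∉span : ¬ InSpan s a
    a∉span (f , f′ , Kf , Kf′ , a≡) = avoid-a Kf (begin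
        (a - f) ^ q₀-1 ≡⟨ cong (_^ q₀-1) (trans (cong (_- f) a≡) (solve 2 (λ f e → (f :+ e) :- f := e) refl f (s * f′))) ⟩
        (s * f′) ^ q₀-1 ≡⟨ ^-distrib-* s f′ q₀-1 ⟩
        s ^ q₀-1 * f′ ^ q₀-1 ≡⟨ cong (s ^ q₀-1 *_) (K^ f′≢0 Kf′) ⟩
        s ^ q₀-1 * 1# ≡⟨ *-identityʳ _ ⟩
        s ^ q₀-1 ∎)
      where
      open ≡-Reasoning
      f′≢0 : f′ ≢ 0#
      f′≢0 refl = a∉K (subst K (sym (trans a≡ (x+y0 f s))) Kf)

    -- Forced by the factorisation `N~` of the normal form through the middle subline: its bottom
    -- left entry requires s = -δ s′.
    s′ : Carrier
    s′ = - ((δ ⁻¹) * s)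

    s′≢0 : s′ ≢ 0#
    s′≢0 = neg-nonzero (*-nonzero (⁻¹-nonzero δ≢0) s≢0)

    δs′ : (- 1#) * (δ * s′) ≡ s
    δs′ = trans (solve 4 (λ o d i s → (:- o) :* (d :* (:- (i :* s))) := o :* (d :* (i :* s))) refl 1# δ (δ ⁻¹) s) (trans (*-identityˡ _) (x*x⁻¹y s δ≢0))

    s^≡ : s ^ q₀-1 ≡ δ ^ q₀-1 * s′ ^ q₀-1
    s^≡ = begin
      s ^ q₀-1 ≡⟨ cong (_^ q₀-1) δs′ ⟨
      ((- 1#) * (δ * s′)) ^ q₀-1 ≡⟨ ^-distrib-* (- 1#) (δ * s′) q₀-1 ⟩
      (- 1#) ^ q₀-1 * (δ * s′) ^ q₀-1 ≡⟨ cong (_* (δ * s′) ^ q₀-1) (K^ (neg-nonzero 1≢0) (K-neg K-1)) ⟩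
      1# * (δ * s′) ^ q₀-1 ≡⟨ *-identityˡ _ ⟩
      (δ * s′) ^ q₀-1 ≡⟨ ^-distrib-* δ s′ q₀-1 ⟩
      δ ^ q₀-1 * s′ ^ q₀-1 ∎
      where open ≡-Reasoning

    good′ : Good s′
    good′ g 1≤g 2g≤n g∣n eq = good-δ/s g 1≤g 2g≤n g∣n (begin
      (s ^ q₀-1) ^ e ≡⟨ cong (_^ e) s^≡ ⟩
      (δ ^ q₀-1 * s′ ^ q₀-1) ^ e ≡⟨ ^-distrib-* (δ ^ q₀-1) (s′ ^ q₀-1) e ⟩
      (δ ^ q₀-1) ^ e * (s′ ^ q₀-1) ^ e ≡⟨ cong ((δ ^ q₀-1) ^ e *_) (trans (^-assocʳ s′ q₀-1 e) eq) ⟩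
      (δ ^ q₀-1) ^ e * 1# ≡⟨ *-identityʳ _ ⟩
      (δ ^ q₀-1) ^ e ∎)
      where
      open ≡-Reasoning
      e = p ℕ.^ g ∸ 1

    ds′∉span : ¬ InSpan s′ (d * s′)
    ds′∉span (f , f′ , Kf , Kf′ , eq) = avoid-d Kf′ (begin
        (d - f′) ^ q₀-1 * s ^ q₀-1 ≡⟨ cong ((d - f′) ^ q₀-1 *_) s^≡ ⟩
        (d - f′) ^ q₀-1 * (δ ^ q₀-1 * s′ ^ q₀-1) ≡⟨ solve 3 (λ x y z → x :* (y :* z) := y :* (x :* z)) refl ((d - f′) ^ q₀-1) (δ ^ q₀-1) (s′ ^ q₀-1) ⟩
        δ ^ q₀-1 * ((d - f′) ^ q₀-1 * s′ ^ q₀-1) ≡⟨ cong (δ ^ q₀-1 *_) (^-distrib-* (d - f′) s′ q₀-1) ⟨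
        δ ^ q₀-1 * ((d - f′) * s′) ^ q₀-1 ≡⟨ cong (λ o → δ ^ q₀-1 * o ^ q₀-1) f≡ ⟩
        δ ^ q₀-1 * f ^ q₀-1 ≡⟨ cong (δ ^ q₀-1 *_) (K^ f≢0 Kf) ⟩
        δ ^ q₀-1 * 1# ≡⟨ *-identityʳ _ ⟩
        δ ^ q₀-1 ∎)
      where
      open ≡-Reasoning
      f≡ : (d - f′) * s′ ≡ f
      f≡ = trans (solve 3 (λ d f s → (d :- f) :* s := d :* s :- s :* f) refl d f′ s′) (trans (cong (_- s′ * f′) eq) (solve 2 (λ f e → (f :+ e) :- e := f) refl f (s′ * f′)))
      f≢0 : f ≢ 0#
      f≢0 f≡0 = *-nonzero (λ d-f′≡0 → d∉K (subst K (sym (x-y≡0⇒x≡y d-f′≡0)) Kf′)) s′≢0 (trans f≡ f≡0)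

    N~ : N a d δ ~ W s′ (d * s′) ·M (mat 0# 1# 1# 0# ·M W s a)
    N~ = scaled s′ s′≢0 (trans (cong (W s′ (d * s′) ·M_) step) (mat≡
      (x+0y _ s) (x+0y _ 0#)
      (trans (cong₂ _+_ (solve 3 (λ d e a → (d :* e) :* a := e :* (a :* d)) refl d s′ a) (trans (*-identityˡ s) s≡))
        (sym (trans (distribˡ s′ (a * d) (- δ)) (cong (_+_ (s′ * (a * d))) refl))))
      (trans (cong₂ _+_ (*-identityʳ _) (zeroʳ 1#)) (trans (+-identityʳ _) (*-comm d s′)))))
      where
      step : mat 0# 1# 1# 0# ·M W s a ≡ mat a 1# s 0#
      step = mat≡ (0x+1y s a) (0x+1y 0# 1#) (1x+0y s a) (1x+0y 0# 1#)
      s≡ : s ≡ s′ * (- δ)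
      s≡ = trans (sym δs′) (trans (solve 3 (λ o d e → (:- o) :* (d :* e) := o :* (e :* (:- d))) refl 1# δ s′) (*-identityˡ _))

-- The exponents p^g - 1 are added over all g from 1 to h, whether or not g divides n; this
-- overestimates the degrees coming from `Good`.
frobSum : ℕ → ℕ → ℕ
frobSum p zero = 0
frobSum p (suc h) = frobSum p h ℕ.+ (p ℕ.^ suc h ∸ 1)

twice-+ : ∀ q e x → q ℕ.* x ℕ.+ (q ℕ.* x ℕ.+ q ℕ.* (2 ℕ.* e)) ≡ q ℕ.* (2 ℕ.* (e ℕ.+ x))
twice-+ = solve 3 (λ q e x → q :* x :+ (q :* x :+ q :* (con 2 :* e)) := q :* (con 2 :* (e :+ x))) refl
  where open +-*-Solver

twice-suc : ∀ q l → q ℕ.+ (q ℕ.+ q ℕ.* (2 ℕ.* l)) ≡ q ℕ.* (2 ℕ.* suc l)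
twice-suc = solve 2 (λ q l → q :+ (q :+ q :* (con 2 :* l)) := q :* (con 2 :* (con 1 :+ l))) refl
  where open +-*-Solver

-- Existence of common neighbours, by counting obstructions

module Neighbours (F : FiniteField) (p n : ℕ) (pp : Prime p) (order≡ : order F ≡ p ℕ.^ n) (1≤n : 1 ≤ n) (m : ℕ) where
  open FiniteField F hiding (order)
  open FieldFacts F
  open PΓL F p n hiding (_≈_)
  open Matrices F p n
  open SemilinearGroup F p n pp order≡ 1≤n
  open Unipotents F p n
  open Subfield F p n pp order≡ 1≤n m
  open NormalForms F p n pp order≡ 1≤n m
  open Group 𝔾 using () renaming (refl to ≋-refl; sym to ≋-sym; trans to ≋-trans; assoc to 𝔾-assoc; ∙-congˡ to 𝔾-congˡ)
  open BasePairs 𝔾 L (λ {x} {y} → L-⊙ {x} {y}) (λ {x} → L-inv {x}) (λ {x} {y} → L-resp {x} {y}) public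

  -- The extra row operation `D` leaves room for changing the base point before a middle subline is
  -- sought. The general case takes the identity; the field of order 64 uses a nontrivial one.
  record Reduction (a d δ : Carrier) : Set where
    field
      {D} : Mat
      KU-D : KUnimodular D
      {a′ d′ δ′} : Carrier
      a′∉K : ¬ K a′
      d′∉K : ¬ K d′
      δ′≢0 : δ′ ≢ 0#
      equivalent : D ·M N a d δ ~ N a′ d′ δ′
      middle : Middle a′ d′ δ′

  -- All conditions see `s` only through its power with exponent q₀ - 1, so a square of the same
  -- class may replace it. The square is needed for the determinant of `W s a`.
  Middle-square : ∀ {a d δ} (M : Middle a d δ) → ∀ {s} → s ≢ 0# → s ^ q₀-1 ≡ Middle.s M ^ q₀-1 → Middle a d δ
  Middle-square {a} {d} {δ} M {s′} s′≢0 eq = record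
    { s = s′ ; s≢0 = s′≢0
    ; good-s = λ g x y z e → good-s g x y z (trans (cong (_^ (p ℕ.^ g ∸ 1)) (sym eq)) e)
    ; good-δ/s = λ g x y z e → good-δ/s g x y z (trans (cong (_^ (p ℕ.^ g ∸ 1)) (sym eq)) e)
    ; avoid-a = λ kf e → avoid-a kf (trans e eq)
    ; avoid-d = λ {f} kf e → avoid-d kf (trans (cong ((d - f) ^ q₀-1 *_) (sym eq)) e) }
    where open Middle M

  ι-cong : ∀ {A B dA dB} → A ~ B → ι A dA ≋ ι B dB
  ι-cong A~B = equiv A~B (λ _ → refl)

  det-·≢0 : ∀ {A B} → det A ≢ 0# → det B ≢ 0# → det (A ·M B) ≢ 0#
  det-·≢0 {A} {B} dA dB eq = *-nonzero dA dB (trans (sym (det-· A B)) eq)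

  ι-⊙ : ∀ {A B} dA dB → ι A dA ⊙ ι B dB ≋ ι (A ·M B) (det-·≢0 {A} {B} dA dB)
  ι-⊙ {A} {B} dA dB = equiv (≡⇒~ (cong (A ·M_) (mapMat-1 B))) (λ _ → refl)

  KU⇒det≢0 : ∀ {D} → KUnimodular D → det D ≢ 0#
  KU⇒det≢0 (kuni _ d) eq = 1≢0 (trans (sym d) eq)

  L-ι : ∀ {A dA} → KMat A → L (ι A dA)
  L-ι kA = _ , kA , ~-refl

  φ : ℕ → ΓL
  φ k = ⟨ I₂ , k ⟩ , λ eq → 1≢0 (trans (sym det-I) eq)

  -- The field automorphism is pulled to the left, where it lies in L and is absorbed into the
  -- outermost factor; the rest of the argument is about matrices.
  φ-ι : ∀ A k dA dA′ → (⟨ A , k ⟩ , dA) ≋ φ k ⊙ ι (mapMat (frob^ k) A) dA′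
  φ-ι A k _ _ = equiv (≡⇒~ (sym (trans (·M-identityˡ _) (trans (mapMat-∘ (frob⁻ k) (frob^ k) A) (mapMat-id (frob⁻-frob k) A)))))
    (λ z → cong (λ l → frob^ l z) (sym (ℕₚ.+-identityʳ k)))

  swap : Mat
  swap = mat 0# 1# 1# 0#

  det-swap : det swap ≢ 0#
  det-swap eq = neg-nonzero 1≢0 (trans (sym (trans (cong₂ _+_ (zeroˡ 0#) (cong -_ (*-identityˡ 1#))) (+-identityˡ _))) eq)

  KMat-swap : KMat swap
  KMat-swap = kmat K-0 K-1 K-1 K-0

  module _ (2≤n : 2 ≤ n) (reduce : ∀ {a d δ} → ¬ K a → ¬ K d → δ ≢ 0# → Reduction a d δ)
           (squareMod : ∀ {s} → s ≢ 0# → ∃ λ r → r ≢ 0# × (r * r) ^ q₀-1 ≡ s ^ q₀-1) where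

    -- Membership of `Z` in T guarantees that the middle point can be represented in G, whichever
    -- group G is between T and the full semilinear group.
    Result : ΓL → Set
    Result y = ∃ λ Z → IsPSL (proj₁ Z) × (∀ x → BasePair x (Z ⊙ x) × BasePair (Z ⊙ x) (y ⊙ x))

    module _ {A : Mat} (detA : det A ≢ 0#) (k : ℕ) {D D′ : Mat} (kuD : KUnimodular D) (kuD′ : KUnimodular D′)
             {a d δ : Carrier} (a∉K : ¬ K a) (d∉K : ¬ K d) (δ≢0 : δ ≢ 0#) (eq : (D ·M A) ·M D′ ~ N a d δ)
             (M : Middle a d δ) {r : Carrier} (s≡r² : Middle.s M ≡ r * r) where
      open Middle M using (s; s≢0)
      open Sublines a∉K d∉K δ≢0 M

      w = ι (W s a) (det-W s≢0)
      w′ = ι (W s′ (d * s′)) (det-W s′≢0)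
      j = ι swap det-swap
      d₁ = ι (adj D′) (KU⇒det≢0 (KU-adj kuD′))
      d₂ = ι (adj D) (KU⇒det≢0 (KU-adj kuD))

      L-φ : L (φ k)
      L-φ = I₂ , KMat-I , ~-refl

      A~ : A ~ adj D ·M (W s′ (d * s′) ·M (swap ·M (W s a ·M adj D′)))
      A~ = ~-trans (≡⇒~ A≡) (~-trans (~-cong (~-refl {adj D}) (~-cong (~-trans eq N~) (~-refl {adj D′})))
        (≡⇒~ (cong (adj D ·M_) (trans (·M-assoc (W s′ (d * s′)) (swap ·M W s a) (adj D′)) (cong (W s′ (d * s′) ·M_) (·M-assoc swap (W s a) (adj D′)))))))
        where
        open ≡-Reasoning
        A≡ : A ≡ adj D ·M (((D ·M A) ·M D′) ·M adj D′)
        A≡ = begin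
          A ≡⟨ ·M-identityˡ A ⟨
          I₂ ·M A ≡⟨ cong (_·M A) (adj-KU kuD) ⟨
          (adj D ·M D) ·M A ≡⟨ ·M-assoc (adj D) D A ⟩
          adj D ·M (D ·M A) ≡⟨ cong (adj D ·M_) (·M-identityʳ (D ·M A)) ⟨
          adj D ·M ((D ·M A) ·M I₂) ≡⟨ cong (λ X → adj D ·M ((D ·M A) ·M X)) (KU-adjʳ kuD′) ⟨
          adj D ·M ((D ·M A) ·M (D′ ·M adj D′)) ≡⟨ cong (adj D ·M_) (·M-assoc (D ·M A) D′ (adj D′)) ⟨
          adj D ·M (((D ·M A) ·M D′) ·M adj D′) ∎

      factorised : ι A detA ≋ d₂ ⊙ (w′ ⊙ (j ⊙ (w ⊙ d₁)))
      factorised = ≋-trans (ι-cong A~) (≋-sym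
        (≋-trans (𝔾-congˡ {d₂} (≋-trans (𝔾-congˡ {w′} (≋-trans (𝔾-congˡ {j} (ι-⊙ (det-W s≢0) (proj₂ d₁))) (ι-⊙ det-swap det₁))) (ι-⊙ (det-W s′≢0) det₂)))
          (ι-⊙ (proj₂ d₂) det₃)))
        where
        det₁ = det-·≢0 {W s a} {adj D′} (det-W s≢0) (proj₂ d₁)
        det₂ = det-·≢0 {swap} {W s a ·M adj D′} det-swap det₁
        det₃ = det-·≢0 {W s′ (d * s′)} {swap ·M (W s a ·M adj D′)} (det-W s′≢0) det₂

      isPSL : IsPSL (proj₁ (w ⊙ d₁))
      isPSL = proj₂ (w ⊙ d₁) , (λ _ → refl) , r , (begin
        det (W s a ·M mapMat (frob^ 0) (adj D′)) ≡⟨ cong (λ X → det (W s a ·M X)) (mapMat-1 (adj D′)) ⟩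
        det (W s a ·M adj D′) ≡⟨ det-· (W s a) (adj D′) ⟩
        det (W s a) * det (adj D′) ≡⟨ cong₂ _*_ (trans (cong₂ _+_ (*-identityʳ s) (trans (cong -_ (zeroˡ a)) -0#≈0#)) (+-identityʳ s)) (KUnimodular.det≡1 (KU-adj kuD′)) ⟩
        s * 1# ≡⟨ *-identityʳ s ⟩
        s ≡⟨ s≡r² ⟩
        r * r ∎)
        where open ≡-Reasoning

      neighbour : ∀ {y} → y ≋ φ k ⊙ ι A detA → Result y
      neighbour {y} y≋ = w ⊙ d₁ , isPSL ,
        common-neighbour {w} {w′} {d₁} {φ k ⊙ d₂} {j} {y} (λ {g} {l} → BaseLemma.base 2≤n s≢0 good a∉span {g} {l})
          (λ {g} {l} → BaseLemma.base 2≤n s′≢0 good′ ds′∉span {g} {l}) (L-ι {dA = proj₂ d₁} (KMat-adj (KUnimodular.entries kuD′)))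
          (L-⊙ {φ k} {d₂} L-φ (L-ι {dA = proj₂ d₂} (KMat-adj (KUnimodular.entries kuD)))) (L-ι {dA = det-swap} KMat-swap)
          (≋-trans y≋ (≋-trans (𝔾-congˡ {φ k} factorised) (≋-sym (𝔾-assoc (φ k) d₂ (w′ ⊙ (j ⊙ (w ⊙ d₁)))))))

    from-normal-form : ∀ A detA k → NormalForm A → ∀ {y} → y ≋ φ k ⊙ ι A detA → Result y
    from-normal-form A detA k nf = step (reduce N.a∉K N.d∉K N.δ≢0)
      where
      module N = NormalForm nf
      step : Reduction N.a N.d N.δ → ∀ {y} → y ≋ φ k ⊙ ι A detA → Result y
      step red = choose (squareMod (Middle.s≢0 R.middle))
        where
        module R = Reduction red
        eq : ((R.D ·M N.D) ·M A) ·M N.D′ ~ NormalForms.N F p n pp order≡ 1≤n m R.a′ R.d′ R.δ′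
        eq = ~-trans (≡⇒~ (trans (cong (_·M N.D′) (·M-assoc R.D N.D A)) (·M-assoc R.D (N.D ·M A) N.D′)))
          (~-trans (~-cong (~-refl {R.D}) N.equivalent) R.equivalent)
        choose : (∃ λ r → r ≢ 0# × (r * r) ^ q₀-1 ≡ Middle.s R.middle ^ q₀-1) → ∀ {y} → y ≋ φ k ⊙ ι A detA → Result y
        choose (r , r≢0 , r²) = neighbour detA k (KU-· R.KU-D N.KU-D) N.KU-D′ R.a′∉K R.d′∉K R.δ′≢0 eq
          (Middle-square R.middle (*-nonzero r≢0 r≢0) r²) refl

    common-neighbours : ∀ y → ¬ L y → Result y
    common-neighbours y@(⟨ A , k ⟩ , dA) y∉L =
      from-normal-form A′ dA′ k (normal-form A′ dA′ irrational) (φ-ι A k dA dA′)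
      where
      A′ = mapMat (frob^ k) A
      dA′ = det-frob^ k A dA
      irrational : ¬ Rational A′
      irrational (B , kB , A′~B) = y∉L (mapMat (frob⁻ k) B , KMat-frob^ (k ℕ.* (n ∸ 1)) kB ,
        ~-trans (≡⇒~ (sym (trans (mapMat-∘ (frob⁻ k) (frob^ k) A) (mapMat-id (frob⁻-frob k) A)))) (mapMat-~ (k ℕ.* (n ∸ 1)) A′~B))

  module Counting (1≤q₀-1 : 1 ≤ q₀-1) (h : ℕ) (half : ∀ {g} → 2 ℕ.* g ≤ n → g ≤ h)
      (bound : q₀-1 ℕ.* (2 ℕ.* frobSum p h ℕ.+ 2 ℕ.* suc q₀-1) < p ℕ.^ n ∸ 1) where

    Klist : List Carrier
    Klist = 0# ∷ filter (λ x → x ^ q₀-1 ≟ 1#) nonzeros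

    ∈Klist : ∀ {x} → K x → x ∈ Klist
    ∈Klist {x} kx with x ≟ 0#
    ... | yes x≡0 = here x≡0
    ... | no x≢0 = there (∈-filter⁺ (λ x → x ^ q₀-1 ≟ 1#) (∈nonzeros⁺ x≢0) (K^ x≢0 kx))

    length-Klist : length Klist ≤ suc q₀-1
    length-Klist = s≤s (power-roots≤ q₀-1 1# _ 1≤q₀-1 (Uniqueₚ.filter⁺ P? nonzeros-unique) (Allₚ.all-filter P? nonzeros))
      where P? = λ x → x ^ q₀-1 ≟ 1#

    module _ (a d δ : Carrier) where

      Condition : Set
      Condition = ℕ × Carrier

      goodConditions : ℕ → List Condition
      goodConditions zero = []
      goodConditions (suc g) = (q₀-1 ℕ.* (p ℕ.^ suc g ∸ 1) , 1#) ∷ (q₀-1 ℕ.* (p ℕ.^ suc g ∸ 1) , (δ ^ q₀-1) ^ (p ℕ.^ suc g ∸ 1)) ∷ goodConditions g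

      -- For each f in K, the class of s must differ from that of a - f and from that of δ/(d - f).
      -- Over at most q₀ values of f this costs degree 2q₀(q₀ - 1).
      spanConditions : List Carrier → List Condition
      spanConditions [] = []
      spanConditions (f ∷ fs) = (q₀-1 , (a - f) ^ q₀-1) ∷ (q₀-1 , δ ^ q₀-1 * ((d - f) ^ q₀-1) ⁻¹) ∷ spanConditions fs

      sum-good : ∀ g → ListAction.sum (map proj₁ (goodConditions g)) ≡ q₀-1 ℕ.* (2 ℕ.* frobSum p g)
      sum-good zero = sym (ℕₚ.*-zeroʳ q₀-1)
      sum-good (suc g) = trans (cong (λ z → x ℕ.+ (x ℕ.+ z)) (sum-good g))
        (twice-+ q₀-1 (frobSum p g) (p ℕ.^ suc g ∸ 1))
        where
        x = q₀-1 ℕ.* (p ℕ.^ suc g ∸ 1)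

      sum-span : ∀ fs → ListAction.sum (map proj₁ (spanConditions fs)) ≡ q₀-1 ℕ.* (2 ℕ.* length fs)
      sum-span [] = sym (ℕₚ.*-zeroʳ q₀-1)
      sum-span (f ∷ fs) = trans (cong (λ z → q₀-1 ℕ.+ (q₀-1 ℕ.+ z)) (sum-span fs))
        (twice-suc q₀-1 (length fs))

      conditions : List Condition
      conditions = goodConditions h ++ spanConditions Klist

      sum-conditions : ListAction.sum (map proj₁ conditions) < length nonzeros
      sum-conditions = begin-strict
        ListAction.sum (map proj₁ conditions) ≡⟨ cong ListAction.sum (Listₚ.map-++ proj₁ (goodConditions h) _) ⟩
        ListAction.sum (map proj₁ (goodConditions h) ++ map proj₁ (spanConditions Klist)) ≡⟨ sum-++ (map proj₁ (goodConditions h)) _ ⟩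
        ListAction.sum (map proj₁ (goodConditions h)) ℕ.+ ListAction.sum (map proj₁ (spanConditions Klist)) ≡⟨ cong₂ ℕ._+_ (sum-good h) (sum-span Klist) ⟩
        q₀-1 ℕ.* (2 ℕ.* frobSum p h) ℕ.+ q₀-1 ℕ.* (2 ℕ.* length Klist) ≡⟨ ℕₚ.*-distribˡ-+ q₀-1 (2 ℕ.* frobSum p h) _ ⟨
        q₀-1 ℕ.* (2 ℕ.* frobSum p h ℕ.+ 2 ℕ.* length Klist) ≤⟨ ℕₚ.*-monoʳ-≤ q₀-1 (ℕₚ.+-monoʳ-≤ (2 ℕ.* frobSum p h) (ℕₚ.*-monoʳ-≤ 2 length-Klist)) ⟩
        q₀-1 ℕ.* (2 ℕ.* frobSum p h ℕ.+ 2 ℕ.* suc q₀-1) <⟨ bound ⟩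
        p ℕ.^ n ∸ 1 ≡⟨ cong (_∸ 1) (trans (sym order≡) order≡1+nonzeros) ⟩
        length nonzeros ∎
        where open ℕₚ.≤-Reasoning

      1≤p^∸1 : ∀ g → 1 ≤ p ℕ.^ suc g ∸ 1
      1≤p^∸1 g = ℕₚ.∸-monoˡ-≤ 1 (ℕₚ.≤-trans (ℕ.nonTrivial⇒n>1 p) (ℕₚ.m≤m*n p (p ℕ.^ g)))
        where
        open import Data.Nat.Primality using (prime⇒nonTrivial; prime⇒nonZero)
        instance
          _ = prime⇒nonTrivial pp
          _ = ℕ.>-nonZero (1≤p^ g)

      positive : All (λ c → 1 ≤ proj₁ c) conditions
      positive = Allₚ.++⁺ (good h) (span Klist)
        where
        good : ∀ g → All (λ c → 1 ≤ proj₁ c) (goodConditions g)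
        good zero = []
        good (suc g) = 1≤ ∷ 1≤ ∷ good g
          where 1≤ = ℕₚ.*-mono-≤ 1≤q₀-1 (1≤p^∸1 g)
        span : ∀ fs → All (λ c → 1 ≤ proj₁ c) (spanConditions fs)
        span [] = []
        span (f ∷ fs) = 1≤q₀-1 ∷ 1≤q₀-1 ∷ span fs

      Avoids : Carrier → Condition → Set
      Avoids s c = s ^ proj₁ c ≢ proj₂ c

      good-avoids : ∀ {s} g → All (Avoids s) (goodConditions g) → ∀ {k} → 1 ≤ k → k ≤ g →
        ((s ^ q₀-1) ^ (p ℕ.^ k ∸ 1) ≢ 1#) × ((s ^ q₀-1) ^ (p ℕ.^ k ∸ 1) ≢ (δ ^ q₀-1) ^ (p ℕ.^ k ∸ 1))
      good-avoids zero _ (s≤s _) ()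
      good-avoids {s} (suc g) (n₁ ∷ n₂ ∷ rest) {k} 1≤k k≤ with ℕₚ.m≤n⇒m<n∨m≡n k≤
      ... | inj₁ (s≤s k≤g) = good-avoids g rest 1≤k k≤g
      ... | inj₂ refl = (λ eq → n₁ (trans (sym (^-assocʳ s q₀-1 _)) eq)) , (λ eq → n₂ (trans (sym (^-assocʳ s q₀-1 _)) eq))

      span-avoids : ∀ {s} fs → All (Avoids s) (spanConditions fs) → ∀ {f} → f ∈ fs →
        (s ^ q₀-1 ≢ (a - f) ^ q₀-1) × (s ^ q₀-1 ≢ δ ^ q₀-1 * ((d - f) ^ q₀-1) ⁻¹)
      span-avoids (f ∷ fs) (n₁ ∷ n₂ ∷ rest) (here refl) = n₁ , n₂
      span-avoids (f ∷ fs) (_ ∷ _ ∷ rest) (there f∈) = span-avoids fs rest f∈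

    middle : ∀ {a d δ} → ¬ K a → ¬ K d → δ ≢ 0# → Middle a d δ
    middle {a} {d} {δ} a∉K d∉K δ≢0 =
      let s , s∈ , avoids = avoid-powers (conditions a d δ) (positive a d δ) nonzeros nonzeros-unique (sum-conditions a d δ)
          goods = Allₚ.++⁻ˡ (goodConditions a d δ h) avoids
          spans = Allₚ.++⁻ʳ (goodConditions a d δ h) avoids
      in record
        { s = s ; s≢0 = ∈nonzeros⁻ s∈
        ; good-s = λ g 1≤g 2g≤n _ → proj₁ (good-avoids a d δ h goods 1≤g (half 2g≤n))
        ; good-δ/s = λ g 1≤g 2g≤n _ → proj₂ (good-avoids a d δ h goods 1≤g (half 2g≤n))
        ; avoid-a = λ kf eq → proj₁ (span-avoids a d δ Klist spans (∈Klist kf)) (sym eq)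
        ; avoid-d = λ {f} kf eq → proj₂ (span-avoids a d δ Klist spans (∈Klist kf))
            (trans (sym (x⁻¹*xy (s ^ q₀-1) (d-f≢0 kf))) (trans (cong (((d - f) ^ q₀-1) ⁻¹ *_) eq) (*-comm _ _))) }
      where
      d-f≢0 : ∀ {f} → K f → (d - f) ^ q₀-1 ≢ 0#
      d-f≢0 {f} kf = ^-nonzero q₀-1 (λ eq → d∉K (subst K (sym (x-y≡0⇒x≡y eq)) kf))

    reduction : ∀ {a d δ} → ¬ K a → ¬ K d → δ ≢ 0# → Reduction a d δ
    reduction {a} {d} {δ} a∉K d∉K δ≢0 = record
      { KU-D = KU-I ; a′∉K = a∉K ; d′∉K = d∉K ; δ′≢0 = δ≢0
      ; equivalent = ≡⇒~ (·M-identityˡ (N a d δ)) ; middle = middle a∉K d∉K δ≢0 }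

-- The numerical inequality behind the count

module DegreeBound where
  open import Data.Nat.Base
  open import Data.Nat.Properties
  open +-*-Solver

  -- The sum of the first r powers of x, starting with 1. At x = q₀ it is (q - 1)/(q₀ - 1), so
  -- dividing the required bound by q₀ - 1 turns its right side into this sum.
  geometric : ℕ → ℕ → ℕ
  geometric x zero = 0
  geometric x (suc r) = 1 + x * geometric x r

  geometric-closed : ∀ y r → y * geometric (suc y) r + 1 ≡ suc y ^ r
  geometric-closed y zero = cong (_+ 1) (*-zeroʳ y)
  geometric-closed y (suc r) = trans (solve 2 (λ y g → y :* (con 1 :+ (con 1 :+ y) :* g) :+ con 1 := (con 1 :+ y) :* (y :* g :+ con 1)) refl y (geometric (suc y) r))
    (cong (suc y *_) (geometric-closed y r))

  geometric-lower : ∀ x r → x ^ r + x ^ suc r ≤ geometric x (2 + r)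
  geometric-lower x zero = ≤-reflexive (solve 1 (λ x → con 1 :+ x :* con 1 := con 1 :+ x :* (con 1 :+ x :* con 0)) refl x)
  geometric-lower x (suc r) = begin
    x * x ^ r + x * x ^ suc r ≡⟨ *-distribˡ-+ x (x ^ r) (x ^ suc r) ⟨
    x * (x ^ r + x ^ suc r) ≤⟨ *-monoʳ-≤ x (geometric-lower x r) ⟩
    x * geometric x (2 + r) ≤⟨ n≤1+n _ ⟩
    geometric x (3 + r) ∎
    where open ≤-Reasoning

  even-pronic : ∀ x → ∃ λ t → x * suc x ≡ 2 * t
  even-pronic zero = 0 , refl
  even-pronic (suc x) with even-pronic x
  ... | t , eq = t + suc x , trans (solve 1 (λ x → (con 1 :+ x) :* (con 2 :+ x) := x :* (con 1 :+ x) :+ con 2 :* (con 1 :+ x)) refl x)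
    (trans (cong (_+ 2 * suc x) eq) (sym (*-distribˡ-+ 2 t (suc x))))

  -- After the initial 1 the terms pair up into multiples of x(1 + x), which is even.
  geometric-odd : ∀ x k → ∃ λ c → geometric x (suc (k * 2)) ≡ 1 + 2 * c
  geometric-odd x zero = 0 , cong suc (*-zeroʳ x)
  geometric-odd x (suc k) with geometric-odd x k | even-pronic x
  ... | c , eq | t , eq′ = t + x * x * c , (begin
    1 + x * (1 + x * geometric x (suc (k * 2))) ≡⟨ cong (λ g → 1 + x * (1 + x * g)) eq ⟩
    1 + x * (1 + x * (1 + 2 * c)) ≡⟨ solve 2 (λ x c → con 1 :+ x :* (con 1 :+ x :* (con 1 :+ con 2 :* c)) := con 1 :+ (x :* (con 1 :+ x) :+ con 2 :* (x :* x :* c))) refl x c ⟩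
    1 + (x * suc x + 2 * (x * x * c)) ≡⟨ cong (λ z → 1 + (z + 2 * (x * x * c))) eq′ ⟩
    1 + (2 * t + 2 * (x * x * c)) ≡⟨ cong suc (*-distribˡ-+ 2 t (x * x * c)) ⟨
    1 + 2 * (t + x * x * c) ∎)
    where open ≡-Reasoning

  square-≤⁻¹ : ∀ {a b} → a * a ≤ b * b → a ≤ b
  square-≤⁻¹ {a} {b} le with a ≤? b
  ... | yes a≤b = a≤b
  ... | no a≰b = ⊥-elim (<⇒≱ (*-mono-< (≰⇒> a≰b) (≰⇒> a≰b)) le)

  frobSum-bound : ∀ p h → 2 ≤ p → frobSum p h + 2 ≤ 2 * p ^ h
  frobSum-bound p zero _ = ≤-refl
  frobSum-bound p (suc h) 2≤p = begin
    frobSum p h + (p ^ suc h ∸ 1) + 2 ≤⟨ +-monoˡ-≤ 2 (+-monoʳ-≤ (frobSum p h) (m∸n≤m _ 1)) ⟩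
    frobSum p h + p ^ suc h + 2 ≡⟨ solve 2 (λ e y → e :+ y :+ con 2 := (e :+ con 2) :+ y) refl (frobSum p h) (p ^ suc h) ⟩
    (frobSum p h + 2) + p ^ suc h ≤⟨ +-monoˡ-≤ _ (frobSum-bound p h 2≤p) ⟩
    2 * p ^ h + p ^ suc h ≤⟨ +-monoˡ-≤ _ (*-monoˡ-≤ (p ^ h) 2≤p) ⟩
    p * p ^ h + p ^ suc h ≡⟨ solve 1 (λ y → y :+ y := con 2 :* y) refl (p ^ suc h) ⟩
    2 * p ^ suc h ∎
    where open ≤-Reasoning

  module _ (p : ℕ) (2≤p : 2 ≤ p) where

    private
      instance
        nz : NonZero p
        nz = >-nonZero (≤-trans (s≤s z≤n) 2≤p)

    half-square : ∀ r m → p ^ ((r * m) / 2) * p ^ ((r * m) / 2) ≤ (p ^ m) ^ r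
    half-square r m = begin
      p ^ h * p ^ h ≡⟨ ^-distribˡ-+-* p h h ⟨
      p ^ (h + h) ≡⟨ cong (p ^_) (solve 1 (λ h → h :+ h := h :* con 2) refl h) ⟩
      p ^ (h * 2) ≤⟨ ^-monoʳ-≤ p (m/n*n≤m (r * m) 2) ⟩
      p ^ (r * m) ≡⟨ cong (p ^_) (*-comm r m) ⟩
      p ^ (m * r) ≡⟨ ^-*-assoc p m r ⟨
      (p ^ m) ^ r ∎
      where
      open ≤-Reasoning
      h = (r * m) / 2

    -- The comparison is made between squares because p^⌊n/2⌋ is only bounded by √q, which need not
    -- be an integer.
    4y≤ : ∀ r m z → 16 * (p ^ m) ^ r ≤ z * z → 4 * p ^ ((r * m) / 2) ≤ z
    4y≤ r m z le = square-≤⁻¹ (begin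
      (4 * y) * (4 * y) ≡⟨ solve 1 (λ y → (con 4 :* y) :* (con 4 :* y) := con 16 :* (y :* y)) refl y ⟩
      16 * (y * y) ≤⟨ *-monoʳ-≤ 16 (half-square r m) ⟩
      16 * (p ^ m) ^ r ≤⟨ le ⟩
      z * z ∎)
      where
      open ≤-Reasoning
      y = p ^ ((r * m) / 2)

    2frobSum< : ∀ h → 2 * frobSum p h < 4 * p ^ h
    2frobSum< h = begin-strict
      2 * frobSum p h <⟨ *-monoʳ-< 2 (m<m+n (frobSum p h) (s≤s (z≤n {1}))) ⟩
      2 * (frobSum p h + 2) ≤⟨ *-monoʳ-≤ 2 (frobSum-bound p h 2≤p) ⟩
      2 * (2 * p ^ h) ≡⟨ *-assoc 2 2 (p ^ h) ⟨
      4 * p ^ h ∎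
      where open ≤-Reasoning

    -- Here `z` is any integer that is at least 4√q. The sum over the field automorphisms stays
    -- below it, and what remains is an inequality in q₀ and r.
    bound-from : ∀ r m {z} → 16 * (p ^ m) ^ r ≤ z * z → z + 2 * p ^ m ≤ geometric (p ^ m) r →
      2 * frobSum p ((r * m) / 2) + 2 * p ^ m < geometric (p ^ m) r
    bound-from r m {z} le le′ = begin-strict
      2 * frobSum p ((r * m) / 2) + 2 * p ^ m <⟨ +-monoˡ-< (2 * p ^ m) (2frobSum< ((r * m) / 2)) ⟩
      4 * p ^ ((r * m) / 2) + 2 * p ^ m ≤⟨ +-monoˡ-≤ (2 * p ^ m) (4y≤ r m z le) ⟩
      z + 2 * p ^ m ≤⟨ le′ ⟩
      geometric (p ^ m) r ∎
      where open ≤-Reasoning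

    -- The choice z = q₀^(r-1) works because q₀^(r-2) ≥ 27 > 16; then z + 2q₀ is already covered by
    -- the two highest terms of the sum.
    bound-≥5 : ∀ j m → 3 ≤ p ^ m → 2 * frobSum p (((5 + j) * m) / 2) + 2 * p ^ m < geometric (p ^ m) (5 + j)
    bound-≥5 j m 3≤x = bound-from (5 + j) m {x ^ (4 + j)} (begin
        16 * x ^ (5 + j) ≤⟨ *-monoˡ-≤ (x ^ (5 + j)) 16≤ ⟩
        x ^ (3 + j) * x ^ (5 + j) ≡⟨ ^-distribˡ-+-* x (3 + j) (5 + j) ⟨
        x ^ (3 + j + (5 + j)) ≡⟨ cong (x ^_) (solve 1 (λ j → con 3 :+ j :+ (con 5 :+ j) := con 4 :+ j :+ (con 4 :+ j)) refl j) ⟩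
        x ^ (4 + j + (4 + j)) ≡⟨ ^-distribˡ-+-* x (4 + j) (4 + j) ⟩
        x ^ (4 + j) * x ^ (4 + j) ∎)
      (begin
        x ^ (4 + j) + 2 * x ≤⟨ +-monoʳ-≤ (x ^ (4 + j)) 2x≤ ⟩
        x ^ (4 + j) + x ^ (3 + j) ≡⟨ +-comm (x ^ (4 + j)) _ ⟩
        x ^ (3 + j) + x ^ (4 + j) ≤⟨ geometric-lower x (3 + j) ⟩
        geometric x (5 + j) ∎)
      where
      open ≤-Reasoning
      x = p ^ m
      instance _ = >-nonZero (≤-trans (s≤s (z≤n {2})) 3≤x)
      16≤ : 16 ≤ x ^ (3 + j)
      16≤ = begin
        16 ≤⟨ ≤ᵇ⇒≤ 16 27 tt ⟩
        3 ^ 3 ≤⟨ ^-monoˡ-≤ 3 3≤x ⟩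
        x ^ 3 ≤⟨ ^-monoʳ-≤ x (m≤m+n 3 j) ⟩
        x ^ (3 + j) ∎
      2x≤ : 2 * x ≤ x ^ (3 + j)
      2x≤ = begin
        2 * x ≤⟨ *-monoˡ-≤ x (≤-trans (n≤1+n 2) 3≤x) ⟩
        x * x ≡⟨ cong (x *_) (*-identityʳ x) ⟨
        x ^ 2 ≤⟨ ^-monoʳ-≤ x (≤-trans (n≤1+n 2) (m≤m+n 3 j)) ⟩
        x ^ (3 + j) ∎

    -- The choice z = q₀(q₀ - 1) makes z + 2q₀ fall short of the sum by exactly 1. It requires 16q₀
    -- ≤ (q₀ - 1)², and 18 is the first value above 1 where this holds, with 288 against 289.
    bound-3-large : ∀ m → 18 ≤ p ^ m → 2 * frobSum p ((3 * m) / 2) + 2 * p ^ m < geometric (p ^ m) 3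
    bound-3-large m 18≤x = bound-from 3 m {x * y} (begin
        16 * x ^ 3 ≡⟨ solve 2 (λ c x → c :* (x :* (x :* (x :* con 1))) := (x :* x) :* (c :* x)) refl 16 x ⟩
        (x * x) * (16 * x) ≤⟨ *-monoʳ-≤ (x * x) 16x≤ ⟩
        (x * x) * (y * y) ≡⟨ solve 2 (λ x y → (x :* x) :* (y :* y) := (x :* y) :* (x :* y)) refl x y ⟩
        (x * y) * (x * y) ∎)
      (begin
        x * y + 2 * x ≡⟨ solve 2 (λ x y → x :* y :+ con 2 :* x := x :* (con 1 :+ y) :+ x) refl x y ⟩
        x * suc y + x ≡⟨ cong (λ z → x * z + x) suc-y ⟩
        x * x + x ≤⟨ n≤1+n _ ⟩
        1 + (x * x + x) ≡⟨ solve 1 (λ x → con 1 :+ (x :* x :+ x) := con 1 :+ x :* (con 1 :+ x :* (con 1 :+ x :* con 0))) refl x ⟩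
        geometric x 3 ∎)
      where
      open ≤-Reasoning
      x = p ^ m
      y = x ∸ 1
      suc-y : suc y ≡ x
      suc-y = m+[n∸m]≡n (≤-trans (s≤s z≤n) 18≤x)
      16x≤ : 16 * x ≤ y * y
      16x≤ = begin
        16 * x ≡⟨ cong (16 *_) suc-y ⟨
        16 * suc y ≡⟨ *-suc 16 y ⟩
        16 + 16 * y ≤⟨ +-monoˡ-≤ (16 * y) (≤-trans (n≤1+n 16) (∸-monoˡ-≤ 1 18≤x)) ⟩
        17 * y ≤⟨ *-monoˡ-≤ y (∸-monoˡ-≤ 1 18≤x) ⟩
        y * y ∎

  bound-3-1 : ∀ p → 3 ≤ p → 2 * frobSum p 1 + 2 * p ^ 1 < geometric (p ^ 1) 3
  bound-3-1 p 3≤p with m≤n⇒∃[o]m+o≡n 3≤p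
  ... | k , refl = begin-strict
    2 * frobSum (3 + k) 1 + 2 * (3 + k) ^ 1 ≡⟨ solve 1 (λ k → con 2 :* (con 2 :+ k :* con 1) :+ con 2 :* ((con 3 :+ k) :* con 1) := con 10 :+ con 4 :* k) refl k ⟩
    10 + 4 * k <⟨ m<m+n _ (s≤s z≤n) ⟩
    10 + 4 * k + (3 + 3 * k + k * k) ≡⟨ solve 1 (λ k → con 10 :+ con 4 :* k :+ (con 3 :+ con 3 :* k :+ k :* k)
      := con 1 :+ ((con 3 :+ k) :* con 1) :* (con 1 :+ ((con 3 :+ k) :* con 1) :* (con 1 :+ ((con 3 :+ k) :* con 1) :* con 0))) refl k ⟩
    geometric ((3 + k) ^ 1) 3 ∎
    where open ≤-Reasoning

  -- Values m = 1 and values q₀ ≥ 18 are covered by the two previous bounds. This leaves 4, 8, 9 and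
  -- 16, the first of which is excluded. The clauses with p = 4 are present because p runs over all
  -- integers from 2 on.
  bound-3 : ∀ p m → 2 ≤ p → 1 ≤ m → 2 < p ^ m → ¬ (p ≡ 2 × m ≡ 2) → 2 * frobSum p ((3 * m) / 2) + 2 * p ^ m < geometric (p ^ m) 3
  bound-3 p 1 _ _ 2<x _ = bound-3-1 p (subst (2 <_) (*-identityʳ p) 2<x)
  bound-3 1 (suc (suc m)) (s≤s ()) _ _ _
  bound-3 2 2 _ _ _ not = ⊥-elim (not (refl , refl))
  bound-3 2 3 _ _ _ _ = ≤ᵇ⇒≤ _ _ tt
  bound-3 2 4 _ _ _ _ = ≤ᵇ⇒≤ _ _ tt
  bound-3 2 (suc (suc (suc (suc (suc m))))) 2≤p _ _ _ = bound-3-large 2 2≤p (5 + m) (≤-trans (≤ᵇ⇒≤ 18 32 tt) (^-monoʳ-≤ 2 (m≤m+n 5 m)))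
  bound-3 3 2 _ _ _ _ = ≤ᵇ⇒≤ _ _ tt
  bound-3 3 (suc (suc (suc m))) 2≤p _ _ _ = bound-3-large 3 2≤p (3 + m) (≤-trans (≤ᵇ⇒≤ 18 27 tt) (^-monoʳ-≤ 3 (m≤m+n 3 m)))
  bound-3 4 2 _ _ _ _ = ≤ᵇ⇒≤ _ _ tt
  bound-3 4 (suc (suc (suc m))) 2≤p _ _ _ = bound-3-large 4 2≤p (3 + m) (≤-trans (≤ᵇ⇒≤ 18 64 tt) (^-monoʳ-≤ 4 (m≤m+n 3 m)))
  bound-3 p@(suc (suc (suc (suc (suc p′))))) (suc (suc m)) 2≤p _ _ _ = bound-3-large p 2≤p (2 + m)
    (≤-trans (≤ᵇ⇒≤ 18 25 tt) (≤-trans (^-monoˡ-≤ 2 (m≤m+n 5 p′)) (^-monoʳ-≤ p (m≤m+n 2 m))))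

  odd-prime-form : ∀ {r} → Prime r → r ≢ 2 → ∃ λ k → r ≡ suc (k * 2)
  odd-prime-form {r} rp r≢2 with r % 2 in eq | m%n<n r 2
  ... | 0 | _ with prime⇒irreducible rp (m%n≡0⇒n∣m r 2 eq)
  ...   | inj₂ 2≡r = ⊥-elim (r≢2 (sym 2≡r))
  odd-prime-form {r} rp r≢2 | 1 | _ = r / 2 , trans (m≡m%n+[m/n]*n r 2) (cong (_+ r / 2 * 2) eq)
  odd-prime-form _ _ | suc (suc _) | s≤s (s≤s ())

  -- In the excluded case the inequality is false: the left side is 3 · (22 + 8) = 90 and the right
  -- side is 63.
  degree-bound : ∀ {p m r} → 2 ≤ p → 1 ≤ m → 2 < p ^ m → Prime r → r ≢ 2 → ¬ (p ≡ 2 × m ≡ 2 × r ≡ 3) →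
    (p ^ m ∸ 1) * (2 * frobSum p ((r * m) / 2) + 2 * suc (p ^ m ∸ 1)) < p ^ (r * m) ∸ 1
  degree-bound {p} {m} {r} 2≤p 1≤m 2<x rp r≢2 not = begin-strict
    y * (2 * frobSum p h + 2 * suc y) <⟨ *-monoʳ-< y inner ⟩
    y * geometric (suc y) r ≡⟨ m+n∸n≡m _ 1 ⟨
    y * geometric (suc y) r + 1 ∸ 1 ≡⟨ cong (_∸ 1) (geometric-closed y r) ⟩
    suc y ^ r ∸ 1 ≡⟨ cong (λ x → x ^ r ∸ 1) suc-y ⟩
    (p ^ m) ^ r ∸ 1 ≡⟨ cong (_∸ 1) (trans (^-*-assoc p m r) (cong (p ^_) (*-comm m r))) ⟩
    p ^ (r * m) ∸ 1 ∎
    where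
    open ≤-Reasoning
    y = p ^ m ∸ 1
    h = (r * m) / 2
    suc-y : suc y ≡ p ^ m
    suc-y = m+[n∸m]≡n (≤-trans (s≤s z≤n) 2<x)
    instance
      y≢0 : NonZero y
      y≢0 = >-nonZero (∸-monoˡ-≤ 1 (≤-trans (n≤1+n 2) 2<x))
    by-shape : ∀ r k → r ≡ suc (k * 2) → r ≢ 1 → ¬ (p ≡ 2 × m ≡ 2 × r ≡ 3) → 2 * frobSum p ((r * m) / 2) + 2 * p ^ m < geometric (p ^ m) r
    by-shape _ 0 refl r≢1 _ = ⊥-elim (r≢1 refl)
    by-shape _ 1 refl _ not = bound-3 p m 2≤p 1≤m 2<x (λ (p≡2 , m≡2) → not (p≡2 , m≡2 , refl))
    by-shape _ (suc (suc k)) refl _ _ = bound-≥5 p 2≤p (k * 2) m 2<x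
    r≢1 : r ≢ 1
    r≢1 refl = <⇒≱ (nonTrivial⇒n>1 1 {{prime⇒nonTrivial rp}}) ≤-refl
    inner : 2 * frobSum p h + 2 * suc y < geometric (suc y) r
    inner with odd-prime-form rp r≢2
    ... | k , r≡ = subst (λ x → 2 * frobSum p h + 2 * x < geometric x r) (sym suc-y) (by-shape r k r≡ r≢1 not)

-- Computations in an explicit field of order 64

module BinaryPolynomials where
  open import Data.Vec.Base using (lookup; zipWith)

  all-bits? : ∀ {k} {P : Vec Bool k → Set} → (∀ v → Dec (P v)) → Dec (∀ v → P v)
  all-bits? {zero} P? = map′ (λ p → λ { [] → p }) (λ f → f []) (P? [])
  all-bits? {suc k} P? = map′ (λ (p , q) → λ { (false ∷ v) → p v ; (true ∷ v) → q v }) (λ f → (λ v → f (false ∷ v)) , (λ v → f (true ∷ v)))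
    (all-bits? (λ v → P? (false ∷ v)) ×-dec all-bits? (λ v → P? (true ∷ v)))

  all-vectors : ∀ k → List (Vec Bool k)
  all-vectors zero = [] ∷ []
  all-vectors (suc k) = map (false ∷_) (all-vectors k) ++ map (true ∷_) (all-vectors k)

  all-vectors-unique : ∀ k → Unique (all-vectors k)
  all-vectors-unique zero = [] ∷ []
  all-vectors-unique (suc k) = Uniqueₚ.++⁺ (Uniqueₚ.map⁺ Vecₚ.∷-injectiveʳ (all-vectors-unique k)) (Uniqueₚ.map⁺ Vecₚ.∷-injectiveʳ (all-vectors-unique k)) disjoint
    where
    disjoint : ∀ {v} → ¬ ((v ∈ map (false ∷_) (all-vectors k)) × (v ∈ map (true ∷_) (all-vectors k)))
    disjoint (v∈ , v∈′) with ∈-map⁻ (false ∷_) v∈ | ∈-map⁻ (true ∷_) v∈′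
    ... | _ , _ , refl | _ , _ , ()

  -- Polynomials of degree < 6 over 𝔽₂ modulo t⁶ + t³ + 1, constant coefficient first.
  Bits : Set
  Bits = Vec Bool 6

  _≟ᵇ_ : (v w : Bits) → Dec (v ≡ w)
  _≟ᵇ_ = Vecₚ.≡-dec Boolₚ._≟_

  𝟘 𝟙 : Bits
  𝟘 = replicate 6 false
  𝟙 = true ∷ replicate 5 false

  infixl 6 _⊕_
  infixl 7 _⊗_

  _⊕_ : ∀ {k} → Vec Bool k → Vec Bool k → Vec Bool k
  _⊕_ = zipWith _xor_

  t· : Bits → Bits
  t· (b₀ ∷ b₁ ∷ b₂ ∷ b₃ ∷ b₄ ∷ b₅ ∷ []) = b₅ ∷ b₀ ∷ b₁ ∷ (b₂ xor b₅) ∷ b₃ ∷ b₄ ∷ []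

  _⊗_ : ∀ {k} → Vec Bool k → Bits → Bits
  [] ⊗ w = 𝟘
  (b ∷ v) ⊗ w = (if b then w else 𝟘) ⊕ t· (v ⊗ w)

  _⊗^_ : Bits → ℕ → Bits
  v ⊗^ zero = 𝟙
  v ⊗^ suc k = v ⊗ (v ⊗^ k)

  square : Bits → Bits
  square v = v ⊗ v

  power-2^ : ℕ → Bits → Bits
  power-2^ zero v = v
  power-2^ (suc k) v = v ⊗ power-2^ k (square v)

  -- v⁶² = v² v⁴ v⁸ v¹⁶ v³², as 𝔽₆₄* has order 63.
  inverse : Bits → Bits
  inverse v = power-2^ 4 (square v)

  -- The root t has order 9, so it does not generate the multiplicative group; γ = 1 + t does. As q₀
  -- - 1 = 3, only cubes matter, and they are the 21 powers of κ.
  γ κ : Bits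
  γ = true ∷ true ∷ false ∷ false ∷ false ∷ false ∷ []
  κ = γ ⊗^ 3

  private
    pattern O = false
    pattern I = true

  -- Stored as literals so that the searches compare against values that are already evaluated;
  -- `κ^-table` checks them against the definition of κ.
  κ-powers : Vec Bits 21
  κ-powers =
    (I ∷ O ∷ O ∷ O ∷ O ∷ O ∷ []) ∷
    (I ∷ I ∷ I ∷ I ∷ O ∷ O ∷ []) ∷
    (O ∷ O ∷ I ∷ I ∷ I ∷ O ∷ []) ∷
    (O ∷ I ∷ I ∷ O ∷ O ∷ I ∷ []) ∷
    (I ∷ O ∷ I ∷ I ∷ I ∷ I ∷ []) ∷
    (O ∷ I ∷ I ∷ O ∷ I ∷ I ∷ []) ∷
    (O ∷ I ∷ I ∷ O ∷ I ∷ O ∷ []) ∷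
    (I ∷ O ∷ O ∷ I ∷ O ∷ O ∷ []) ∷
    (O ∷ I ∷ I ∷ I ∷ I ∷ I ∷ []) ∷
    (I ∷ I ∷ I ∷ O ∷ O ∷ I ∷ []) ∷
    (O ∷ I ∷ O ∷ O ∷ I ∷ I ∷ []) ∷
    (O ∷ I ∷ O ∷ I ∷ O ∷ I ∷ []) ∷
    (O ∷ O ∷ O ∷ O ∷ I ∷ I ∷ []) ∷
    (O ∷ O ∷ I ∷ O ∷ I ∷ I ∷ []) ∷
    (O ∷ O ∷ O ∷ I ∷ O ∷ O ∷ []) ∷
    (I ∷ O ∷ O ∷ O ∷ I ∷ I ∷ []) ∷
    (I ∷ I ∷ O ∷ I ∷ I ∷ I ∷ []) ∷
    (O ∷ O ∷ I ∷ O ∷ I ∷ O ∷ []) ∷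
    (I ∷ I ∷ I ∷ O ∷ I ∷ O ∷ []) ∷
    (O ∷ I ∷ I ∷ O ∷ O ∷ O ∷ []) ∷
    (O ∷ I ∷ O ∷ O ∷ O ∷ I ∷ []) ∷ []

  κ^ : Fin 21 → Bits
  κ^ = lookup κ-powers

  -- As t has order 9, its cube is a primitive cube root of unity and generates the field of order
  -- 4.
  subfield : List Bits
  subfield = 𝟘 ∷ 𝟙 ∷ t³ ∷ t³ ⊕ 𝟙 ∷ []
    where t³ = false ∷ false ∷ false ∷ true ∷ false ∷ false ∷ []

  -- The exponents of the cubes of the elements of a nonzero coset of 𝔽₄, with respect to κ.
  cosets : Vec (List (Fin 21)) 5
  cosets = (# 1 ∷ # 4 ∷ # 14 ∷ # 16 ∷ []) ∷ (# 2 ∷ # 7 ∷ # 8 ∷ # 11 ∷ []) ∷ (# 3 ∷ # 13 ∷ # 15 ∷ # 20 ∷ []) ∷ (# 5 ∷ # 6 ∷ # 9 ∷ # 19 ∷ []) ∷ (# 10 ∷ # 12 ∷ # 17 ∷ # 18 ∷ []) ∷ []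

  coset : Fin 5 → List (Fin 21)
  coset = lookup cosets

  infix 4 _≢₂₁_ _≢₂₁?_
  _≢₂₁_ : ℕ → ℕ → Set
  x ≢₂₁ y = x % 21 ≢ y % 21

  _≢₂₁?_ : ∀ x y → Dec (x ≢₂₁ y)
  x ≢₂₁? y = ¬? (x % 21 ℕₚ.≟ y % 21)

  -- The numbers 2^g - 1 for g = 1, 2, 3, the proper divisors of n = 6.
  Exponents : List ℕ
  Exponents = 1 ∷ 3 ∷ 7 ∷ []

  -- The conditions of `Middle` in logarithms to base κ: k and j are the logarithms of s³ and δ³,
  -- while i and i′ number the cosets of K that contain a and d.
  Suitable : Fin 5 → Fin 5 → Fin 21 → Fin 21 → Set
  Suitable i i′ j k = All (λ N → toℕ k ℕ.* N ≢₂₁ 0) Exponents × All (λ N → toℕ k ℕ.* N ≢₂₁ toℕ j ℕ.* N) Exponents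
    × All (λ α → toℕ α ≢₂₁ toℕ k) (coset i) × All (λ β → toℕ β ℕ.+ toℕ k ≢₂₁ toℕ j) (coset i′)

  suitable? : ∀ i i′ j k → Dec (Suitable i i′ j k)
  suitable? i i′ j k = All.all? (λ N → toℕ k ℕ.* N ≢₂₁? 0) Exponents ×-dec All.all? (λ N → toℕ k ℕ.* N ≢₂₁? toℕ j ℕ.* N) Exponents
    ×-dec All.all? (λ α → toℕ α ≢₂₁? toℕ k) (coset i) ×-dec All.all? (λ β → toℕ β ℕ.+ toℕ k ≢₂₁? toℕ j) (coset i′)

  -- A change of base point turns the exponent j of δ into j - 2β; it has to avoid the bad values 7 and 14.
  Movable : Fin 5 → Fin 21 → Fin 21 → Set
  Movable i j β = All (λ α → toℕ α ℕ.+ toℕ β ≢₂₁ toℕ j) (coset i) × 7 ℕ.+ (toℕ β ℕ.+ toℕ β) ≢₂₁ toℕ j × 14 ℕ.+ (toℕ β ℕ.+ toℕ β) ≢₂₁ toℕ j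

  movable? : ∀ i j β → Dec (Movable i j β)
  movable? i j β = All.all? (λ α → toℕ α ℕ.+ toℕ β ≢₂₁? toℕ j) (coset i) ×-dec ((7 ℕ.+ (toℕ β ℕ.+ toℕ β)) ≢₂₁? toℕ j) ×-dec ((14 ℕ.+ (toℕ β ℕ.+ toℕ β)) ≢₂₁? toℕ j)

  InCoset : Bits → Fin 5 → Set
  InCoset v i = All (λ f → Any (λ α → (v ⊕ f) ⊗^ 3 ≡ κ^ α) (coset i)) subfield
    × All (λ α → Any (λ f → (v ⊕ f) ⊗^ 3 ≡ κ^ α) subfield) (coset i)

  -- Each table is established by running its decision procedure; `abstract` keeps these runs from
  -- being unfolded wherever a table is used.
  abstract
    unit-table : ∀ v → v ≡ 𝟘 ⊎ v ⊗ inverse v ≡ 𝟙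
    unit-table = toWitness {a? = all-bits? (λ v → (v ≟ᵇ 𝟘) ⊎-dec ((v ⊗ inverse v) ≟ᵇ 𝟙))} tt

    κ^-table : ∀ j → κ^ j ≡ κ ⊗^ toℕ j
    κ^-table = toWitness {a? = Finₚ.all? (λ j → (κ^ j) ≟ᵇ (κ ⊗^ toℕ j))} tt

    cube-table : ∀ v → v ≡ 𝟘 ⊎ ∃ λ (j : Fin 21) → v ⊗^ 3 ≡ κ^ j
    cube-table = toWitness {a? = all-bits? (λ v → (v ≟ᵇ 𝟘) ⊎-dec Finₚ.any? (λ j → (v ⊗^ 3) ≟ᵇ (κ^ j)))} tt

    κ-table : ∀ (i j : Fin 21) → κ^ i ≡ κ^ j → i ≡ j
    κ-table = toWitness {a? = Finₚ.all? (λ i → Finₚ.all? (λ j → ((κ^ i) ≟ᵇ (κ^ j)) →-dec (i Finₚ.≟ j)))} tt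

    subfield-table : ∀ v → v ⊗^ 4 ≡ v → v ∈ subfield
    subfield-table = toWitness {a? = all-bits? (λ v → ((v ⊗^ 4) ≟ᵇ v) →-dec Any.any? (v ≟ᵇ_) subfield)} tt

    coset-table : ∀ v → v ⊗^ 4 ≡ v ⊎ ∃ λ i → InCoset v i
    coset-table = toWitness {a? = all-bits? (λ v → ((v ⊗^ 4) ≟ᵇ v) ⊎-dec Finₚ.any? (λ i →
      All.all? (λ f → Any.any? (λ α → ((v ⊕ f) ⊗^ 3) ≟ᵇ (κ^ α)) (coset i)) subfield
      ×-dec All.all? (λ α → Any.any? (λ f → ((v ⊕ f) ⊗^ 3) ≟ᵇ (κ^ α)) subfield) (coset i)))} tt

    suitable-or-movable : ∀ i i′ j → (∃ λ k → Suitable i i′ j k) ⊎ Any (Movable i j) (coset i′)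
    suitable-or-movable = toWitness {a? = Finₚ.all? (λ i → Finₚ.all? (λ i′ → Finₚ.all? (λ j →
      Finₚ.any? (suitable? i i′ j) ⊎-dec Any.any? (movable? i j) (coset i′))))} tt

    -- Applied after a change of base point, when `Movable` has excluded the logarithms 7 and 14; so
    -- a single change suffices.
    suitable-unless : ∀ i i′ j → (toℕ j ≡ 7 ⊎ toℕ j ≡ 14) ⊎ ∃ λ k → Suitable i i′ j k
    suitable-unless = toWitness {a? = Finₚ.all? (λ i → Finₚ.all? (λ i′ → Finₚ.all? (λ j →
      ((toℕ j ℕₚ.≟ 7) ⊎-dec (toℕ j ℕₚ.≟ 14)) ⊎-dec Finₚ.any? (suitable? i i′ j))))} tt

  xor≡𝟘 : ∀ {k} (v w : Vec Bool k) → v ⊕ w ≡ replicate k false → v ≡ w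
  xor≡𝟘 [] [] _ = refl
  xor≡𝟘 (false ∷ v) (false ∷ w) eq = cong (false ∷_) (xor≡𝟘 v w (cong Vec.tail eq))
  xor≡𝟘 (true ∷ v) (true ∷ w) eq = cong (true ∷_) (xor≡𝟘 v w (cong Vec.tail eq))
  xor≡𝟘 (false ∷ v) (true ∷ w) ()
  xor≡𝟘 (true ∷ v) (false ∷ w) ()

  all-vectors-length : length (all-vectors 6) ≡ 64
  all-vectors-length = refl

-- Transfer of the tables to an arbitrary field of order 64

module FieldOfOrder64 (F : FiniteField) (pp : Prime 2) (order≡ : order F ≡ 2 ℕ.^ 6) (1≤6 : 1 ≤ 6) where
  open BinaryPolynomials
  open FiniteField F hiding (order)
  open FieldFacts F
  open PΓL F 2 6 hiding (_≈_; e)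
  open Frobenius F 2 6 pp order≡
  open Matrices F 2 6
  open Subfield F 2 6 pp order≡ 1≤6 2
  open NormalForms F 2 6 pp order≡ 1≤6 2
  open Neighbours F 2 6 pp order≡ 1≤6 2 using (Reduction)
  open ≡-Reasoning

  1+1≡0 : 1# + 1# ≡ 0#
  1+1≡0 = trans (cong (_+_ 1#) (sym (+-identityʳ 1#))) p×1≡0

  x+x≡0 : ∀ x → x + x ≡ 0#
  x+x≡0 x = trans (sym (cong₂ _+_ (*-identityˡ x) (*-identityˡ x))) (trans (sym (distribʳ x 1# 1#)) (trans (cong (_* x) 1+1≡0) (zeroˡ x)))

  -x≡x : ∀ x → - x ≡ x
  -x≡x x = +-cancelˡ x _ _ (trans (-‿inverseʳ x) (sym (x+x≡0 x)))

  injective⇒surjective : ∀ {A : Set} (f : A → Carrier) → (∀ {v w} → f v ≡ f w → v ≡ w) →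
    ∀ vs → Unique vs → order F ≤ length vs → ∀ x → ∃ λ v → x ≡ f v
  injective⇒surjective f f-inj vs unique order≤ x with Any.any? (x ≟_) (map f vs)
  ... | yes x∈ = let v , _ , eq = ∈-map⁻ f x∈ in v , eq
  ... | no x∉ = ⊥-elim (ℕₚ.<⇒≱ (s≤s order≤) (subst (λ l → suc l ≤ order F) (Listₚ.length-map f vs)
      (unique-⊆⇒length≤ (fresh ∷ Uniqueₚ.map⁺ f-inj unique) (λ _ → elements-complete _))))
    where
    fresh : All (x ≢_) (map f vs)
    fresh = All.tabulate (λ y∈ x≡y → x∉ (Any.map (λ y≡ → trans x≡y y≡) y∈))

  ^63 : ∀ {x} → x ≢ 0# → x ^ 63 ≡ 1#
  ^63 {x} x≢0 = trans (cong (λ k → x ^ (k ∸ 1)) (sym order≡)) (^[order-1] x≢0)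

  -- At most 21 elements satisfy y^21 = 1. The seventh power of any other nonzero y has order 9,
  -- since y^63 = 1.
  primitive-ninth-root : ∃ λ ζ → ζ ^ 9 ≡ 1# × ζ ^ 3 ≢ 1#
  primitive-ninth-root =
    let y , y∈ , av = avoid-powers ((21 , 1#) ∷ []) (s≤s z≤n ∷ []) nonzeros nonzeros-unique
          (ℕₚ.≤-trans (ℕₚ.≤ᵇ⇒≤ 22 63 _) (ℕₚ.≤-reflexive (cong (_∸ 1) (trans (sym order≡) order≡1+nonzeros))))
    in y ^ 7 , trans (^-assocʳ y 7 9) (^63 (∈nonzeros⁻ y∈)) , λ eq → All.head av (trans (sym (^-assocʳ y 7 3)) eq)

  -- ζ^9 - 1 factors as (ζ³ - 1)(ζ⁶ + ζ³ + 1), the second factor being the ninth cyclotomic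
  -- polynomial; signs disappear in characteristic 2.
  ninth-root-equation : ∀ {ζ} → ζ ^ 9 ≡ 1# → ζ ^ 3 ≢ 1# → ζ ^ 6 ≡ ζ ^ 3 + 1#
  ninth-root-equation {ζ} ζ⁹≡1 ζ³≢1 = x-y≡0⇒x≡y (trans (cong (_+_ (ζ ^ 6)) (-x≡x _)) (zero-product product≡0 (λ eq → ζ³≢1 (x-y≡0⇒x≡y eq))))
    where
    product≡0 : (ζ ^ 3 - 1#) * (ζ ^ 6 + (ζ ^ 3 + 1#)) ≡ 0#
    product≡0 = begin
      (ζ ^ 3 - 1#) * (ζ ^ 6 + (ζ ^ 3 + 1#))
        ≡⟨ cong₂ (λ x y → (x - 1#) * (y + (x + 1#))) refl (^-homo-* ζ 3 3) ⟩
      (ζ ^ 3 - 1#) * (ζ ^ 3 * ζ ^ 3 + (ζ ^ 3 + 1#))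
        ≡⟨ difference-of-cubes (ζ ^ 3) ⟩
      ζ ^ 3 * (ζ ^ 3 * ζ ^ 3) - 1#
        ≡⟨ cong (_- 1#) (trans (cong (ζ ^ 3 *_) (sym (^-homo-* ζ 3 3))) (trans (sym (^-homo-* ζ 3 6)) ζ⁹≡1)) ⟩
      1# - 1#
        ≡⟨ -‿inverseʳ 1# ⟩
      0# ∎
      where
      difference-of-cubes : ∀ x → (x - 1#) * (x * x + (x + 1#)) ≡ x * (x * x) - 1#
      difference-of-cubes x = begin
        (x - 1#) * (x * x + (x + 1#)) ≡⟨ solve 2 (λ x o → (x :- o) :* (x :* x :+ (x :+ o)) := x :* (x :* x) :+ x :* x :+ x :* o :- o :* (x :* x) :- o :* x :- o :* o) refl x 1# ⟩
        x * (x * x) + x * x + x * 1# - 1# * (x * x) - 1# * x - 1# * 1#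
          ≡⟨ cong₂ (λ y z → x * (x * x) + x * x + y - 1# * (x * x) - z - 1# * 1#) (*-identityʳ x) (*-identityˡ x) ⟩
        x * (x * x) + x * x + x - 1# * (x * x) - x - 1# * 1#
          ≡⟨ cong₂ (λ y z → x * (x * x) + x * x + x - y - x - z) (*-identityˡ (x * x)) (*-identityˡ 1#) ⟩
        x * (x * x) + x * x + x - x * x - x - 1#
          ≡⟨ solve 4 (λ c s x o → c :+ s :+ x :- s :- x :- o := c :- o) refl (x * (x * x)) (x * x) x 1# ⟩
        x * (x * x) - 1# ∎

  bit : Bool → Carrier
  bit false = 0#
  bit true = 1#

  module Evaluation (ζ : Carrier) (ζ⁶ : ζ ^ 6 ≡ ζ ^ 3 + 1#) where

    e : ∀ {k} → Vec Bool k → Carrier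
    e [] = 0#
    e (b ∷ v) = bit b + ζ * e v

    bit-xor : ∀ a b → bit (a xor b) ≡ bit a + bit b
    bit-xor false b = sym (+-identityˡ _)
    bit-xor true false = sym (+-identityʳ _)
    bit-xor true true = sym 1+1≡0

    e-⊕ : ∀ {k} (v w : Vec Bool k) → e (v ⊕ w) ≡ e v + e w
    e-⊕ [] [] = sym (+-identityˡ 0#)
    e-⊕ (a ∷ v) (b ∷ w) = trans (cong₂ (λ x y → x + ζ * y) (bit-xor a b) (e-⊕ v w))
      (solve 5 (λ a b z v w → (a :+ b) :+ z :* (v :+ w) := (a :+ z :* v) :+ (b :+ z :* w)) refl (bit a) (bit b) ζ (e v) (e w))

    e-t· : ∀ v → e (t· v) ≡ ζ * e v
    e-t· (b₀ ∷ b₁ ∷ b₂ ∷ b₃ ∷ b₄ ∷ b₅ ∷ []) = begin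
      c₅ + ζ * (c₀ + ζ * (c₁ + ζ * (bit (b₂ xor b₅) + ζ * (c₃ + ζ * (c₄ + ζ * 0#)))))
        ≡⟨ cong₂ (λ x y → c₅ + ζ * (c₀ + ζ * (c₁ + ζ * (x + ζ * (c₃ + ζ * y))))) (bit-xor b₂ b₅) (x+z0 c₄) ⟩
      c₅ + ζ * (c₀ + ζ * (c₁ + ζ * ((c₂ + c₅) + ζ * (c₃ + ζ * c₄))))
        ≡⟨ solve 7 (λ z c₀ c₁ c₂ c₃ c₄ c₅ → c₅ :+ z :* (c₀ :+ z :* (c₁ :+ z :* ((c₂ :+ c₅) :+ z :* (c₃ :+ z :* c₄))))
            := z :* (c₀ :+ z :* (c₁ :+ z :* (c₂ :+ z :* (c₃ :+ z :* c₄)))) :+ (z :* (z :* z) :* c₅ :+ c₅)) refl ζ c₀ c₁ c₂ c₃ c₄ c₅ ⟩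
      ζ * (c₀ + ζ * (c₁ + ζ * (c₂ + ζ * (c₃ + ζ * c₄)))) + (ζ * (ζ * ζ) * c₅ + c₅)
        ≡⟨ cong (_+_ (ζ * (c₀ + ζ * (c₁ + ζ * (c₂ + ζ * (c₃ + ζ * c₄)))))) c₅-term ⟩
      ζ * (c₀ + ζ * (c₁ + ζ * (c₂ + ζ * (c₃ + ζ * c₄)))) + ζ * (ζ * (ζ * (ζ * (ζ * ζ)))) * c₅
        ≡⟨ solve 7 (λ z c₀ c₁ c₂ c₃ c₄ c₅ → z :* (c₀ :+ z :* (c₁ :+ z :* (c₂ :+ z :* (c₃ :+ z :* c₄)))) :+ z :* (z :* (z :* (z :* (z :* z)))) :* c₅
            := z :* (c₀ :+ z :* (c₁ :+ z :* (c₂ :+ z :* (c₃ :+ z :* (c₄ :+ z :* c₅)))))) refl ζ c₀ c₁ c₂ c₃ c₄ c₅ ⟩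
      ζ * (c₀ + ζ * (c₁ + ζ * (c₂ + ζ * (c₃ + ζ * (c₄ + ζ * c₅)))))
        ≡⟨ cong (λ x → ζ * (c₀ + ζ * (c₁ + ζ * (c₂ + ζ * (c₃ + ζ * (c₄ + ζ * x)))))) (x+z0 c₅) ⟨
      ζ * (c₀ + ζ * (c₁ + ζ * (c₂ + ζ * (c₃ + ζ * (c₄ + ζ * (c₅ + ζ * 0#))))))
        ∎
      where
      c₀ = bit b₀
      c₁ = bit b₁
      c₂ = bit b₂
      c₃ = bit b₃
      c₄ = bit b₄
      c₅ = bit b₅
      x+z0 : ∀ x → x + ζ * 0# ≡ x
      x+z0 x = trans (cong (_+_ x) (zeroʳ ζ)) (+-identityʳ x)
      c₅-term : ζ * (ζ * ζ) * c₅ + c₅ ≡ ζ * (ζ * (ζ * (ζ * (ζ * ζ)))) * c₅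
      c₅-term = begin
        ζ * (ζ * ζ) * c₅ + c₅ ≡⟨ cong₂ _+_ (cong (λ x → ζ * (ζ * x) * c₅) (sym (*-identityʳ ζ))) (sym (*-identityˡ c₅)) ⟩
        ζ ^ 3 * c₅ + 1# * c₅ ≡⟨ distribʳ c₅ (ζ ^ 3) 1# ⟨
        (ζ ^ 3 + 1#) * c₅ ≡⟨ cong (_* c₅) ζ⁶ ⟨
        ζ ^ 6 * c₅ ≡⟨ cong (λ x → ζ * (ζ * (ζ * (ζ * (ζ * x)))) * c₅) (*-identityʳ ζ) ⟩
        ζ * (ζ * (ζ * (ζ * (ζ * ζ)))) * c₅ ∎

    e-replicate : ∀ k → e (replicate k false) ≡ 0#
    e-replicate zero = refl
    e-replicate (suc k) = trans (+-identityˡ _) (trans (cong (ζ *_) (e-replicate k)) (zeroʳ ζ))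

    e-𝟙 : e 𝟙 ≡ 1#
    e-𝟙 = trans (cong (λ x → 1# + ζ * x) (e-replicate 5)) (trans (cong (_+_ 1#) (zeroʳ ζ)) (+-identityʳ 1#))

    e-⊗ : ∀ {k} (v : Vec Bool k) w → e (v ⊗ w) ≡ e v * e w
    e-⊗ [] w = trans (e-replicate 6) (sym (zeroˡ _))
    e-⊗ (b ∷ v) w = trans (e-⊕ (if b then w else 𝟘) (t· (v ⊗ w))) (trans (cong₂ _+_ (e-if b) (trans (e-t· (v ⊗ w)) (cong (ζ *_) (e-⊗ v w))))
      (solve 4 (λ b z v w → b :* w :+ z :* (v :* w) := (b :+ z :* v) :* w) refl (bit b) ζ (e v) (e w)))
      where
      e-if : ∀ b → e (if b then w else 𝟘) ≡ bit b * e w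
      e-if false = trans (e-replicate 6) (sym (zeroˡ _))
      e-if true = sym (*-identityˡ _)

  module Logarithms (e : Bits → Carrier) (e-⊕ : ∀ v w → e (v ⊕ w) ≡ e v + e w) (e-⊗ : ∀ v w → e (v ⊗ w) ≡ e v * e w)
      (e-𝟘 : e 𝟘 ≡ 0#) (e-𝟙 : e 𝟙 ≡ 1#) where

    e-⊗^ : ∀ v k → e (v ⊗^ k) ≡ e v ^ k
    e-⊗^ v zero = e-𝟙
    e-⊗^ v (suc k) = trans (e-⊗ v (v ⊗^ k)) (cong (e v *_) (e-⊗^ v k))

    -- By `unit-table` every nonzero residue is invertible, so evaluation cannot send one to zero.
    -- This takes the place of a proof that the modulus is irreducible.
    e-injective : ∀ v w → e v ≡ e w → v ≡ w
    e-injective v w eq with unit-table (v ⊕ w)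
    ... | inj₁ v⊕w≡𝟘 = xor≡𝟘 v w v⊕w≡𝟘
    ... | inj₂ unit = ⊥-elim (1≢0 (begin
      1# ≡⟨ e-𝟙 ⟨
      e 𝟙 ≡⟨ cong e unit ⟨
      e ((v ⊕ w) ⊗ inverse (v ⊕ w)) ≡⟨ e-⊗ (v ⊕ w) _ ⟩
      e (v ⊕ w) * e (inverse (v ⊕ w)) ≡⟨ cong (_* e (inverse (v ⊕ w))) (trans (e-⊕ v w) (trans (cong (e v +_) (sym eq)) (x+x≡0 (e v)))) ⟩
      0# * e (inverse (v ⊕ w)) ≡⟨ zeroˡ _ ⟩
      0# ∎))

    abstract
      e-surjective : ∀ x → ∃ λ v → x ≡ e v
      e-surjective = injective⇒surjective e (λ {v} {w} → e-injective v w) (all-vectors 6) (all-vectors-unique 6) (ℕₚ.≤-reflexive (trans order≡ (sym all-vectors-length)))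

    κF : Carrier
    κF = e γ ^ 3

    e-κ^ : ∀ j → e (κ^ j) ≡ κF ^ toℕ j
    e-κ^ j = trans (cong e (κ^-table j)) (trans (e-⊗^ κ (toℕ j)) (cong (_^ toℕ j) (e-⊗^ γ 3)))

    κF^21 : κF ^ 21 ≡ 1#
    κF^21 = trans (^-assocʳ (e γ) 3 21) (^63 eγ≢0)
      where
      eγ≢0 : e γ ≢ 0#
      eγ≢0 eq with e-injective γ 𝟘 (trans eq (sym e-𝟘))
      ... | ()

    κF^-mod : ∀ x → κF ^ x ≡ κF ^ (x % 21)
    κF^-mod x = begin
      κF ^ x ≡⟨ cong (κF ^_) (trans (m≡m%n+[m/n]*n x 21) (cong (x % 21 ℕ.+_) (ℕₚ.*-comm (x / 21) 21))) ⟩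
      κF ^ (x % 21 ℕ.+ 21 ℕ.* (x / 21)) ≡⟨ ^-homo-* κF (x % 21) _ ⟩
      κF ^ (x % 21) * κF ^ (21 ℕ.* (x / 21)) ≡⟨ cong (κF ^ (x % 21) *_) (trans (sym (^-assocʳ κF 21 (x / 21))) (trans (cong (_^ (x / 21)) κF^21) (1^ (x / 21)))) ⟩
      κF ^ (x % 21) * 1# ≡⟨ *-identityʳ _ ⟩
      κF ^ (x % 21) ∎

    κF^-injective : ∀ x y → κF ^ x ≡ κF ^ y → x % 21 ≡ y % 21
    κF^-injective x y eq = trans (sym (Finₚ.toℕ-fromℕ< (m%n<n x 21))) (trans (cong toℕ i≡j) (Finₚ.toℕ-fromℕ< (m%n<n y 21)))
      where
      i = fromℕ< (m%n<n x 21)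
      j = fromℕ< (m%n<n y 21)
      back : ∀ x → e (κ^ (fromℕ< (m%n<n x 21))) ≡ κF ^ x
      back x = trans (e-κ^ (fromℕ< (m%n<n x 21))) (trans (cong (κF ^_) (Finₚ.toℕ-fromℕ< (m%n<n x 21))) (sym (κF^-mod x)))
      i≡j : i ≡ j
      i≡j = κ-table i j (e-injective (κ^ i) (κ^ j) (trans (back x) (trans eq (sym (back y)))))

    K⇒⊗^4 : ∀ v → K (e v) → v ⊗^ 4 ≡ v
    K⇒⊗^4 v kv = e-injective (v ⊗^ 4) v (trans (e-⊗^ v 4) (trans (sym (frob^≡^ 2 (e v))) kv))

    ⊗^4⇒K : ∀ v → v ⊗^ 4 ≡ v → K (e v)
    ⊗^4⇒K v eq = trans (frob^≡^ 2 (e v)) (trans (sym (e-⊗^ v 4)) (cong e eq))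

    subfield⇒K : ∀ {v} → v ∈ subfield → K (e v)
    subfield⇒K {v} v∈ = All.lookup table v∈
      where
      table : All (λ v → K (e v)) subfield
      table = ⊗^4⇒K _ refl ∷ ⊗^4⇒K _ refl ∷ ⊗^4⇒K _ refl ∷ ⊗^4⇒K _ refl ∷ []

    cube-log : ∀ {x} → x ≢ 0# → ∃ λ (j : Fin 21) → x ^ 3 ≡ κF ^ toℕ j
    cube-log {x} x≢0 with e-surjective x
    ... | v , refl with cube-table v
    ...   | inj₁ refl = ⊥-elim (x≢0 e-𝟘)
    ...   | inj₂ (j , eq) = j , trans (sym (e-⊗^ v 3)) (trans (cong e eq) (e-κ^ j))

    record CosetOf (a : Carrier) (i : Fin 5) : Set where
      field
        to : ∀ {f} → K f → Any (λ α → (a - f) ^ 3 ≡ κF ^ toℕ α) (coset i)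
        from : All (λ α → ∃ λ f → K f × (a - f) ^ 3 ≡ κF ^ toℕ α) (coset i)

    find-coset : ∀ {a} → ¬ K a → ∃ (CosetOf a)
    find-coset {a} a∉K with e-surjective a
    ... | v , refl with coset-table v
    ...   | inj₁ eq = ⊥-elim (a∉K (⊗^4⇒K v eq))
    ...   | inj₂ (i , to , from) = i , record
            { to = to′
            ; from = All.map (λ {α} any → let f , f∈ , eq = find any in e f , subfield⇒K f∈ , translate f α eq) from }
      where
      translate : ∀ f α → (v ⊕ f) ⊗^ 3 ≡ κ^ α → (e v - e f) ^ 3 ≡ κF ^ toℕ α
      translate f α eq = trans (cong (λ x → (e v + x) ^ 3) (-x≡x (e f))) (trans (cong (_^ 3) (sym (e-⊕ v f)))
        (trans (sym (e-⊗^ (v ⊕ f) 3)) (trans (cong e eq) (e-κ^ α))))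
      to′ : ∀ {f} → K f → Any (λ α → (e v - f) ^ 3 ≡ κF ^ toℕ α) (coset i)
      to′ {f} kf with e-surjective f
      ... | w , refl = Any.map (λ {α} → translate w α) (All.lookup to (subfield-table w (K⇒⊗^4 w kf)))

    suitable⇒middle : ∀ {a d δ} i i′ j k → CosetOf a i → CosetOf d i′ → δ ^ 3 ≡ κF ^ toℕ j → Suitable i i′ j k → Middle a d δ
    suitable⇒middle {a} {d} {δ} i i′ j k ca cd δ³ (k≢0 , k≢j , k∉a , k∉d) = record
      { s = s ; s≢0 = s≢0
      ; good-s = λ g 1≤g 2g≤6 _ eq → All.lookup k≢0 (exponent g 1≤g 2g≤6) (κF^-injective (toℕ k ℕ.* (2 ℕ.^ g ∸ 1)) 0
          (trans (sym (^-assocʳ κF (toℕ k) _)) (trans (cong (_^ (2 ℕ.^ g ∸ 1)) (sym s³)) eq)))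
      ; good-δ/s = λ g 1≤g 2g≤6 _ eq → All.lookup k≢j (exponent g 1≤g 2g≤6) (κF^-injective (toℕ k ℕ.* (2 ℕ.^ g ∸ 1)) (toℕ j ℕ.* (2 ℕ.^ g ∸ 1))
          (trans (sym (^-assocʳ κF (toℕ k) _)) (trans (cong (_^ (2 ℕ.^ g ∸ 1)) (sym s³)) (trans eq (trans (cong (_^ (2 ℕ.^ g ∸ 1)) δ³) (^-assocʳ κF (toℕ j) _))))))
      ; avoid-a = λ kf eq → let α , α∈ , eq′ = find (CosetOf.to ca kf) in
          All.lookup k∉a α∈ (κF^-injective (toℕ α) (toℕ k) (trans (sym eq′) (trans eq s³)))
      ; avoid-d = λ kf eq → let β , β∈ , eq′ = find (CosetOf.to cd kf) in
          All.lookup k∉d β∈ (κF^-injective (toℕ β ℕ.+ toℕ k) (toℕ j) (trans (^-homo-* κF (toℕ β) (toℕ k)) (trans (cong₂ _*_ (sym eq′) (sym s³)) (trans eq δ³)))) }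
      where
      -- Only s³ is prescribed, and the k-th power of γ has the cube κ^k.
      s = e γ ^ toℕ k
      s³ : s ^ 3 ≡ κF ^ toℕ k
      s³ = ^-comm (e γ) (toℕ k) 3
      s≢0 : s ≢ 0#
      s≢0 eq = ^-nonzero (toℕ k) κF≢0 (trans (sym s³) (trans (cong (_^ 3) eq) (0^ 3 (s≤s z≤n))))
        where
        κF≢0 : κF ≢ 0#
        κF≢0 eq = 1≢0 (trans (sym κF^21) (trans (cong (_^ 21) eq) (0^ 21 (s≤s z≤n))))
      exponent : ∀ g → 1 ≤ g → 2 ℕ.* g ≤ 6 → (2 ℕ.^ g ∸ 1) ∈ Exponents
      exponent 1 _ _ = here refl
      exponent 2 _ _ = there (here refl)
      exponent 3 _ _ = there (there (here refl))
      exponent (suc (suc (suc (suc g)))) _ le = ⊥-elim (ℕₚ.<⇒≱ (ℕₚ.≤ᵇ⇒≤ 7 8 _) (ℕₚ.≤-trans (ℕₚ.*-monoʳ-≤ 2 (ℕₚ.m≤m+n 4 g)) le))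

    -- The row operation replacing the image of the first point of the subline by that of another one.
    module Move {a d δ f} (a∉K : ¬ K a) (d∉K : ¬ K d) (δ≢0 : δ ≢ 0#) (Kf : K f) where

      d-f≢0 : d - f ≢ 0#
      d-f≢0 eq = d∉K (subst K (sym (x-y≡0⇒x≡y eq)) Kf)

      i = (d - f) ⁻¹
      i≢0 = ⁻¹-nonzero d-f≢0
      a′ = a - i * δ
      d′ = - i
      δ′ = i * (i * δ)
      D = mat (- f) 1# (- 1#) 0#

      KU-D′ : KUnimodular D
      KU-D′ = kuni (kmat (K-neg Kf) K-1 (K-neg K-1) K-0) (trans (cong₂ _-_ (zeroʳ (- f)) (*-identityˡ (- 1#))) (trans (+-identityˡ _) (-‿involutive 1#)))

      equation : D ·M N a d δ ~ N a′ d′ δ′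
      equation = scaled i i≢0 (mat≡
        (begin
          a - i * δ ≡⟨ cong (_- i * δ) (x⁻¹*xy a d-f≢0) ⟨
          i * ((d - f) * a) - i * δ ≡⟨ solve 5 (λ i d f a δ → i :* ((d :- f) :* a) :- i :* δ := i :* ((:- f) :* a :+ (a :* d :- δ))) refl i d f a δ ⟩
          i * ((- f) * a + (a * d - δ)) ≡⟨ cong (λ x → i * ((- f) * a + x)) (*-identityˡ _) ⟨
          i * ((- f) * a + 1# * (a * d - δ)) ∎)
        (begin
          1# ≡⟨ inverseˡ d-f≢0 ⟨
          i * (d - f) ≡⟨ cong (i *_) (+-comm d (- f)) ⟩
          i * (- f + d) ≡⟨ cong₂ (λ x y → i * (x + y)) (*-identityʳ (- f)) (*-identityˡ d) ⟨
          i * ((- f) * 1# + 1# * d) ∎)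
        (begin
          a′ * d′ - δ′ ≡⟨ solve 3 (λ a i δ → (a :- i :* δ) :* (:- i) :- i :* (i :* δ) := i :* (:- a)) refl a i δ ⟩
          i * (- a) ≡⟨ cong (i *_) (trans (cong (_+ 0# * (a * d - δ)) (trans (sym (-‿distribˡ-* 1# a)) (cong -_ (*-identityˡ a)))) (trans (cong (- a +_) (zeroˡ _)) (+-identityʳ _))) ⟨
          i * ((- 1#) * a + 0# * (a * d - δ)) ∎)
        (begin
          - i ≡⟨ cong -_ (*-identityʳ i) ⟨
          - (i * 1#) ≡⟨ -‿distribʳ-* i 1# ⟩
          i * - 1# ≡⟨ cong (i *_) (trans (cong₂ _+_ (*-identityʳ (- 1#)) (zeroˡ d)) (+-identityʳ _)) ⟨
          i * ((- 1#) * 1# + 0# * d) ∎))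

      d′∉K : ¬ K d′
      d′∉K kd′ = d∉K (subst K (solve 2 (λ d f → (d :- f) :+ f := d) refl d f)
        (K-+ (K-cancelˡ i≢0 (subst K (-‿involutive i) (K-neg kd′)) (subst K (sym (inverseˡ d-f≢0)) K-1)) Kf))

      module _ ci (j β : Fin 21) (ca : CosetOf a ci) (δ³ : δ ^ 3 ≡ κF ^ toℕ j) (d-f³ : (d - f) ^ 3 ≡ κF ^ toℕ β) (mov : Movable ci j β) where

        i³ : i ^ 3 * κF ^ toℕ β ≡ 1#
        i³ = trans (cong (i ^ 3 *_) (sym d-f³)) (trans (*-comm _ _) (^-inverse 3 d-f≢0))

        -- If a′ were in K, then a - a′ = iδ would be one of the differences a - f, and the
        -- logarithm of its cube is j - β; the first clause of `Movable` rules this out.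
        a′∉K : ¬ K a′
        a′∉K ka′ = let α , α∈ , eq = find (CosetOf.to ca ka′) in
          All.lookup (proj₁ mov) α∈ (κF^-injective (toℕ α ℕ.+ toℕ β) (toℕ j) (begin
            κF ^ (toℕ α ℕ.+ toℕ β) ≡⟨ ^-homo-* κF (toℕ α) (toℕ β) ⟩
            κF ^ toℕ α * κF ^ toℕ β ≡⟨ cong (_* κF ^ toℕ β) eq ⟨
            (a - a′) ^ 3 * κF ^ toℕ β ≡⟨ cong (λ x → x ^ 3 * κF ^ toℕ β) (solve 2 (λ a e → a :- (a :- e) := e) refl a (i * δ)) ⟩
            (i * δ) ^ 3 * κF ^ toℕ β ≡⟨ cong (_* κF ^ toℕ β) (^-distrib-* i δ 3) ⟩
            (i ^ 3 * δ ^ 3) * κF ^ toℕ β ≡⟨ solve 3 (λ x y z → (x :* y) :* z := (x :* z) :* y) refl (i ^ 3) (δ ^ 3) (κF ^ toℕ β) ⟩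
            (i ^ 3 * κF ^ toℕ β) * δ ^ 3 ≡⟨ cong (_* δ ^ 3) i³ ⟩
            1# * δ ^ 3 ≡⟨ *-identityˡ _ ⟩
            δ ^ 3 ≡⟨ δ³ ⟩
            κF ^ toℕ j ∎))

        δ′-log : ∀ {x} → δ′ ^ 3 ≡ κF ^ x → (x ℕ.+ (toℕ β ℕ.+ toℕ β)) % 21 ≡ toℕ j % 21
        δ′-log {x} eq = κF^-injective (x ℕ.+ (toℕ β ℕ.+ toℕ β)) (toℕ j) (begin
          κF ^ (x ℕ.+ (toℕ β ℕ.+ toℕ β)) ≡⟨ trans (^-homo-* κF x _) (cong (κF ^ x *_) (^-homo-* κF (toℕ β) (toℕ β))) ⟩
          κF ^ x * (κF ^ toℕ β * κF ^ toℕ β) ≡⟨ cong (_* (κF ^ toℕ β * κF ^ toℕ β)) eq ⟨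
          (i * (i * δ)) ^ 3 * (κF ^ toℕ β * κF ^ toℕ β) ≡⟨ cong (_* (κF ^ toℕ β * κF ^ toℕ β)) (trans (^-distrib-* i (i * δ) 3) (cong (i ^ 3 *_) (^-distrib-* i δ 3))) ⟩
          (i ^ 3 * (i ^ 3 * δ ^ 3)) * (κF ^ toℕ β * κF ^ toℕ β) ≡⟨ solve 3 (λ x y z → (x :* (x :* y)) :* (z :* z) := (x :* z) :* ((x :* z) :* y)) refl (i ^ 3) (δ ^ 3) (κF ^ toℕ β) ⟩
          (i ^ 3 * κF ^ toℕ β) * ((i ^ 3 * κF ^ toℕ β) * δ ^ 3) ≡⟨ cong (λ o → o * (o * δ ^ 3)) i³ ⟩
          1# * (1# * δ ^ 3) ≡⟨ trans (*-identityˡ _) (*-identityˡ _) ⟩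
          δ ^ 3 ≡⟨ δ³ ⟩
          κF ^ toℕ j ∎)

        moved : Reduction a d δ
        moved =
          let i₁ , ca′ = find-coset a′∉K
              i₂ , cd′ = find-coset d′∉K
              j′ , δ′³ = cube-log δ′≢0
          in record { KU-D = KU-D′ ; a′∉K = a′∉K ; d′∉K = d′∉K ; δ′≢0 = δ′≢0 ; equivalent = equation ; middle = choose i₁ i₂ j′ ca′ cd′ δ′³ (suitable-unless i₁ i₂ j′) }
          where
          δ′≢0 = *-nonzero i≢0 (*-nonzero i≢0 δ≢0)
          choose : ∀ i₁ i₂ j′ → CosetOf a′ i₁ → CosetOf d′ i₂ → δ′ ^ 3 ≡ κF ^ toℕ j′ → ((toℕ j′ ≡ 7 ⊎ toℕ j′ ≡ 14) ⊎ ∃ λ k → Suitable i₁ i₂ j′ k) → Middle a′ d′ δ′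
          choose _ _ _ _ _ δ′³ (inj₁ (inj₁ j′≡7)) = ⊥-elim (proj₁ (proj₂ mov) (δ′-log {7} (trans δ′³ (cong (κF ^_) j′≡7))))
          choose _ _ _ _ _ δ′³ (inj₁ (inj₂ j′≡14)) = ⊥-elim (proj₂ (proj₂ mov) (δ′-log {14} (trans δ′³ (cong (κF ^_) j′≡14))))
          choose i₁ i₂ j′ ca′ cd′ δ′³ (inj₂ (k , suit)) = suitable⇒middle i₁ i₂ j′ k ca′ cd′ δ′³ suit

    reduction : ∀ {a d δ} → ¬ K a → ¬ K d → δ ≢ 0# → Reduction a d δ
    reduction {a} {d} {δ} a∉K d∉K δ≢0 =
      let i , ca = find-coset a∉K
          i′ , cd = find-coset d∉K
          j , δ³ = cube-log δ≢0
      in choose i i′ j ca cd δ³ (suitable-or-movable i i′ j)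
      where
      choose : ∀ i i′ j → CosetOf a i → CosetOf d i′ → δ ^ 3 ≡ κF ^ toℕ j → (∃ λ k → Suitable i i′ j k) ⊎ Any (Movable i j) (coset i′) → Reduction a d δ
      choose i i′ j ca cd δ³ (inj₁ (k , suit)) = record
        { KU-D = KU-I ; a′∉K = a∉K ; d′∉K = d∉K ; δ′≢0 = δ≢0
        ; equivalent = ≡⇒~ (·M-identityˡ (N a d δ)) ; middle = suitable⇒middle i i′ j k ca cd δ³ suit }
      choose i i′ j ca cd δ³ (inj₂ movable) =
        let β , β∈ , mov = find movable
            f , Kf , d-f³ = All.lookup (CosetOf.from cd) β∈
        in Move.moved a∉K d∉K δ≢0 Kf i j β ca δ³ d-f³ mov

  reduction-64 : ∀ {a d δ} → ¬ K a → ¬ K d → δ ≢ 0# → Reduction a d δ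
  reduction-64 = from-root primitive-ninth-root
    where
    from-root : (∃ λ ζ → ζ ^ 9 ≡ 1# × ζ ^ 3 ≢ 1#) → ∀ {a d δ} → ¬ K a → ¬ K d → δ ≢ 0# → Reduction a d δ
    from-root (ζ , ζ⁹≡1 , ζ³≢1) = Logarithms.reduction e e-⊕ e-⊗ (e-replicate 6) e-𝟙
      where open Evaluation ζ (ninth-root-equation ζ⁹≡1 ζ³≢1)

-- The normaliser of PSL(2,K), and the case n = 2m

module Normaliser (F : FiniteField) (p n : ℕ) (pp : Prime p) (order≡ : order F ≡ p ℕ.^ n) (1≤n : 1 ≤ n) (m : ℕ) where
  open FiniteField F hiding (order)
  open FieldFacts F
  open PΓL F p n hiding (_≈_; e)
  open Frobenius F p n pp order≡
  open Matrices F p n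
  open Unipotents F p n
  open SemilinearGroup F p n pp order≡ 1≤n using (module Frob^)
  open Subfield F p n pp order≡ 1≤n m
  open NormalForms F p n pp order≡ 1≤n m hiding (N)

  K-sqrt : p ≡ 2 → ∀ {x} → K (x * x) → K x
  K-sqrt p≡2 {x} kxx = frob^-inj 1 (trans (square (frob^ m x)) (trans (sym (frob^-* m x x)) (trans kxx (sym (square x)))))
    where
    pow≡ : ∀ {k} → k ≡ 2 → ∀ y → y ^ k ≡ y * y
    pow≡ refl y = cong (y *_) (*-identityʳ y)
    square : ∀ y → frob y ≡ y * y
    square y = trans (pow≡^ y p) (pow≡ p≡2 y)

  -- In characteristic 2 the ratio of the two squares lies in K and has its unique square root
  -- there. Otherwise the last two entries differ by 2sxy, whose quotient by 2sx² is y/x.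
  square-ratio : ∀ {s x y δ} → s ≢ 0# → x ≢ 0# → K (s * (x * x)) → K (s * (y * y)) → K (s * (δ - x * y)) → K (s * (δ + x * y)) → K ((x ⁻¹) * y)
  square-ratio {s} {x} {y} {δ} s≢0 x≢0 kxx kyy k- k+ with p ℕₚ.≟ 2
  ... | yes p≡2 = K-sqrt p≡2 (K-cancelˡ (*-nonzero s≢0 (*-nonzero x≢0 x≢0)) kxx (subst K (begin
      s * (y * y) ≡⟨ cong (λ o → s * (o * o)) (x*x⁻¹y y x≢0) ⟨
      s * ((x * ((x ⁻¹) * y)) * (x * ((x ⁻¹) * y))) ≡⟨ solve 3 (λ s x z → s :* ((x :* z) :* (x :* z)) := (s :* (x :* x)) :* (z :* z)) refl s x ((x ⁻¹) * y) ⟩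
      (s * (x * x)) * (((x ⁻¹) * y) * ((x ⁻¹) * y)) ∎) kyy))
    where open ≡-Reasoning
  ... | no p≢2 = K-cancelˡ (*-nonzero 2≢0 (*-nonzero s≢0 (*-nonzero x≢0 x≢0))) (K-* (K-+ K-1 K-1) kxx) (subst K (begin
      s * (δ + x * y) - s * (δ - x * y) ≡⟨ solve 3 (λ s δ z → s :* (δ :+ z) :- s :* (δ :- z) := s :* z :+ s :* z) refl s δ (x * y) ⟩
      s * (x * y) + s * (x * y) ≡⟨ cong₂ _+_ (*-identityˡ _) (*-identityˡ _) ⟨
      1# * (s * (x * y)) + 1# * (s * (x * y)) ≡⟨ distribʳ _ 1# 1# ⟨
      (1# + 1#) * (s * (x * y)) ≡⟨ cong (λ o → (1# + 1#) * (s * (x * o))) (x*x⁻¹y y x≢0) ⟨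
      (1# + 1#) * (s * (x * (x * ((x ⁻¹) * y)))) ≡⟨ solve 4 (λ t s x z → t :* (s :* (x :* (x :* z))) := (t :* (s :* (x :* x))) :* z) refl (1# + 1#) s x ((x ⁻¹) * y) ⟩
      ((1# + 1#) * (s * (x * x))) * ((x ⁻¹) * y) ∎) (K-+ k+ (K-neg k-)))
    where
    open ≡-Reasoning
    2≢0 = OddCharacteristic.2≢0 F p pp p≢2 p×1≡0

  rationalPair-square : ∀ {s x y δ} → s ≢ 0# → K (s * (x * x)) → K (s * (y * y)) → K (s * (δ - x * y)) → K (s * (δ + x * y)) → RationalPair x y
  rationalPair-square {s} {x} {y} s≢0 kxx kyy k- k+ with x ≟ 0#
  ... | no x≢0 = x ⁻¹ , ⁻¹-nonzero x≢0 , subst K (sym (inverseˡ x≢0)) K-1 , square-ratio s≢0 x≢0 kxx kyy k- k+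
  ... | yes refl with y ≟ 0#
  ...   | yes refl = 1# , 1≢0 , subst K (sym (zeroʳ 1#)) K-0 , subst K (sym (zeroʳ 1#)) K-0
  ...   | no y≢0 = y ⁻¹ , ⁻¹-nonzero y≢0 , subst K (sym (zeroʳ _)) K-0 , subst K (sym (inverseˡ y≢0)) K-1

  rational-entries : ∀ {x y δ} → Rational (mat (δ - x * y) (x * x) (- (y * y)) (δ + x * y)) → RationalPair x y
  rational-entries (B , kmat ka kb kc kd , scaled s s≢0 refl) =
    rationalPair-square s≢0 kb (subst K (trans (cong -_ (sym (-‿distribʳ-* s _))) (-‿involutive _)) (K-neg kc)) ka kd

  rational-entries⁻ : ∀ {x y δ} → Rational (mat (δ + x * y) (- (x * x)) (y * y) (δ - x * y)) → RationalPair x y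
  rational-entries⁻ (B , kB , eq) = rational-entries
    (adj B , KMat-adj kB , ~-trans (≡⇒~ (mat≡ refl (sym (-‿involutive _)) refl refl)) (adj-~ eq))

  -- The unipotent matrix fixing the column (1 , 1).
  w : Mat
  w = mat (1# + 1#) (- 1#) 1# 0#

  -- The three unipotent matrices fix the columns (1 0), (0 1) and (1 1). The entries of a conjugate
  -- are quadratic in the image of the fixed column, so its rationality makes that image rational,
  -- and three rational images make `A` rational.
  normalises⇒rational : ∀ A → det A ≢ 0# → Rational (u 1# ^^ A) → Rational (v 1# ^^ A) → Rational (w ^^ A) → Rational A
  normalises⇒rational A@(mat a b c d) detA ru rv rw = columns-rational detA
      (rational-entries (Rational-~ (≡⇒~ conj-u) ru)) (rational-entries⁻ (Rational-~ (≡⇒~ conj-v) rv)) (rational-entries⁻ (Rational-~ (≡⇒~ conj-w) rw))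
    where
    δ = det A
    conj-u : u 1# ^^ A ≡ mat (δ - a * c) (a * a) (- (c * c)) (δ + a * c)
    conj-u = trans (cong (_·M adj A) (·u 1# a b c d)) (trans (cong₂ (λ x y → mat a (x + b) c (y + d) ·M adj A) (*-identityʳ a) (*-identityʳ c)) (mat≡
      (solve 4 (λ a b c d → a :* d :+ (a :+ b) :* (:- c) := (a :* d :+ :- (b :* c)) :- a :* c) refl a b c d)
      (solve 2 (λ a b → a :* (:- b) :+ (a :+ b) :* a := a :* a) refl a b)
      (solve 2 (λ c d → c :* d :+ (c :+ d) :* (:- c) := :- (c :* c)) refl c d)
      (solve 4 (λ a b c d → c :* (:- b) :+ (c :+ d) :* a := (a :* d :+ :- (b :* c)) :+ a :* c) refl a b c d)))
    conj-v : v 1# ^^ A ≡ mat (δ + b * d) (- (b * b)) (d * d) (δ - b * d)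
    conj-v = trans (cong (_·M adj A) (·v 1# a b c d)) (trans (cong₂ (λ x y → mat (a + x) b (c + y) d ·M adj A) (*-identityʳ b) (*-identityʳ d)) (mat≡
      (solve 4 (λ a b c d → (a :+ b) :* d :+ b :* (:- c) := (a :* d :+ :- (b :* c)) :+ b :* d) refl a b c d)
      (solve 2 (λ a b → (a :+ b) :* (:- b) :+ b :* a := :- (b :* b)) refl a b)
      (solve 2 (λ c d → (c :+ d) :* d :+ d :* (:- c) := d :* d) refl c d)
      (solve 4 (λ a b c d → (c :+ d) :* (:- b) :+ d :* a := (a :* d :+ :- (b :* c)) :- b :* d) refl a b c d)))
    conj-w : w ^^ A ≡ mat (δ + (a + b) * (c + d)) (- ((a + b) * (a + b))) ((c + d) * (c + d)) (δ - (a + b) * (c + d))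
    conj-w = trans (cong (_·M adj A) (mat≡ (row₁ a b) (row₂ a b) (row₁ c d) (row₂ c d))) (mat≡
      (solve 4 (λ a b c d → (a :+ a :+ b) :* d :+ (:- a) :* (:- c) := (a :* d :+ :- (b :* c)) :+ (a :+ b) :* (c :+ d)) refl a b c d)
      (solve 2 (λ a b → (a :+ a :+ b) :* (:- b) :+ (:- a) :* a := :- ((a :+ b) :* (a :+ b))) refl a b)
      (solve 2 (λ c d → (c :+ c :+ d) :* d :+ (:- c) :* (:- c) := (c :+ d) :* (c :+ d)) refl c d)
      (solve 4 (λ a b c d → (c :+ c :+ d) :* (:- b) :+ (:- c) :* a := (a :* d :+ :- (b :* c)) :- (a :+ b) :* (c :+ d)) refl a b c d))
      where
      row₁ : ∀ x y → x * (1# + 1#) + y * 1# ≡ x + x + y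
      row₁ x y = cong₂ _+_ (trans (distribˡ x 1# 1#) (cong₂ _+_ (*-identityʳ x) (*-identityʳ x))) (*-identityʳ y)
      row₂ : ∀ x y → x * (- 1#) + y * 0# ≡ - x
      row₂ x y = trans (x+y0 _ y) (trans (sym (-‿distribʳ-* x 1#)) (cong -_ (*-identityʳ x)))

  infixl 6 _+M_
  _+M_ : Mat → Mat → Mat
  mat a b c d +M mat a′ b′ c′ d′ = mat (a + a′) (b + b′) (c + c′) (d + d′)

  -- For n = 2m the map τ = x ↦ x^(p^m) is an involution, and any nonscalar τ-fixed D that commutes with
  -- A⁻¹τ(A) has a τ-fixed conjugate ADA⁻¹.
  module Involution (n≡2m : n ≡ 2 ℕ.* m) {η} (η∉K : ¬ K η) {ξ} (Kξ : K ξ) (ξ≢0 : ξ ≢ 0#) (ξ≢1 : ξ ≢ 1#) where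

    τ : Carrier → Carrier
    τ = frob^ m

    ττ : ∀ x → τ (τ x) ≡ x
    ττ x = trans (sym (frob^-∘ m m x)) (trans (cong (λ k → frob^ k x) (trans (cong (m ℕ.+_) (sym (ℕₚ.+-identityʳ m))) (sym n≡2m))) (frob^n x))

    τM : Mat → Mat
    τM = mapMat τ

    τ-fixed⇒KMat : ∀ A → τM A ≡ A → KMat A
    τ-fixed⇒KMat (mat a b c d) eq = kmat (mat-a eq) (mat-b eq) (mat-c eq) (mat-d eq)

    -- A monic quadratic has at most two roots, while 0, 1 and ξ are three elements of K. Here the
    -- assumption q₀ > 2 enters, through the existence of ξ.
    quadratic-nonroot : ∀ s t → ∃ λ y → K y × t + y * (s + y * 1#) ≢ 0#
    quadratic-nonroot s t with t + 0# * (s + 0# * 1#) ≟ 0# | t + 1# * (s + 1# * 1#) ≟ 0# | t + ξ * (s + ξ * 1#) ≟ 0#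
    ... | no r | _ | _ = 0# , K-0 , r
    ... | yes _ | no r | _ = 1# , K-1 , r
    ... | yes _ | yes _ | no r = ξ , Kξ , r
    ... | yes r₀ | yes r₁ | yes r₂ = ⊥-elim (ℕₚ.<⇒≱ (ℕₚ.n<1+n 2) (roots≤degree (t ∷ s ∷ []) (0# ∷ 1# ∷ ξ ∷ [])
        ((0≢1 ∷ (λ e → ξ≢0 (sym e)) ∷ []) ∷ ((λ e → ξ≢1 (sym e)) ∷ []) ∷ [] ∷ []) (r₀ ∷ r₁ ∷ r₂ ∷ [])))

    det-shift : ∀ A y → det (A +M scale y I₂) ≡ det A + y * ((Mat.a A + Mat.d A) + y * 1#)
    det-shift (mat a b c d) y = trans (cong₂ _-_ (cong₂ _*_ (cong (_+_ a) (*-identityʳ y)) (cong (_+_ d) (*-identityʳ y))) (cong₂ _*_ (o b) (o c)))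
      (trans (solve 5 (λ a b c d y → (a :+ y) :* (d :+ y) :- b :* c := (a :* d :+ :- (b :* c)) :+ y :* ((a :+ d) :+ y)) refl a b c d y)
        (cong (λ z → det (mat a b c d) + y * ((a + d) + z)) (sym (*-identityʳ y))))
      where
      o : ∀ x → x + y * 0# ≡ x
      o x = x+y0 x y

    Scalar : Mat → Set
    Scalar A = (Mat.b A ≡ 0#) × (Mat.c A ≡ 0#) × (Mat.a A - Mat.d A ≡ 0#)

    -- Combinations of N, adj N and the identity commute with N. The multiple y of the identity is
    -- chosen to make the determinant nonzero, and η outside K keeps the combination from being
    -- scalar.
    generic-commuting : ∀ N → τM N ≡ adj N → ¬ Scalar N → ∃ λ D → KMat D × det D ≢ 0# × ¬ (D ~ I₂) × D ·M N ≡ N ·M D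
    generic-commuting N@(mat a b c d) τN≡ nonscalar =
      D₀ +M scale y I₂ , kmat (K-+ Ka (K-* Ky K-1)) (K-+ Kb (K-* Ky K-0)) (K-+ Kc (K-* Ky K-0)) (K-+ Kd (K-* Ky K-1)) ,
      (λ eq → proj₂ (proj₂ found) (trans (sym (det-shift D₀ y)) eq)) , nonscalar-D , commutes
      where
      -- This is ηN + τ(ηN), because τ(N) = adj N.
      D₀ = mat (η * a + τ η * d) (η * b + τ η * - b) (η * c + τ η * - c) (η * d + τ η * a)
      fixed : ∀ {x x′} → τ x ≡ x′ → τ x′ ≡ x → K (η * x + τ η * x′)
      fixed {x} {x′} e e′ = trans (frob^-+ m _ _) (trans (cong₂ _+_ (trans (frob^-* m η x) (cong (τ η *_) e)) (trans (frob^-* m (τ η) x′) (cong₂ _*_ (ττ η) e′))) (+-comm _ _))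
      back : ∀ {x x′} → τ x ≡ x′ → τ x′ ≡ x
      back {x} e = trans (cong τ (sym e)) (ττ x)
      Ka = fixed (mat-a τN≡) (back (mat-a τN≡))
      Kb = fixed (mat-b τN≡) (back (mat-b τN≡))
      Kc = fixed (mat-c τN≡) (back (mat-c τN≡))
      Kd = fixed (mat-d τN≡) (back (mat-d τN≡))
      found = quadratic-nonroot ((η * a + τ η * d) + (η * d + τ η * a)) (det D₀)
      y = proj₁ found
      Ky = proj₁ (proj₂ found)
      η-τη≢0 : η - τ η ≢ 0#
      η-τη≢0 eq = η∉K (sym (x-y≡0⇒x≡y eq))
      nonscalar-D : ¬ (D₀ +M scale y I₂ ~ I₂)
      nonscalar-D (scaled s s≢0 eq) = nonscalar
        ( zero-product (trans (sym (off b)) (zero-product (sym (mat-b eq)) s≢0)) η-τη≢0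
        , zero-product (trans (sym (off c)) (zero-product (sym (mat-c eq)) s≢0)) η-τη≢0
        , zero-product (trans (solve 5 (λ e t a d z → (e :- t) :* (a :- d) := (e :* a :+ t :* d :+ z) :- (e :* d :+ t :* a :+ z)) refl η (τ η) a d (y * 1#))
            (x≡y⇒x-y≡0 (*-cancelˡ s≢0 (trans (sym (mat-a eq)) (mat-d eq))))) η-τη≢0 )
        where
        off : ∀ x → η * x + τ η * - x + y * 0# ≡ (η - τ η) * x
        off x = trans (x+y0 _ y) (solve 3 (λ e t x → e :* x :+ t :* (:- x) := (e :- t) :* x) refl η (τ η) x)
      commutes : (D₀ +M scale y I₂) ·M N ≡ N ·M (D₀ +M scale y I₂)
      commutes = trans (cong (_·M N) D≡) (trans (mat≡
        (solve 7 (λ e t y a b c d → (e :* a :+ t :* d :+ y) :* a :+ (e :* b :+ t :* (:- b)) :* c := a :* (e :* a :+ t :* d :+ y) :+ b :* (e :* c :+ t :* (:- c))) refl η (τ η) y a b c d)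
        (solve 6 (λ e t y a b d → (e :* a :+ t :* d :+ y) :* b :+ (e :* b :+ t :* (:- b)) :* d := a :* (e :* b :+ t :* (:- b)) :+ b :* (e :* d :+ t :* a :+ y)) refl η (τ η) y a b d)
        (solve 6 (λ e t y a c d → (e :* c :+ t :* (:- c)) :* a :+ (e :* d :+ t :* a :+ y) :* c := c :* (e :* a :+ t :* d :+ y) :+ d :* (e :* c :+ t :* (:- c))) refl η (τ η) y a c d)
        (solve 7 (λ e t y a b c d → (e :* c :+ t :* (:- c)) :* b :+ (e :* d :+ t :* a :+ y) :* d := c :* (e :* b :+ t :* (:- b)) :+ d :* (e :* d :+ t :* a :+ y)) refl η (τ η) y a b c d))
        (cong (N ·M_) (sym D≡)))
        where
        D≡ : D₀ +M scale y I₂ ≡ mat (η * a + τ η * d + y) (η * b + τ η * - b) (η * c + τ η * - c) (η * d + τ η * a + y)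
        D≡ = mat≡ (cong (_+_ _) (*-identityʳ y)) (x+y0 _ y) (x+y0 _ y) (cong (_+_ _) (*-identityʳ y))

    scalar-commuting : ∀ N → Scalar N → u 1# ·M N ≡ N ·M u 1#
    scalar-commuting (mat a _ _ d) (refl , refl , a-d≡0) = trans (u· 1# a 0# 0# d) (trans
      (mat≡ (x+y0 a 1#) (trans (+-identityˡ _) (trans (*-identityˡ d) (trans (sym (x-y≡0⇒x≡y a-d≡0)) (trans (sym (*-identityʳ a)) (sym (+-identityʳ _)))))) refl (sym (0x+y 1# d)))
      (sym (·u 1# a 0# 0# d)))

    u1≁I : ¬ (u 1# ~ I₂)
    u1≁I (scaled s s≢0 eq) = s≢0 (trans (sym (*-identityʳ s)) (sym (mat-b eq)))

    commuting : ∀ N → τM N ≡ adj N → ∃ λ D → KMat D × det D ≢ 0# × ¬ (D ~ I₂) × D ·M N ≡ N ·M D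
    commuting N τN≡ with Mat.b N ≟ 0# | Mat.c N ≟ 0# | Mat.a N - Mat.d N ≟ 0#
    ... | no b≢0 | _ | _ = generic-commuting N τN≡ (λ sc → b≢0 (proj₁ sc))
    ... | yes _ | no c≢0 | _ = generic-commuting N τN≡ (λ sc → c≢0 (proj₁ (proj₂ sc)))
    ... | yes _ | yes _ | no a≢d = generic-commuting N τN≡ (λ sc → a≢d (proj₂ (proj₂ sc)))
    ... | yes b≡0 | yes c≡0 | yes a≡d = u 1# , KMat-u1 , (λ eq → 1≢0 (trans (sym (det-u 1#)) eq)) , u1≁I , scalar-commuting N (b≡0 , c≡0 , a≡d)

    adj-adj : ∀ A → adj (adj A) ≡ A
    adj-adj (mat a b c d) = mat≡ refl (-‿involutive b) (-‿involutive c) refl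

    τM-adj : ∀ A → τM (adj A) ≡ adj (τM A)
    τM-adj (mat a b c d) = mat≡ refl (frob^-neg m b) (frob^-neg m c) refl

    τMτM : ∀ A → τM (τM A) ≡ A
    τMτM (mat a b c d) = mat≡ (ττ a) (ττ b) (ττ c) (ττ d)

    τM-KMat : ∀ {D} → KMat D → τM D ≡ D
    τM-KMat {mat _ _ _ _} (kmat a b c d) = mat≡ a b c d

    -- Commutation gives E · τ(A) = δ · τ(A) · D for E = D ^^ A, hence τ(δ)E = δτ(E). Thus δ⁻¹E is
    -- fixed by τ.
    conjugate-rational : ∀ A D → det A ≢ 0# → KMat D → D ·M (adj A ·M τM A) ≡ (adj A ·M τM A) ·M D → Rational (D ^^ A)
    conjugate-rational A D detA kD comm = scale (δ ⁻¹) E , τ-fixed⇒KMat _ fixed , scale~ (⁻¹-nonzero detA)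
      where
      open ≡-Reasoning
      δ = det A
      N = adj A ·M τM A
      E = D ^^ A
      τδ≢0 : τ δ ≢ 0#
      τδ≢0 = frob^-nonzero m detA
      AN : A ·M N ≡ scale δ (τM A)
      AN = trans (sym (·M-assoc A (adj A) (τM A))) (trans (cong (_·M τM A) (·M-adj A)) (trans (scale-·M δ I₂ (τM A)) (cong (scale δ) (·M-identityˡ _))))
      E·τA : E ·M τM A ≡ scale δ (τM A ·M D)
      E·τA = begin
        ((A ·M D) ·M adj A) ·M τM A ≡⟨ ·M-assoc (A ·M D) (adj A) (τM A) ⟩
        (A ·M D) ·M N ≡⟨ ·M-assoc A D N ⟩
        A ·M (D ·M N) ≡⟨ cong (A ·M_) comm ⟩
        A ·M (N ·M D) ≡⟨ ·M-assoc A N D ⟨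
        (A ·M N) ·M D ≡⟨ cong (_·M D) AN ⟩
        scale δ (τM A) ·M D ≡⟨ scale-·M δ (τM A) D ⟩
        scale δ (τM A ·M D) ∎
      τE : τM E ≡ (τM A ·M D) ·M adj (τM A)
      τE = trans (Frob^.mapMat-· m (A ·M D) (adj A)) (cong₂ _·M_ (trans (Frob^.mapMat-· m A D) (cong (τM A ·M_) (τM-KMat kD))) (τM-adj A))
      relation : scale (τ δ) E ≡ scale δ (τM E)
      relation = begin
        scale (τ δ) E ≡⟨ cong (scale (τ δ)) (·M-identityʳ E) ⟨
        scale (τ δ) (E ·M I₂) ≡⟨ ·M-scale (τ δ) E I₂ ⟨
        E ·M scale (τ δ) I₂ ≡⟨ cong (λ s → E ·M scale s I₂) (Frob^.mapMat-det m A) ⟨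
        E ·M scale (det (τM A)) I₂ ≡⟨ cong (E ·M_) (·M-adj (τM A)) ⟨
        E ·M (τM A ·M adj (τM A)) ≡⟨ ·M-assoc E (τM A) (adj (τM A)) ⟨
        (E ·M τM A) ·M adj (τM A) ≡⟨ cong (_·M adj (τM A)) E·τA ⟩
        scale δ (τM A ·M D) ·M adj (τM A) ≡⟨ scale-·M δ (τM A ·M D) (adj (τM A)) ⟩
        scale δ ((τM A ·M D) ·M adj (τM A)) ≡⟨ cong (scale δ) τE ⟨
        scale δ (τM E) ∎
      τδ⁻¹ : τ (δ ⁻¹) ≡ (τ δ) ⁻¹
      τδ⁻¹ = *-cancelˡ τδ≢0 (trans (sym (frob^-* m δ (δ ⁻¹))) (trans (cong τ (⁻¹-inverse δ detA)) (trans (frob^-1 m) (sym (⁻¹-inverse (τ δ) τδ≢0)))))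
      fixed : τM (scale (δ ⁻¹) E) ≡ scale (δ ⁻¹) E
      fixed = begin
        τM (scale (δ ⁻¹) E) ≡⟨ Frob^.mapMat-scale m (δ ⁻¹) E ⟩
        scale (τ (δ ⁻¹)) (τM E) ≡⟨ cong (λ s → scale s (τM E)) τδ⁻¹ ⟩
        scale ((τ δ) ⁻¹) (τM E) ≡⟨ cong (scale ((τ δ) ⁻¹)) (trans (sym (scale-1 (τM E))) (cong (λ s → scale s (τM E)) (sym (inverseˡ detA)))) ⟩
        scale ((τ δ) ⁻¹) (scale (δ ⁻¹ * δ) (τM E)) ≡⟨ cong (scale ((τ δ) ⁻¹)) (scale-scale (δ ⁻¹) δ (τM E)) ⟨
        scale ((τ δ) ⁻¹) (scale (δ ⁻¹) (scale δ (τM E))) ≡⟨ cong (λ X → scale ((τ δ) ⁻¹) (scale (δ ⁻¹) X)) relation ⟨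
        scale ((τ δ) ⁻¹) (scale (δ ⁻¹) (scale (τ δ) E)) ≡⟨ trans (cong (scale ((τ δ) ⁻¹)) (scale-scale (δ ⁻¹) (τ δ) E)) (scale-scale ((τ δ) ⁻¹) (δ ⁻¹ * τ δ) E) ⟩
        scale ((τ δ) ⁻¹ * (δ ⁻¹ * τ δ)) E ≡⟨ cong (λ s → scale s E) (trans (cong ((τ δ) ⁻¹ *_) (*-comm _ (τ δ))) (x⁻¹*xy (δ ⁻¹) τδ≢0)) ⟩
        scale (δ ⁻¹) E ∎

    rational-conjugates : ∀ A → det A ≢ 0# → ∃ λ D → KMat D × det D ≢ 0# × ¬ (D ~ I₂) × Rational (D ^^ A)
    rational-conjugates A detA =
      let D , kD , detD , D≁I , comm = commuting (adj A ·M τM A) τN≡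
      in D , kD , detD , D≁I , conjugate-rational A D detA kD comm
      where
      open ≡-Reasoning
      τN≡ : τM (adj A ·M τM A) ≡ adj (adj A ·M τM A)
      τN≡ = begin
        τM (adj A ·M τM A) ≡⟨ Frob^.mapMat-· m (adj A) (τM A) ⟩
        τM (adj A) ·M τM (τM A) ≡⟨ cong₂ _·M_ (τM-adj A) (trans (τMτM A) (sym (adj-adj A))) ⟩
        adj (τM A) ·M adj (adj A) ≡⟨ adj-· (adj A) (τM A) ⟨
        adj (adj A ·M τM A) ∎

-- PSL(2,q) inside the semilinear group

module SpecialSubgroup (F : FiniteField) (p n : ℕ) (pp : Prime p) (order≡ : order F ≡ p ℕ.^ n) (1≤n : 1 ≤ n) where
  open FiniteField F hiding (order)
  open FieldFacts F
  open PΓL F p n hiding (_≈_)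
  open Frobenius F p n pp order≡
  open Matrices F p n
  open SemilinearGroup F p n pp order≡ 1≤n
  open Unipotents F p n
  open Group 𝔾 using () renaming (trans to ≋-trans; sym to ≋-sym)

  LinearElt : Elt → Set
  LinearElt x = ∀ z → frob^ (aut x) z ≡ z

  frob⁻-linear : ∀ k → (∀ z → frob^ k z ≡ z) → ∀ z → frob⁻ k z ≡ z
  frob⁻-linear k lin z = trans (cong (frob⁻ k) (sym (lin z))) (frob⁻-frob k z)

  ∙-matrix : ∀ x y → LinearElt x → matrix (x ∙ y) ≡ matrix x ·M matrix y
  ∙-matrix ⟨ A , j ⟩ ⟨ B , k ⟩ lin = cong (A ·M_) (mapMat-id (frob⁻-linear j lin) B)

  ∙-linear : ∀ x y → LinearElt x → LinearElt y → LinearElt (x ∙ y)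
  ∙-linear x y lx ly z = trans (frob^-∘ (aut x) (aut y) z) (trans (lx _) (ly z))

  PSL-∙ : ∀ x y → IsPSL x → IsPSL y → IsPSL (x ∙ y)
  PSL-∙ x y (dx , lx , s , s²) (dy , ly , t , t²) =
    proj₂ ((x , dx) ⊙ (y , dy)) , ∙-linear x y lx ly , s * t ,
    trans (cong det (∙-matrix x y lx)) (trans (det-· (matrix x) (matrix y)) (trans (cong₂ _*_ s² t²)
      (solve 2 (λ s t → (s :* s) :* (t :* t) := (s :* t) :* (s :* t)) refl s t)))

  linear : ∀ A → det A ≢ 0# → ΓL
  linear A dA = ⟨ A , 0 ⟩ , dA

  infixl 8 _^ᶜ_
  _^ᶜ_ : ΓL → ΓL → ΓL
  h ^ᶜ g = (g ⊙ h) ⊙ ⊙-inv g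

  conjugate-matrix : ∀ g h → LinearElt (proj₁ h) →
    matrix (proj₁ (h ^ᶜ g)) ≡ mapMat (frob⁻ (aut (proj₁ g))) (matrix (proj₁ h)) ^^ matrix (proj₁ g)
  conjugate-matrix (⟨ A , k ⟩ , _) (⟨ H , j ⟩ , _) lin = cong ((A ·M mapMat (frob⁻ k) H) ·M_)
    (trans (mapMat-∘ (frob⁻ (k ℕ.+ j)) (frob^ k) (adj A)) (mapMat-id (λ z → trans (frob⁻-+ k j (frob^ k z)) (trans (cong (frob⁻ k) (frob⁻-linear j lin _)) (frob⁻-frob k z))) (adj A)))

  conjugate-linear : ∀ g h → LinearElt (proj₁ h) → LinearElt (proj₁ (h ^ᶜ g))
  conjugate-linear (⟨ A , k ⟩ , _) (⟨ H , j ⟩ , _) lin z = trans (frob^-∘ (k ℕ.+ j) (k ℕ.* (n ∸ 1)) z)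
    (trans (frob^-∘ k j _) (trans (cong (frob^ k) (lin _)) (frob-frob⁻ k z)))

  PSL-conjugate : ∀ g h → IsPSL (proj₁ h) → IsPSL (proj₁ (h ^ᶜ g))
  PSL-conjugate g@(⟨ A , k ⟩ , dA) h@(⟨ H , j ⟩ , dH) (_ , lin , s , s²) =
    proj₂ (h ^ᶜ g) , conjugate-linear g h lin , det A * frob⁻ k s , (begin
      det (matrix (proj₁ (h ^ᶜ g))) ≡⟨ cong det (conjugate-matrix g h lin) ⟩
      det ((A ·M mapMat (frob⁻ k) H) ·M adj A) ≡⟨ det-· (A ·M mapMat (frob⁻ k) H) (adj A) ⟩
      det (A ·M mapMat (frob⁻ k) H) * det (adj A) ≡⟨ cong₂ _*_ (det-· A (mapMat (frob⁻ k) H)) (det-adj A) ⟩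
      (det A * det (mapMat (frob⁻ k) H)) * det A ≡⟨ cong (λ o → (det A * o) * det A) (trans (Frob^.mapMat-det (k ℕ.* (n ∸ 1)) H) (trans (cong (frob⁻ k) s²) (frob^-* (k ℕ.* (n ∸ 1)) s s))) ⟩
      (det A * (frob⁻ k s * frob⁻ k s)) * det A ≡⟨ solve 2 (λ d s → (d :* (s :* s)) :* d := (d :* s) :* (d :* s)) refl (det A) (frob⁻ k s) ⟩
      (det A * frob⁻ k s) * (det A * frob⁻ k s) ∎)
    where open ≡-Reasoning

  unimodular-PSL : ∀ A → det A ≡ 1# → IsPSL ⟨ A , 0 ⟩
  unimodular-PSL A dA = (λ eq → 1≢0 (trans (sym dA) eq)) , (λ _ → refl) , 1# , trans dA (sym (*-identityˡ 1#))

  unimodular-representative : ∀ x → IsPSL x → ∃ λ A → det A ≡ 1# × matrix x ~ A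
  unimodular-representative ⟨ A , k ⟩ (dA , _ , s , s²) = scale (s ⁻¹) A , trans (det-scale (s ⁻¹) A) (trans (cong ((s ⁻¹ * s ⁻¹) *_) s²)
      (trans (solve 2 (λ i s → (i :* i) :* (s :* s) := (i :* s) :* (i :* s)) refl (s ⁻¹) s) (trans (cong₂ _*_ (inverseˡ s≢0) (inverseˡ s≢0)) (*-identityˡ 1#)))) ,
      scale~ (⁻¹-nonzero s≢0)
    where
    s≢0 : s ≢ 0#
    s≢0 refl = dA (trans s² (zeroˡ 0#))

-- From the isomorphism of M ∩ T to a field embedding

module SubfieldSubgroup (F F′ : FiniteField) (p n m : ℕ) (pp : Prime p)
    (order≡ : order F ≡ p ℕ.^ n) (order≡′ : order F′ ≡ p ℕ.^ m) (1≤n : 1 ≤ n) (1≤m : 1 ≤ m)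
    (M : PΓL.Elt F p n → Set) (M-sub : PΓL.IsSubgroup F p n M)
    (iso : IsoToPSL F p n (λ x → M x × PΓL.IsPSL F p n x) F′ m) where
  open FiniteField F hiding (order)
  open FieldFacts F
  open PΓL F p n hiding (_≈_; e)
  open Frobenius F p n pp order≡
  open Matrices F p n
  open SemilinearGroup F p n pp order≡ 1≤n
  open Unipotents F p n
  open SpecialSubgroup F p n pp order≡ 1≤n
  open Representations F F′ p n m pp order≡ order≡′ 1≤n 1≤m using (Representation; Unimodular; ·-unimodular)
  open StandardForm F F′ p n m pp order≡ order≡′ 1≤n 1≤m
  open Subfield F p n pp order≡ 1≤n m
  open IsoToPSL iso hiding (module A; module B)
  open Group 𝔾 using () renaming (trans to ≋-trans; sym to ≋-sym)
  private
    module F′ = FiniteField F′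
    module L′ = FieldFacts F′
    module B = PΓL F′ p m
    module M′ = Matrices F′ p m
    module Fr′ = Frobenius F′ p m pp order≡′
    module S′ = SemilinearGroup F′ p m pp order≡′ 1≤m
    module P′ = SpecialSubgroup F′ p m pp order≡′ 1≤m
    module 𝔾′ = Group S′.𝔾
    module M = IsSubgroup M-sub

  H : Elt → Set
  H x = M x × IsPSL x

  H-ΓL : ∀ x → H x → ΓL
  H-ΓL x (_ , d , _) = x , d

  PSL′-ΓL : ∀ y → B.IsPSL y → S′.ΓL
  PSL′-ΓL y (d , _) = y , d

  H-∙ : ∀ x y → H x → H y → H (x ∙ y)
  H-∙ x y (mx , px) (my , py) = M.closed-∙ {x} {y} mx my , PSL-∙ x y px py

  from-ΓL : ∀ y → B.IsPSL y → ΓL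
  from-ΓL y py = H-ΓL (from y) (from-mem y py)

  to-ΓL : ∀ x → H x → S′.ΓL
  to-ΓL x hx = PSL′-ΓL (to x) (to-mem x hx)

  from-cong : ∀ x y (px : B.IsPSL x) (py : B.IsPSL y) → PSL′-ΓL x px S′.≋ PSL′-ΓL y py → from-ΓL x px ≋ from-ΓL y py
  from-cong x y px py eq = ≈⇒≋ {from-ΓL x px} {from-ΓL y py} (from-resp {x} {y} px py (S′.≋⇒≈ eq))

  to-cong : ∀ x y (hx : H x) (hy : H y) → H-ΓL x hx ≋ H-ΓL y hy → to-ΓL x hx S′.≋ to-ΓL y hy
  to-cong x y hx hy eq = S′.≈⇒≋ {to-ΓL x hx} {to-ΓL y hy} (to-resp {x} {y} hx hy (≋⇒≈ eq))

  from-to : ∀ x (hx : H x) → from-ΓL (to x) (to-mem x hx) ≋ H-ΓL x hx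
  from-to x hx = ≈⇒≋ {from-ΓL (to x) (to-mem x hx)} {H-ΓL x hx} (from∘to x hx)

  to-from : ∀ y (py : B.IsPSL y) → to-ΓL (from y) (from-mem y py) S′.≋ PSL′-ΓL y py
  to-from y py = S′.≈⇒≋ {to-ΓL (from y) (from-mem y py)} {PSL′-ΓL y py} (to∘from y py)

  -- Multiplicativity is given for `to` only; it passes to `from` because the two maps are inverse
  -- to each other.
  from-∙ : ∀ x y (px : B.IsPSL x) (py : B.IsPSL y) → from-ΓL (x B.∙ y) (P′.PSL-∙ x y px py) ≋ from-ΓL x px ⊙ from-ΓL y py
  from-∙ x y px py = ≋-trans (≋-sym (from-cong (to (from x ∙ from y)) (x B.∙ y) (to-mem _ hXY) (P′.PSL-∙ x y px py) to≋))
      (from-to (from x ∙ from y) hXY)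
    where
    hX = from-mem x px
    hY = from-mem y py
    hXY : H (from x ∙ from y)
    hXY = H-∙ (from x) (from y) hX hY
    to≋ : to-ΓL (from x ∙ from y) hXY S′.≋ PSL′-ΓL (x B.∙ y) (P′.PSL-∙ x y px py)
    to≋ = 𝔾′.trans {to-ΓL (from x ∙ from y) hXY} {to-ΓL (from x) hX S′.⊙ to-ΓL (from y) hY} {PSL′-ΓL x px S′.⊙ PSL′-ΓL y py}
      (S′.≈⇒≋ {to-ΓL (from x ∙ from y) hXY} {to-ΓL (from x) hX S′.⊙ to-ΓL (from y) hY} (hom (from x) (from y) hX hY))
      (S′.⊙-cong {to-ΓL (from x) hX} {PSL′-ΓL x px} {to-ΓL (from y) hY} {PSL′-ΓL y py} (to-from x px) (to-from y py))

  ρ : B.Mat → Mat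
  ρ A = matrix (from B.⟨ A , 0 ⟩)

  ρ-H : ∀ A → Unimodular A → H (from B.⟨ A , 0 ⟩)
  ρ-H A uA = from-mem B.⟨ A , 0 ⟩ (P′.unimodular-PSL A uA)

  ρ-ΓL : ∀ A → Unimodular A → ΓL
  ρ-ΓL A uA = from-ΓL B.⟨ A , 0 ⟩ (P′.unimodular-PSL A uA)

  ρ-linear : ∀ A (uA : Unimodular A) → LinearElt (from B.⟨ A , 0 ⟩)
  ρ-linear A uA = proj₁ (proj₂ (proj₂ (ρ-H A uA)))

  representation : Representation ρ
  representation = record
    { nonsingular = λ {A} uA → proj₁ (proj₂ (ρ-H A uA))
    ; hom = λ {A} {C} uA uC → ~-trans (matrix~ (from-∙ B.⟨ A , 0 ⟩ B.⟨ C , 0 ⟩ (P′.unimodular-PSL A uA) (P′.unimodular-PSL C uC)))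
        (≡⇒~ (∙-matrix (from B.⟨ A , 0 ⟩) (from B.⟨ C , 0 ⟩) (ρ-linear A uA)))
    ; faithful = λ {A} {C} uA uC eq → S′.matrix~ (faithful A C uA uC (equiv eq (λ z → trans (ρ-linear A uA z) (sym (ρ-linear C uC z))))) }
    where
    faithful : ∀ A C (uA : Unimodular A) (uC : Unimodular C) → ρ-ΓL A uA ≋ ρ-ΓL C uC → PSL′-ΓL B.⟨ A , 0 ⟩ (P′.unimodular-PSL A uA) S′.≋ PSL′-ΓL B.⟨ C , 0 ⟩ (P′.unimodular-PSL C uC)
    faithful A C uA uC eq = 𝔾′.trans (𝔾′.sym (to-from B.⟨ A , 0 ⟩ (P′.unimodular-PSL A uA)))
      (𝔾′.trans (to-cong (from B.⟨ A , 0 ⟩) (from B.⟨ C , 0 ⟩) (ρ-H A uA) (ρ-H C uC) eq) (to-from B.⟨ C , 0 ⟩ (P′.unimodular-PSL C uC)))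

  module Standard (C : Mat) (detC : det C ≢ 0#) (h : FieldHom) (standard : ∀ A → Unimodular A → ρ A ^^ C ~ FieldHom.mapθ h A) where
    open FieldHom h

    θ-^ : ∀ x k → θ (x L′.^ k) ≡ θ x ^ k
    θ-^ x zero = θ-1
    θ-^ x (suc k) = trans (θ-* x _) (cong (θ x *_) (θ-^ x k))

    K-θ : ∀ x → K (θ x)
    K-θ x = trans (frob^≡^ m (θ x)) (trans (sym (θ-^ x (p ℕ.^ m))) (cong θ (trans (sym (Fr′.frob^≡^ m x)) (Fr′.frob^n x))))

    θ-nonzero : ∀ {x} → x ≢ F′.0# → θ x ≢ 0#
    θ-nonzero {x} x≢0 eq = 1≢0 (trans (sym θ-1) (trans (cong θ (sym (F′.⁻¹-inverse x x≢0))) (trans (θ-* x _) (trans (cong (_* θ (x F′.⁻¹)) eq) (zeroˡ _)))))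

    θ-injective : ∀ {x y} → θ x ≡ θ y → x ≡ y
    θ-injective {x} {y} eq with x F′.+ F′.- y L′.≟ F′.0#
    ... | yes d = L′.x-y≡0⇒x≡y d
    ... | no d = ⊥-elim (θ-nonzero d (trans (θ-+ x _) (trans (cong (θ x +_) (θ-neg y)) (x≡y⇒x-y≡0 eq))))

    -- The images of the nonzero elements of F′ are already q₀ - 1 roots of X^(q₀-1) = 1, so a
    -- nonzero element of K outside the image would be one root too many.
    θ-surjective : 1 ≤ q₀-1 → ∀ {x} → K x → ∃ λ y → x ≡ θ y
    θ-surjective 1≤q₀-1 {x} kx with x ≟ 0#
    ... | yes x≡0 = F′.0# , trans x≡0 (sym θ-0)
    ... | no x≢0 = search (Any.any? (x ≟_) (map θ L′.nonzeros))
      where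
      search : Dec (x ∈ map θ L′.nonzeros) → ∃ λ y → x ≡ θ y
      search (yes x∈) = let y , _ , eq = ∈-map⁻ θ x∈ in y , eq
      search (no x∉) = ⊥-elim (ℕₚ.<⇒≱ (ℕₚ.n<1+n q₀-1) (subst (_≤ q₀-1) (cong suc (trans (Listₚ.length-map θ L′.nonzeros) length≡))
        (power-roots≤ q₀-1 1# (x ∷ map θ L′.nonzeros) 1≤q₀-1
          (All.tabulate (λ y∈ x≡y → x∉ (Any.map (trans x≡y) y∈)) ∷ Uniqueₚ.map⁺ θ-injective L′.nonzeros-unique)
          (K^ x≢0 kx ∷ Allₚ.map⁺ (All.tabulate (λ {y} y∈ → K^ (θ-nonzero (L′.∈nonzeros⁻ y∈)) (K-θ y)))))))
        where
        length≡ : length L′.nonzeros ≡ q₀-1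
        length≡ = cong (_∸ 1) (trans (sym L′.order≡1+nonzeros) order≡′)

    c : ΓL
    c = linear C detC

    KMat-mapθ : ∀ A → KMat (mapθ A)
    KMat-mapθ (B.mat a b c d) = kmat (K-θ a) (K-θ b) (K-θ c) (K-θ d)

    conjugate-~ : ∀ h → LinearElt (proj₁ h) → matrix (proj₁ (h ^ᶜ c)) ~ matrix (proj₁ h) ^^ C
    conjugate-~ h lin = ≡⇒~ (trans (conjugate-matrix c h lin) (cong (_^^ C) (mapMat-1 (matrix (proj₁ h)))))

    M∩T⇒rational : ∀ x → (hx : H x) → L (H-ΓL x hx ^ᶜ c)
    M∩T⇒rational x hx = from-representative (P′.unimodular-representative (to x) (to-mem x hx))
      where
      from-representative : (∃ λ A → Unimodular A × B.matrix (to x) M′.~ A) → L (H-ΓL x hx ^ᶜ c)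
      from-representative (A , uA , to~A) = mapθ A , KMat-mapθ A ,
          ~-trans (conjugate-~ (H-ΓL x hx) (proj₁ (proj₂ (proj₂ hx)))) (~-trans (^^-~ C (matrix~ x≋)) (standard A uA))
        where
        x≋ : H-ΓL x hx ≋ ρ-ΓL A uA
        x≋ = ≋-trans (≋-sym (from-to x hx)) (from-cong (to x) B.⟨ A , 0 ⟩ (to-mem x hx) (P′.unimodular-PSL A uA) (S′.equiv to~A (proj₁ (proj₂ (to-mem x hx)))))

    ρ-conjugate : ∀ A (uA : Unimodular A) → matrix (proj₁ (ρ-ΓL A uA ^ᶜ c)) ~ mapθ A
    ρ-conjugate A uA = ~-trans (conjugate-~ (ρ-ΓL A uA) (ρ-linear A uA)) (standard A uA)

-- Conjugation identities in an abstract group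

module Conjugation (𝔾 : Group 0ℓ 0ℓ) where
  open Group 𝔾 renaming (refl to ≈-refl; sym to ≈-sym; trans to ≈-trans)
  open import Algebra.Properties.Group 𝔾 using (∙-cancelˡ; ∙-cancelʳ; inverseˡ-unique; ⁻¹-involutive)
  open import Relation.Binary.Reasoning.Setoid setoid

  conj : Carrier → Carrier → Carrier
  conj g h = (g ∙ h) ∙ g ⁻¹

  x[x⁻¹y] : ∀ x y → x ∙ (x ⁻¹ ∙ y) ≈ y
  x[x⁻¹y] x y = ≈-trans (≈-sym (assoc x (x ⁻¹) y)) (≈-trans (∙-congʳ (inverseʳ x)) (identityˡ y))

  x⁻¹[xy] : ∀ x y → x ⁻¹ ∙ (x ∙ y) ≈ y
  x⁻¹[xy] x y = ≈-trans (≈-sym (assoc (x ⁻¹) x y)) (≈-trans (∙-congʳ (inverseˡ x)) (identityˡ y))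

  [xy⁻¹]y : ∀ x y → (x ∙ y ⁻¹) ∙ y ≈ x
  [xy⁻¹]y x y = ≈-trans (assoc x (y ⁻¹) y) (≈-trans (∙-congˡ (inverseˡ y)) (identityʳ x))

  conj-∙ʳ : ∀ g h → conj g h ∙ g ≈ g ∙ h
  conj-∙ʳ g h = [xy⁻¹]y (g ∙ h) g

  conj-cong : ∀ g {h h′} → h ≈ h′ → conj g h ≈ conj g h′
  conj-cong g eq = ∙-congʳ (∙-congˡ eq)

  conj-injective : ∀ g {h h′} → conj g h ≈ conj g h′ → h ≈ h′
  conj-injective g {h} {h′} eq = ∙-cancelˡ g h h′ (∙-cancelʳ (g ⁻¹) _ _ eq)

  conj-∙ : ∀ g x y → conj g (x ∙ y) ≈ conj g x ∙ conj g y
  conj-∙ g x y = ∙-cancelʳ g _ _ (begin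
    conj g (x ∙ y) ∙ g ≈⟨ conj-∙ʳ g (x ∙ y) ⟩
    g ∙ (x ∙ y) ≈⟨ assoc g x y ⟨
    (g ∙ x) ∙ y ≈⟨ ∙-congʳ (conj-∙ʳ g x) ⟨
    (conj g x ∙ g) ∙ y ≈⟨ assoc (conj g x) g y ⟩
    conj g x ∙ (g ∙ y) ≈⟨ ∙-congˡ (conj-∙ʳ g y) ⟨
    conj g x ∙ (conj g y ∙ g) ≈⟨ assoc (conj g x) (conj g y) g ⟨
    (conj g x ∙ conj g y) ∙ g ∎)

  conj-ε : ∀ g → conj g ε ≈ ε
  conj-ε g = ∙-cancelʳ g _ _ (≈-trans (conj-∙ʳ g ε) (≈-trans (identityʳ g) (≈-sym (identityˡ g))))

  conj-⁻¹ : ∀ g x → conj g (x ⁻¹) ≈ conj g x ⁻¹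
  conj-⁻¹ g x = inverseˡ-unique _ _ (≈-trans (≈-sym (conj-∙ g (x ⁻¹) x)) (≈-trans (conj-cong g (inverseˡ x)) (conj-ε g)))

  conj-conj : ∀ g x h → conj g (conj x h) ≈ conj (conj g x) (conj g h)
  conj-conj g x h = ≈-trans (conj-∙ g (x ∙ h) (x ⁻¹)) (∙-cong (conj-∙ g x h) (conj-⁻¹ g x))

  g-conj⁻¹ : ∀ g h → g ∙ conj (g ⁻¹) h ≈ h ∙ g
  g-conj⁻¹ g h = begin
    g ∙ ((g ⁻¹ ∙ h) ∙ g ⁻¹ ⁻¹) ≈⟨ assoc g (g ⁻¹ ∙ h) _ ⟨
    (g ∙ (g ⁻¹ ∙ h)) ∙ g ⁻¹ ⁻¹ ≈⟨ ∙-cong (x[x⁻¹y] g h) (⁻¹-involutive g) ⟩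
    h ∙ g ∎

  conj-conj⁻¹ : ∀ g h → conj g (conj (g ⁻¹) h) ≈ h
  conj-conj⁻¹ g h = ∙-cancelʳ g _ _ (≈-trans (conj-∙ʳ g _) (g-conj⁻¹ g h))

  fixes-translate : ∀ {a g m} c → a ∙ g ≈ m ∙ a → (c ∙ a) ∙ g ≈ conj c m ∙ (c ∙ a)
  fixes-translate {a} {g} {m} c eq = begin
    (c ∙ a) ∙ g ≈⟨ assoc c a g ⟩
    c ∙ (a ∙ g) ≈⟨ ∙-congˡ eq ⟩
    c ∙ (m ∙ a) ≈⟨ assoc c m a ⟨
    (c ∙ m) ∙ a ≈⟨ ∙-congʳ (conj-∙ʳ c m) ⟨
    (conj c m ∙ c) ∙ a ≈⟨ assoc (conj c m) c a ⟩
    conj c m ∙ (c ∙ a) ∎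

  fixes-own : ∀ a h → a ∙ ((a ⁻¹ ∙ h) ∙ a) ≈ h ∙ a
  fixes-own a h = ≈-trans (≈-sym (assoc a (a ⁻¹ ∙ h) a)) (∙-congʳ (x[x⁻¹y] a h))

  fixes-coset : ∀ {a b g h m} → a ≈ m ∙ b → a ∙ g ≈ h ∙ a → b ∙ g ≈ ((m ⁻¹ ∙ h) ∙ m) ∙ b
  fixes-coset {a} {b} {g} {h} {m} a≈ eq = begin
    b ∙ g ≈⟨ ∙-congʳ (x⁻¹[xy] m b) ⟨
    (m ⁻¹ ∙ (m ∙ b)) ∙ g ≈⟨ ∙-congʳ (∙-congˡ a≈) ⟨
    (m ⁻¹ ∙ a) ∙ g ≈⟨ assoc (m ⁻¹) a g ⟩
    m ⁻¹ ∙ (a ∙ g) ≈⟨ ∙-congˡ eq ⟩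
    m ⁻¹ ∙ (h ∙ a) ≈⟨ ∙-congˡ (∙-congˡ a≈) ⟩
    m ⁻¹ ∙ (h ∙ (m ∙ b)) ≈⟨ assoc (m ⁻¹) h _ ⟨
    (m ⁻¹ ∙ h) ∙ (m ∙ b) ≈⟨ assoc (m ⁻¹ ∙ h) m b ⟨
    ((m ⁻¹ ∙ h) ∙ m) ∙ b ∎

  quotient-translate : ∀ c a b → (c ∙ b) ∙ (c ∙ a) ⁻¹ ≈ conj c (b ∙ a ⁻¹)
  quotient-translate c a b = ∙-cancelʳ (c ∙ a) _ _ (begin
    ((c ∙ b) ∙ (c ∙ a) ⁻¹) ∙ (c ∙ a) ≈⟨ [xy⁻¹]y (c ∙ b) (c ∙ a) ⟩
    c ∙ b ≈⟨ ∙-congˡ ([xy⁻¹]y b a) ⟨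
    c ∙ ((b ∙ a ⁻¹) ∙ a) ≈⟨ assoc c (b ∙ a ⁻¹) a ⟨
    (c ∙ (b ∙ a ⁻¹)) ∙ a ≈⟨ ∙-congʳ (conj-∙ʳ c (b ∙ a ⁻¹)) ⟨
    (conj c (b ∙ a ⁻¹) ∙ c) ∙ a ≈⟨ assoc _ c a ⟩
    conj c (b ∙ a ⁻¹) ∙ (c ∙ a) ∎)

  quotient⁻¹ : ∀ a b → (b ∙ a ⁻¹) ⁻¹ ∙ b ≈ a
  quotient⁻¹ a b = ∙-cancelˡ (b ∙ a ⁻¹) _ _ (≈-trans (x[x⁻¹y] (b ∙ a ⁻¹) b) (≈-sym ([xy⁻¹]y b a)))

  translate-conj⁻¹ : ∀ c z a → c ∙ (conj (c ⁻¹) z ∙ a) ≈ z ∙ (c ∙ a)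
  translate-conj⁻¹ c z a = ≈-trans (≈-sym (assoc c _ a)) (≈-trans (∙-congʳ (g-conj⁻¹ c z)) (assoc z c a))

  fixes-other : ∀ a b h → b ∙ ((a ⁻¹ ∙ h) ∙ a) ≈ conj (b ∙ a ⁻¹) h ∙ b
  fixes-other a b h = begin
    b ∙ g ≈⟨ ∙-congʳ ([xy⁻¹]y b a) ⟨
    (y ∙ a) ∙ g ≈⟨ assoc y a g ⟩
    y ∙ (a ∙ g) ≈⟨ ∙-congˡ (fixes-own a h) ⟩
    y ∙ (h ∙ a) ≈⟨ assoc y h a ⟨
    (y ∙ h) ∙ a ≈⟨ ∙-congʳ (conj-∙ʳ y h) ⟨
    (conj y h ∙ y) ∙ a ≈⟨ assoc (conj y h) y a ⟩
    conj y h ∙ (y ∙ a) ≈⟨ ∙-congˡ ([xy⁻¹]y b a) ⟩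
    conj y h ∙ b ∎
    where
    y = b ∙ a ⁻¹
    g = (a ⁻¹ ∙ h) ∙ a

  conjugate-trivial : ∀ a h → (a ⁻¹ ∙ h) ∙ a ≈ ε → h ≈ ε
  conjugate-trivial a h eq = ∙-cancelʳ a _ _ (≈-trans (≈-sym (fixes-own a h)) (≈-trans (∙-congˡ eq) (≈-trans (identityʳ a) (≈-sym (identityˡ a)))))

-- Consequences of maximality

module MaximalSubgroup (p n : ℕ) (F : FiniteField) (G M : PΓL.Elt F p n → Set)
    (G-sub : PΓL.IsSubgroup F p n G) (maximal : PΓL.IsMaximalSubgroupOf F p n M G) where
  open PΓL F p n
  private
    module G = IsSubgroup G-sub

  M-sub : IsSubgroup M
  M-sub = proj₁ maximal
  private
    module M = IsSubgroup M-sub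

  M⊆G : M ⊆ G
  M⊆G = proj₁ (proj₂ maximal)

  outside : ∃ λ g → G g × ¬ M g
  outside = proj₁ (proj₂ (proj₂ maximal))

  dichotomy : ∀ K → IsSubgroup K → M ⊆ K → K ⊆ G → (K ⊆ M) ⊎ (G ⊆ K)
  dichotomy = proj₂ (proj₂ (proj₂ maximal))

  -- Maximality applied to the subgroup that is G if P holds and M otherwise decides P.
  excluded-middle : (P : Set) → P ⊎ ¬ P
  excluded-middle P = decide (dichotomy K K-sub (λ x mx → M⊆G x mx , inj₁ mx) (λ _ → proj₁))
    where
    K : Elt → Set
    K x = G x × (M x ⊎ P)
    K-sub : IsSubgroup K
    K-sub = record
      { ⊆PΓL = λ x (gx , _) → G.⊆PΓL x gx
      ; respects = λ { {x} {y} eq (gx , inj₁ mx) → G.respects {x} {y} eq gx , inj₁ (M.respects {x} {y} eq mx)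
                     ; {x} {y} eq (gx , inj₂ P-holds) → G.respects {x} {y} eq gx , inj₂ P-holds }
      ; has-e = G.has-e , inj₁ M.has-e
      ; closed-∙ = λ { {x} {y} (gx , inj₁ mx) (gy , inj₁ my) → G.closed-∙ {x} {y} gx gy , inj₁ (M.closed-∙ {x} {y} mx my)
                     ; {x} {y} (gx , inj₂ P-holds) (gy , _) → G.closed-∙ {x} {y} gx gy , inj₂ P-holds
                     ; {x} {y} (gx , inj₁ _) (gy , inj₂ P-holds) → G.closed-∙ {x} {y} gx gy , inj₂ P-holds }
      ; closed-inv = λ { {x} (gx , inj₁ mx) → G.closed-inv {x} gx , inj₁ (M.closed-inv {x} mx)
                       ; {x} (gx , inj₂ P-holds) → G.closed-inv {x} gx , inj₂ P-holds } }
    decide : (K ⊆ M) ⊎ (G ⊆ K) → P ⊎ ¬ P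
    decide (inj₁ K⊆M) = inj₂ (λ P-holds → proj₂ (proj₂ outside) (K⊆M _ (proj₁ (proj₂ outside) , inj₂ P-holds)))
    decide (inj₂ G⊆K) with proj₂ (G⊆K _ (proj₁ (proj₂ outside)))
    ... | inj₁ mg = ⊥-elim (proj₂ (proj₂ outside) mg)
    ... | inj₂ P-holds = inj₁ P-holds

-- The coset action: base size and diameter

module Action (p n : ℕ) (pp : Prime p) (1≤n : 1 ≤ n) (F F′ : FiniteField) (order≡ : order F ≡ p ℕ.^ n)
    (G M : PΓL.Elt F p n → Set) (G-sub : PΓL.IsSubgroup F p n G) (T⊆G : PΓL._⊆_ F p n (PΓL.IsPSL F p n) G)
    (m : ℕ) (1≤m : 1 ≤ m) (2<q₀ : 2 < p ℕ.^ m) (m<n : m < n) (maximal : PΓL.IsMaximalSubgroupOf F p n M G)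
    (order≡′ : order F′ ≡ p ℕ.^ m) (iso : IsoToPSL F p n (λ x → M x × PΓL.IsPSL F p n x) F′ m) where
  open FiniteField F hiding (order)
  open FieldFacts F
  open PΓL F p n hiding (_≈_; e)
  open CosetAction G M
  open Frobenius F p n pp order≡
  open Matrices F p n
  open SemilinearGroup F p n pp order≡ 1≤n
  open Unipotents F p n
  open SpecialSubgroup F p n pp order≡ 1≤n
  open Subfield F p n pp order≡ 1≤n m
  open MaximalSubgroup p n F G M G-sub maximal
  open SubfieldSubgroup F F′ p n m pp order≡ order≡′ 1≤n 1≤m M M-sub iso
  open StandardForm F F′ p n m pp order≡ order≡′ 1≤n 1≤m using (FieldHom; standard-form)
  open Representations F F′ p n m pp order≡ order≡′ 1≤n 1≤m using (Unimodular)
  open Normaliser F p n pp order≡ 1≤n m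
  open Neighbours F p n pp order≡ 1≤n m using (BasePair; Stabilises; Reduction; common-neighbours)
  open Conjugation 𝔾 using (conj-cong; conj-injective; conj-∙; conj-ε; conj-⁻¹; conj-conj; conj-conj⁻¹; fixes-translate; fixes-own; fixes-coset; quotient-translate; quotient⁻¹; translate-conj⁻¹; fixes-other; conjugate-trivial)
  open Group 𝔾 using () renaming (trans to ≋-trans; sym to ≋-sym; refl to ≋-refl; ∙-congˡ to ⊙-congˡ; ∙-congʳ to ⊙-congʳ)
  private
    module G = IsSubgroup G-sub
    module M = IsSubgroup M-sub
    module F′ = FiniteField F′
    module L′ = FieldFacts F′
    module B = PΓL F′ p m
    module U′ = Unipotents F′ p m
    module N′ = Normaliser F′ p m pp order≡′ 1≤m m

  instance
    p-nonTrivial : ℕ.NonTrivial p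
    p-nonTrivial = prime⇒nonTrivial pp

  1≤q₀-1 : 1 ≤ q₀-1
  1≤q₀-1 = ℕₚ.∸-monoˡ-≤ 1 (ℕₚ.≤-trans (ℕₚ.n≤1+n 2) 2<q₀)

  2≤n : 2 ≤ n
  2≤n = ℕₚ.≤-trans (s≤s 1≤m) m<n

  outside-K : ∃ λ t → ¬ K t
  outside-K = let t , t∈ , av = avoid-powers ((q₀-1 , 1#) ∷ []) (1≤q₀-1 ∷ []) nonzeros nonzeros-unique
                    (subst (q₀-1 ℕ.+ 0 <_) (cong (_∸ 1) (trans (sym order≡) order≡1+nonzeros))
                      (subst (_< p ℕ.^ n ∸ 1) (sym (ℕₚ.+-identityʳ q₀-1)) (ℕₚ.∸-monoˡ-< (ℕₚ.^-monoʳ-< p (ℕ.nonTrivial⇒n>1 p) m<n) (1≤p^ m))))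
              in t , λ kt → All.head av (K^ (∈nonzeros⁻ t∈) kt)

  module Core (C : Mat) (detC : det C ≢ 0#) (h : FieldHom) (standard : ∀ A → Unimodular A → ρ A ^^ C ~ FieldHom.mapθ h A) where
    open FieldHom h
    open Standard C detC h standard

    gΓ : ∀ x → G x → ΓL
    gΓ x gx = x , G.⊆PΓL x gx

    mΓ : ∀ x → M x → ΓL
    mΓ x mx = x , M.⊆PΓL x mx

    pt : Point → ΓL
    pt (x , gx) = gΓ x gx

    M-resp : ∀ g h → g ≋ h → M (proj₁ g) → M (proj₁ h)
    M-resp g h eq = M.respects {proj₁ g} {proj₁ h} (≋⇒≈ eq)

    Galois-fixed : Mat → Set
    Galois-fixed U = ∀ j → mapMat (frob^ j) U ≡ U

    -- M normalises M ∩ T, so conjugating by an element of M gives again an element of M ∩ T, which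
    -- is rational after transport by `c`. The element may involve a field automorphism, and
    -- `Galois-fixed` makes sure that it leaves `U` alone.
    conjugate-rational-by : ∀ U A → Unimodular A → mapθ A ≡ U → Galois-fixed U → ∀ x (mx : M x) →
      Rational (U ^^ matrix (proj₁ (mΓ x mx ^ᶜ c)))
    conjugate-rational-by U A uA θA≡U U-fixed x mx = Rational-~ matrix≡ (L-resp {g = hˣ ^ᶜ c} {h = (hᶜ ^ᶜ x′)} (conj-conj c xΓ hA) (M∩T⇒rational (proj₁ hˣ) (mhˣ , PSL-conjugate xΓ hA (proj₂ (ρ-H A uA)))))
      where
      hA = ρ-ΓL A uA
      xΓ = mΓ x mx
      x′ = xΓ ^ᶜ c
      hᶜ = hA ^ᶜ c
      hˣ = hA ^ᶜ xΓ
      mhˣ : M (proj₁ hˣ)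
      mhˣ = M.closed-∙ {x ∙ proj₁ hA} {inv x} (M.closed-∙ {x} {proj₁ hA} mx (proj₁ (ρ-H A uA))) (M.closed-inv {x} mx)
      matrix≡ : matrix (proj₁ (hᶜ ^ᶜ x′)) ~ U ^^ matrix (proj₁ x′)
      matrix≡ = ~-trans (≡⇒~ (conjugate-matrix x′ hᶜ (conjugate-linear c hA (ρ-linear A uA))))
        (^^-~ (matrix (proj₁ x′)) (~-trans (mapMat-~ (aut (proj₁ x′) ℕ.* (n ∸ 1)) (~-trans (ρ-conjugate A uA) (≡⇒~ θA≡U)))
          (≡⇒~ (U-fixed (aut (proj₁ x′) ℕ.* (n ∸ 1))))))

    M⇒L : ∀ x (mx : M x) → L (mΓ x mx ^ᶜ c)
    M⇒L x mx = normalises⇒rational _ (proj₂ (mΓ x mx ^ᶜ c))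
      (conjugate-rational-by (u 1#) (U′.u F′.1#) (U′.det-u F′.1#) (trans (mapθ-u F′.1#) (cong u θ-1)) (λ j → mat≡ (frob^-1 j) (frob^-1 j) (frob^-0 j) (frob^-1 j)) x mx)
      (conjugate-rational-by (v 1#) (U′.v F′.1#) (U′.det-v F′.1#) (trans (mapθ-v F′.1#) (cong v θ-1)) (λ j → mat≡ (frob^-1 j) (frob^-0 j) (frob^-1 j) (frob^-1 j)) x mx)
      (conjugate-rational-by w N′.w det-w′ (mat≡ (trans (θ-+ _ _) (cong₂ _+_ θ-1 θ-1)) (trans (θ-neg F′.1#) (cong -_ θ-1)) θ-1 θ-0)
        (λ j → mat≡ (trans (frob^-+ j 1# 1#) (cong₂ _+_ (frob^-1 j) (frob^-1 j))) (trans (frob^-neg j 1#) (cong -_ (frob^-1 j))) (frob^-1 j) (frob^-0 j)) x mx)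
      where
      det-w′ : Unimodular N′.w
      det-w′ = trans (cong₂ F′._+_ (L′.zeroʳ _) (trans (cong F′.-_ (L′.*-identityʳ _)) (L′.-‿involutive F′.1#))) (L′.+-identityˡ F′.1#)

    conj⁻¹-PSL : ∀ z → IsPSL (proj₁ z) → IsPSL (proj₁ (z ^ᶜ ⊙-inv c))
    conj⁻¹-PSL z = PSL-conjugate (⊙-inv c) z

    uΓ : Carrier → ΓL
    uΓ t = linear (u t) (λ eq → 1≢0 (trans (sym (det-u t)) eq))

    uΓ-PSL : ∀ t → IsPSL (proj₁ (uΓ t))
    uΓ-PSL t = unimodular-PSL (u t) (det-u t)

    bΓ : Carrier → ΓL
    bΓ t = uΓ t ^ᶜ ⊙-inv c

    bΓ-G : ∀ t → G (proj₁ (bΓ t))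
    bΓ-G t = T⊆G _ (conj⁻¹-PSL (uΓ t) (uΓ-PSL t))

    bΓ-∉L : ∀ {t} → ¬ K t → ¬ L (bΓ t ^ᶜ c)
    bΓ-∉L {t} t∉K l = rational-u (L-resp {g = bΓ t ^ᶜ c} {h = uΓ t} (conj-conj⁻¹ c (uΓ t)) l)
      where
      rational-u : ¬ Rational (u t)
      rational-u (B , kmat ka kb _ _ , scaled s s≢0 refl) = t∉K (K-cancelˡ s≢0 (subst K (*-identityʳ s) ka) kb)

    -- The elements of G that `c` conjugates into L form a subgroup containing M. By maximality it
    -- is M or G, and it is not G because T contains an element conjugate to `u t` with t outside K.
    L⇒M : ∀ x (gx : G x) → L (gΓ x gx ^ᶜ c) → M x
    L⇒M x gx lx = conclude (dichotomy N N-sub (λ y my → M⊆G y my , M.⊆PΓL y my , M⇒L y my) (λ _ → proj₁))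
      where
      N : Elt → Set
      N y = G y × Σ (IsPΓL y) λ d → L ((y , d) ^ᶜ c)
      N-sub : IsSubgroup N
      N-sub = record
        { ⊆PΓL = λ y (gy , _) → G.⊆PΓL y gy
        ; respects = λ {y} {z} eq (gy , dy , ly) → let gz = G.respects {y} {z} eq gy in
            gz , G.⊆PΓL z gz , L-resp {g = (y , dy) ^ᶜ c} {h = gΓ z gz ^ᶜ c} (conj-cong c {(y , dy)} {gΓ z gz} (≈⇒≋ eq)) ly
        ; has-e = G.has-e , proj₂ ⊙-e , L-resp {g = ⊙-e} {h = ⊙-e ^ᶜ c} (≋-sym {⊙-e ^ᶜ c} {⊙-e} (conj-ε c)) L-e
        ; closed-∙ = λ {y} {z} (gy , dy , ly) (gz , dz , lz) → G.closed-∙ {y} {z} gy gz , proj₂ ((y , dy) ⊙ (z , dz)) ,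
            L-resp {g = ((y , dy) ^ᶜ c) ⊙ ((z , dz) ^ᶜ c)} {h = ((y , dy) ⊙ (z , dz)) ^ᶜ c} (≋-sym (conj-∙ c (y , dy) (z , dz))) (L-⊙ {(y , dy) ^ᶜ c} {(z , dz) ^ᶜ c} ly lz)
        ; closed-inv = λ {y} (gy , dy , ly) → G.closed-inv {y} gy , proj₂ (⊙-inv (y , dy)) ,
            L-resp {g = ⊙-inv ((y , dy) ^ᶜ c)} {h = ⊙-inv (y , dy) ^ᶜ c} (≋-sym (conj-⁻¹ c (y , dy))) (L-inv {(y , dy) ^ᶜ c} ly) }
      conclude : (N ⊆ M) ⊎ (G ⊆ N) → M x
      conclude (inj₁ N⊆M) = N⊆M x (gx , G.⊆PΓL x gx , lx)
      conclude (inj₂ G⊆N) = let t , t∉K = outside-K ; _ , _ , l = G⊆N _ (bΓ-G t) in ⊥-elim (bΓ-∉L t∉K l)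

    -- A nontrivial element of M. Its conjugates show that no point stabiliser is trivial, so
    -- neither the empty set nor a single point is a base.
    h₀ : ΓL
    h₀ = ρ-ΓL (U′.u F′.1#) (U′.det-u F′.1#)

    h₀-M : M (proj₁ h₀)
    h₀-M = proj₁ (ρ-H (U′.u F′.1#) (U′.det-u F′.1#))

    h₀ᶜ : h₀ ^ᶜ c ≋ uΓ 1#
    h₀ᶜ = equiv (~-trans (ρ-conjugate (U′.u F′.1#) (U′.det-u F′.1#)) (≡⇒~ (trans (mapθ-u F′.1#) (cong u θ-1))))
      (conjugate-linear c h₀ (ρ-linear (U′.u F′.1#) (U′.det-u F′.1#)))

    h₀≢e : ¬ (h₀ ≋ ⊙-e)
    h₀≢e eq = 1≢0 (u-injective (matrix~ (≋-trans (≋-sym h₀ᶜ) (≋-trans (conj-cong c eq) (conj-ε c)))))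

    own : Point → ΓL
    own α = (⊙-inv (pt α) ⊙ h₀) ⊙ pt α

    own-G : ∀ α → G (proj₁ (own α))
    own-G (x , gx) = G.closed-∙ {inv x ∙ proj₁ h₀} {x} (G.closed-∙ {inv x} {proj₁ h₀} (G.closed-inv {x} gx) (M⊆G _ h₀-M)) gx

    own-fixes : ∀ α → Fixes (proj₁ (own α)) α
    own-fixes α = proj₁ h₀ , h₀-M , ≋⇒≈ (fixes-own (pt α) h₀)

    own≢e : ∀ α → ¬ (own α ≋ ⊙-e)
    own≢e α eq = h₀≢e (conjugate-trivial (pt α) h₀ eq)

    fixes-equal : ∀ {g} α γ (gg : G g) → α ≡ᶜ γ → Fixes g α → Fixes g γ
    fixes-equal {g} α γ gg (k , mk , eq) (l , ml , eq′) = (inv k ∙ l) ∙ k ,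
      M.closed-∙ {inv k ∙ l} {k} (M.closed-∙ {inv k} {l} (M.closed-inv {k} mk) ml) mk ,
      ≋⇒≈ (fixes-coset {pt α} {pt γ} {gΓ g gg} {mΓ l ml} {mΓ k mk} (≈⇒≋ eq) (≈⇒≋ eq′))

    base⇒distinct : ∀ α γ → IsBase (α ∷ γ ∷ []) → ¬ (α ≡ᶜ γ)
    base⇒distinct α γ base α≡γ = own≢e α (≈⇒≋ (base (proj₁ (own α)) (own-G α)
      (own-fixes α ∷ fixes-equal α γ (own-G α) α≡γ (own-fixes α) ∷ [])))

    -- Multiplying representatives by `c` on the left turns cosets of M into cosets of L, to which
    -- the results on base pairs apply.
    stabilises : ∀ {g} α (gg : G g) → Fixes g α → Stabilises (gΓ g gg) (c ⊙ pt α)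
    stabilises {g} α gg (l , ml , eq) = mΓ l ml ^ᶜ c , M⇒L l ml , fixes-translate {pt α} {gΓ g gg} {mΓ l ml} c (≈⇒≋ eq)

    basePair⇒base : ∀ α γ → BasePair (c ⊙ pt α) (c ⊙ pt γ) → IsBase (α ∷ γ ∷ [])
    basePair⇒base α γ pair g gg (fα ∷ fγ ∷ []) = ≋⇒≈ (pair (gΓ g gg) (stabilises α gg fα) (stabilises γ gg fγ))

    basePair-resp : ∀ {x x′ y y′} → x ≋ x′ → y ≋ y′ → BasePair x y → BasePair x′ y′
    basePair-resp {x} {x′} {y} {y′} ex ey pair g sx sy = pair g (transfer x x′ ex sx) (transfer y y′ ey sy)
      where
      transfer : ∀ x x′ → x ≋ x′ → Stabilises g x′ → Stabilises g x
      transfer x x′ eq (l , Ll , s) = l , Ll , ≋-trans (⊙-congʳ {g} {x} {x′} eq) (≋-trans s (⊙-congˡ {l} {x′} {x} (≋-sym eq)))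

    unequal⇒∉L : ∀ α β → ¬ (α ≡ᶜ β) → ¬ L ((c ⊙ pt β) ⊙ ⊙-inv (c ⊙ pt α))
    unequal⇒∉L α@(x , gx) β@(y , gy) α≢β l = α≢β (inv (y ∙ inv x) , M.closed-inv {y ∙ inv x} my , ≋⇒≈ {pt α} {⊙-inv q ⊙ pt β} (≋-sym (quotient⁻¹ (pt α) (pt β))))
      where
      q = pt β ⊙ ⊙-inv (pt α)
      gq : G (proj₁ q)
      gq = G.closed-∙ {y} {inv x} gy (G.closed-inv {x} gx)
      my : M (y ∙ inv x)
      my = L⇒M (y ∙ inv x) gq (L-resp {g = (c ⊙ pt β) ⊙ ⊙-inv (c ⊙ pt α)} {h = gΓ (y ∙ inv x) gq ^ᶜ c} (≋-trans (quotient-translate c (pt α) (pt β)) (conj-cong c {q} {gΓ (y ∙ inv x) gq} (equiv ~-refl (λ _ → refl)))) l)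

    Base₂ : Set
    Base₂ = ∀ α β → ¬ (α ≡ᶜ β) → ∃ λ γ → Adj α γ × Adj γ β

    module OddCase (reduce : ∀ {a d δ} → ¬ K a → ¬ K d → δ ≢ 0# → Reduction a d δ)
        (squareMod : ∀ {s} → s ≢ 0# → ∃ λ r → r ≢ 0# × (r * r) ^ q₀-1 ≡ s ^ q₀-1) where

      middle-point : Base₂
      middle-point α β α≢β = neighbour (common-neighbours 2≤n reduce squareMod y (unequal⇒∉L α β α≢β))
        where
        y = (c ⊙ pt β) ⊙ ⊙-inv (c ⊙ pt α)
        neighbour : (∃ λ Z → IsPSL (proj₁ Z) × (∀ x → BasePair x (Z ⊙ x) × BasePair (Z ⊙ x) (y ⊙ x))) → ∃ λ γ → Adj α γ × Adj γ β
        neighbour (Z , Z-PSL , pairs) = γ , (base⇒distinct α γ baseαγ , baseαγ) , (base⇒distinct γ β baseγβ , baseγβ)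
          where
          γ : Point
          γ = proj₁ ((Z ^ᶜ ⊙-inv c) ⊙ pt α) , G.closed-∙ {proj₁ (Z ^ᶜ ⊙-inv c)} {proj₁ α} (T⊆G _ (conj⁻¹-PSL Z Z-PSL)) (proj₂ α)
          cγ : Z ⊙ (c ⊙ pt α) ≋ c ⊙ pt γ
          cγ = ≋-trans (≋-sym (translate-conj⁻¹ c Z (pt α))) (⊙-congˡ {c} {(Z ^ᶜ ⊙-inv c) ⊙ pt α} {pt γ} (equiv ~-refl (λ _ → refl)))
          cβ : y ⊙ (c ⊙ pt α) ≋ c ⊙ pt β
          cβ = Conjugation.[xy⁻¹]y 𝔾 (c ⊙ pt β) (c ⊙ pt α)
          baseαγ : IsBase (α ∷ γ ∷ [])
          baseαγ = basePair⇒base α γ (basePair-resp {c ⊙ pt α} {c ⊙ pt α} {Z ⊙ (c ⊙ pt α)} {c ⊙ pt γ} (≋-refl {c ⊙ pt α}) cγ (proj₁ (pairs (c ⊙ pt α))))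
          baseγβ : IsBase (γ ∷ β ∷ [])
          baseγβ = basePair⇒base γ β (basePair-resp {Z ⊙ (c ⊙ pt α)} {c ⊙ pt γ} {y ⊙ (c ⊙ pt α)} {c ⊙ pt β} cγ cβ (proj₂ (pairs (c ⊙ pt α))))

      base-size-2 : BaseSizeIs2
      base-size-2 =
        (λ base → h₀≢e (≈⇒≋ (base (proj₁ h₀) (M⊆G _ h₀-M) []))) ,
        (λ (α , base) → own≢e α (≈⇒≋ (base (proj₁ (own α)) (own-G α) (own-fixes α ∷ [])))) ,
        pair
        where
        ε : Point
        ε = proj₁ ⊙-e , G.has-e
        g : Point
        g = proj₁ outside , proj₁ (proj₂ outside)
        distinct : ¬ (ε ≡ᶜ g)
        distinct (k , mk , eq) = proj₂ (proj₂ outside) (M-resp (⊙-inv (mΓ k mk)) (pt g)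
          (≋-trans (≋-sym (Group.identityʳ 𝔾 (⊙-inv (mΓ k mk)))) (≋-trans (⊙-congˡ {⊙-inv (mΓ k mk)} {pt ε} {mΓ k mk ⊙ pt g} (≈⇒≋ eq)) (Conjugation.x⁻¹[xy] 𝔾 (mΓ k mk) (pt g))))
          (M.closed-inv {k} mk))
        pair : ∃₂ λ α β → ¬ (α ≡ᶜ β) × IsBase (α ∷ β ∷ [])
        pair = let γ , adj , _ = middle-point ε g distinct in ε , γ , adj

      diameter-2 : SaxlDiameter 2
      diameter-2 = within , ε , far-point outside-K
        where
        within : ∀ α β → Within 2 α β
        -- Equality of two cosets is an existential over the arbitrary predicate M; maximality
        -- decides it.
        within α β with excluded-middle (α ≡ᶜ β)
        ... | inj₁ α≡β = inj₁ (inj₁ α≡β)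
        ... | inj₂ α≢β = let γ , αγ , γβ = middle-point α β α≢β in inj₂ (γ , inj₂ (α , α≡α , αγ) , γβ)
          where
          α≡α : α ≡ᶜ α
          α≡α = proj₁ ⊙-e , M.has-e , ≋⇒≈ {pt α} {⊙-e ⊙ pt α} (≋-sym (Group.identityˡ 𝔾 (pt α)))
        ε : Point
        ε = proj₁ ⊙-e , G.has-e
        -- Both M and its translate contain h₀, because u(1) and u(t) commute.
        h₀-fixes-ε : Fixes (proj₁ h₀) ε
        h₀-fixes-ε = proj₁ h₀ , h₀-M , ≋⇒≈ {⊙-e ⊙ h₀} {h₀ ⊙ ⊙-e} (≋-trans (Group.identityˡ 𝔾 h₀) (≋-sym (Group.identityʳ 𝔾 h₀)))
        far-point : (∃ λ t → ¬ K t) → ∃ λ β → ¬ Within 1 ε β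
        far-point (t , t∉K) = b , far
          where
          b : Point
          b = proj₁ (bΓ t) , bΓ-G t
          u-commute : uΓ t ⊙ uΓ 1# ≋ uΓ 1# ⊙ uΓ t
          u-commute = equiv (≡⇒~ (trans (cong (u t ·M_) (mapMat-1 (u 1#))) (trans (trans (u-+ t 1#) (trans (cong u (+-comm t 1#)) (sym (u-+ 1# t)))) (cong (u 1# ·M_) (sym (mapMat-1 (u t))))))) (λ _ → refl)
          commute : bΓ t ⊙ h₀ ≋ h₀ ⊙ bΓ t
          commute = conj-injective c (≋-trans (conj-∙ c (bΓ t) h₀) (≋-trans (⊙-cong {bΓ t ^ᶜ c} {uΓ t} {h₀ ^ᶜ c} {uΓ 1#} (conj-conj⁻¹ c (uΓ t)) h₀ᶜ)
            (≋-trans u-commute (≋-trans (⊙-cong {uΓ 1#} {h₀ ^ᶜ c} {uΓ t} {bΓ t ^ᶜ c} (≋-sym h₀ᶜ) (≋-sym (conj-conj⁻¹ c (uΓ t)))) (≋-sym (conj-∙ c h₀ (bΓ t)))))))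
          h₀-fixes-b : Fixes (proj₁ h₀) b
          h₀-fixes-b = proj₁ h₀ , h₀-M , ≋⇒≈ commute
          far : ¬ Within 1 ε b
          far (inj₁ (k , mk , eq)) = bΓ-∉L t∉K (L-resp {g = mΓ _ mb ^ᶜ c} {h = bΓ t ^ᶜ c} (conj-cong c {mΓ _ mb} {bΓ t} (equiv ~-refl (λ _ → refl))) (M⇒L _ mb))
            where
            mb : M (proj₁ (bΓ t))
            mb = M-resp (⊙-inv (mΓ k mk)) (pt b)
              (≋-trans (≋-sym (Group.identityʳ 𝔾 (⊙-inv (mΓ k mk)))) (≋-trans (⊙-congˡ {⊙-inv (mΓ k mk)} {pt ε} {mΓ k mk ⊙ pt b} (≈⇒≋ eq)) (Conjugation.x⁻¹[xy] 𝔾 (mΓ k mk) (pt b))))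
              (M.closed-inv {k} mk)
          far (inj₂ (γ , ε≡γ , _ , base)) = h₀≢e (≈⇒≋ (base (proj₁ h₀) (M⊆G _ h₀-M) (fixes-equal ε γ (M⊆G _ h₀-M) ε≡γ h₀-fixes-ε ∷ h₀-fixes-b ∷ [])))

    module QuadraticCase (p≡2 : p ≡ 2) (n≡2m : n ≡ 2 ℕ.* m) where

      square-root : ∀ δ → ∃ λ r → r * r ≡ δ
      square-root δ = frob^ (n ∸ 1) δ , trans (sym (trans (pow≡^ _ p) (pow≡ p≡2 _))) (trans (cong (λ k → frob^ k δ) (ℕₚ.m+[n∸m]≡n 1≤n)) (frob^n δ))
        where
        pow≡ : ∀ {k} → k ≡ 2 → ∀ y → y ^ k ≡ y * y
        pow≡ refl y = cong (y *_) (*-identityʳ y)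

      -- In characteristic 2 the determinant is the square of an element of K, so dividing by that
      -- element makes the matrix unimodular with entries in K: PGL(2,K) and PSL(2,K) coincide.
      realise : ∀ X → KMat X → (dX : det X ≢ 0#) → ∃ λ (g : ΓL) → M (proj₁ g) × g ^ᶜ c ≋ linear X dX
      realise X@(mat x y z t) (kmat kx ky kz kt) dX = from-root (square-root (det X))
        where
        from-root : (∃ λ r → r * r ≡ det X) → ∃ λ (g : ΓL) → M (proj₁ g) × g ^ᶜ c ≋ linear X dX
        from-root (r , r²) = from-entries (entry kx) (entry ky) (entry kz) (entry kt)
          where
          r≢0 : r ≢ 0#
          r≢0 refl = dX (trans (sym r²) (zeroˡ 0#))
          i = r ⁻¹
          Ki : K i
          Ki = K-⁻¹ r≢0 (K-sqrt p≡2 (subst K (sym r²) (K-+ (K-* kx kt) (K-neg (K-* ky kz)))))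
          entry : ∀ {x} → K x → ∃ λ b → i * x ≡ θ b
          entry k = θ-surjective 1≤q₀-1 (K-* Ki k)
          det-X₁ : det (scale i X) ≡ 1#
          det-X₁ = trans (det-scale i X) (trans (cong ((i * i) *_) (sym r²)) (trans (solve 2 (λ i r → (i :* i) :* (r :* r) := (i :* r) :* (i :* r)) refl i r)
            (trans (cong₂ _*_ (inverseˡ r≢0) (inverseˡ r≢0)) (*-identityˡ 1#))))
          from-entries : (∃ λ b → i * x ≡ θ b) → (∃ λ b → i * y ≡ θ b) → (∃ λ b → i * z ≡ θ b) → (∃ λ b → i * t ≡ θ b) →
            ∃ λ (g : ΓL) → M (proj₁ g) × g ^ᶜ c ≋ linear X dX
          from-entries (x′ , ex) (y′ , ey) (z′ , ez) (t′ , et) = ρ-ΓL A uA , proj₁ (ρ-H A uA) ,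
              equiv (~-trans (ρ-conjugate A uA) (~-trans (≡⇒~ (sym X₁≡)) (~-sym (scale~ (⁻¹-nonzero r≢0))))) (conjugate-linear c (ρ-ΓL A uA) (ρ-linear A uA))
            where
            A = B.mat x′ y′ z′ t′
            X₁≡ : scale i X ≡ mapθ A
            X₁≡ = mat≡ ex ey ez et
            uA : Unimodular A
            uA = θ-injective (trans (sym (mapθ-det A)) (trans (cong det (sym X₁≡)) (trans det-X₁ (sym θ-1))))

      third-element : ∃ λ ξ → K ξ × ξ ≢ 0# × ξ ≢ 1#
      third-element =
        let y , y∈ , av = L′.avoid-powers ((1 , F′.1#) ∷ []) (s≤s z≤n ∷ []) L′.nonzeros L′.nonzeros-unique
              (subst (1 <_) (cong (_∸ 1) (trans (sym order≡′) L′.order≡1+nonzeros)) (ℕₚ.∸-monoˡ-≤ 1 2<q₀))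
        in θ y , K-θ y , θ-nonzero (L′.∈nonzeros⁻ y∈) ,
           λ eq → All.head av (trans (L′.*-identityʳ y) (θ-injective (trans eq (sym θ-1))))

      -- A nontrivial rational matrix whose conjugate by the element leading from α to β is again
      -- rational yields h₁ and h₂ in M, and the conjugate of h₁ by α then fixes both points without
      -- being trivial.
      base-fails : ∀ α β → ¬ IsBase (α ∷ β ∷ [])
      base-fails α β base = from-conjugates (conjugates outside-K third-element)
        where
        y = (c ⊙ pt β) ⊙ ⊙-inv (c ⊙ pt α)
        k = aut (proj₁ y)
        q = pt β ⊙ ⊙-inv (pt α)
        Conjugates : Set
        Conjugates = ∃ λ D → KMat D × det D ≢ 0# × ¬ (D ~ I₂) × Rational (D ^^ matrix (proj₁ y))
        conjugates : (∃ λ η → ¬ K η) → (∃ λ ξ → K ξ × ξ ≢ 0# × ξ ≢ 1#) → Conjugates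
        conjugates (η , η∉K) (ξ , Kξ , ξ≢0 , ξ≢1) = Involution.rational-conjugates n≡2m η∉K Kξ ξ≢0 ξ≢1 (matrix (proj₁ y)) (proj₂ y)
        from-conjugates : Conjugates → ⊥
        from-conjugates (D , kD , dD , D≁I , E , kE , D^y~E) =
            finish (realise D′ (KMat-frob^ k kD) dD′) (realise E kE (~-det D^y~E (det-^^ D (matrix (proj₁ y)) dD (proj₂ y))))
          where
          -- Conjugation by `y` applies the inverse of its field automorphism before its matrix, so
          -- D is twisted beforehand to compensate.
          D′ = mapMat (frob^ k) D
          dD′ = det-frob^ k D dD
          dE = ~-det D^y~E (det-^^ D (matrix (proj₁ y)) dD (proj₂ y))
          back : mapMat (frob⁻ k) D′ ≡ D
          back = trans (mapMat-∘ (frob⁻ k) (frob^ k) D) (mapMat-id (frob⁻-frob k) D)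
          D′^y : linear D′ dD′ ^ᶜ y ≋ linear E dE
          D′^y = equiv (~-trans (≡⇒~ (trans (conjugate-matrix y (linear D′ dD′) (λ _ → refl)) (cong (_^^ matrix (proj₁ y)) back))) D^y~E)
            (conjugate-linear y (linear D′ dD′) (λ _ → refl))
          D′≢I : ¬ (linear D′ dD′ ≋ ⊙-e)
          D′≢I eq = D≁I (~-trans (≡⇒~ (sym back)) (~-trans (mapMat-~ (k ℕ.* (n ∸ 1)) (matrix~ eq)) (≡⇒~ (Frob^.mapMat-I (k ℕ.* (n ∸ 1))))))
          finish : (∃ λ (g : ΓL) → M (proj₁ g) × g ^ᶜ c ≋ linear D′ dD′) → (∃ λ (g : ΓL) → M (proj₁ g) × g ^ᶜ c ≋ linear E dE) → ⊥
          finish (h₁ , mh₁ , h₁ᶜ) (h₂ , mh₂ , h₂ᶜ) = h₁≢e (conjugate-trivial (pt α) h₁ g≋e)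
            where
            g = (⊙-inv (pt α) ⊙ h₁) ⊙ pt α
            gG : G (proj₁ g)
            gG = G.closed-∙ {inv (proj₁ α) ∙ proj₁ h₁} {proj₁ α} (G.closed-∙ {inv (proj₁ α)} {proj₁ h₁} (G.closed-inv {proj₁ α} (proj₂ α)) (M⊆G _ mh₁)) (proj₂ α)
            h₁≢e : ¬ (h₁ ≋ ⊙-e)
            h₁≢e eq = D′≢I (≋-trans (≋-sym h₁ᶜ) (≋-trans (conj-cong c eq) (conj-ε c)))
            h₁^q : h₁ ^ᶜ q ≋ h₂
            h₁^q = conj-injective c (≋-trans (conj-conj c q h₁) (≋-trans step (≋-sym h₂ᶜ)))
              where
              step : (h₁ ^ᶜ c) ^ᶜ (q ^ᶜ c) ≋ linear E dE
              step = ≋-trans (⊙-cong {(q ^ᶜ c) ⊙ (h₁ ^ᶜ c)} {y ⊙ linear D′ dD′} {⊙-inv (q ^ᶜ c)} {⊙-inv y}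
                  (⊙-cong {q ^ᶜ c} {y} {h₁ ^ᶜ c} {linear D′ dD′} y≋ h₁ᶜ) (⊙-inv-cong {q ^ᶜ c} {y} y≋)) D′^y
                where
                y≋ : q ^ᶜ c ≋ y
                y≋ = ≋-sym (quotient-translate c (pt α) (pt β))
            fixes-α : Fixes (proj₁ g) α
            fixes-α = proj₁ h₁ , mh₁ , ≋⇒≈ (fixes-own (pt α) h₁)
            fixes-β : Fixes (proj₁ g) β
            fixes-β = proj₁ h₂ , mh₂ , ≋⇒≈ (≋-trans (fixes-other (pt α) (pt β) h₁) (⊙-congʳ {pt β} {h₁ ^ᶜ q} {h₂} h₁^q))
            g≋e : g ≋ ⊙-e
            g≋e = ≈⇒≋ (base (proj₁ g) gG (fixes-α ∷ fixes-β ∷ []))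

      not-base-size-2 : ¬ BaseSizeIs2
      not-base-size-2 (_ , _ , α , β , _ , base) = base-fails α β base

-- The two cases of the theorem

open DegreeBound using (geometric; geometric-closed; geometric-odd; odd-prime-form; degree-bound)
open import Data.Nat using (_^_; _*_)

prime⇒2≤ : ∀ {p} → Prime p → 2 ≤ p
prime⇒2≤ {p} pp = ℕ.nonTrivial⇒n>1 p {{prime⇒nonTrivial pp}}

module OddRatio (m r p : ℕ) (pp : Prime p) (1≤m : 1 ≤ m) (2<q₀ : 2 < p ^ m) (rp : Prime r) (r≢2 : r ≢ 2)
    (1≤n : 1 ≤ r * m) (F : FiniteField) (order≡ : order F ≡ p ^ (r * m)) where
  open FiniteField F using (0#; 1#) renaming (_*_ to _·_)
  open FieldFacts F using (^-homo-*; ^-assocʳ; ^-nonzero; *-nonzero; ^[order-1]; *-identityʳ; *-identityˡ) renaming (_^_ to _^#_)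
  open Subfield F p (r * m) pp order≡ 1≤n m
  open Neighbours F p (r * m) pp order≡ 1≤n m

  suc-q₀-1 : suc q₀-1 ≡ p ^ m
  suc-q₀-1 = ℕₚ.m+[n∸m]≡n (1≤p^ m)

  q-1 : q₀-1 * geometric (suc q₀-1) r ≡ p ^ (r * m) ∸ 1
  q-1 = trans (sym (ℕₚ.m+n∸n≡m _ 1)) (cong (_∸ 1) (trans (geometric-closed q₀-1 r)
    (trans (cong (_^ r) suc-q₀-1) (trans (ℕₚ.^-*-assoc p m r) (cong (p ^_) (ℕₚ.*-comm m r))))))

  -- The norm s^((q-1)/(q₀-1)) lies in K and its exponent is odd, so the product of s and its norm is a square in sK.
  squareMod : ∀ {s} → s ≢ 0# → ∃ λ t → t ≢ 0# × (t · t) ^# q₀-1 ≡ s ^# q₀-1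
  squareMod {s} s≢0 = from-odd (odd-prime-form rp r≢2)
    where
    open ≡-Reasoning
    from-odd : (∃ λ k → r ≡ suc (k * 2)) → ∃ λ t → t ≢ 0# × (t · t) ^# q₀-1 ≡ s ^# q₀-1
    from-odd (k , r≡) = let c , eq = geometric-odd (suc q₀-1) k in from-half c (trans (cong (geometric (suc q₀-1)) r≡) eq)
      where
      from-half : ∀ c → geometric (suc q₀-1) r ≡ 1 ℕ.+ 2 * c → ∃ λ t → t ≢ 0# × (t · t) ^# q₀-1 ≡ s ^# q₀-1
      from-half c eq = s ^# suc c , ^-nonzero (suc c) s≢0 , (begin
        ((s ^# suc c) · (s ^# suc c)) ^# q₀-1 ≡⟨ cong (_^# q₀-1) (^-homo-* s (suc c) (suc c)) ⟨
        (s ^# (suc c ℕ.+ suc c)) ^# q₀-1 ≡⟨ ^-assocʳ s (suc c ℕ.+ suc c) q₀-1 ⟩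
        s ^# ((suc c ℕ.+ suc c) * q₀-1) ≡⟨ cong (s ^#_) (trans (exponents c q₀-1) (cong (ℕ._+ q₀-1) (trans (cong (q₀-1 *_) (sym eq)) q-1))) ⟩
        s ^# (p ^ (r * m) ∸ 1 ℕ.+ q₀-1) ≡⟨ ^-homo-* s (p ^ (r * m) ∸ 1) q₀-1 ⟩
        (s ^# (p ^ (r * m) ∸ 1)) · (s ^# q₀-1) ≡⟨ cong (λ e → (s ^# (e ∸ 1)) · (s ^# q₀-1)) order≡ ⟨
        (s ^# (order F ∸ 1)) · (s ^# q₀-1) ≡⟨ cong (_· (s ^# q₀-1)) (^[order-1] s≢0) ⟩
        1# · (s ^# q₀-1) ≡⟨ *-identityˡ _ ⟩
        s ^# q₀-1 ∎)
        where
        exponents : ∀ c y → (suc c ℕ.+ suc c) * y ≡ y * (1 ℕ.+ 2 * c) ℕ.+ y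
        exponents = solve 2 (λ c y → (con 1 :+ c :+ (con 1 :+ c)) :* y := y :* (con 1 :+ con 2 :* c) :+ y) refl
          where open +-*-Solver

  generic-reduction : ¬ (p ≡ 2 × m ≡ 2 × r ≡ 3) → ∀ {a d δ} → ¬ K a → ¬ K d → δ ≢ 0# → Reduction a d δ
  generic-reduction not = Counting.reduction (ℕₚ.∸-monoˡ-≤ 1 (ℕₚ.≤-trans (ℕₚ.n≤1+n 2) 2<q₀)) ((r * m) / 2)
    (λ {g} 2g≤n → subst (_≤ (r * m) / 2) (trans (cong (_/ 2) (ℕₚ.*-comm 2 g)) (m*n/n≡m g 2)) (/-monoˡ-≤ 2 2g≤n))
    (degree-bound (prime⇒2≤ pp) 1≤m 2<q₀ rp r≢2 not)

reduction : ∀ m r p (pp : Prime p) → 1 ≤ m → 2 < p ^ m → Prime r → r ≢ 2 → (1≤n : 1 ≤ r * m) (F : FiniteField) (order≡ : order F ≡ p ^ (r * m)) →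
  ∀ {a d δ} → ¬ Subfield.K F p (r * m) pp order≡ 1≤n m a → ¬ Subfield.K F p (r * m) pp order≡ 1≤n m d → δ ≢ FiniteField.0# F →
  Neighbours.Reduction F p (r * m) pp order≡ 1≤n m a d δ
reduction m r p pp 1≤m 2<q₀ rp r≢2 1≤n F order≡ with p ℕₚ.≟ 2 | m ℕₚ.≟ 2 | r ℕₚ.≟ 3
... | yes refl | yes refl | yes refl = FieldOfOrder64.reduction-64 F pp order≡ 1≤n
... | no p≢2 | _ | _ = OddRatio.generic-reduction m r p pp 1≤m 2<q₀ rp r≢2 1≤n F order≡ (λ (p≡2 , _) → p≢2 p≡2)
... | yes _ | no m≢2 | _ = OddRatio.generic-reduction m r p pp 1≤m 2<q₀ rp r≢2 1≤n F order≡ (λ (_ , m≡2 , _) → m≢2 m≡2)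
... | yes _ | yes _ | no r≢3 = OddRatio.generic-reduction m r p pp 1≤m 2<q₀ rp r≢2 1≤n F order≡ (λ (_ , _ , r≡3) → r≢3 r≡3)

m<r*m : ∀ {r m} → 2 ≤ r → 1 ≤ m → m < r * m
m<r*m {r} {m} 2≤r 1≤m = ℕₚ.≤-trans (subst (m <_) (cong (m ℕ.+_) (sym (ℕₚ.+-identityʳ m))) (ℕₚ.m<m+n m 1≤m)) (ℕₚ.*-monoˡ-≤ m 2≤r)

theorem3p11 : (p n : ℕ) → Prime p → 5 ≤ p ^ n →
    (F : FiniteField) → order F ≡ p ^ n →
    (G : PΓL.Elt F p n → Set) → PΓL.IsSubgroup F p n G →
    PΓL._⊆_ F p n (PΓL.IsPSL F p n) G →
    (m : ℕ) → 1 ≤ m → 2 < p ^ m →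
    (OddPrimeRatio n m ⊎ (p ≡ 2 × n ≡ 2 * m)) →
    (M : PΓL.Elt F p n → Set) → PΓL.IsMaximalSubgroupOf F p n M G →
    Σ FiniteField (λ F' → order F' ≡ p ^ m
    × IsoToPSL F p n (λ x → M x × PΓL.IsPSL F p n x) F' m) →
    (PΓL.CosetAction.BaseSizeIs2 F p n G M ⇔ OddPrimeRatio n m)
    × (OddPrimeRatio n m → PΓL.CosetAction.SaxlDiameter F p n G M 2)
theorem3p11 p n pp _ F order≡ G G-sub T⊆G m 1≤m 2<q₀ ratio M maximal (F′ , order≡′ , iso) =
  mk⇔ (λ base → odd-ratio ratio base) (λ odd → proj₁ (odd-case odd)) , (λ odd → proj₂ (odd-case odd))
  where
  odd-case : OddPrimeRatio n m → PΓL.CosetAction.BaseSizeIs2 F p n G M × PΓL.CosetAction.SaxlDiameter F p n G M 2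
  odd-case (r , refl , rp , r≢2) = with-standard-form (StandardForm.standard-form F F′ p n m pp order≡ order≡′ 1≤n 1≤m
      (SubfieldSubgroup.representation F F′ p n m pp order≡ order≡′ 1≤n 1≤m M (proj₁ maximal) iso))
    where
    m<n : m < r * m
    m<n = m<r*m (prime⇒2≤ rp) 1≤m
    1≤n : 1 ≤ r * m
    1≤n = ℕₚ.≤-trans (s≤s z≤n) m<n
    with-standard-form : _ → PΓL.CosetAction.BaseSizeIs2 F p n G M × PΓL.CosetAction.SaxlDiameter F p n G M 2
    with-standard-form (C , detC , h , standard) = O.base-size-2 , O.diameter-2
      where
      module O = Action.Core.OddCase p n pp 1≤n F F′ order≡ G M G-sub T⊆G m 1≤m 2<q₀ m<n maximal order≡′ iso C detC h standard
        (reduction m r p pp 1≤m 2<q₀ rp r≢2 1≤n F order≡) (OddRatio.squareMod m r p pp 1≤m 2<q₀ rp r≢2 1≤n F order≡)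

  quadratic-case : p ≡ 2 → n ≡ 2 * m → ¬ PΓL.CosetAction.BaseSizeIs2 F p n G M
  quadratic-case p≡2 n≡2m = with-standard-form (StandardForm.standard-form F F′ p n m pp order≡ order≡′ 1≤n 1≤m
      (SubfieldSubgroup.representation F F′ p n m pp order≡ order≡′ 1≤n 1≤m M (proj₁ maximal) iso))
    where
    m<n : m < n
    m<n = subst (m <_) (sym n≡2m) (m<r*m ℕₚ.≤-refl 1≤m)
    1≤n : 1 ≤ n
    1≤n = ℕₚ.≤-trans (s≤s z≤n) m<n
    with-standard-form : _ → ¬ PΓL.CosetAction.BaseSizeIs2 F p n G M
    with-standard-form (C , detC , h , standard) = Q.not-base-size-2
      where
      module Q = Action.Core.QuadraticCase p n pp 1≤n F F′ order≡ G M G-sub T⊆G m 1≤m 2<q₀ m<n maximal order≡′ iso C detC h standard p≡2 n≡2m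

  odd-ratio : (OddPrimeRatio n m ⊎ (p ≡ 2 × n ≡ 2 * m)) → PΓL.CosetAction.BaseSizeIs2 F p n G M → OddPrimeRatio n m
  odd-ratio (inj₁ odd) _ = odd
  odd-ratio (inj₂ (p≡2 , n≡2m)) base = ⊥-elim (quadratic-case p≡2 n≡2m base)
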